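{- For every nonnegative integer $n$, \begin{align*} \overline{a}_5(5n+2) &= 4c_5(5n+1),\\ \overline{a}_5(5n+3) &= 4c_5(5n+2),\\ \overline{a}_5(10n+1) &= 2c_5(10n),\\ \overline{a}_5(10n+9) &= 2c_5(10n+8),\\ \overline{a}_5(20n+6) &= 10c_5(10n+2),\\ \overline{a}_5(20n+14) &= 10c_5(10n+6). \end{align*} Furthermore, for every nonnegative integer $n$ and every integer $k\geq 2$, $$\overline{a}_5(5^{k}n) = \left(\frac{5^{k} - 1}{4}\right)\overline{a}_5(5n) - \left(\frac{5^{k} - 5}{4}\right)\overline{a}_5(n).$$
   Context: For a partition $\lambda=(\lambda_1,\ldots,\lambda_m)$ of $n$ with conjugate parts $\lambda'_j$, the hook number of the node $(i,j)$ of its Ferrers--Young diagram is $\lambda_i+\lambda'_j-i-j+1$; $\lambda$ is a $5$-core if none of its hook numbers is divisible by $5$. $c_5(n)$ denotes the number of partitions of $n$ that are $5$-cores. With $f_j:=\prod_{k\ge 1}(1-q^{jk})$ (for $|q|<1$, or as a formal power series), its generating function is $\sum_{n\ge 0} c_5(n)q^n = f_5^5/f_1$ (a known identity). Let $\varphi(-q):=\sum_{n=-\infty}^{\infty}(-1)^n q^{n^2}=f_1^2/f_2$, so that $\varphi(-q^5)=f_5^2/f_{10}$. The integers $\overline{a}_5(n)$ are defined by $$\sum_{n=0}^\infty \overline{a}_5(n)q^n=\frac{\varphi^5(-q^5)}{\varphi(-q)}=1+2q+4q^2+8q^3+14q^4+14q^5+20q^6+24q^7+\cdots .$$ By convention $c_5(n)=\overline{a}_5(n)=0$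 for $n<0$. -}

module Defs where

open import Data.Bool.Base using (true; false; T; if_then_else_)
open import Data.Empty using (⊥-elim)
open import Data.Fin.Base using (Fin; toℕ; zero; suc)
open import Data.Fin.Properties using (all?)
open import Data.Integer.Base as ℤ using (ℤ; +_; 0ℤ; 1ℤ; -1ℤ)
open import Data.Integer.Divisibility using (_∣_)
import Data.Integer.Properties as ℤ
open import Data.List.Base using (List; []; _∷_; _++_; map; filter; length; lookup)
open import Data.List.Membership.Propositional using (_∈_)
open import Data.List.Membership.Propositional.Properties using (∈-map⁺; ∈-map⁻; ∈-++⁺ˡ; ∈-++⁺ʳ; ∈-++⁻)
open import Data.List.Relation.Binary.Disjoint.Propositional using (Disjoint)
open import Data.List.Relation.Unary.All as All using (All; []; _∷_)
open import Data.List.Relation.Unary.AllPairs using (AllPairs; []; _∷_)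
open import Data.List.Relation.Unary.Any using (here)
open import Data.List.Relation.Unary.Linked using (Linked; []; [-]; _∷_)
open import Data.List.Relation.Unary.Linked.Properties using (Linked⇒AllPairs)
open import Data.List.Relation.Unary.Unique.Propositional using (Unique)
import Data.List.Relation.Unary.Unique.Propositional.Properties as Unique
open import Data.List.Properties using (∷-injectiveʳ)
open import Data.Nat.Base as ℕ using (ℕ; zero; suc; _∸_; _≤_; _<_; _≥_; z≤n; s≤s; NonZero)
import Data.Nat.Divisibility as ℕ
open import Data.Nat.ListAction using (sum)
import Data.Nat.Properties as ℕ
open import Data.Product.Base using (_×_; _,_; proj₁; proj₂)
open import Data.Sum.Base using (inj₁; inj₂)
open import Data.Unit.Base using (tt)
open import Function.Bundles using (_⇔_; mk⇔)
open import Relation.Binary.PropositionalEquality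
open import Relation.Nullary using (¬_; ¬?; yes; no; does)
open import Relation.Unary using (Decidable)

open import Algebra.Properties.Monoid.Sum ℤ.+-0-monoid using (sum⁺-syntax)

record IsPartition (n : ℕ) (λs : List ℕ) : Set where
  constructor mkIsPartition
  field
    nonincreasing : Linked _≥_ λs
    positive      : All (0 <_) λs
    total         : sum λs ≡ n

conjugatePart : List ℕ → ℕ → ℕ
conjugatePart λs j = length (filter (j ℕ.≤?_) λs)

-- The Fin indices count from 0, so the node is (suc (toℕ i) , suc (toℕ j)).
hook : (λs : List ℕ) (i : Fin (length λs)) (j : Fin (lookup λs i)) → ℤ
hook λs i j = + lookup λs i ℤ.+ + conjugatePart λs j′ ℤ.- + i′ ℤ.- + j′ ℤ.+ 1ℤ
  where
  i′ = suc (toℕ i)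
  j′ = suc (toℕ j)

IsCore : ℕ → List ℕ → Set
IsCore t λs = ∀ i (j : Fin (lookup λs i)) → ¬ (+ t ∣ hook λs i j)

isCore? : ∀ t → Decidable (IsCore t)
isCore? t λs = all? λ i → all? λ j → ¬? (t ℕ.∣? ℤ.∣ hook λs i j ∣)

-- Partitions of n with at most l parts, all of them at most k.
boxed : (l k n : ℕ) → List (List ℕ)
boxed l       k       zero    = [] ∷ []
boxed zero    k       (suc n) = []
boxed (suc l) zero    (suc n) = []
boxed (suc l) (suc k) (suc n) =
  boxed (suc l) k (suc n) ++
  (if k ℕ.≤ᵇ n then map (suc k ∷_) (boxed l (suc k) (n ∸ k)) else [])

partitions : ℕ → List (List ℕ)
partitions n = boxed n n n

c₅ : ℕ → ℕ
c₅ n = length (filter (isCore? 5) (partitions n))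

-- partitions n lists every partition of n exactly once (∈-partitions and
-- partitions-unique), so c₅ n counts the partitions of n that are 5-cores.

private
  boxed-sound : ∀ l k n {λs} → λs ∈ boxed l k n → All (_≤ k) λs × IsPartition n λs
  boxed-sound l k zero (here refl) = [] , mkIsPartition [] [] refl
  boxed-sound (suc l) (suc k) (suc n) p with ∈-++⁻ (boxed (suc l) k (suc n)) p
  ... | inj₁ q with boxed-sound (suc l) k (suc n) q
  ...   | below , isP = All.map ℕ.m≤n⇒m≤1+n below , isP
  boxed-sound (suc l) (suc k) (suc n) p | inj₂ q with k ℕ.≤ᵇ n in eq
  ... | true with ∈-map⁻ (suc k ∷_) q
  ...   | μs , r , refl with boxed-sound l (suc k) (n ∸ k) r
  ...     | below , mkIsPartition dec pos tot =
    (ℕ.≤-refl ∷ below) ,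
    mkIsPartition (cons below dec) (s≤s z≤n ∷ pos)
      (cong suc (trans (cong (k ℕ.+_) tot) (ℕ.m+[n∸m]≡n k≤n)))
    where
    k≤n = ℕ.≤ᵇ⇒≤ k n (subst T (sym eq) tt)
    cons : ∀ {x xs} → All (_≤ x) xs → Linked _≥_ xs → Linked _≥_ (x ∷ xs)
    cons []        []  = [-]
    cons (y≤x ∷ _) lnk = y≤x ∷ lnk

  boxed-complete : ∀ l k n {λs} → length λs ≤ l → All (_≤ k) λs → AllPairs _≥_ λs →
                   All (0 <_) λs → sum λs ≡ n → λs ∈ boxed l k n
  boxed-complete l k zero {[]} _ _ _ _ _ = here refl
  boxed-complete l k zero {suc x ∷ _} _ _ _ _ ()
  boxed-complete l k zero {zero ∷ _} _ _ _ (() ∷ _) _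
  boxed-complete (suc l) zero (suc n) {zero ∷ _} _ _ _ (() ∷ _) _
  boxed-complete (suc l) zero (suc n) {suc x ∷ _} _ (() ∷ _) _ _ _
  boxed-complete (suc l) (suc k) (suc n) {x ∷ xs} (s≤s len) (x≤ ∷ below) (x≥ ∷ dec) (x>0 ∷ pos) tot
    with x ℕ.≟ suc k
  ... | no x≢ = ∈-++⁺ˡ (boxed-complete (suc l) k (suc n) (s≤s len)
                  (x≤k ∷ All.map (λ y≤x → ℕ.≤-trans y≤x x≤k) x≥)
                  (x≥ ∷ dec) (x>0 ∷ pos) tot)
    where x≤k = ℕ.≤-pred (ℕ.≤∧≢⇒< x≤ x≢)
  ... | yes refl = ∈-++⁺ʳ (boxed (suc l) k (suc n)) last
    where
    tot′ : k ℕ.+ sum xs ≡ n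
    tot′ = ℕ.suc-injective tot
    last : suc k ∷ xs ∈ (if k ℕ.≤ᵇ n then map (suc k ∷_) (boxed l (suc k) (n ∸ k)) else [])
    last with k ℕ.≤ᵇ n in eq
    ... | true  = ∈-map⁺ (suc k ∷_) (boxed-complete l (suc k) (n ∸ k) len below dec pos
                     (trans (sym (ℕ.m+n∸m≡n k (sum xs))) (cong (_∸ k) tot′)))
    ... | false = ⊥-elim (subst T eq (ℕ.≤⇒≤ᵇ (subst (k ≤_) tot′ (ℕ.m≤m+n k (sum xs)))))

  boxed-unique : ∀ l k n → Unique (boxed l k n)
  boxed-unique l       k       zero    = [] ∷ []
  boxed-unique zero    k       (suc n) = []
  boxed-unique (suc l) zero    (suc n) = []
  boxed-unique (suc l) (suc k) (suc n) with k ℕ.≤ᵇ n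
  ... | true = Unique.++⁺ (boxed-unique (suc l) k (suc n))
                  (Unique.map⁺ ∷-injectiveʳ (boxed-unique l (suc k) (n ∸ k))) disjoint
    where
    disjoint : Disjoint (boxed (suc l) k (suc n)) (map (suc k ∷_) (boxed l (suc k) (n ∸ k)))
    disjoint (p , q) with ∈-map⁻ (suc k ∷_) q
    ... | _ , _ , refl with boxed-sound (suc l) k (suc n) p
    ...   | k<k ∷ _ , _ = ℕ.<-irrefl refl k<k
  ... | false = Unique.++⁺ (boxed-unique (suc l) k (suc n)) [] λ ()

  length≤sum : ∀ {xs} → All (0 <_) xs → length xs ≤ sum xs
  length≤sum []        = z≤n
  length≤sum (p ∷ pos) = ℕ.+-mono-≤ p (length≤sum pos)

  all≤sum : ∀ xs → All (_≤ sum xs) xs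
  all≤sum []       = []
  all≤sum (x ∷ xs) = ℕ.m≤m+n x (sum xs) ∷
    All.map (λ y≤ → ℕ.≤-trans y≤ (ℕ.m≤n+m (sum xs) x)) (all≤sum xs)

∈-partitions : ∀ {n λs} → λs ∈ partitions n ⇔ IsPartition n λs
∈-partitions {n} {λs} = mk⇔ (λ p → proj₂ (boxed-sound n n n p)) complete
  where
  complete : IsPartition n λs → λs ∈ partitions n
  complete (mkIsPartition dec pos refl) =
    boxed-complete n n n (length≤sum pos) (all≤sum λs)
      (Linked⇒AllPairs (λ x≥y y≥z → ℕ.≤-trans y≥z x≥y) dec) pos refl

partitions-unique : ∀ n → Unique (partitions n)
partitions-unique n = boxed-unique n n n

Series : Set
Series = ℕ → ℤ

infixl 7 _·_ _÷_
infixr 8 _^_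

one : Series
one zero    = 1ℤ
one (suc _) = 0ℤ

_·_ : Series → Series → Series
(a · b) n = ∑[ i ≤ n ] (a (toℕ i) ℤ.* b (n ∸ toℕ i))

_^_ : Series → ℕ → Series
a ^ zero  = one
a ^ suc k = a · a ^ k

-- Long division; this is the quotient when b has constant term 1 (see ÷-·).
_÷_ : Series → Series → Series
(a ÷ b) zero    = a 0
(a ÷ b) (suc n) = ((λ m → a (suc m) ℤ.- a 0 ℤ.* b (suc m)) ÷ b) n

÷-· : ∀ a b → b 0 ≡ 1ℤ → ∀ n → ((a ÷ b) · b) n ≡ a n
÷-· a b b₀≡1 zero = begin
  a 0 ℤ.* b 0 ℤ.+ 0ℤ  ≡⟨ ℤ.+-identityʳ _ ⟩
  a 0 ℤ.* b 0         ≡⟨ cong (λ y → a 0 ℤ.* y) b₀≡1 ⟩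
  a 0 ℤ.* 1ℤ          ≡⟨ ℤ.*-identityʳ _ ⟩
  a 0                 ∎
  where open ≡-Reasoning
÷-· a b b₀≡1 (suc n) = begin
  x ℤ.+ ((a′ ÷ b) · b) n        ≡⟨ cong (λ y → x ℤ.+ y) (÷-· a′ b b₀≡1 n) ⟩
  x ℤ.+ (a (suc n) ℤ.- x)       ≡⟨ ℤ.+-comm x _ ⟩
  a (suc n) ℤ.- x ℤ.+ x         ≡⟨ ℤ.+-assoc (a (suc n)) (ℤ.- x) x ⟩
  a (suc n) ℤ.+ (ℤ.- x ℤ.+ x)   ≡⟨ cong (λ y → a (suc n) ℤ.+ y) (ℤ.+-inverseˡ x) ⟩
  a (suc n) ℤ.+ 0ℤ              ≡⟨ ℤ.+-identityʳ _ ⟩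
  a (suc n)                     ∎
  where
  open ≡-Reasoning
  x = a 0 ℤ.* b (suc n)
  a′ = λ m → a (suc m) ℤ.- a 0 ℤ.* b (suc m)

φ-term : (j m : ℕ) → ℤ → ℤ
φ-term j m n = if does (+ j ℤ.* n ℤ.^ 2 ℤ.≟ + m) then -1ℤ ℤ.^ ℤ.∣ n ∣ else 0ℤ

-- φ(-q^j) = Σ_{n ∈ ℤ} (-1)ⁿ q^(jn²). Since j ≥ 1, only the n with |n| ≤ m can
-- contribute to the coefficient of q^m.
φ[-q^_] : (j : ℕ) .{{_ : NonZero j}} → Series
φ[-q^ j ] m = ∑[ i ≤ 2 ℕ.* m ] φ-term j m (toℕ i ℤ.⊖ m)

ā₅ : Series
ā₅ = φ[-q^ 5 ] ^ 5 ÷ φ[-q^ 1 ]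

ā₅-quotient : ∀ n → (ā₅ · φ[-q^ 1 ]) n ≡ (φ[-q^ 5 ] ^ 5) n
ā₅-quotient = ÷-· (φ[-q^ 5 ] ^ 5) φ[-q^ 1 ] refl

{-# OPTIONS --safe #-}

-- Put D = q Σ c₅(n) qⁿ and B = f₁⁵/f₅. The abacus writes a 5-core as five bead counts of fixed sum, and the Jacobi triple
-- products of the five runners multiply to that of f₁, so that D = q f₅⁵/f₁. On the other side B = 1 - 5 Σ H(n) qⁿ with
-- H(n) = Σ_{d ∣ n} χ(d) d and χ the Legendre symbol modulo 5: f₁⁶ is the Wronskian of the two Rogers-Ramanujan theta series α and β,
-- because multiplication by 2 + i on ℤ[i] takes the double series of f₁³ f₁³ to that of α and β, and α β = f₁ f₅. The 5-dissection
-- of f₁, with middle part -q f₂₅, exhibits D as the conorm of f₁ and yields D(n) = χ(n) H(n) for 5 ∤ n and D(5n) = 5 D(n).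
-- The same tiling of ℤ² gives φ(-q)² = φ(-q⁵)² - 4q K and ψ(q)² = G + q ψ(q⁵)² with eta quotients K and G, and these imply
-- 5 Σ ā₅(n) qⁿ = 15 D(q) + 20 D(q²) + B(q) + 4 B(q²), from which all the congruence classes can be read off; the D part and
-- the B part are eigenvectors of U₅ : Σ a(n) qⁿ ↦ Σ a(5n) qⁿ with eigenvalues 5 and 1.
module Submission where

open import Algebra.Bundles using (CommutativeRing; CommutativeMonoid)
import Algebra.Solver.Ring
open import Algebra.Solver.Ring.AlmostCommutativeRing using (AlmostCommutativeRing; fromCommutativeRing; _-Raw-AlmostCommutative⟶_; Induced-equivalence)
open import Data.Bool.Base using (if_then_else_)
open import Data.Empty using (⊥; ⊥-elim)
open import Data.Fin.Base using (Fin; zero; suc; toℕ; fromℕ<)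
import Data.Fin.Properties as Fin
open import Data.Integer.Base as ℤ using (ℤ; +_; 0ℤ; 1ℤ; -1ℤ; -[1+_]; _⊖_; ∣_∣)
import Data.Integer.DivMod as ℤ
import Data.Integer.Properties as ℤ
open import Data.Integer.Solver using (module +-*-Solver)
import Data.Integer.Tactic.RingSolver as ℤ-Solver
open import Data.List.Base using (List; []; _∷_; _++_; map; filter; cartesianProduct; downFrom; upTo; applyUpTo; length; lookup; replicate)
open import Data.List.Membership.DecPropositional using (_∈?_)
open import Data.List.Membership.Propositional using (_∈_; _∉_)
open import Data.List.Membership.Propositional.Properties using (∈-map⁺; ∈-map⁻; ∈-++⁺ˡ; ∈-++⁺ʳ; ∈-++⁻; ∈-filter⁺; ∈-filter⁻; ∈-cartesianProduct⁺; ∈-cartesianProduct⁻; ∈-downFrom⁺; ∈-upTo⁺; ∈-upTo⁻; ∈-downFrom⁻)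
open import Data.List.Membership.Propositional.Properties.WithK using (unique∧set⇒bag)
import Data.List.Properties as List
open import Data.List.Relation.Binary.BagAndSetEquality using (∼bag⇒↭)
open import Data.List.Relation.Binary.Permutation.Propositional using (_↭_; refl; prep; swap) renaming (trans to transitive)
open import Data.List.Relation.Binary.Permutation.Propositional.Properties using (↭-length)
open import Data.List.Relation.Unary.All as All using (All; []; _∷_)
import Data.List.Relation.Unary.All.Properties as All
open import Data.List.Relation.Unary.AllPairs as AllPairs using ([]; _∷_; AllPairs)
import Data.List.Relation.Unary.AllPairs.Properties as AllPairs
open import Data.List.Relation.Unary.Any using (here; there)
open import Data.List.Relation.Unary.Linked.Properties using (Linked⇒AllPairs; AllPairs⇒Linked)
open import Data.List.Relation.Unary.Unique.Propositional using (Unique)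
import Data.List.Relation.Unary.Unique.Propositional.Properties as Unique
open import Data.Maybe.Base using (just; nothing)
open import Data.Nat.Base using (ℕ; zero; suc; _+_; _*_; _∸_; _≤_; _<_; z≤n; s≤s; NonZero; _≥_; _>_; _⊓_; _^_)
open import Data.Nat.DivMod using (_%_; _/_; m%n<n; m≡m%n+[m/n]*n; %-distribˡ-+; m*n%n≡0; m<n⇒m%n≡m; [m+kn]%n≡m%n; [m+n]%n≡m%n; m<n⇒m/n≡0; m/n≡1+[m∸n]/n; m*n/n≡m)
open import Data.Nat.Divisibility using (_∣_; _∣?_; divides; ∣n⇒∣m*n; ∣-trans; m∣m*n; ∣m+n∣m⇒∣n; ∣m∣n⇒∣m+n; ∣⇒≤; ∣-refl; *-cancelˡ-∣; *-monoʳ-∣; _∣0)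
open import Data.Nat.ListAction using (sum)
open import Data.Nat.Primality using (Prime; prime?; euclidsLemma; prime⇒nonZero)
import Data.Nat.Properties as ℕ
import Data.Nat.Tactic.RingSolver as ℕ-Solver
open import Data.Product.Base using (_×_; _,_; proj₁; proj₂; ∃)
open import Data.Sum.Base using (inj₁; inj₂)
open import Data.Unit.Base using (⊤; tt)
open import Defs using (Series; one; _·_; φ[-q^_]; φ-term; c₅; IsPartition; mkIsPartition; conjugatePart; hook; IsCore; isCore?; partitions; partitions-unique; ∈-partitions; ā₅; ā₅-quotient) renaming (_^_ to _^ˢ_)
open import Function.Base using (_∘_; id)
open import Function.Bundles using (mk⇔; Equivalence)
open import Level using (0ℓ)
open import Relation.Binary.Definitions using (WeaklyDecidable; tri<; tri≈; tri>)
open import Relation.Binary.PropositionalEquality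
import Relation.Binary.Reasoning.Setoid as SetoidReasoning
open import Relation.Nullary using (yes; no; ¬_; does; Dec)
open import Relation.Nullary.Decidable using (from-yes)
open import Relation.Unary using (Decidable)
import Algebra.Properties.AbelianGroup ℤ.+-0-abelianGroup as ℤ+
import Algebra.Properties.CommutativeSemigroup as CommSemigroup
open import Algebra.Properties.Monoid.Sum ℤ.+-0-monoid using (sum-syntax)

-- Everything takes place in ℤ[[q]]: there is no second variable z, there are no fifth roots of
-- unity and no quotients. The variable z of the triple product is replaced by sequences of series
-- indexed by its exponent, and limits by congruences modulo `q^m` between finite products. An eta
-- quotient is an equation with its denominators cleared, from which series with constant term 1 are
-- cancelled. The norm of f₁, classically a product over the fifth roots of unity, is read off as
-- the class 0 part of f₁⁵ = f₅ B: since H(5n) = H(n), that part is f₅ B(q⁵). This is why B must be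
-- known as an Eisenstein series before D can be dissected, and why the Wronskian is needed at all.
-- A dimension count for modular forms of level 10 would give the final relation. Here it is
-- polynomial algebra in q, f₁, f₂, f₅, f₁₀ modulo the two theta relations, each used twice: once to
-- collapse B(q) + 4 B(q²) to a single eta quotient, and once more to make the terms in D appear.

infix  4 _≈_ _≈[_]_
infixl 6 _⊞_
infixl 7 _✶_

-- The ring of formal power series

_≈_ : Series → Series → Set
F ≈ G = ∀ n → F n ≡ G n

-- Congruence modulo `q^m`, the only notion of limit in use: a statement on infinite products or
-- sums is proved modulo every `q^m` from finite ones.
_≈[_]_ : Series → ℕ → Series → Set
F ≈[ m ] G = ∀ n → n < m → F n ≡ G n

tail : Series → Series
tail F n = F (suc n)

0S : Series
0S _ = 0ℤ

-- Unfolding these on series would let the unifier lose sight of the summands and factors.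
opaque
  _⊞_ : Series → Series → Series
  (F ⊞ G) n = F n ℤ.+ G n

  neg : Series → Series
  neg F n = ℤ.- F n

  scale : ℤ → Series → Series
  scale c F n = c ℤ.* F n

  mono : ℤ → ℕ → Series
  mono c zero    zero    = c
  mono c zero    (suc n) = 0ℤ
  mono c (suc k) zero    = 0ℤ
  mono c (suc k) (suc n) = mono c k n

  _✶_ : Series → Series → Series
  F ✶ G = F · G

const : ℤ → Series
const c = mono c 0

≈-refl : ∀ {F} → F ≈ F
≈-refl n = refl

≈-sym : ∀ {F G} → F ≈ G → G ≈ F
≈-sym p n = sym (p n)

≈-trans : ∀ {F G H} → F ≈ G → G ≈ H → F ≈ H
≈-trans p q n = trans (p n) (q n)

opaque
  unfolding _⊞_ neg scale mono _✶_

  -- Coefficient `n` of a product sees only the coefficients up to `n`; hence products respect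
  -- congruence modulo `q^m`.
  ·-cong-≤ : ∀ n {F F′ G G′} → (∀ k → k ≤ n → F k ≡ F′ k) → (∀ k → k ≤ n → G k ≡ G′ k) →
             (F · G) n ≡ (F′ · G′) n
  ·-cong-≤ zero    p q = cong₂ (λ x y → x ℤ.* y ℤ.+ 0ℤ) (p 0 z≤n) (q 0 z≤n)
  ·-cong-≤ (suc n) p q = cong₂ ℤ._+_ (cong₂ ℤ._*_ (p 0 z≤n) (q (suc n) ℕ.≤-refl))
    (·-cong-≤ n (λ k k≤n → p (suc k) (s≤s k≤n)) (λ k k≤n → q k (ℕ.m≤n⇒m≤1+n k≤n)))

  ·-cong : ∀ {F F′ G G′} → F ≈ F′ → G ≈ G′ → F · G ≈ F′ · G′
  ·-cong p q n = ·-cong-≤ n (λ k _ → p k) (λ k _ → q k)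

  ·-distribʳ : ∀ H F G → (F ⊞ G) · H ≈ F · H ⊞ G · H
  ·-distribʳ H F G zero    = lemma (F 0) (G 0) (H 0)
    where
    lemma : ∀ f g h → (f ℤ.+ g) ℤ.* h ℤ.+ 0ℤ ≡ f ℤ.* h ℤ.+ 0ℤ ℤ.+ (g ℤ.* h ℤ.+ 0ℤ)
    lemma = ℤ-Solver.solve-∀
  ·-distribʳ H F G (suc n) = trans
    (cong (λ y → (F 0 ℤ.+ G 0) ℤ.* H (suc n) ℤ.+ y) (·-distribʳ H (tail F) (tail G) n))
    (lemma (F 0) (G 0) (H (suc n)) ((tail F · H) n) ((tail G · H) n))
    where
    lemma : ∀ f g h x y → (f ℤ.+ g) ℤ.* h ℤ.+ (x ℤ.+ y) ≡ f ℤ.* h ℤ.+ x ℤ.+ (g ℤ.* h ℤ.+ y)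
    lemma = ℤ-Solver.solve-∀

  ·-scaleˡ : ∀ c F G → scale c F · G ≈ scale c (F · G)
  ·-scaleˡ c F G zero    = lemma c (F 0) (G 0)
    where
    lemma : ∀ c f g → c ℤ.* f ℤ.* g ℤ.+ 0ℤ ≡ c ℤ.* (f ℤ.* g ℤ.+ 0ℤ)
    lemma = ℤ-Solver.solve-∀
  ·-scaleˡ c F G (suc n) = trans
    (cong (λ y → c ℤ.* F 0 ℤ.* G (suc n) ℤ.+ y) (·-scaleˡ c (tail F) G n))
    (lemma c (F 0) (G (suc n)) ((tail F · G) n))
    where
    lemma : ∀ c f g x → c ℤ.* f ℤ.* g ℤ.+ c ℤ.* x ≡ c ℤ.* (f ℤ.* g ℤ.+ x)
    lemma = ℤ-Solver.solve-∀

  -- The product is defined by peeling off the first coefficient of the left factor. Peeling off the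
  -- last one yields commutativity, and later isolates the newest coefficient when a factor is
  -- cancelled.
  ·-suc : ∀ F G n → (F · G) (suc n) ≡ (F · tail G) n ℤ.+ F (suc n) ℤ.* G 0
  ·-suc F G zero    = lemma (F 0) (F 1) (G 0) (G 1)
    where
    lemma : ∀ a b c d → a ℤ.* d ℤ.+ (b ℤ.* c ℤ.+ 0ℤ) ≡ a ℤ.* d ℤ.+ 0ℤ ℤ.+ b ℤ.* c
    lemma = ℤ-Solver.solve-∀
  ·-suc F G (suc n) = trans (cong (λ y → F 0 ℤ.* G (2 + n) ℤ.+ y) (·-suc (tail F) G n))
    (sym (ℤ.+-assoc (F 0 ℤ.* G (2 + n)) _ _))

  ·-comm : ∀ F G → F · G ≈ G · F
  ·-comm F G zero    = cong (λ y → y ℤ.+ 0ℤ) (ℤ.*-comm (F 0) (G 0))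
  ·-comm F G (suc n) = begin
    F 0 ℤ.* G (suc n) ℤ.+ (tail F · G) n ≡⟨ ℤ.+-comm (F 0 ℤ.* G (suc n)) _ ⟩
    (tail F · G) n ℤ.+ F 0 ℤ.* G (suc n) ≡⟨ cong₂ ℤ._+_ (·-comm (tail F) G n) (ℤ.*-comm (F 0) _) ⟩
    (G · tail F) n ℤ.+ G (suc n) ℤ.* F 0 ≡⟨ ·-suc G F n ⟨
    (G · F) (suc n)                      ∎
    where open ≡-Reasoning

  ·-assoc : ∀ F G H → (F · G) · H ≈ F · (G · H)
  ·-assoc F G H zero    = lemma (F 0) (G 0) (H 0)
    where
    lemma : ∀ f g h → (f ℤ.* g ℤ.+ 0ℤ) ℤ.* h ℤ.+ 0ℤ ≡ f ℤ.* (g ℤ.* h ℤ.+ 0ℤ) ℤ.+ 0ℤ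
    lemma = ℤ-Solver.solve-∀
  ·-assoc F G H (suc n) = begin
    (F · G) 0 ℤ.* H (suc n) ℤ.+ (tail (F · G) · H) n
      -- By definition `tail (F · G)` is `scale (F 0) (tail G) ⊞ tail F · G`.
      ≡⟨ cong (λ y → (F · G) 0 ℤ.* H (suc n) ℤ.+ y) (·-distribʳ H (scale (F 0) (tail G)) (tail F · G) n) ⟩
    (F · G) 0 ℤ.* H (suc n) ℤ.+ ((scale (F 0) (tail G) · H) n ℤ.+ ((tail F · G) · H) n)
      ≡⟨ cong₂ (λ x y → (F · G) 0 ℤ.* H (suc n) ℤ.+ (x ℤ.+ y))
               (·-scaleˡ (F 0) (tail G) H n) (·-assoc (tail F) G H n) ⟩
    (F 0 ℤ.* G 0 ℤ.+ 0ℤ) ℤ.* H (suc n) ℤ.+ (F 0 ℤ.* (tail G · H) n ℤ.+ (tail F · (G · H)) n)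
      ≡⟨ lemma (F 0) (G 0) (H (suc n)) _ _ ⟩
    F 0 ℤ.* (G 0 ℤ.* H (suc n) ℤ.+ (tail G · H) n) ℤ.+ (tail F · (G · H)) n ∎
    where
    open ≡-Reasoning
    lemma : ∀ f g h x y → (f ℤ.* g ℤ.+ 0ℤ) ℤ.* h ℤ.+ (f ℤ.* x ℤ.+ y) ≡ f ℤ.* (g ℤ.* h ℤ.+ x) ℤ.+ y
    lemma = ℤ-Solver.solve-∀

  ·-zeroˡ : ∀ F → 0S · F ≈ 0S
  ·-zeroˡ F zero    = refl
  ·-zeroˡ F (suc n) = trans (ℤ.+-identityˡ _) (·-zeroˡ F n)

  ·-const : ∀ c F → const c · F ≈ scale c F
  ·-const c F zero    = ℤ.+-identityʳ _
  ·-const c F (suc n) = trans (cong (λ y → c ℤ.* F (suc n) ℤ.+ y) (·-zeroˡ F n)) (ℤ.+-identityʳ _)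

  one≈const : one ≈ const 1ℤ
  one≈const zero    = refl
  one≈const (suc n) = refl

  ·-identityˡ : ∀ F → one · F ≈ F
  ·-identityˡ F n = trans (·-cong {G = F} one≈const (λ _ → refl) n) (trans (·-const 1ℤ F n) (ℤ.*-identityˡ (F n)))

  ✶≈· : ∀ F G → F ✶ G ≈ F · G
  ✶≈· F G n = refl

  ⊞-at : ∀ F G n → (F ⊞ G) n ≡ F n ℤ.+ G n
  ⊞-at F G n = refl

  neg-at : ∀ F n → neg F n ≡ ℤ.- F n
  neg-at F n = refl

  scale-at : ∀ c F n → scale c F n ≡ c ℤ.* F n
  scale-at c F n = refl

  ⊞-cong : ∀ {F F′ G G′} → F ≈ F′ → G ≈ G′ → F ⊞ G ≈ F′ ⊞ G′
  ⊞-cong p q n = cong₂ ℤ._+_ (p n) (q n)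

  neg-cong : ∀ {F F′} → F ≈ F′ → neg F ≈ neg F′
  neg-cong p n = cong ℤ.-_ (p n)

  scale-cong : ∀ c {F F′} → F ≈ F′ → scale c F ≈ scale c F′
  scale-cong c p n = cong (λ y → c ℤ.* y) (p n)

  ⊞-assoc : ∀ F G H → (F ⊞ G) ⊞ H ≈ F ⊞ (G ⊞ H)
  ⊞-assoc F G H n = ℤ.+-assoc (F n) (G n) (H n)

  ⊞-comm : ∀ F G → F ⊞ G ≈ G ⊞ F
  ⊞-comm F G n = ℤ.+-comm (F n) (G n)

  ⊞-identityˡ : ∀ F → 0S ⊞ F ≈ F
  ⊞-identityˡ F n = ℤ.+-identityˡ (F n)

  ⊞-identityʳ : ∀ F → F ⊞ 0S ≈ F
  ⊞-identityʳ F n = ℤ.+-identityʳ (F n)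

  ⊞-inverseˡ : ∀ F → neg F ⊞ F ≈ 0S
  ⊞-inverseˡ F n = ℤ.+-inverseˡ (F n)

  ⊞-inverseʳ : ∀ F → F ⊞ neg F ≈ 0S
  ⊞-inverseʳ F n = ℤ.+-inverseʳ (F n)

  ✶-cong-≤ : ∀ n {F F′ G G′} → (∀ k → k ≤ n → F k ≡ F′ k) → (∀ k → k ≤ n → G k ≡ G′ k) →
             (F ✶ G) n ≡ (F′ ✶ G′) n
  ✶-cong-≤ = ·-cong-≤

  ✶-cong : ∀ {F F′ G G′} → F ≈ F′ → G ≈ G′ → F ✶ G ≈ F′ ✶ G′
  ✶-cong = ·-cong

  ✶-comm : ∀ F G → F ✶ G ≈ G ✶ F
  ✶-comm = ·-comm

  ✶-assoc : ∀ F G H → (F ✶ G) ✶ H ≈ F ✶ (G ✶ H)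
  ✶-assoc = ·-assoc

  ✶-distribʳ : ∀ H F G → (F ⊞ G) ✶ H ≈ F ✶ H ⊞ G ✶ H
  ✶-distribʳ = ·-distribʳ

  ✶-identityˡ : ∀ F → one ✶ F ≈ F
  ✶-identityˡ = ·-identityˡ

  ✶-const : ∀ c F → const c ✶ F ≈ scale c F
  ✶-const = ·-const

  ✶-at-0 : ∀ F G → (F ✶ G) 0 ≡ F 0 ℤ.* G 0
  ✶-at-0 F G = ℤ.+-identityʳ _

  ✶-sucʳ : ∀ F G n → (F ✶ G) (suc n) ≡ (F ✶ tail G) n ℤ.+ F (suc n) ℤ.* G 0
  ✶-sucʳ = ·-suc

seriesRing : CommutativeRing 0ℓ 0ℓ
seriesRing = record
  { Carrier = Series
  ; _≈_ = _≈_
  ; _+_ = _⊞_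
  ; _*_ = _✶_
  ; -_ = neg
  ; 0# = 0S
  ; 1# = one
  ; isCommutativeRing = record
    { isRing = record
      { +-isAbelianGroup = record
        { isGroup = record
          { isMonoid = record
            { isSemigroup = record
              { isMagma = record
                { isEquivalence = record { refl = ≈-refl ; sym = ≈-sym ; trans = ≈-trans }
                ; ∙-cong = ⊞-cong
                }
              ; assoc = ⊞-assoc
              }
            ; identity = ⊞-identityˡ , ⊞-identityʳ
            }
          ; inverse = ⊞-inverseˡ , ⊞-inverseʳ
          ; ⁻¹-cong = neg-cong
          }
        ; comm = ⊞-comm
        }
      ; *-cong = ✶-cong
      ; *-assoc = ✶-assoc
      ; *-identity = ✶-identityˡ , λ F → ≈-trans (✶-comm F one) (✶-identityˡ F)
      ; distrib = (λ H F G → ≈-trans (✶-comm H (F ⊞ G)) (≈-trans (✶-distribʳ H F G)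
                    (⊞-cong (✶-comm F H) (✶-comm G H)))) , ✶-distribʳ
      }
    ; *-comm = ✶-comm
    }
  }

⊞-congˡ : ∀ F {G G′} → G ≈ G′ → F ⊞ G ≈ F ⊞ G′
⊞-congˡ F p = ⊞-cong {F} ≈-refl p

⊞-congʳ : ∀ G {F F′} → F ≈ F′ → F ⊞ G ≈ F′ ⊞ G
⊞-congʳ G p = ⊞-cong {G = G} p ≈-refl

module 𝕊 = CommutativeRing seriesRing

opaque
  unfolding _⊞_ neg scale mono _✶_

  const-+ : ∀ c d → const (c ℤ.+ d) ≈ const c ⊞ const d
  const-+ c d zero    = refl
  const-+ c d (suc n) = refl

  const-* : ∀ c d → const (c ℤ.* d) ≈ const c ✶ const d
  const-* c d zero    = sym (✶-const c (const d) 0)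
  const-* c d (suc n) = sym (trans (✶-const c (const d) (suc n)) (ℤ.*-zeroʳ c))

  const-neg : ∀ c → const (ℤ.- c) ≈ neg (const c)
  const-neg c zero    = refl
  const-neg c (suc n) = refl

  const-0 : const 0ℤ ≈ 0S
  const-0 zero    = refl
  const-0 (suc n) = refl

const-morphism : AlmostCommutativeRing.rawRing (fromCommutativeRing ℤ.+-*-commutativeRing)
                 -Raw-AlmostCommutative⟶ fromCommutativeRing seriesRing
const-morphism = record
  { ⟦_⟧    = const
  ; +-homo = const-+
  ; *-homo = const-*
  ; -‿homo = const-neg
  ; 0-homo = const-0
  ; 1-homo = ≈-sym one≈const
  }

≈[]-refl : ∀ {m F} → F ≈[ m ] F
≈[]-refl n _ = refl

≈[]-sym : ∀ {m F G} → F ≈[ m ] G → G ≈[ m ] F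
≈[]-sym p n n<m = sym (p n n<m)

≈[]-trans : ∀ {m F G H} → F ≈[ m ] G → G ≈[ m ] H → F ≈[ m ] H
≈[]-trans p q n n<m = trans (p n n<m) (q n n<m)

≈⇒≈[] : ∀ {m F G} → F ≈ G → F ≈[ m ] G
≈⇒≈[] p n _ = p n

≈[]-≤ : ∀ {m m′ F G} → m′ ≤ m → F ≈[ m ] G → F ≈[ m′ ] G
≈[]-≤ m′≤m p n n<m′ = p n (ℕ.<-≤-trans n<m′ m′≤m)

opaque
  unfolding _⊞_ neg scale mono _✶_

  ⊞-cong[] : ∀ {m F F′ G G′} → F ≈[ m ] F′ → G ≈[ m ] G′ → F ⊞ G ≈[ m ] F′ ⊞ G′
  ⊞-cong[] p q n n<m = cong₂ ℤ._+_ (p n n<m) (q n n<m)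

✶-cong[] : ∀ {m F F′ G G′} → F ≈[ m ] F′ → G ≈[ m ] G′ → F ✶ G ≈[ m ] F′ ✶ G′
✶-cong[] p q n n<m = ✶-cong-≤ n (λ k k≤n → p k (ℕ.≤-<-trans k≤n n<m)) (λ k k≤n → q k (ℕ.≤-<-trans k≤n n<m))

-- Coefficient `n` of `U ✶ F` is `F n` plus terms in earlier coefficients of `F`, so these are
-- determined one after the other. This takes the place of division by eta products.
✶-cancelˡ[] : ∀ {m} U {F G} → U 0 ≡ 1ℤ → U ✶ F ≈[ m ] U ✶ G → F ≈[ m ] G
✶-cancelˡ[] {m} U {F} {G} U₀ p n n<m = below (suc n) n<m n ℕ.≤-refl
  where
  open ≡-Reasoning
  comm-p : ∀ n → n < m → (F ✶ U) n ≡ (G ✶ U) n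
  comm-p n n<m = trans (✶-comm F U n) (trans (p n n<m) (✶-comm U G n))
  below : ∀ n → n ≤ m → ∀ k → k < n → F k ≡ G k
  at : ∀ n → n < m → F n ≡ G n
  at zero n<m = begin
    F 0         ≡⟨ ℤ.*-identityʳ (F 0) ⟨
    F 0 ℤ.* 1ℤ  ≡⟨ cong (F 0 ℤ.*_) U₀ ⟨
    F 0 ℤ.* U 0 ≡⟨ ✶-at-0 F U ⟨
    (F ✶ U) 0   ≡⟨ comm-p 0 n<m ⟩
    (G ✶ U) 0   ≡⟨ ✶-at-0 G U ⟩
    G 0 ℤ.* U 0 ≡⟨ cong (G 0 ℤ.*_) U₀ ⟩
    G 0 ℤ.* 1ℤ  ≡⟨ ℤ.*-identityʳ (G 0) ⟩
    G 0         ∎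
  at (suc n) n<m = begin
    F (suc n)          ≡⟨ ℤ.*-identityʳ _ ⟨
    F (suc n) ℤ.* 1ℤ   ≡⟨ cong (F (suc n) ℤ.*_) U₀ ⟨
    F (suc n) ℤ.* U 0  ≡⟨ ℤ+.∙-cancelˡ ((F ✶ tail U) n) _ _ (begin
      (F ✶ tail U) n ℤ.+ F (suc n) ℤ.* U 0 ≡⟨ ✶-sucʳ F U n ⟨
      (F ✶ U) (suc n)                      ≡⟨ comm-p (suc n) n<m ⟩
      (G ✶ U) (suc n)                      ≡⟨ ✶-sucʳ G U n ⟩
      (G ✶ tail U) n ℤ.+ G (suc n) ℤ.* U 0 ≡⟨ cong (ℤ._+ G (suc n) ℤ.* U 0)
        (✶-cong-≤ n {F = G} {F′ = F} {G = tail U} (λ k k≤n → sym (below (suc n) (ℕ.<⇒≤ n<m) k (s≤s k≤n))) (λ _ _ → refl)) ⟩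
      (F ✶ tail U) n ℤ.+ G (suc n) ℤ.* U 0 ∎) ⟩
    G (suc n) ℤ.* U 0  ≡⟨ cong (G (suc n) ℤ.*_) U₀ ⟩
    G (suc n) ℤ.* 1ℤ   ≡⟨ ℤ.*-identityʳ _ ⟩
    G (suc n)          ∎
  below (suc n) n<m k (s≤s k≤n) with ℕ.m≤n⇒m<n∨m≡n k≤n
  ... | inj₁ k<n  = below n (ℕ.<⇒≤ n<m) k k<n
  ... | inj₂ refl = at n n<m

✶-cancelˡ : ∀ U {F G} → U 0 ≡ 1ℤ → U ✶ F ≈ U ✶ G → F ≈ G
✶-cancelˡ U {F} {G} U₀ p n = ✶-cancelˡ[] {suc n} U {F} {G} U₀ (λ k _ → p k) n ℕ.≤-refl

opaque
  unfolding _⊞_ neg scale mono _✶_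

  mono-✶-+ : ∀ c k F n → (mono c k ✶ F) (k + n) ≡ c ℤ.* F n
  mono-✶-+ c zero    F n = ·-const c F n
  mono-✶-+ c (suc k) F n = trans (ℤ.+-identityˡ _) (mono-✶-+ c k F n)

  mono-✶-< : ∀ c k F n → n < k → (mono c k ✶ F) n ≡ 0ℤ
  mono-✶-< c (suc k) F zero    _         = refl
  mono-✶-< c (suc k) F (suc n) (s≤s n<k) = trans (ℤ.+-identityˡ _) (mono-✶-< c k F n n<k)

opaque
  unfolding _⊞_ neg scale mono _✶_

  mono-diag : ∀ c k → mono c k k ≡ c
  mono-diag c zero    = refl
  mono-diag c (suc k) = mono-diag c k

  mono-off : ∀ c k n → k ≢ n → mono c k n ≡ 0ℤ
  mono-off c zero    zero    k≢n with () ← k≢n refl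
  mono-off c zero    (suc n) k≢n = refl
  mono-off c (suc k) zero    k≢n = refl
  mono-off c (suc k) (suc n) k≢n = mono-off c k n (k≢n ∘ cong suc)

  mono-< : ∀ c k n → n < k → mono c k n ≡ 0ℤ
  mono-< c k n n<k = mono-off c k n (λ { refl → ℕ.<-irrefl refl n<k })

  mono-0 : ∀ k → mono 0ℤ k ≈ 0S
  mono-0 zero    zero    = refl
  mono-0 zero    (suc n) = refl
  mono-0 (suc k) zero    = refl
  mono-0 (suc k) (suc n) = mono-0 k n

  mono-+ : ∀ c d k → mono (c ℤ.+ d) k ≈ mono c k ⊞ mono d k
  mono-+ c d zero    zero    = refl
  mono-+ c d zero    (suc n) = refl
  mono-+ c d (suc k) zero    = refl
  mono-+ c d (suc k) (suc n) = mono-+ c d k n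

  mono-mono : ∀ c j d k → mono c j ✶ mono d k ≈ mono (c ℤ.* d) (j + k)
  mono-mono c zero d k n = trans (·-const c (mono d k) n) (scale-mono k n)
    where
    scale-mono : ∀ k n → c ℤ.* mono d k n ≡ mono (c ℤ.* d) k n
    scale-mono zero    zero    = refl
    scale-mono zero    (suc n) = ℤ.*-zeroʳ c
    scale-mono (suc k) zero    = ℤ.*-zeroʳ c
    scale-mono (suc k) (suc n) = scale-mono k n
  mono-mono c (suc j) d k zero    = refl
  mono-mono c (suc j) d k (suc n) = trans (ℤ.+-identityˡ _) (mono-mono c j d k n)

-- Polynomial identities in a commutative ring

ℤ-raw = AlmostCommutativeRing.rawRing (fromCommutativeRing ℤ.+-*-commutativeRing)

-- The identities are proved in an arbitrary ring, where the solver cannot unfold the operations.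
module Identities (R : AlmostCommutativeRing 0ℓ 0ℓ) (ι : ℤ-raw -Raw-AlmostCommutative⟶ R) where

  open AlmostCommutativeRing R using (Carrier; 1#; reflexive) renaming (_≈_ to _≃_; _+_ to _⊕_; _*_ to _⊗_; -_ to ⊝_)
  open _-Raw-AlmostCommutative⟶_ ι using () renaming (⟦_⟧ to ⟪_⟫)

  private
    coeff≟ : WeaklyDecidable (Induced-equivalence ι)
    coeff≟ c d with c ℤ.≟ d
    ... | yes eq = just (reflexive (cong ⟪_⟫ eq))
    ... | no  _  = nothing

  open Algebra.Solver.Ring ℤ-raw R ι coeff≟
  open AlmostCommutativeRing R using (+-cong; *-cong) renaming (refl to ≃-refl; sym to ≃-sym; trans to ≃-trans)

  [1+x][1+y] : ∀ x y → (⟪ 1ℤ ⟫ ⊕ x) ⊗ (⟪ 1ℤ ⟫ ⊕ y) ≃ (⟪ 1ℤ ⟫ ⊕ x ⊗ y) ⊕ (x ⊕ y)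
  [1+x][1+y] = solve 2 (λ x y → (con 1ℤ :+ x) :* (con 1ℤ :+ y) := (con 1ℤ :+ x :* y) :+ (x :+ y)) ≃-refl

  factorial-step : ∀ a b x y g h → (a ⊗ (⟪ 1ℤ ⟫ ⊕ ⊝ x)) ⊗ (b ⊗ (⟪ 1ℤ ⟫ ⊕ ⊝ y)) ⊗ (g ⊕ x ⊗ h) ≃
                   (⟪ 1ℤ ⟫ ⊕ ⊝ x) ⊗ (a ⊗ (b ⊗ (⟪ 1ℤ ⟫ ⊕ ⊝ y)) ⊗ g) ⊕
                   x ⊗ (⟪ 1ℤ ⟫ ⊕ ⊝ y) ⊗ ((a ⊗ (⟪ 1ℤ ⟫ ⊕ ⊝ x)) ⊗ b ⊗ h)
  factorial-step = solve 6 (λ a b x y g h →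
    (a :* (con 1ℤ :+ :- x)) :* (b :* (con 1ℤ :+ :- y)) :* (g :+ x :* h) :=
    (con 1ℤ :+ :- x) :* (a :* (b :* (con 1ℤ :+ :- y)) :* g) :+
    x :* (con 1ℤ :+ :- y) :* ((a :* (con 1ℤ :+ :- x)) :* b :* h)) ≃-refl

  factorial-collect : ∀ x y r → (⟪ 1ℤ ⟫ ⊕ ⊝ x) ⊗ r ⊕ x ⊗ (⟪ 1ℤ ⟫ ⊕ ⊝ y) ⊗ r ≃ r ⊗ (⟪ 1ℤ ⟫ ⊕ ⊝ (x ⊗ y))
  factorial-collect = solve 3 (λ x y r →
    (con 1ℤ :+ :- x) :* r :+ x :* (con 1ℤ :+ :- y) :* r := r :* (con 1ℤ :+ :- (x :* y))) ≃-refl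

  pascal-left : ∀ p g₀ g₁ q u g₂ → (p ⊗ g₀ ⊕ g₁) ⊕ q ⊗ (u ⊗ g₁ ⊕ g₂) ≃
                (p ⊗ g₀ ⊕ (q ⊗ u) ⊗ g₁) ⊕ (g₁ ⊕ q ⊗ g₂)
  pascal-left = solve 6 (λ p g₀ g₁ q u g₂ → (p :* g₀ :+ g₁) :+ q :* (u :* g₁ :+ g₂) :=
                (p :* g₀ :+ (q :* u) :* g₁) :+ (g₁ :+ q :* g₂)) ≃-refl

  pascal-right : ∀ p r g₀ g₁ q g₂ → p ⊗ (g₀ ⊕ r ⊗ g₁) ⊕ (g₁ ⊕ q ⊗ g₂) ≃
                 (p ⊗ g₀ ⊕ (p ⊗ r) ⊗ g₁) ⊕ (g₁ ⊕ q ⊗ g₂)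
  pascal-right = solve 6 (λ p r g₀ g₁ q g₂ → p :* (g₀ :+ r :* g₁) :+ (g₁ :+ q :* g₂) :=
                 (p :* g₀ :+ (p :* r) :* g₁) :+ (g₁ :+ q :* g₂)) ≃-refl

  pascal-edge : ∀ o q u g → o ⊕ q ⊗ (u ⊕ g) ≃ q ⊗ u ⊕ (o ⊕ q ⊗ g)
  pascal-edge = solve 4 (λ o q u g → o :+ q :* (u :+ g) := q :* u :+ (o :+ q :* g)) ≃-refl

  [ag+h]m : ∀ a g h m → (a ⊗ g ⊕ h) ⊗ m ≃ h ⊗ m ⊕ (a ⊗ m) ⊗ g
  [ag+h]m = solve 4 (λ a g h m → (a :* g :+ h) :* m := h :* m :+ (a :* m) :* g) ≃-refl

  x[gm] : ∀ x g m → x ⊗ (g ⊗ m) ≃ (x ⊗ m) ⊗ g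
  x[gm] = solve 3 (λ x g m → x :* (g :* m) := (x :* m) :* g) ≃-refl

  factor-out : ∀ a b x → a ⊗ b ⊕ x ⊗ (a ⊗ b) ≃ a ⊗ (⟪ 1ℤ ⟫ ⊕ x) ⊗ b
  factor-out = solve 3 (λ a b x → a :* b :+ x :* (a :* b) := a :* (con 1ℤ :+ x) :* b) ≃-refl

  square-split : ∀ a b → b ⊗ (a ⊗ a) ⊗ b ≃ (a ⊗ b) ⊗ (a ⊗ b)
  square-split = solve 2 (λ a b → b :* (a :* a) :* b := (a :* b) :* (a :* b)) ≃-refl

  ψ-product : ∀ f p → f ⊗ (p ⊗ (⟪ + 2 ⟫ ⊗ p)) ⊗ f ≃ ⟪ + 2 ⟫ ⊗ ((p ⊗ f) ⊗ (p ⊗ f))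
  ψ-product = solve 2 (λ f p → f :* (p :* (con (+ 2) :* p)) :* f := con (+ 2) :* ((p :* f) :* (p :* f))) ≃-refl

  αβ-product : ∀ f a b c d → f ⊗ (c ⊗ b) ⊗ (f ⊗ (d ⊗ a)) ≃ (⟪ 1ℤ ⟫ ⊗ a ⊗ b ⊗ c ⊗ d ⊗ f) ⊗ f
  αβ-product = solve 5 (λ f a b c d → f :* (c :* b) :* (f :* (d :* a)) := (con 1ℤ :* a :* b :* c :* d :* f) :* f) ≃-refl

  G-product : ∀ f a b c d g h → f ⊗ (c ⊗ b) ⊗ (f ⊗ (d ⊗ a)) ⊗ (g ⊗ f) ⊗ h ≃ ((⟪ 1ℤ ⟫ ⊗ a ⊗ b ⊗ c ⊗ d ⊗ g) ⊗ h) ⊗ (f ⊗ (f ⊗ f))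
  G-product = solve 7 (λ f a b c d g h → f :* (c :* b) :* (f :* (d :* a)) :* (g :* f) :* h :=
    ((con 1ℤ :* a :* b :* c :* d :* g) :* h) :* (f :* (f :* f))) ≃-refl

  K-product : ∀ t a b c d e g → t ⊗ (c ⊗ b) ⊗ (t ⊗ (d ⊗ a)) ⊗ (e ⊗ t) ⊗ g ≃ (⟪ 1ℤ ⟫ ⊗ a ⊗ b ⊗ e ⊗ c ⊗ d) ⊗ g ⊗ (t ⊗ (t ⊗ t))
  K-product = solve 7 (λ t a b c d e g → t :* (c :* b) :* (t :* (d :* a)) :* (e :* t) :* g :=
    (con 1ℤ :* a :* b :* e :* c :* d) :* g :* (t :* (t :* t))) ≃-refl

  log-step : ∀ a b k l → ⊝ (a ⊗ k) ⊗ b ⊕ a ⊗ ⊝ (b ⊗ l) ≃ ⊝ (a ⊗ b ⊗ (k ⊕ l))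
  log-step = solve 4 (λ a b k l → :- (a :* k) :* b :+ a :* :- (b :* l) := :- (a :* b :* (k :+ l))) ≃-refl

  wronskian-log : ∀ α β x a b c d → β ⊗ ⊝ (α ⊗ (x ⊕ (c ⊕ b))) ⊕ ⊝ (α ⊗ ⊝ (β ⊗ (x ⊕ (d ⊕ a)))) ≃
                  (α ⊗ β) ⊗ (d ⊕ (⊝ c ⊕ (⊝ b ⊕ a)))
  wronskian-log = solve 7 (λ α β x a b c d → β :* :- (α :* (x :+ (c :+ b))) :+ :- (α :* :- (β :* (x :+ (d :+ a)))) :=
                  (α :* β) :* (d :+ (:- c :+ (:- b :+ a)))) ≃-refl

  wronskian-collect : ∀ α β α′ β′ → ⟪ + 4 ⟫ ⊗ (⟪ + 40 ⟫ ⊗ (α ⊗ β′) ⊕ (⟪ -[1+ 39 ] ⟫ ⊗ (α′ ⊗ β) ⊕ ⟪ + 8 ⟫ ⊗ (α ⊗ β))) ≃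
                      ⟪ + 32 ⟫ ⊗ (α ⊗ β ⊕ ⊝ (⟪ + 5 ⟫ ⊗ (β ⊗ α′ ⊕ ⊝ (α ⊗ β′))))
  wronskian-collect = solve 4 (λ α β α′ β′ → con (+ 4) :* (con (+ 40) :* (α :* β′) :+ (con -[1+ 39 ] :* (α′ :* β) :+ con (+ 8) :* (α :* β))) :=
                      con (+ 32) :* (α :* β :+ :- (con (+ 5) :* (β :* α′ :+ :- (α :* β′))))) ≃-refl

  wronskian-end : ∀ f g h → f ⊗ g ⊕ ⊝ (⟪ + 5 ⟫ ⊗ (f ⊗ g ⊗ h)) ≃ f ⊗ (g ⊗ (⟪ 1ℤ ⟫ ⊕ ⊝ (⟪ + 5 ⟫ ⊗ h)))
  wronskian-end = solve 3 (λ f g h → f :* g :+ :- (con (+ 5) :* (f :* g :* h)) := f :* (g :* (con 1ℤ :+ :- (con (+ 5) :* h)))) ≃-refl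

  sixth-power : ∀ f → f ⊗ (f ⊗ f) ⊗ (f ⊗ (f ⊗ f)) ≃ f ⊗ (f ⊗ (f ⊗ (f ⊗ (f ⊗ f))))
  sixth-power = solve 1 (λ f → f :* (f :* f) :* (f :* (f :* f)) := f :* (f :* (f :* (f :* (f :* f))))) ≃-refl

  geometric-end : ∀ x g → (⟪ 1ℤ ⟫ ⊕ x) ⊗ g ≃ g ⊕ x ⊗ g
  geometric-end = solve 2 (λ x g → (con 1ℤ :+ x) :* g := g :+ x :* g) ≃-refl

  -- With `a`, `e`, `b` of degrees 0, 1, 2 modulo 5, the families `Y`, `Z` and `W` are the
  -- homogeneous parts of `e ⊗ Pol`, of (a - e - b)⁵ reduced by e² = ab, and of (a + e + b)³. The
  -- index is the degree, which becomes the class of the exponents of q.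
  Y₀ : Carrier → Carrier → Carrier → Carrier
  Y₀ a e b = ⟪ + 5 ⟫ ⊗ e ⊗ e ⊗ e ⊗ e ⊗ e

  Y₁ : Carrier → Carrier → Carrier → Carrier
  Y₁ a e b = ⟪ + 1 ⟫ ⊗ a ⊗ a ⊗ a ⊗ a ⊗ e ⊕ ⟪ -[1+ 2 ] ⟫ ⊗ e ⊗ e ⊗ e ⊗ e ⊗ b

  Y₂ : Carrier → Carrier → Carrier → Carrier
  Y₂ a e b = ⟪ + 1 ⟫ ⊗ a ⊗ a ⊗ a ⊗ e ⊗ e ⊕ ⟪ + 2 ⟫ ⊗ e ⊗ e ⊗ e ⊗ b ⊗ b

  Y₃ : Carrier → Carrier → Carrier → Carrier
  Y₃ a e b = ⟪ + 2 ⟫ ⊗ a ⊗ a ⊗ e ⊗ e ⊗ e ⊕ ⟪ -[1+ 0 ] ⟫ ⊗ e ⊗ e ⊗ b ⊗ b ⊗ b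

  Y₄ : Carrier → Carrier → Carrier → Carrier
  Y₄ a e b = ⟪ + 3 ⟫ ⊗ a ⊗ e ⊗ e ⊗ e ⊗ e ⊕ ⟪ + 1 ⟫ ⊗ e ⊗ b ⊗ b ⊗ b ⊗ b

  Z₀ : Carrier → Carrier → Carrier → Carrier
  Z₀ a e b = ⟪ + 1 ⟫ ⊗ a ⊗ a ⊗ a ⊗ a ⊗ a ⊕ ⟪ -[1+ 10 ] ⟫ ⊗ e ⊗ e ⊗ e ⊗ e ⊗ e ⊕ ⟪ -[1+ 0 ] ⟫ ⊗ b ⊗ b ⊗ b ⊗ b ⊗ b

  Z₁ : Carrier → Carrier → Carrier → Carrier
  Z₁ a e b = ⟪ -[1+ 4 ] ⟫ ⊗ a ⊗ a ⊗ a ⊗ a ⊗ e ⊕ ⟪ + 15 ⟫ ⊗ e ⊗ e ⊗ e ⊗ e ⊗ b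

  Z₂ : Carrier → Carrier → Carrier → Carrier
  Z₂ a e b = ⟪ + 5 ⟫ ⊗ a ⊗ a ⊗ a ⊗ e ⊗ e ⊕ ⟪ + 10 ⟫ ⊗ e ⊗ e ⊗ e ⊗ b ⊗ b

  Z₃ : Carrier → Carrier → Carrier → Carrier
  Z₃ a e b = ⟪ + 10 ⟫ ⊗ a ⊗ a ⊗ e ⊗ e ⊗ e ⊕ ⟪ -[1+ 4 ] ⟫ ⊗ e ⊗ e ⊗ b ⊗ b ⊗ b

  Z₄ : Carrier → Carrier → Carrier → Carrier
  Z₄ a e b = ⟪ -[1+ 14 ] ⟫ ⊗ a ⊗ e ⊗ e ⊗ e ⊗ e ⊕ ⟪ -[1+ 4 ] ⟫ ⊗ e ⊗ b ⊗ b ⊗ b ⊗ b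

  W₀ : Carrier → Carrier → Carrier → Carrier
  W₀ a e b = ⟪ + 1 ⟫ ⊗ a ⊗ a ⊗ a ⊕ ⟪ + 3 ⟫ ⊗ e ⊗ b ⊗ b

  -- Modulo e² = ab, the product of the four conjugates of a - e - b under e ↦ ζe, b ↦ ζ²b with ζ⁵ =
  -- 1. The full norm is `Z₀` = a⁵ - 11e⁵ - b⁵: writing a = u², e = uv, b = v², it factors over the
  -- golden ratio, and 11 is the fifth Lucas number.
  Pol : Carrier → Carrier → Carrier → Carrier
  Pol a e b = ⟪ + 1 ⟫ ⊗ a ⊗ a ⊗ a ⊗ a ⊕ ⟪ + 1 ⟫ ⊗ a ⊗ a ⊗ a ⊗ e ⊕ ⟪ + 2 ⟫ ⊗ a ⊗ a ⊗ e ⊗ e ⊕ ⟪ + 3 ⟫ ⊗ a ⊗ e ⊗ e ⊗ e ⊕ ⟪ + 5 ⟫ ⊗ e ⊗ e ⊗ e ⊗ e ⊕ ⟪ -[1+ 2 ] ⟫ ⊗ e ⊗ e ⊗ e ⊗ b ⊕ ⟪ + 2 ⟫ ⊗ e ⊗ e ⊗ b ⊗ b ⊕ ⟪ -[1+ 0 ] ⟫ ⊗ e ⊗ b ⊗ b ⊗ b ⊕ ⟪ + 1 ⟫ ⊗ b ⊗ b ⊗ b ⊗ b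

  -- The ring solver knows no relation between `a`, `e` and `b`, so `quintic` and `conorm` carry an
  -- explicit multiple of e² - ab; `K₁` and `K₂` are the cofactors.
  K₁ : Carrier → Carrier → Carrier → Carrier
  K₁ a e b = ⟪ + 5 ⟫ ⊗ a ⊗ a ⊗ a ⊕ ⟪ -[1+ 19 ] ⟫ ⊗ a ⊗ a ⊗ e ⊕ ⟪ -[1+ 9 ] ⟫ ⊗ a ⊗ a ⊗ b ⊕ ⟪ + 20 ⟫ ⊗ a ⊗ e ⊗ e ⊕ ⟪ + 30 ⟫ ⊗ a ⊗ e ⊗ b ⊕ ⟪ + 10 ⟫ ⊗ a ⊗ b ⊗ b ⊕ ⟪ + 10 ⟫ ⊗ e ⊗ e ⊗ e ⊕ ⟪ -[1+ 19 ] ⟫ ⊗ e ⊗ e ⊗ b ⊕ ⟪ -[1+ 19 ] ⟫ ⊗ e ⊗ b ⊗ b ⊕ ⟪ -[1+ 4 ] ⟫ ⊗ b ⊗ b ⊗ b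

  K₂ : Carrier → Carrier → Carrier → Carrier
  K₂ a e b = ⟪ + 1 ⟫ ⊗ a ⊗ a ⊗ a ⊕ ⟪ + 1 ⟫ ⊗ a ⊗ a ⊗ e ⊕ ⟪ + 2 ⟫ ⊗ a ⊗ e ⊗ e ⊕ ⟪ + 6 ⟫ ⊗ e ⊗ e ⊗ e ⊕ ⟪ -[1+ 1 ] ⟫ ⊗ e ⊗ e ⊗ b ⊕ ⟪ + 1 ⟫ ⊗ e ⊗ b ⊗ b ⊕ ⟪ -[1+ 0 ] ⟫ ⊗ b ⊗ b ⊗ b

  W₁ : Carrier → Carrier → Carrier → Carrier
  W₁ a e b = ⟪ + 3 ⟫ ⊗ a ⊗ a ⊗ e ⊕ ⟪ + 1 ⟫ ⊗ b ⊗ b ⊗ b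

  W₂ : Carrier → Carrier → Carrier → Carrier
  W₂ a e b = ⟪ + 3 ⟫ ⊗ a ⊗ a ⊗ b ⊕ ⟪ + 3 ⟫ ⊗ a ⊗ e ⊗ e

  W₃ : Carrier → Carrier → Carrier → Carrier
  W₃ a e b = ⟪ + 6 ⟫ ⊗ a ⊗ e ⊗ b ⊕ ⟪ + 1 ⟫ ⊗ e ⊗ e ⊗ e

  W₄ : Carrier → Carrier → Carrier → Carrier
  W₄ a e b = ⟪ + 3 ⟫ ⊗ a ⊗ b ⊗ b ⊕ ⟪ + 3 ⟫ ⊗ e ⊗ e ⊗ b

  quintic : ∀ a e b → (a ⊕ (⊝ e ⊕ ⊝ b)) ⊗ ((a ⊕ (⊝ e ⊕ ⊝ b)) ⊗ ((a ⊕ (⊝ e ⊕ ⊝ b)) ⊗ ((a ⊕ (⊝ e ⊕ ⊝ b)) ⊗ (a ⊕ (⊝ e ⊕ ⊝ b))))) ≃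
            (Z₀ a e b ⊕ (Z₁ a e b ⊕ (Z₂ a e b ⊕ (Z₃ a e b ⊕ Z₄ a e b)))) ⊕ (e ⊗ e ⊕ ⊝ (a ⊗ b)) ⊗ K₁ a e b
  quintic = solve 3 (λ a e b → (a :+ (:- e :+ :- b)) :* ((a :+ (:- e :+ :- b)) :* ((a :+ (:- e :+ :- b)) :* ((a :+ (:- e :+ :- b)) :* (a :+ (:- e :+ :- b))))) :=
    ((con (+ 1) :* a :* a :* a :* a :* a :+ con (-[1+ 10 ]) :* e :* e :* e :* e :* e :+ con (-[1+ 0 ]) :* b :* b :* b :* b :* b) :+ ((con (-[1+ 4 ]) :* a :* a :* a :* a :* e :+ con (+ 15) :* e :* e :* e :* e :* b) :+ ((con (+ 5) :* a :* a :* a :* e :* e :+ con (+ 10) :* e :* e :* e :* b :* b) :+ ((con (+ 10) :* a :* a :* e :* e :* e :+ con (-[1+ 4 ]) :* e :* e :* b :* b :* b) :+ (con (-[1+ 14 ]) :* a :* e :* e :* e :* e :+ con (-[1+ 4 ]) :* e :* b :* b :* b :* b)))))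
    :+ (e :* e :+ :- (a :* b)) :* (con (+ 5) :* a :* a :* a :+ con (-[1+ 19 ]) :* a :* a :* e :+ con (-[1+ 9 ]) :* a :* a :* b :+ con (+ 20) :* a :* e :* e :+ con (+ 30) :* a :* e :* b :+ con (+ 10) :* a :* b :* b :+ con (+ 10) :* e :* e :* e :+ con (-[1+ 19 ]) :* e :* e :* b :+ con (-[1+ 19 ]) :* e :* b :* b :+ con (-[1+ 4 ]) :* b :* b :* b)) ≃-refl

  conorm : ∀ a e b → (a ⊕ (⊝ e ⊕ ⊝ b)) ⊗ Pol a e b ≃ Z₀ a e b ⊕ (e ⊗ e ⊕ ⊝ (a ⊗ b)) ⊗ K₂ a e b
  conorm = solve 3 (λ a e b → (a :+ (:- e :+ :- b)) :* (con (+ 1) :* a :* a :* a :* a :+ con (+ 1) :* a :* a :* a :* e :+ con (+ 2) :* a :* a :* e :* e :+ con (+ 3) :* a :* e :* e :* e :+ con (+ 5) :* e :* e :* e :* e :+ con (-[1+ 2 ]) :* e :* e :* e :* b :+ con (+ 2) :* e :* e :* b :* b :+ con (-[1+ 0 ]) :* e :* b :* b :* b :+ con (+ 1) :* b :* b :* b :* b) :=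
    (con (+ 1) :* a :* a :* a :* a :* a :+ con (-[1+ 10 ]) :* e :* e :* e :* e :* e :+ con (-[1+ 0 ]) :* b :* b :* b :* b :* b) :+ (e :* e :+ :- (a :* b)) :* (con (+ 1) :* a :* a :* a :+ con (+ 1) :* a :* a :* e :+ con (+ 2) :* a :* e :* e :+ con (+ 6) :* e :* e :* e :+ con (-[1+ 1 ]) :* e :* e :* b :+ con (+ 1) :* e :* b :* b :+ con (-[1+ 0 ]) :* b :* b :* b)) ≃-refl

  conorm-split : ∀ a e b → e ⊗ Pol a e b ≃ Y₀ a e b ⊕ (Y₁ a e b ⊕ (Y₂ a e b ⊕ (Y₃ a e b ⊕ Y₄ a e b)))
  conorm-split = solve 3 (λ a e b → e :* (con (+ 1) :* a :* a :* a :* a :+ con (+ 1) :* a :* a :* a :* e :+ con (+ 2) :* a :* a :* e :* e :+ con (+ 3) :* a :* e :* e :* e :+ con (+ 5) :* e :* e :* e :* e :+ con (-[1+ 2 ]) :* e :* e :* e :* b :+ con (+ 2) :* e :* e :* b :* b :+ con (-[1+ 0 ]) :* e :* b :* b :* b :+ con (+ 1) :* b :* b :* b :* b) :=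
    (con (+ 5) :* e :* e :* e :* e :* e) :+ ((con (+ 1) :* a :* a :* a :* a :* e :+ con (-[1+ 2 ]) :* e :* e :* e :* e :* b) :+ ((con (+ 1) :* a :* a :* a :* e :* e :+ con (+ 2) :* e :* e :* e :* b :* b) :+ ((con (+ 2) :* a :* a :* e :* e :* e :+ con (-[1+ 0 ]) :* e :* e :* b :* b :* b) :+ (con (+ 3) :* a :* e :* e :* e :* e :+ con (+ 1) :* e :* b :* b :* b :* b))))) ≃-refl

  cube-split : ∀ a e b → (a ⊕ (e ⊕ b)) ⊗ ((a ⊕ (e ⊕ b)) ⊗ (a ⊕ (e ⊕ b))) ≃ W₀ a e b ⊕ (W₁ a e b ⊕ (W₂ a e b ⊕ (W₃ a e b ⊕ W₄ a e b)))
  cube-split = solve 3 (λ a e b → (a :+ (e :+ b)) :* ((a :+ (e :+ b)) :* (a :+ (e :+ b))) :=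
    (con (+ 1) :* a :* a :* a :+ con (+ 3) :* e :* b :* b) :+ ((con (+ 3) :* a :* a :* e :+ con (+ 1) :* b :* b :* b) :+ ((con (+ 3) :* a :* a :* b :+ con (+ 3) :* a :* e :* e) :+ ((con (+ 6) :* a :* e :* b :+ con (+ 1) :* e :* e :* e) :+ (con (+ 3) :* a :* b :* b :+ con (+ 3) :* e :* e :* b))))) ≃-refl

  W₂-factor : ∀ a e b → W₂ a e b ≃ ⟪ + 3 ⟫ ⊗ (a ⊗ (e ⊗ e ⊕ a ⊗ b))
  W₂-factor = solve 3 (λ a e b → (con (+ 3) :* a :* a :* b :+ con (+ 3) :* a :* e :* e) := con (+ 3) :* (a :* (e :* e :+ a :* b))) ≃-refl

  neg-square : ∀ a e b → ⊝ e ⊗ ⊝ e ⊕ ⊝ (a ⊗ ⊝ b) ≃ e ⊗ e ⊕ a ⊗ b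
  neg-square = solve 3 (λ a e b → :- e :* :- e :+ :- (a :* :- b) := e :* e :+ a :* b) ≃-refl

  -- The signs 1, -1, -1, 1 are the Legendre symbol of the degree: away from degree 0 the parts of
  -- f₁⁵ and of `e ⊗ Pol` agree up to -5 and this twist. It is the source of D(n) = χ(n) H(n).
  Z-collect : ∀ a e b → Z₁ a e b ⊕ (Z₂ a e b ⊕ (Z₃ a e b ⊕ Z₄ a e b)) ≃
              ⟪ -[1+ 4 ] ⟫ ⊗ (Y₁ a e b ⊕ (⟪ -1ℤ ⟫ ⊗ Y₂ a e b ⊕ (⟪ -1ℤ ⟫ ⊗ Y₃ a e b ⊕ Y₄ a e b)))
  Z-collect = solve 3 (λ a e b → (con (-[1+ 4 ]) :* a :* a :* a :* a :* e :+ con (+ 15) :* e :* e :* e :* e :* b) :+ ((con (+ 5) :* a :* a :* a :* e :* e :+ con (+ 10) :* e :* e :* e :* b :* b) :+ ((con (+ 10) :* a :* a :* e :* e :* e :+ con (-[1+ 4 ]) :* e :* e :* b :* b :* b) :+ (con (-[1+ 14 ]) :* a :* e :* e :* e :* e :+ con (-[1+ 4 ]) :* e :* b :* b :* b :* b))) :=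
    con -[1+ 4 ] :* ((con (+ 1) :* a :* a :* a :* a :* e :+ con (-[1+ 2 ]) :* e :* e :* e :* e :* b) :+ (con -1ℤ :* (con (+ 1) :* a :* a :* a :* e :* e :+ con (+ 2) :* e :* e :* e :* b :* b) :+ (con -1ℤ :* (con (+ 2) :* a :* a :* e :* e :* e :+ con (-[1+ 0 ]) :* e :* e :* b :* b :* b) :+ (con (+ 3) :* a :* e :* e :* e :* e :+ con (+ 1) :* e :* b :* b :* b :* b))))) ≃-refl

  Y₀-power : ∀ a x g b → Y₀ a (x ⊗ g) b ≃ ⟪ + 5 ⟫ ⊗ (x ⊗ (x ⊗ (x ⊗ (x ⊗ x))) ⊗ (g ⊗ (g ⊗ (g ⊗ (g ⊗ g)))))
  Y₀-power = solve 4 (λ a x g b → con (+ 5) :* (x :* g) :* (x :* g) :* (x :* g) :* (x :* g) :* (x :* g) :=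
    con (+ 5) :* (x :* (x :* (x :* (x :* x))) :* (g :* (g :* (g :* (g :* g)))))) ≃-refl

  linear-term : ∀ a b g g′ h → (a ⊗ g ⊕ b ⊗ g′) ⊗ h ≃ a ⊗ (g ⊗ h) ⊕ b ⊗ (g′ ⊗ h)
  linear-term = solve 5 (λ a b g g′ h → (a :* g :+ b :* g′) :* h := a :* (g :* h) :+ b :* (g′ :* h)) ≃-refl

  linear-collect : ∀ a b x y z w → (a ⊗ x ⊕ b ⊗ y) ⊕ (a ⊗ z ⊕ b ⊗ w) ≃ a ⊗ (x ⊕ z) ⊕ b ⊗ (y ⊕ w)
  linear-collect = solve 6 (λ a b x y z w → (a :* x :+ b :* y) :+ (a :* z :+ b :* w) := a :* (x :+ z) :+ b :* (y :+ w)) ≃-refl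

  times-collect₀ : ∀ a b g h h′ x → g ⊗ (a ⊗ h ⊕ b ⊗ h′) ⊕ a ⊗ x ≃ a ⊗ (g ⊗ h ⊕ x) ⊕ b ⊗ (g ⊗ h′)
  times-collect₀ = solve 6 (λ a b g h h′ x → g :* (a :* h :+ b :* h′) :+ a :* x := a :* (g :* h :+ x) :+ b :* (g :* h′)) ≃-refl

  times-collect : ∀ a b g h h′ x y → g ⊗ (a ⊗ h ⊕ b ⊗ h′) ⊕ (a ⊗ x ⊕ b ⊗ y) ≃ a ⊗ (g ⊗ h ⊕ x) ⊕ b ⊗ (g ⊗ h′ ⊕ y)
  times-collect = solve 7 (λ a b g h h′ x y → g :* (a :* h :+ b :* h′) :+ (a :* x :+ b :* y) := a :* (g :* h :+ x) :+ b :* (g :* h′ :+ y)) ≃-refl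

  φ-clear : ∀ φ b c d → (φ ⊗ φ) ⊗ ((b ⊗ b) ⊗ (c ⊗ (d ⊗ d))) ≃
    (φ ⊗ b) ⊗ (φ ⊗ b) ⊗ (c ⊗ (d ⊗ d))
  φ-clear = solve 4 (λ φ b c d → (φ :* φ) :* ((b :* b) :* (c :* (d :* d))) :=
    (φ :* b) :* (φ :* b) :* (c :* (d :* d))) ≃-refl

  φ-clear′ : ∀ Φ k x b c d → ((Φ ⊗ Φ) ⊕ ⟪ -[1+ 3 ] ⟫ ⊗ (x ⊗ k)) ⊗ ((b ⊗ b) ⊗ (c ⊗ (d ⊗ d))) ≃
    ((Φ ⊗ d) ⊗ (Φ ⊗ d)) ⊗ (b ⊗ (b ⊗ c)) ⊕ ⟪ -[1+ 3 ] ⟫ ⊗ (x ⊗ (k ⊗ c ⊗ b) ⊗ (b ⊗ (d ⊗ d)))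
  φ-clear′ = solve 6 (λ Φ k x b c d → ((Φ :* Φ) :+ con (-[1+ 3 ]) :* (x :* k)) :* ((b :* b) :* (c :* (d :* d))) :=
    ((Φ :* d) :* (Φ :* d)) :* (b :* (b :* c)) :+ con (-[1+ 3 ]) :* (x :* (k :* c :* b) :* (b :* (d :* d)))) ≃-refl

  ψ-clear : ∀ p a c d → (p ⊗ p) ⊗ ((a ⊗ a) ⊗ ((c ⊗ c) ⊗ d)) ≃
    (p ⊗ a) ⊗ (p ⊗ a) ⊗ ((c ⊗ c) ⊗ d)
  ψ-clear = solve 4 (λ p a c d → (p :* p) :* ((a :* a) :* ((c :* c) :* d)) :=
    (p :* a) :* (p :* a) :* ((c :* c) :* d)) ≃-refl

  ψ-clear′ : ∀ g x p a c d → (⟪ + 4 ⟫ ⊗ g ⊕ x ⊗ (p ⊗ p)) ⊗ ((a ⊗ a) ⊗ ((c ⊗ c) ⊗ d)) ≃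
    ⟪ + 4 ⟫ ⊗ ((g ⊗ d ⊗ a) ⊗ (a ⊗ (c ⊗ c))) ⊕ x ⊗ (((p ⊗ c) ⊗ (p ⊗ c)) ⊗ ((a ⊗ a) ⊗ d))
  ψ-clear′ = solve 6 (λ g x p a c d → (con (+ 4) :* g :+ x :* (p :* p)) :* ((a :* a) :* ((c :* c) :* d)) :=
    con (+ 4) :* ((g :* d :* a) :* (a :* (c :* c))) :+ x :* (((p :* c) :* (p :* c)) :* ((a :* a) :* d))) ≃-refl

  four-out : ∀ a b c d x → ⟪ + 4 ⟫ ⊗ ((b ⊗ (c ⊗ (c ⊗ c))) ⊗ (a ⊗ (c ⊗ c))) ⊕ x ⊗ (((⟪ + 2 ⟫ ⊗ (d ⊗ d)) ⊗ (⟪ + 2 ⟫ ⊗ (d ⊗ d))) ⊗ ((a ⊗ a) ⊗ d)) ≃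
    ⟪ + 4 ⟫ ⊗ (a ⊗ (b ⊗ (c ⊗ (c ⊗ (c ⊗ (c ⊗ c))))) ⊕ x ⊗ ((a ⊗ a) ⊗ (d ⊗ (d ⊗ (d ⊗ (d ⊗ d))))))
  four-out = solve 5 (λ a b c d x → con (+ 4) :* ((b :* (c :* (c :* c))) :* (a :* (c :* c))) :+ x :* (((con (+ 2) :* (d :* d)) :* (con (+ 2) :* (d :* d))) :* ((a :* a) :* d)) :=
    con (+ 4) :* (a :* (b :* (c :* (c :* (c :* (c :* c))))) :+ x :* ((a :* a) :* (d :* (d :* (d :* (d :* d))))))) ≃-refl

  four-out′ : ∀ b c d → (⟪ + 2 ⟫ ⊗ (b ⊗ b)) ⊗ (⟪ + 2 ⟫ ⊗ (b ⊗ b)) ⊗ ((c ⊗ c) ⊗ d) ≃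
    ⟪ + 4 ⟫ ⊗ ((b ⊗ (b ⊗ (b ⊗ b))) ⊗ ((c ⊗ c) ⊗ d))
  four-out′ = solve 3 (λ b c d → (con (+ 2) :* (b :* b)) :* (con (+ 2) :* (b :* b)) :* ((c :* c) :* d) :=
    con (+ 4) :* ((b :* (b :* (b :* b))) :* ((c :* c) :* d))) ≃-refl

  φ-tidy : ∀ a b c d x → ((c ⊗ c) ⊗ (c ⊗ c)) ⊗ (b ⊗ (b ⊗ c)) ⊕ ⟪ -[1+ 3 ] ⟫ ⊗ (x ⊗ (a ⊗ (d ⊗ (d ⊗ d))) ⊗ (b ⊗ (d ⊗ d))) ≃
    (b ⊗ b) ⊗ (c ⊗ (c ⊗ (c ⊗ (c ⊗ c)))) ⊕ ⟪ -[1+ 3 ] ⟫ ⊗ (x ⊗ (a ⊗ (b ⊗ (d ⊗ (d ⊗ (d ⊗ (d ⊗ d)))))))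
  φ-tidy = solve 5 (λ a b c d x → ((c :* c) :* (c :* c)) :* (b :* (b :* c)) :+ con (-[1+ 3 ]) :* (x :* (a :* (d :* (d :* d))) :* (b :* (d :* d))) :=
    (b :* b) :* (c :* (c :* (c :* (c :* c)))) :+ con (-[1+ 3 ]) :* (x :* (a :* (b :* (d :* (d :* (d :* (d :* d)))))))) ≃-refl

  φ-tidy′ : ∀ a c d → ((a ⊗ a) ⊗ (a ⊗ a)) ⊗ (c ⊗ (d ⊗ d)) ≃
    (a ⊗ (a ⊗ (a ⊗ a))) ⊗ (c ⊗ (d ⊗ d))
  φ-tidy′ = solve 3 (λ a c d → ((a :* a) :* (a :* a)) :* (c :* (d :* d)) :=
    (a :* (a :* (a :* a))) :* (c :* (d :* d))) ≃-refl

  level-ten₁ : ∀ a b c d x C C₂ B B₂ → ((a ⊗ (a ⊗ a)) ⊗ ((b ⊗ b) ⊗ ((c ⊗ c) ⊗ (d ⊗ (d ⊗ (d ⊗ (d ⊗ d))))))) ⊗ (⟪ + 15 ⟫ ⊗ (x ⊗ C) ⊕ (⟪ + 20 ⟫ ⊗ (x ⊗ x ⊗ C₂) ⊕ (B ⊕ ⟪ + 4 ⟫ ⊗ B₂))) ≃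
    ⟪ + 15 ⟫ ⊗ (x ⊗ ((a ⊗ C) ⊗ ((a ⊗ a) ⊗ ((b ⊗ b) ⊗ ((c ⊗ c) ⊗ (d ⊗ (d ⊗ (d ⊗ (d ⊗ d))))))))) ⊕ (⟪ + 20 ⟫ ⊗ (x ⊗ x ⊗ ((b ⊗ C₂) ⊗ ((a ⊗ (a ⊗ a)) ⊗ (b ⊗ ((c ⊗ c) ⊗ (d ⊗ (d ⊗ (d ⊗ (d ⊗ d))))))))) ⊕ ((c ⊗ B) ⊗ ((a ⊗ (a ⊗ a)) ⊗ ((b ⊗ b) ⊗ (c ⊗ (d ⊗ (d ⊗ (d ⊗ (d ⊗ d))))))) ⊕ ⟪ + 4 ⟫ ⊗ ((d ⊗ B₂) ⊗ ((a ⊗ (a ⊗ a)) ⊗ ((b ⊗ b) ⊗ ((c ⊗ c) ⊗ (d ⊗ (d ⊗ (d ⊗ d)))))))))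
  level-ten₁ = solve 9 (λ a b c d x C C₂ B B₂ → ((a :* (a :* a)) :* ((b :* b) :* ((c :* c) :* (d :* (d :* (d :* (d :* d))))))) :* (con (+ 15) :* (x :* C) :+ (con (+ 20) :* (x :* x :* C₂) :+ (B :+ con (+ 4) :* B₂))) :=
    con (+ 15) :* (x :* ((a :* C) :* ((a :* a) :* ((b :* b) :* ((c :* c) :* (d :* (d :* (d :* (d :* d))))))))) :+ (con (+ 20) :* (x :* x :* ((b :* C₂) :* ((a :* (a :* a)) :* (b :* ((c :* c) :* (d :* (d :* (d :* (d :* d))))))))) :+ ((c :* B) :* ((a :* (a :* a)) :* ((b :* b) :* (c :* (d :* (d :* (d :* (d :* d))))))) :+ con (+ 4) :* ((d :* B₂) :* ((a :* (a :* a)) :* ((b :* b) :* ((c :* c) :* (d :* (d :* (d :* d)))))))))) ≃-refl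

  level-ten₂ : ∀ a b c d x → ⟪ + 15 ⟫ ⊗ (x ⊗ ((c ⊗ (c ⊗ (c ⊗ (c ⊗ c)))) ⊗ ((a ⊗ a) ⊗ ((b ⊗ b) ⊗ ((c ⊗ c) ⊗ (d ⊗ (d ⊗ (d ⊗ (d ⊗ d))))))))) ⊕ (⟪ + 20 ⟫ ⊗ (x ⊗ x ⊗ ((d ⊗ (d ⊗ (d ⊗ (d ⊗ d)))) ⊗ ((a ⊗ (a ⊗ a)) ⊗ (b ⊗ ((c ⊗ c) ⊗ (d ⊗ (d ⊗ (d ⊗ (d ⊗ d))))))))) ⊕ ((a ⊗ (a ⊗ (a ⊗ (a ⊗ a)))) ⊗ ((a ⊗ (a ⊗ a)) ⊗ ((b ⊗ b) ⊗ (c ⊗ (d ⊗ (d ⊗ (d ⊗ (d ⊗ d))))))) ⊕ ⟪ + 4 ⟫ ⊗ ((b ⊗ (b ⊗ (b ⊗ (b ⊗ b)))) ⊗ ((a ⊗ (a ⊗ a)) ⊗ ((b ⊗ b) ⊗ ((c ⊗ c) ⊗ (d ⊗ (d ⊗ (d ⊗ d))))))))) ≃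
    ⟪ + 15 ⟫ ⊗ (x ⊗ ((c ⊗ (c ⊗ (c ⊗ (c ⊗ c)))) ⊗ ((a ⊗ a) ⊗ ((b ⊗ b) ⊗ ((c ⊗ c) ⊗ (d ⊗ (d ⊗ (d ⊗ (d ⊗ d))))))))) ⊕ (⟪ + 20 ⟫ ⊗ (x ⊗ x ⊗ ((d ⊗ (d ⊗ (d ⊗ (d ⊗ d)))) ⊗ ((a ⊗ (a ⊗ a)) ⊗ (b ⊗ ((c ⊗ c) ⊗ (d ⊗ (d ⊗ (d ⊗ (d ⊗ d))))))))) ⊕ ((a ⊗ (a ⊗ a)) ⊗ ((b ⊗ b) ⊗ (d ⊗ (d ⊗ d)))) ⊗ (a ⊗ ((a ⊗ (a ⊗ (a ⊗ a))) ⊗ (c ⊗ (d ⊗ d))) ⊕ ⟪ + 4 ⟫ ⊗ (b ⊗ ((b ⊗ (b ⊗ (b ⊗ b))) ⊗ ((c ⊗ c) ⊗ d)))))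
  level-ten₂ = solve 5 (λ a b c d x → con (+ 15) :* (x :* ((c :* (c :* (c :* (c :* c)))) :* ((a :* a) :* ((b :* b) :* ((c :* c) :* (d :* (d :* (d :* (d :* d))))))))) :+ (con (+ 20) :* (x :* x :* ((d :* (d :* (d :* (d :* d)))) :* ((a :* (a :* a)) :* (b :* ((c :* c) :* (d :* (d :* (d :* (d :* d))))))))) :+ ((a :* (a :* (a :* (a :* a)))) :* ((a :* (a :* a)) :* ((b :* b) :* (c :* (d :* (d :* (d :* (d :* d))))))) :+ con (+ 4) :* ((b :* (b :* (b :* (b :* b)))) :* ((a :* (a :* a)) :* ((b :* b) :* ((c :* c) :* (d :* (d :* (d :* d))))))))) :=
    con (+ 15) :* (x :* ((c :* (c :* (c :* (c :* c)))) :* ((a :* a) :* ((b :* b) :* ((c :* c) :* (d :* (d :* (d :* (d :* d))))))))) :+ (con (+ 20) :* (x :* x :* ((d :* (d :* (d :* (d :* d)))) :* ((a :* (a :* a)) :* (b :* ((c :* c) :* (d :* (d :* (d :* (d :* d))))))))) :+ ((a :* (a :* a)) :* ((b :* b) :* (d :* (d :* d)))) :* (a :* ((a :* (a :* (a :* a))) :* (c :* (d :* d))) :+ con (+ 4) :* (b :* ((b :* (b :* (b :* b))) :* ((c :* c) :* d)))))) ≃-refl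

  level-ten₃ : ∀ a b c d x → ⟪ + 15 ⟫ ⊗ (x ⊗ ((c ⊗ (c ⊗ (c ⊗ (c ⊗ c)))) ⊗ ((a ⊗ a) ⊗ ((b ⊗ b) ⊗ ((c ⊗ c) ⊗ (d ⊗ (d ⊗ (d ⊗ (d ⊗ d))))))))) ⊕ (⟪ + 20 ⟫ ⊗ (x ⊗ x ⊗ ((d ⊗ (d ⊗ (d ⊗ (d ⊗ d)))) ⊗ ((a ⊗ (a ⊗ a)) ⊗ (b ⊗ ((c ⊗ c) ⊗ (d ⊗ (d ⊗ (d ⊗ (d ⊗ d))))))))) ⊕ ((a ⊗ (a ⊗ a)) ⊗ ((b ⊗ b) ⊗ (d ⊗ (d ⊗ d)))) ⊗ (a ⊗ ((b ⊗ b) ⊗ (c ⊗ (c ⊗ (c ⊗ (c ⊗ c)))) ⊕ ⟪ -[1+ 3 ] ⟫ ⊗ (x ⊗ (a ⊗ (b ⊗ (d ⊗ (d ⊗ (d ⊗ (d ⊗ d)))))))) ⊕ ⟪ + 4 ⟫ ⊗ (b ⊗ (a ⊗ (b ⊗ (c ⊗ (c ⊗ (c ⊗ (c ⊗ c))))) ⊕ x ⊗ ((a ⊗ a) ⊗ (d ⊗ (d ⊗ (d ⊗ (d ⊗ d))))))))) ≃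
    ⟪ + 15 ⟫ ⊗ (x ⊗ ((c ⊗ (c ⊗ (c ⊗ (c ⊗ c)))) ⊗ ((a ⊗ a) ⊗ ((b ⊗ b) ⊗ ((c ⊗ c) ⊗ (d ⊗ (d ⊗ (d ⊗ (d ⊗ d))))))))) ⊕ (⟪ + 20 ⟫ ⊗ (x ⊗ x ⊗ ((d ⊗ (d ⊗ (d ⊗ (d ⊗ d)))) ⊗ ((a ⊗ (a ⊗ a)) ⊗ (b ⊗ ((c ⊗ c) ⊗ (d ⊗ (d ⊗ (d ⊗ (d ⊗ d))))))))) ⊕ ⟪ + 5 ⟫ ⊗ ((c ⊗ c) ⊗ (((a ⊗ (a ⊗ (a ⊗ a))) ⊗ (c ⊗ (d ⊗ d))) ⊗ ((b ⊗ (b ⊗ (b ⊗ b))) ⊗ ((c ⊗ c) ⊗ d)))))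
  level-ten₃ = solve 5 (λ a b c d x → con (+ 15) :* (x :* ((c :* (c :* (c :* (c :* c)))) :* ((a :* a) :* ((b :* b) :* ((c :* c) :* (d :* (d :* (d :* (d :* d))))))))) :+ (con (+ 20) :* (x :* x :* ((d :* (d :* (d :* (d :* d)))) :* ((a :* (a :* a)) :* (b :* ((c :* c) :* (d :* (d :* (d :* (d :* d))))))))) :+ ((a :* (a :* a)) :* ((b :* b) :* (d :* (d :* d)))) :* (a :* ((b :* b) :* (c :* (c :* (c :* (c :* c)))) :+ con (-[1+ 3 ]) :* (x :* (a :* (b :* (d :* (d :* (d :* (d :* d)))))))) :+ con (+ 4) :* (b :* (a :* (b :* (c :* (c :* (c :* (c :* c))))) :+ x :* ((a :* a) :* (d :* (d :* (d :* (d :* d))))))))) :=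
    con (+ 15) :* (x :* ((c :* (c :* (c :* (c :* c)))) :* ((a :* a) :* ((b :* b) :* ((c :* c) :* (d :* (d :* (d :* (d :* d))))))))) :+ (con (+ 20) :* (x :* x :* ((d :* (d :* (d :* (d :* d)))) :* ((a :* (a :* a)) :* (b :* ((c :* c) :* (d :* (d :* (d :* (d :* d))))))))) :+ con (+ 5) :* ((c :* c) :* (((a :* (a :* (a :* a))) :* (c :* (d :* d))) :* ((b :* (b :* (b :* b))) :* ((c :* c) :* d)))))) ≃-refl

  level-ten₄ : ∀ a b c d x → ⟪ + 15 ⟫ ⊗ (x ⊗ ((c ⊗ (c ⊗ (c ⊗ (c ⊗ c)))) ⊗ ((a ⊗ a) ⊗ ((b ⊗ b) ⊗ ((c ⊗ c) ⊗ (d ⊗ (d ⊗ (d ⊗ (d ⊗ d))))))))) ⊕ (⟪ + 20 ⟫ ⊗ (x ⊗ x ⊗ ((d ⊗ (d ⊗ (d ⊗ (d ⊗ d)))) ⊗ ((a ⊗ (a ⊗ a)) ⊗ (b ⊗ ((c ⊗ c) ⊗ (d ⊗ (d ⊗ (d ⊗ (d ⊗ d))))))))) ⊕ ⟪ + 5 ⟫ ⊗ ((c ⊗ c) ⊗ (((b ⊗ b) ⊗ (c ⊗ (c ⊗ (c ⊗ (c ⊗ c)))) ⊕ ⟪ -[1+ 3 ] ⟫ ⊗ (x ⊗ (a ⊗ (b ⊗ (d ⊗ (d ⊗ (d ⊗ (d ⊗ d)))))))) ⊗ (a ⊗ (b ⊗ (c ⊗ (c ⊗ (c ⊗ (c ⊗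 c))))) ⊕ x ⊗ ((a ⊗ a) ⊗ (d ⊗ (d ⊗ (d ⊗ (d ⊗ d))))))))) ≃
    ⟪ + 5 ⟫ ⊗ ((c ⊗ (c ⊗ (c ⊗ (c ⊗ c)))) ⊗ (c ⊗ (c ⊗ (c ⊗ (c ⊗ c)))) ⊗ b ⊗ (a ⊗ ((b ⊗ b) ⊗ (c ⊗ c))))
  level-ten₄ = solve 5 (λ a b c d x → con (+ 15) :* (x :* ((c :* (c :* (c :* (c :* c)))) :* ((a :* a) :* ((b :* b) :* ((c :* c) :* (d :* (d :* (d :* (d :* d))))))))) :+ (con (+ 20) :* (x :* x :* ((d :* (d :* (d :* (d :* d)))) :* ((a :* (a :* a)) :* (b :* ((c :* c) :* (d :* (d :* (d :* (d :* d))))))))) :+ con (+ 5) :* ((c :* c) :* (((b :* b) :* (c :* (c :* (c :* (c :* c)))) :+ con (-[1+ 3 ]) :* (x :* (a :* (b :* (d :* (d :* (d :* (d :* d)))))))) :* (a :* (b :* (c :* (c :* (c :* (c :* c))))) :+ x :* ((a :* a) :* (d :* (d :* (d :* (d :* d))))))))) :=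
    con (+ 5) :* ((c :* (c :* (c :* (c :* c)))) :* (c :* (c :* (c :* (c :* c)))) :* b :* (a :* ((b :* b) :* (c :* c))))) ≃-refl

  level-ten₅ : ∀ a b c d A → ((a ⊗ (a ⊗ a)) ⊗ ((b ⊗ b) ⊗ ((c ⊗ c) ⊗ (d ⊗ (d ⊗ (d ⊗ (d ⊗ d))))))) ⊗ (⟪ + 5 ⟫ ⊗ A) ≃
    ⟪ + 5 ⟫ ⊗ (A ⊗ (a ⊗ a) ⊗ (d ⊗ (d ⊗ (d ⊗ (d ⊗ d)))) ⊗ (a ⊗ ((b ⊗ b) ⊗ (c ⊗ c))))
  level-ten₅ = solve 5 (λ a b c d A → ((a :* (a :* a)) :* ((b :* b) :* ((c :* c) :* (d :* (d :* (d :* (d :* d))))))) :* (con (+ 5) :* A) :=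
    con (+ 5) :* (A :* (a :* a) :* (d :* (d :* (d :* (d :* d)))) :* (a :* ((b :* b) :* (c :* c))))) ≃-refl

  A-clear : ∀ A φ b d → A ⊗ (φ ⊗ b) ⊗ (d ⊗ (d ⊗ (d ⊗ (d ⊗ d)))) ≃
    (A ⊗ φ) ⊗ (b ⊗ (d ⊗ (d ⊗ (d ⊗ (d ⊗ d)))))
  A-clear = solve 4 (λ A φ b d → A :* (φ :* b) :* (d :* (d :* (d :* (d :* d)))) :=
    (A :* φ) :* (b :* (d :* (d :* (d :* (d :* d)))))) ≃-refl

  A-clear′ : ∀ Φ b d → (Φ ⊗ (Φ ⊗ (Φ ⊗ (Φ ⊗ Φ)))) ⊗ (b ⊗ (d ⊗ (d ⊗ (d ⊗ (d ⊗ d))))) ≃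
    ((Φ ⊗ d) ⊗ ((Φ ⊗ d) ⊗ ((Φ ⊗ d) ⊗ ((Φ ⊗ d) ⊗ (Φ ⊗ d))))) ⊗ b
  A-clear′ = solve 3 (λ Φ b d → (Φ :* (Φ :* (Φ :* (Φ :* Φ)))) :* (b :* (d :* (d :* (d :* (d :* d))))) :=
    ((Φ :* d) :* ((Φ :* d) :* ((Φ :* d) :* ((Φ :* d) :* (Φ :* d))))) :* b) ≃-refl

  A-clear″ : ∀ b c → ((c ⊗ c) ⊗ ((c ⊗ c) ⊗ ((c ⊗ c) ⊗ ((c ⊗ c) ⊗ (c ⊗ c))))) ⊗ b ≃
    (c ⊗ (c ⊗ (c ⊗ (c ⊗ c)))) ⊗ (c ⊗ (c ⊗ (c ⊗ (c ⊗ c)))) ⊗ b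
  A-clear″ = solve 2 (λ b c → ((c :* c) :* ((c :* c) :* ((c :* c) :* ((c :* c) :* (c :* c))))) :* b :=
    (c :* (c :* (c :* (c :* c)))) :* (c :* (c :* (c :* (c :* c)))) :* b) ≃-refl

  -- Here `a`, `b`, `c`, `d` stand for f₁, f₂, f₅, f₁₀ and `x` for q; the common factor clears all
  -- denominators. The terms of `B` and `B₂` then contain a times the left side of the first
  -- relation plus 4b times that of the second. On the right sides the terms in `x` cancel and
  -- 5ab²c⁵ is left, so that with its cofactor the sum is 5c² times the product of both left sides.
  -- Applying the relations again to this product gives the wanted term and the cross terms -15x and
  -- -20x², which is where the coefficients 15 and 20 come from.
  level-ten : ∀ a b c d x C C₂ B B₂ A →
    (a ⊗ (a ⊗ (a ⊗ a))) ⊗ (c ⊗ (d ⊗ d)) ≃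
      (b ⊗ b) ⊗ (c ⊗ (c ⊗ (c ⊗ (c ⊗ c)))) ⊕ ⟪ -[1+ 3 ] ⟫ ⊗ (x ⊗ (a ⊗ (b ⊗ (d ⊗ (d ⊗ (d ⊗ (d ⊗ d))))))) →
    (b ⊗ (b ⊗ (b ⊗ b))) ⊗ ((c ⊗ c) ⊗ d) ≃
      a ⊗ (b ⊗ (c ⊗ (c ⊗ (c ⊗ (c ⊗ c))))) ⊕ x ⊗ ((a ⊗ a) ⊗ (d ⊗ (d ⊗ (d ⊗ (d ⊗ d))))) →
    a ⊗ C ≃ (c ⊗ (c ⊗ (c ⊗ (c ⊗ c)))) →
    b ⊗ C₂ ≃ (d ⊗ (d ⊗ (d ⊗ (d ⊗ d)))) →
    c ⊗ B ≃ (a ⊗ (a ⊗ (a ⊗ (a ⊗ a)))) →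
    d ⊗ B₂ ≃ (b ⊗ (b ⊗ (b ⊗ (b ⊗ b)))) →
    A ⊗ (a ⊗ a) ⊗ (d ⊗ (d ⊗ (d ⊗ (d ⊗ d)))) ≃ (c ⊗ (c ⊗ (c ⊗ (c ⊗ c)))) ⊗ (c ⊗ (c ⊗ (c ⊗ (c ⊗ c)))) ⊗ b →
    ((a ⊗ (a ⊗ a)) ⊗ ((b ⊗ b) ⊗ ((c ⊗ c) ⊗ (d ⊗ (d ⊗ (d ⊗ (d ⊗ d))))))) ⊗ (⟪ + 5 ⟫ ⊗ A) ≃
      ((a ⊗ (a ⊗ a)) ⊗ ((b ⊗ b) ⊗ ((c ⊗ c) ⊗ (d ⊗ (d ⊗ (d ⊗ (d ⊗ d))))))) ⊗ (⟪ + 15 ⟫ ⊗ (x ⊗ C) ⊕ (⟪ + 20 ⟫ ⊗ (x ⊗ x ⊗ C₂) ⊕ (B ⊕ ⟪ + 4 ⟫ ⊗ B₂)))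
  level-ten a b c d x C C₂ B B₂ A φ-eta ψ-eta C-eta C₂-eta B-eta B₂-eta A-eta =
    ≃-trans (level-ten₅ a b c d A) (≃-trans (*-cong ≃-refl (*-cong A-eta ≃-refl))
    (≃-sym (≃-trans (level-ten₁ a b c d x C C₂ B B₂)
    (≃-trans (+-cong (*-cong ≃-refl (*-cong ≃-refl (*-cong C-eta ≃-refl))) (+-cong (*-cong ≃-refl (*-cong ≃-refl (*-cong C₂-eta ≃-refl)))
      (+-cong (*-cong B-eta ≃-refl) (*-cong ≃-refl (*-cong B₂-eta ≃-refl)))))
    (≃-trans (level-ten₂ a b c d x)
    (≃-trans (+-cong ≃-refl (+-cong ≃-refl (*-cong ≃-refl (+-cong (*-cong ≃-refl φ-eta) (*-cong ≃-refl (*-cong ≃-refl ψ-eta))))))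
    (≃-trans (level-ten₃ a b c d x)
    (≃-trans (+-cong ≃-refl (+-cong ≃-refl (*-cong ≃-refl (*-cong ≃-refl (*-cong φ-eta ψ-eta)))))
    (level-ten₄ a b c d x)))))))))

open Identities (fromCommutativeRing seriesRing) const-morphism public

module ≈-Reasoning = SetoidReasoning 𝕊.setoid

✶-congˡ : ∀ F {G G′} → G ≈ G′ → F ✶ G ≈ F ✶ G′
✶-congˡ F p = ✶-cong {F} {F} ≈-refl p

✶-congʳ : ∀ G {F F′} → F ≈ F′ → F ✶ G ≈ F′ ✶ G
✶-congʳ G p = ✶-cong {G = G} {G} p ≈-refl

✶-identityʳ : ∀ F → F ✶ one ≈ F
✶-identityʳ = 𝕊.*-identityʳ

module ✶-Properties = CommSemigroup (CommutativeMonoid.commutativeSemigroup 𝕊.*-commutativeMonoid)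
open ✶-Properties public
  using () renaming (interchange to ✶-interchange)

-- Infinite products

Prod : (ℕ → Series) → ℕ → Series
Prod d zero    = one
Prod d (suc N) = Prod d N ✶ d N

Prod-cong : ∀ {d e} → (∀ k → d k ≈ e k) → ∀ N → Prod d N ≈ Prod e N
Prod-cong p zero    = ≈-refl
Prod-cong p (suc N) = ✶-cong (Prod-cong p N) (p N)

Prod-✶ : ∀ d e N → Prod (λ k → d k ✶ e k) N ≈ Prod d N ✶ Prod e N
Prod-✶ d e zero    = ≈-sym (✶-identityˡ one)
Prod-✶ d e (suc N) = ≈-trans (✶-congʳ (d N ✶ e N) (Prod-✶ d e N)) (✶-interchange (Prod d N) (Prod e N) (d N) (e N))

Prod-one : ∀ N → Prod (λ _ → one) N ≈ one
Prod-one zero    = ≈-refl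
Prod-one (suc N) = ≈-trans (✶-identityʳ _) (Prod-one N)

Prod-+ : ∀ d a b → Prod d (a + b) ≈ Prod d a ✶ Prod (λ k → d (a + k)) b
Prod-+ d a zero    rewrite ℕ.+-identityʳ a = ≈-sym (✶-identityʳ _)
Prod-+ d a (suc b) rewrite ℕ.+-suc a b =
  ≈-trans (✶-congʳ (d (a + b)) (Prod-+ d a b)) (✶-assoc (Prod d a) _ (d (a + b)))

Prod-regroup : ∀ d t N → Prod d (N * t) ≈ Prod (λ r → Prod (λ k → d (r + k * t)) N) t
Prod-regroup d t zero    = ≈-sym (Prod-one t)
Prod-regroup d t (suc N) rewrite ℕ.+-comm t (N * t) = begin
  Prod d (N * t + t)                                ≈⟨ Prod-+ d (N * t) t ⟩
  Prod d (N * t) ✶ Prod (λ r → d (N * t + r)) t     ≈⟨ ✶-cong (Prod-regroup d t N)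
    (Prod-cong (λ r n → cong (λ k → d k n) (ℕ.+-comm (N * t) r)) t) ⟩
  Prod (λ r → Prod (λ k → d (r + k * t)) N) t ✶ Prod (λ r → d (r + N * t)) t ≈⟨ Prod-✶ _ _ t ⟨
  Prod (λ r → Prod (λ k → d (r + k * t)) (suc N)) t ∎
  where open ≈-Reasoning

-- Convergence with a fixed rate: factor `k` is 1 modulo `q^k`, so the first `N` factors give the
-- product modulo `q^N`.
Tends : (ℕ → Series) → Set
Tends d = ∀ k → d k ≈[ k ] one

Prod-stable : ∀ {d} → Tends d → ∀ N M → Prod d (N + M) ≈[ N ] Prod d N
Prod-stable {d} tends N zero    rewrite ℕ.+-identityʳ N = ≈[]-refl
Prod-stable {d} tends N (suc M) rewrite ℕ.+-suc N M =
  ≈[]-trans (✶-cong[] {F = Prod d (N + M)} {G = d (N + M)} {G′ = one} (Prod-stable tends N M) (≈[]-≤ (ℕ.m≤m+n N M) (tends (N + M))))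
            (≈⇒≈[] (✶-identityʳ (Prod d N)))

-- A diagonal definition: under `Tends`, the factors from index `n + 1` on no longer affect the
-- coefficient of `q^n`.
Pinf : (ℕ → Series) → Series
Pinf d n = Prod d (suc n) n

Pinf-≈[] : ∀ {d} → Tends d → ∀ N → Pinf d ≈[ N ] Prod d N
Pinf-≈[] {d} tends N n n<N = sym (trans
  (cong (λ M → Prod d M n) (sym (ℕ.m+[n∸m]≡n n<N)))
  (Prod-stable tends (suc n) (N ∸ suc n) n ℕ.≤-refl))

≈[]⇒≈ : ∀ {F G} → (∀ m → F ≈[ m ] G) → F ≈ G
≈[]⇒≈ p n = p (suc n) n ℕ.≤-refl

Tends-✶ : ∀ {d e} → Tends d → Tends e → Tends (λ k → d k ✶ e k)
Tends-✶ p q k = ≈[]-trans (✶-cong[] (p k) (q k)) (≈⇒≈[] (✶-identityˡ one))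

Pinf-cong : ∀ {d e} → (∀ k → d k ≈ e k) → Pinf d ≈ Pinf e
Pinf-cong p n = Prod-cong p (suc n) n

Pinf-✶ : ∀ {d e} → Tends d → Tends e → Pinf (λ k → d k ✶ e k) ≈ Pinf d ✶ Pinf e
Pinf-✶ {d} {e} p q = ≈[]⇒≈ λ N → ≈[]-trans (Pinf-≈[] (Tends-✶ p q) N)
  (≈[]-trans (≈⇒≈[] (Prod-✶ d e N)) (≈[]-sym (✶-cong[] (Pinf-≈[] p N) (Pinf-≈[] q N))))

Prod-cong[] : ∀ {m d e} → (∀ k → d k ≈[ m ] e k) → ∀ N → Prod d N ≈[ m ] Prod e N
Prod-cong[] p zero    = ≈[]-refl
Prod-cong[] p (suc N) = ✶-cong[] (Prod-cong[] p N) (p N)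

k≤k*t : ∀ k t .{{_ : NonZero t}} → k ≤ k * t
k≤k*t = ℕ.m≤m*n

Tends-stride : ∀ {d} → Tends d → ∀ r t .{{_ : NonZero t}} → Tends (λ k → d (r + k * t))
Tends-stride p r t k = ≈[]-≤ (ℕ.≤-trans (k≤k*t k t) (ℕ.m≤n+m _ r)) (p (r + k * t))

Pinf-regroup : ∀ {d} → Tends d → ∀ t .{{_ : NonZero t}} →
               Pinf d ≈ Prod (λ r → Pinf (λ k → d (r + k * t))) t
Pinf-regroup {d} p t = ≈[]⇒≈ λ N →
  ≈[]-trans (≈[]-≤ (k≤k*t N t) (Pinf-≈[] p (N * t)))
  (≈[]-trans (≈⇒≈[] (Prod-regroup d t N))
  (Prod-cong[] (λ r → ≈[]-sym (Pinf-≈[] (Tends-stride p r t) N)) t))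

factor : ℤ → ℕ → ℕ → ℕ → Series
factor ε i s k = one ⊞ mono ε (i + k * s)

Tends-factor : ∀ ε i s .{{_ : NonZero s}} → Tends (factor ε i s)
Tends-factor ε i s k n n<k = trans (⊞-at one (mono ε (i + k * s)) n) (trans (cong (λ y → one n ℤ.+ y) (mono-< ε (i + k * s) n
  (ℕ.<-≤-trans n<k (ℕ.≤-trans (k≤k*t k s) (ℕ.m≤n+m _ i))))) (ℤ.+-identityʳ (one n)))

-- (- ε q^i ; q^s)_∞
P : ℤ → ℕ → ℕ → Series
P ε i s = Pinf (factor ε i s)

P-≈[] : ∀ ε i s .{{_ : NonZero s}} N → P ε i s ≈[ N ] Prod (factor ε i s) N
P-≈[] ε i s = Pinf-≈[] (Tends-factor ε i s)

mono-exp : ∀ c {j k} → j ≡ k → mono c j ≈ mono c k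
mono-exp c refl n = refl

P-regroup : ∀ ε i s .{{_ : NonZero s}} t .{{_ : NonZero t}} →
            P ε i s ≈ Prod (λ r → P ε (i + r * s) (t * s)) t
P-regroup ε i s t = ≈-trans (Pinf-regroup (Tends-factor ε i s) t)
  (Prod-cong (λ r → Pinf-cong (λ k → ⊞-congˡ one (mono-exp ε (exponent i r k t s)))) t)
  where
  exponent : ∀ i r k t s → i + (r + k * t) * s ≡ i + r * s + k * (t * s)
  exponent = ℕ-Solver.solve-∀

P-peel : ∀ ε i s .{{_ : NonZero s}} → P ε i s ≈ (one ⊞ mono ε i) ✶ P ε (i + s) s
P-peel ε i s = ≈[]⇒≈ λ N → ≈[]-trans (≈[]-≤ (ℕ.n≤1+n N) (P-≈[] ε i s (suc N)))
  (≈[]-trans (≈⇒≈[] (≈-trans (Prod-+ (factor ε i s) 1 N) (✶-cong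
      (≈-trans (✶-identityˡ _) (⊞-congˡ one (mono-exp ε (ℕ.+-identityʳ i))))
      (Prod-cong (λ k → ⊞-congˡ one (mono-exp ε (sym (ℕ.+-assoc i s (k * s))))) N))))
  (✶-cong[] {F = one ⊞ mono ε i} ≈[]-refl (≈[]-sym (P-≈[] ε (i + s) s N))))

difference-of-squares : ∀ k → (one ⊞ mono 1ℤ k) ✶ (one ⊞ mono -1ℤ k) ≈ one ⊞ mono -1ℤ (k + k)
difference-of-squares k = begin
  (one ⊞ mono 1ℤ k) ✶ (one ⊞ mono -1ℤ k)
    ≈⟨ ✶-cong (⊞-cong one≈const ≈-refl) (⊞-cong one≈const ≈-refl) ⟩
  (const 1ℤ ⊞ mono 1ℤ k) ✶ (const 1ℤ ⊞ mono -1ℤ k)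
    ≈⟨ [1+x][1+y] (mono 1ℤ k) (mono -1ℤ k) ⟩
  const 1ℤ ⊞ mono 1ℤ k ✶ mono -1ℤ k ⊞ (mono 1ℤ k ⊞ mono -1ℤ k)
    ≈⟨ ⊞-cong (⊞-cong (≈-sym one≈const) (mono-mono 1ℤ k -1ℤ k)) (≈-trans (≈-sym (mono-+ 1ℤ -1ℤ k)) (mono-0 k)) ⟩
  one ⊞ mono -1ℤ (k + k) ⊞ 0S
    ≈⟨ 𝕊.+-identityʳ _ ⟩
  one ⊞ mono -1ℤ (k + k) ∎
  where open ≈-Reasoning

P-square : ∀ i s .{{_ : NonZero s}} → P 1ℤ i s ✶ P -1ℤ i s ≈ P -1ℤ (i + i) (s + s)
P-square i s = ≈-trans (≈-sym (Pinf-✶ (Tends-factor 1ℤ i s) (Tends-factor -1ℤ i s)))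
  (Pinf-cong λ k → ≈-trans (difference-of-squares (i + k * s))
    (⊞-congˡ one (mono-exp -1ℤ (exponent i k s))))
  where
  exponent : ∀ i k s → (i + k * s) + (i + k * s) ≡ i + i + k * (s + s)
  exponent = ℕ-Solver.solve-∀

P-at-0 : ∀ ε i s → P ε (suc i) s 0 ≡ 1ℤ
P-at-0 ε i s = trans (✶-at-0 one (one ⊞ mono ε (suc (i + 0)))) (trans (ℤ.*-identityˡ _)
  (trans (⊞-at one _ 0) (cong (λ y → 1ℤ ℤ.+ y) (mono-< ε (suc (i + 0)) 0 (s≤s z≤n)))))

-- Finite sums and theta series over an index set

sumL : ∀ {I : Set} → (I → ℤ) → List I → ℤ
sumL f []       = 0ℤ
sumL f (i ∷ is) = f i ℤ.+ sumL f is

module _ {I : Set} where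

  sumL-cong : ∀ {f g : I → ℤ} L → (∀ {i} → i ∈ L → f i ≡ g i) → sumL f L ≡ sumL g L
  sumL-cong []      p = refl
  sumL-cong (i ∷ L) p = cong₂ ℤ._+_ (p (here refl)) (sumL-cong L (p ∘ there))

  sumL-++ : ∀ (f : I → ℤ) L M → sumL f (L ++ M) ≡ sumL f L ℤ.+ sumL f M
  sumL-++ f []      M = sym (ℤ.+-identityˡ _)
  sumL-++ f (i ∷ L) M = trans (cong (λ y → f i ℤ.+ y) (sumL-++ f L M)) (sym (ℤ.+-assoc (f i) _ _))

  sumL-map : ∀ {J : Set} (f : I → ℤ) (σ : J → I) L → sumL f (map σ L) ≡ sumL (f ∘ σ) L
  sumL-map f σ []      = refl
  sumL-map f σ (j ∷ L) = cong (λ y → f (σ j) ℤ.+ y) (sumL-map f σ L)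

  sumL-↭ : ∀ (f : I → ℤ) {L M} → L ↭ M → sumL f L ≡ sumL f M
  sumL-↭ f refl         = refl
  sumL-↭ f (prep i p)   = cong (λ y → f i ℤ.+ y) (sumL-↭ f p)
  sumL-↭ f (swap {ys = M} i j p) = trans (cong (λ y → f i ℤ.+ (f j ℤ.+ y)) (sumL-↭ f p)) (lemma (f i) (f j) (sumL f M))
    where
    lemma : ∀ x y z → x ℤ.+ (y ℤ.+ z) ≡ y ℤ.+ (x ℤ.+ z)
    lemma = ℤ-Solver.solve-∀
  sumL-↭ f (transitive p q)  = trans (sumL-↭ f p) (sumL-↭ f q)

  sumL-set : ∀ (f : I → ℤ) {L M} → Unique L → Unique M → (∀ {i} → i ∈ L → i ∈ M) → (∀ {i} → i ∈ M → i ∈ L) →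
             sumL f L ≡ sumL f M
  sumL-set f u v p q = sumL-↭ f (∼bag⇒↭ (unique∧set⇒bag u v (mk⇔ p q)))

  sumL-0 : ∀ L → sumL {I} (λ _ → 0ℤ) L ≡ 0ℤ
  sumL-0 []      = refl
  sumL-0 (i ∷ L) = trans (ℤ.+-identityˡ _) (sumL-0 L)

  sumL-+ : ∀ (f g : I → ℤ) L → sumL (λ i → f i ℤ.+ g i) L ≡ sumL f L ℤ.+ sumL g L
  sumL-+ f g []      = refl
  sumL-+ f g (i ∷ L) = trans (cong (λ y → f i ℤ.+ g i ℤ.+ y) (sumL-+ f g L)) (lemma (f i) (g i) _ _)
    where
    lemma : ∀ a b c d → a ℤ.+ b ℤ.+ (c ℤ.+ d) ≡ a ℤ.+ c ℤ.+ (b ℤ.+ d)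
    lemma = ℤ-Solver.solve-∀

  sumL-* : ∀ c (f : I → ℤ) L → sumL (λ i → c ℤ.* f i) L ≡ c ℤ.* sumL f L
  sumL-* c f []      = sym (ℤ.*-zeroʳ c)
  sumL-* c f (i ∷ L) = trans (cong (λ y → c ℤ.* f i ℤ.+ y) (sumL-* c f L)) (sym (ℤ.*-distribˡ-+ c (f i) _))

  sumL-filter : ∀ {p} {Q : I → Set p} (Q? : Decidable Q) (f : I → ℤ) L → (∀ i → ¬ Q i → f i ≡ 0ℤ) →
                sumL f (filter Q? L) ≡ sumL f L
  sumL-filter Q? f []      z = refl
  sumL-filter Q? f (i ∷ L) z with Q? i
  ... | yes _ = cong (λ y → f i ℤ.+ y) (sumL-filter Q? f L z)
  ... | no ¬q = trans (sumL-filter Q? f L z) (sym (trans (cong (λ y → y ℤ.+ sumL f L) (z i ¬q)) (ℤ.+-identityˡ _)))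

module _ {I J : Set} where

  -- Follows the recursion of the Cauchy product, so that `sumL-pairs` is an induction in step with
  -- `_·_`.
  pairs : (ℕ → List I) → (ℕ → List J) → ℕ → List (I × J)
  pairs f g zero    = cartesianProduct (f 0) (g 0)
  pairs f g (suc m) = cartesianProduct (f 0) (g (suc m)) ++ pairs (f ∘ suc) g m

  ∈-pairs⁺ : ∀ f g m {k i j} → i ∈ f k → j ∈ g (m ∸ k) → k ≤ m → (i , j) ∈ pairs f g m
  ∈-pairs⁺ f g zero    {zero}  i∈ j∈ _ = ∈-cartesianProduct⁺ i∈ j∈
  ∈-pairs⁺ f g (suc m) {zero}  i∈ j∈ _ = ∈-++⁺ˡ (∈-cartesianProduct⁺ i∈ j∈)
  ∈-pairs⁺ f g (suc m) {suc k} i∈ j∈ (s≤s k≤m) = ∈-++⁺ʳ (cartesianProduct (f 0) (g (suc m))) (∈-pairs⁺ (f ∘ suc) g m i∈ j∈ k≤m)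

  ∈-pairs⁻ : ∀ f g m {i j} → (i , j) ∈ pairs f g m → ∃ λ k → k ≤ m × i ∈ f k × j ∈ g (m ∸ k)
  ∈-pairs⁻ f g zero    p = 0 , z≤n , ∈-cartesianProduct⁻ (f 0) (g 0) p
  ∈-pairs⁻ f g (suc m) p with ∈-++⁻ (cartesianProduct (f 0) (g (suc m))) p
  ... | inj₁ q = 0 , z≤n , ∈-cartesianProduct⁻ (f 0) (g (suc m)) q
  ... | inj₂ q with ∈-pairs⁻ (f ∘ suc) g m q
  ...   | k , k≤m , i∈ , j∈ = suc k , s≤s k≤m , i∈ , j∈

  pairs-unique : ∀ f g m → (∀ k → Unique (f k)) → (∀ k → Unique (g k)) →
                 (∀ {k l i} → i ∈ f k → i ∈ f l → k ≡ l) → Unique (pairs f g m)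
  pairs-unique f g zero    uf ug disj = Unique.cartesianProduct⁺ (uf 0) (ug 0)
  pairs-unique f g (suc m) uf ug disj = Unique.++⁺ (Unique.cartesianProduct⁺ (uf 0) (ug (suc m)))
    (pairs-unique (f ∘ suc) g m (uf ∘ suc) ug (λ p q → ℕ.suc-injective (disj p q)))
    λ (p , q) → contra (proj₁ (∈-cartesianProduct⁻ (f 0) (g (suc m)) p)) (∈-pairs⁻ (f ∘ suc) g m q)
    where
    contra : ∀ {i j} → i ∈ f 0 → (∃ λ k → k ≤ m × i ∈ f (suc k) × j ∈ g (m ∸ k)) → ⊥
    contra i∈ (k , _ , i∈′ , _) with () ← disj i∈ i∈′

  sumL-pairs : ∀ C C′ f g m → sumL (λ (i , j) → C i ℤ.* C′ j) (pairs f g m) ≡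
               ((λ k → sumL C (f k)) · (λ k → sumL C′ (g k))) m
  sumL-× : ∀ C C′ L M → sumL (λ ((i , j) : I × J) → C i ℤ.* C′ j) (cartesianProduct L M) ≡ sumL C L ℤ.* sumL C′ M
  sumL-× C C′ []      M = refl
  sumL-× C C′ (i ∷ L) M = begin
    sumL _ (map (i ,_) M ++ cartesianProduct L M)         ≡⟨ sumL-++ _ (map (i ,_) M) _ ⟩
    sumL _ (map (i ,_) M) ℤ.+ sumL _ (cartesianProduct L M) ≡⟨ cong₂ ℤ._+_ (trans (sumL-map _ (i ,_) M) (sumL-* (C i) C′ M)) (sumL-× C C′ L M) ⟩
    C i ℤ.* sumL C′ M ℤ.+ sumL C L ℤ.* sumL C′ M          ≡⟨ ℤ.*-distribʳ-+ (sumL C′ M) (C i) (sumL C L) ⟨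
    (C i ℤ.+ sumL C L) ℤ.* sumL C′ M                      ∎
    where open ≡-Reasoning
  sumL-pairs C C′ f g zero    = trans (sumL-× C C′ (f 0) (g 0)) (sym (ℤ.+-identityʳ _))
  sumL-pairs C C′ f g (suc m) = trans (sumL-++ _ (cartesianProduct (f 0) (g (suc m))) _)
    (cong₂ ℤ._+_ (sumL-× C C′ (f 0) (g (suc m))) (sumL-pairs C C′ (f ∘ suc) g m))

-- A statistic E taking each value finitely often, so that Σ_i C i q^(E i) is a series.
record Levels {I : Set} (E : I → ℕ) : Set where
  field
    lev      : ℕ → List I
    unique   : ∀ m → Unique (lev m)
    sound    : ∀ {m i} → i ∈ lev m → E i ≡ m
    complete : ∀ {m i} → E i ≡ m → i ∈ lev m

open Levels

Θ : ∀ {I : Set} {E : I → ℕ} → Levels E → (I → ℤ) → Series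
Θ lv C m = sumL C (lev lv m)

module _ {I : Set} {E : I → ℕ} (lv : Levels E) where

  Θ-cong : ∀ {C C′} → (∀ i → C i ≡ C′ i) → Θ lv C ≈ Θ lv C′
  Θ-cong p m = sumL-cong (lev lv m) (λ {i} _ → p i)

  Θ-+ : ∀ C C′ → Θ lv (λ i → C i ℤ.+ C′ i) ≈ Θ lv C ⊞ Θ lv C′
  Θ-+ C C′ m = trans (sumL-+ C C′ (lev lv m)) (sym (⊞-at (Θ lv C) (Θ lv C′) m))

  Θ-* : ∀ c C → Θ lv (λ i → c ℤ.* C i) ≈ scale c (Θ lv C)
  Θ-* c C m = trans (sumL-* c C (lev lv m)) (sym (scale-at c (Θ lv C) m))

  Θ-neg : ∀ C → Θ lv (λ i → ℤ.- C i) ≈ neg (Θ lv C)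
  Θ-neg C m = trans (sumL-cong (lev lv m) (λ {i} _ → sym (ℤ.-1*i≡-i (C i)))) (trans (sumL-* -1ℤ C (lev lv m)) (trans (ℤ.-1*i≡-i _) (sym (neg-at (Θ lv C) m))))

  -- Any list that contains the whole level computes the coefficient.
  Θ-covering : ∀ C m L → Unique L → (∀ i → E i ≡ m → i ∈ L) → sumL (λ i → mono (C i) (E i) m) L ≡ Θ lv C m
  Θ-covering C m L u covers = begin
    sumL (λ i → mono (C i) (E i) m) L                          ≡⟨ sumL-filter (λ i → E i ℕ.≟ m) _ L (λ i E≢m → mono-off (C i) (E i) m E≢m) ⟨
    sumL (λ i → mono (C i) (E i) m) (filter (λ i → E i ℕ.≟ m) L) ≡⟨ sumL-set _ (Unique.filter⁺ _ u) (unique lv m)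
        (λ i∈ → complete lv (proj₂ (∈-filter⁻ (λ i → E i ℕ.≟ m) {xs = L} i∈)))
        (λ i∈ → ∈-filter⁺ (λ i → E i ℕ.≟ m) (covers _ (sound lv i∈)) (sound lv i∈)) ⟩
    sumL (λ i → mono (C i) (E i) m) (lev lv m)                 ≡⟨ sumL-cong (lev lv m) (λ {i} i∈ → trans (cong (λ e → mono (C i) e m) (sound lv i∈)) (mono-diag (C i) m)) ⟩
    sumL C (lev lv m)                                          ∎
    where open ≡-Reasoning

  Θ-reindex : ∀ {J : Set} {E′ : J → ℕ} (lv′ : Levels E′) (σ : J → I) (τ : I → J) →
              (∀ i → σ (τ i) ≡ i) → (∀ j → τ (σ j) ≡ j) → (∀ j → E (σ j) ≡ E′ j) →
              ∀ C → Θ lv C ≈ Θ lv′ (C ∘ σ)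
  Θ-reindex lv′ σ τ στ τσ E∘σ C m = trans
    (sumL-set C (unique lv m)
      (Unique.map⁺ (λ {x} {y} p → trans (sym (τσ x)) (trans (cong τ p) (τσ y))) (unique lv′ m))
      (λ {i} i∈ → subst (_∈ map σ (lev lv′ m)) (στ i) (∈-map⁺ σ (complete lv′ (trans (sym (E∘σ (τ i))) (trans (cong E (στ i)) (sound lv i∈))))))
      (λ i∈ → let (j , j∈ , eq) = ∈-map⁻ σ i∈ in complete lv (trans (cong E eq) (trans (E∘σ j) (sound lv′ j∈)))))
    (sumL-map C σ (lev lv′ m))

  Levels-+ : ∀ c → Levels (λ i → c + E i)
  Levels-+ c .lev m with c ℕ.≤? m
  ... | yes _ = lev lv (m ∸ c)
  ... | no  _ = []
  Levels-+ c .unique m with c ℕ.≤? m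
  ... | yes _ = unique lv (m ∸ c)
  ... | no  _ = []
  Levels-+ c .sound {m} i∈ with c ℕ.≤? m | i∈
  ... | yes c≤m | i∈ = trans (cong (λ y → c + y) (sound lv i∈)) (ℕ.m+[n∸m]≡n c≤m)
  Levels-+ c .complete {m} {i} refl with c ℕ.≤? m
  ... | yes c≤m = complete lv (sym (ℕ.m+n∸m≡n c (E i)))
  ... | no  c≰m = ⊥-elim (c≰m (ℕ.m≤m+n c (E i)))

  Θ-shift : ∀ c C → Θ (Levels-+ c) C ≈ mono 1ℤ c ✶ Θ lv C
  Θ-shift c C m with c ℕ.≤? m
  ... | yes c≤m = sym (trans (cong (mono 1ℤ c ✶ Θ lv C) (sym (ℕ.m+[n∸m]≡n c≤m))) (trans (mono-✶-+ 1ℤ c (Θ lv C) (m ∸ c)) (ℤ.*-identityˡ _)))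
  ... | no  c≰m = sym (mono-✶-< 1ℤ c (Θ lv C) m (ℕ.≰⇒> c≰m))

  module _ {J : Set} {E′ : J → ℕ} (lv′ : Levels E′) where

    Levels-× : Levels (λ ((i , j) : I × J) → E i + E′ j)
    Levels-× .lev = pairs (lev lv) (lev lv′)
    Levels-× .unique m = pairs-unique (lev lv) (lev lv′) m (unique lv) (unique lv′) (λ p q → trans (sym (sound lv p)) (sound lv q))
    Levels-× .sound {m} p with ∈-pairs⁻ (lev lv) (lev lv′) m p
    ... | k , k≤m , i∈ , j∈ = trans (cong₂ _+_ (sound lv i∈) (sound lv′ j∈)) (ℕ.m+[n∸m]≡n k≤m)
    Levels-× .complete {_} {i , j} refl = ∈-pairs⁺ (lev lv) (lev lv′) (E i + E′ j) (complete lv refl)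
      (complete lv′ (sym (ℕ.m+n∸m≡n (E i) (E′ j)))) (ℕ.m≤m+n (E i) (E′ j))

    Θ-✶ : ∀ C C′ → Θ lv C ✶ Θ lv′ C′ ≈ Θ Levels-× (λ (i , j) → C i ℤ.* C′ j)
    Θ-✶ C C′ m = trans (✶≈· (Θ lv C) (Θ lv′ C′) m) (sym (sumL-pairs C C′ (lev lv) (lev lv′) m))

map-filter-unique : ∀ {I J : Set} {p} {Q : I → Set p} (Q? : Decidable Q) (τ : I → J) →
                    (∀ {i i′} → Q i → Q i′ → τ i ≡ τ i′ → i ≡ i′) → ∀ {L} → Unique L → Unique (map τ (filter Q? L))
map-filter-unique Q? τ inj []      = []
map-filter-unique Q? τ inj {i ∷ L} (fresh ∷ u) with Q? i
... | no _  = map-filter-unique Q? τ inj u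
... | yes q = go fresh ∷ map-filter-unique Q? τ inj u
  where
  go : ∀ {L} → All (i ≢_) L → All (τ i ≢_) (map τ (filter Q? L))
  go []                       = []
  go {i′ ∷ L} (i≢i′ ∷ fresh) with Q? i′
  ... | yes q′ = (λ eq → i≢i′ (inj q q′ eq)) ∷ go fresh
  ... | no  _  = go fresh

-- `k` and `τ`, with inverse `σ`, identify `I` with five copies of `J`. A copy inherits finite
-- levels without any growth estimate of its own.
Levels-slice : ∀ {I J : Set} {E : I → ℕ} → Levels E → (k : I → ℕ) (τ : I → J) (σ : ℕ → J → I) →
               (∀ i → σ (k i) (τ i) ≡ i) → (∀ r j → r < 5 → τ (σ r j) ≡ j) → (∀ r j → r < 5 → k (σ r j) ≡ r) →
               ∀ r → r < 5 → Levels (E ∘ σ r)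
Levels-slice lv k τ σ στ τσ kσ r r<5 .lev m = map τ (filter (λ i → k i ℕ.≟ r) (lev lv m))
Levels-slice {E = E} lv k τ σ στ τσ kσ r r<5 .unique m = map-filter-unique (λ i → k i ℕ.≟ r) τ
  (λ {i} {i′} p q eq → trans (sym (στ i)) (trans (cong₂ σ (trans p (sym q)) eq) (στ i′))) (unique lv m)
Levels-slice {E = E} lv k τ σ στ τσ kσ r r<5 .sound {m} j∈ with ∈-map⁻ τ j∈
... | i , i∈ , refl with ∈-filter⁻ (λ i → k i ℕ.≟ r) {xs = lev lv m} i∈
...   | i∈′ , refl = trans (cong E (στ i)) (sound lv i∈′)
Levels-slice lv k τ σ στ τσ kσ r r<5 .complete {i = j} eq =
  subst (_∈ _) (τσ r j r<5) (∈-map⁺ τ (∈-filter⁺ _ (complete lv eq) (kσ r j r<5)))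

sumL-split : ∀ {I : Set} (f : I → ℤ) (k : I → ℕ) L → (∀ i → k i < 5) →
             sumL f L ≡ sumL (λ r → sumL f (filter (λ i → k i ℕ.≟ r) L)) (0 ∷ 1 ∷ 2 ∷ 3 ∷ 4 ∷ [])
sumL-split f k []      k<5 = refl
sumL-split f k (i ∷ L) k<5 = trans (cong (λ y → f i ℤ.+ y) (sumL-split f k L k<5)) (step (k<5 i))
  where
  S : ℕ → ℤ
  S r = sumL f (filter (λ i → k i ℕ.≟ r) L)
  lemma₀ : ∀ x a b c d e → x ℤ.+ (a ℤ.+ (b ℤ.+ (c ℤ.+ (d ℤ.+ (e ℤ.+ 0ℤ))))) ≡ (x ℤ.+ a) ℤ.+ (b ℤ.+ (c ℤ.+ (d ℤ.+ (e ℤ.+ 0ℤ))))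
  lemma₀ = ℤ-Solver.solve-∀
  lemma₁ : ∀ x a b c d e → x ℤ.+ (a ℤ.+ (b ℤ.+ (c ℤ.+ (d ℤ.+ (e ℤ.+ 0ℤ))))) ≡ a ℤ.+ ((x ℤ.+ b) ℤ.+ (c ℤ.+ (d ℤ.+ (e ℤ.+ 0ℤ))))
  lemma₁ = ℤ-Solver.solve-∀
  lemma₂ : ∀ x a b c d e → x ℤ.+ (a ℤ.+ (b ℤ.+ (c ℤ.+ (d ℤ.+ (e ℤ.+ 0ℤ))))) ≡ a ℤ.+ (b ℤ.+ ((x ℤ.+ c) ℤ.+ (d ℤ.+ (e ℤ.+ 0ℤ))))
  lemma₂ = ℤ-Solver.solve-∀
  lemma₃ : ∀ x a b c d e → x ℤ.+ (a ℤ.+ (b ℤ.+ (c ℤ.+ (d ℤ.+ (e ℤ.+ 0ℤ))))) ≡ a ℤ.+ (b ℤ.+ (c ℤ.+ ((x ℤ.+ d) ℤ.+ (e ℤ.+ 0ℤ))))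
  lemma₃ = ℤ-Solver.solve-∀
  lemma₄ : ∀ x a b c d e → x ℤ.+ (a ℤ.+ (b ℤ.+ (c ℤ.+ (d ℤ.+ (e ℤ.+ 0ℤ))))) ≡ a ℤ.+ (b ℤ.+ (c ℤ.+ (d ℤ.+ ((x ℤ.+ e) ℤ.+ 0ℤ))))
  lemma₄ = ℤ-Solver.solve-∀
  step : k i < 5 → f i ℤ.+ sumL S (0 ∷ 1 ∷ 2 ∷ 3 ∷ 4 ∷ []) ≡
         sumL (λ r → sumL f (filter (λ i → k i ℕ.≟ r) (i ∷ L))) (0 ∷ 1 ∷ 2 ∷ 3 ∷ 4 ∷ [])
  step ki<5 with k i
  ... | 0 = lemma₀ (f i) (S 0) (S 1) (S 2) (S 3) (S 4)
  ... | 1 = lemma₁ (f i) (S 0) (S 1) (S 2) (S 3) (S 4)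
  ... | 2 = lemma₂ (f i) (S 0) (S 1) (S 2) (S 3) (S 4)
  ... | 3 = lemma₃ (f i) (S 0) (S 1) (S 2) (S 3) (S 4)
  ... | 4 = lemma₄ (f i) (S 0) (S 1) (S 2) (S 3) (S 4)
  step (s≤s (s≤s (s≤s (s≤s (s≤s ()))))) | suc (suc (suc (suc (suc _))))

Θ-slices : ∀ {I J : Set} {E : I → ℕ} (lv : Levels E) (k : I → ℕ) (τ : I → J) (σ : ℕ → J → I) →
           (∀ i → k i < 5) → (∀ i → σ (k i) (τ i) ≡ i) →
           (τσ : ∀ r j → r < 5 → τ (σ r j) ≡ j) (kσ : ∀ r j → r < 5 → k (σ r j) ≡ r)
           (lv′ : ∀ r → r < 5 → Levels (E ∘ σ r)) → ∀ C m r (r<5 : r < 5) →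
           sumL C (filter (λ i → k i ℕ.≟ r) (lev lv m)) ≡ Θ (lv′ r r<5) (C ∘ σ r) m
Θ-slices {E = E} lv k τ σ k<5 στ τσ kσ lv′ C m r r<5 = trans
  (sumL-set C (Unique.filter⁺ (λ i → k i ℕ.≟ r) (unique lv m))
    (Unique.map⁺ (λ {x} {y} p → trans (sym (τσ r x r<5)) (trans (cong τ p) (τσ r y r<5))) (unique (lv′ r r<5) m))
    (λ i∈ → into (∈-filter⁻ (λ i → k i ℕ.≟ r) {xs = lev lv m} i∈))
    (λ i∈ → outof (∈-map⁻ (σ r) i∈)))
  (sumL-map C (σ r) (lev (lv′ r r<5) m))
  where
  into : ∀ {i} → i ∈ lev lv m × k i ≡ r → i ∈ map (σ r) (lev (lv′ r r<5) m)
  into {i} (i∈ , refl) = subst (_∈ map (σ (k i)) (lev (lv′ (k i) r<5) m)) (στ i) (∈-map⁺ (σ r) (complete (lv′ r r<5) (trans (cong E (στ i)) (sound lv i∈))))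
  outof : ∀ {i} → (∃ λ j → j ∈ lev (lv′ r r<5) m × i ≡ σ r j) → i ∈ filter (λ i → k i ℕ.≟ r) (lev lv m)
  outof (j , j∈ , refl) = ∈-filter⁺ (λ i → k i ℕ.≟ r) (complete lv (sound (lv′ r r<5) j∈)) (kσ r j r<5)

module ⊞-Properties = CommSemigroup (CommutativeMonoid.commutativeSemigroup 𝕊.+-commutativeMonoid)

opaque
  unfolding _⊞_ neg scale mono _✶_

  mono-neg : ∀ k → mono -1ℤ k ≈ neg (mono 1ℤ k)
  mono-neg zero    zero    = refl
  mono-neg zero    (suc n) = refl
  mono-neg (suc k) zero    = refl
  mono-neg (suc k) (suc n) = mono-neg k n

opaque
  unfolding scale mono

  scale-mono : ∀ c k → scale c (mono 1ℤ k) ≈ mono c k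
  scale-mono c zero    zero    = ℤ.*-identityʳ c
  scale-mono c zero    (suc n) = ℤ.*-zeroʳ c
  scale-mono c (suc k) zero    = ℤ.*-zeroʳ c
  scale-mono c (suc k) (suc n) = scale-mono c k n

mono-0-1 : mono 1ℤ 0 ≈ one
mono-0-1 = ≈-sym one≈const

✶-zeroˡ : ∀ F → 0S ✶ F ≈ 0S
✶-zeroˡ = 𝕊.zeroˡ

✶-zeroʳ : ∀ F → F ✶ 0S ≈ 0S
✶-zeroʳ = 𝕊.zeroʳ

⊞-interchange : ∀ F G H K → (F ⊞ G) ⊞ (H ⊞ K) ≈ (F ⊞ H) ⊞ (G ⊞ K)
⊞-interchange = ⊞-Properties.interchange

⊞-left-comm : ∀ F G H → F ⊞ (G ⊞ H) ≈ G ⊞ (F ⊞ H)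
⊞-left-comm = ⊞-Properties.x∙yz≈y∙xz

-- Gaussian binomial coefficients

module Gauss (s : ℕ) where

  Q : ℕ → Series
  Q l = mono 1ℤ (l * s)

  QQ : ∀ k l → Q k ✶ Q l ≈ Q (k + l)
  QQ k l = ≈-trans (mono-mono 1ℤ (k * s) 1ℤ (l * s)) (mono-exp 1ℤ (sym (ℕ.*-distribʳ-+ s k l)))

  -- The Gaussian binomial coefficient in the base `q^s`, generated by one of its two Pascal rules.
  gauss : ℕ → ℕ → Series
  gauss zero    zero    = one
  gauss zero    (suc l) = 0S
  gauss (suc n) zero    = one
  gauss (suc n) (suc l) = gauss n l ⊞ Q (suc l) ✶ gauss n (suc l)

  gauss-zero : ∀ n → gauss n 0 ≡ one
  gauss-zero zero    = refl
  gauss-zero (suc n) = refl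

  gauss-> : ∀ n l → n < l → gauss n l ≈ 0S
  gauss-> zero    (suc l) _         = ≈-refl
  gauss-> (suc n) (suc l) (s≤s n<l) = ≈-trans
    (⊞-cong (gauss-> n l n<l) (≈-trans (✶-congˡ (Q (suc l)) (gauss-> n (suc l) (ℕ.m≤n⇒m≤1+n n<l))) (✶-zeroʳ _)))
    (𝕊.+-identityʳ 0S)

  gauss-diag : ∀ n → gauss n n ≈ one
  gauss-diag zero    = ≈-refl
  gauss-diag (suc n) = ≈-trans
    (⊞-cong (gauss-diag n) (≈-trans (✶-congˡ (Q (suc n)) (gauss-> n (suc n) ℕ.≤-refl)) (✶-zeroʳ _)))
    (𝕊.+-identityʳ one)

  -- The second Pascal rule. In the triple product it adds a factor containing z, while the defining
  -- rule adds one containing z⁻¹.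
  gauss-pascal : ∀ n l → gauss (suc n) (suc l) ≈ Q (n ∸ l) ✶ gauss n l ⊞ gauss n (suc l)
  gauss-pascal zero    zero    = ≈-trans (⊞-congˡ one (✶-zeroʳ (Q 1))) (⊞-congʳ 0S (≈-sym (≈-trans (✶-identityʳ (Q 0)) mono-0-1)))
  gauss-pascal zero    (suc l) = ≈-trans (⊞-congˡ 0S (✶-zeroʳ (Q (2 + l)))) (⊞-congʳ 0S (≈-sym (✶-zeroʳ (Q 0))))
  gauss-pascal (suc n) zero    = begin
    one ⊞ Q 1 ✶ gauss (suc n) 1                   ≈⟨ ⊞-congˡ one (✶-congˡ (Q 1) IH) ⟩
    one ⊞ Q 1 ✶ (Q n ⊞ gauss n 1)                 ≈⟨ pascal-edge one (Q 1) (Q n) (gauss n 1) ⟩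
    Q 1 ✶ Q n ⊞ (one ⊞ Q 1 ✶ gauss n 1)           ≈⟨ ⊞-cong (≈-trans (QQ 1 n) (≈-sym (✶-identityʳ _)))
                                                        (⊞-congʳ (Q 1 ✶ gauss n 1) (λ m → cong (λ G → G m) (sym (gauss-zero n)))) ⟩
    Q (suc n) ✶ one ⊞ gauss (suc n) 1             ∎
    where
    open ≈-Reasoning
    IH : gauss (suc n) 1 ≈ Q n ⊞ gauss n 1
    IH = ≈-trans (gauss-pascal n 0) (⊞-congʳ (gauss n 1) (≈-trans (✶-congˡ (Q n) (λ m → cong (λ G → G m) (gauss-zero n))) (✶-identityʳ (Q n))))
  gauss-pascal (suc n) (suc l) = begin
    gauss (suc n) (suc l) ⊞ Q (2 + l) ✶ gauss (suc n) (2 + l)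
      ≈⟨ ⊞-cong (gauss-pascal n l) (✶-congˡ (Q (2 + l)) (gauss-pascal n (suc l))) ⟩
    Q (n ∸ l) ✶ gauss n l ⊞ gauss n (suc l) ⊞ Q (2 + l) ✶ (Q (n ∸ suc l) ✶ gauss n (suc l) ⊞ gauss n (2 + l))
      ≈⟨ pascal-left (Q (n ∸ l)) (gauss n l) (gauss n (suc l)) (Q (2 + l)) (Q (n ∸ suc l)) (gauss n (2 + l)) ⟩
    Q (n ∸ l) ✶ gauss n l ⊞ (Q (2 + l) ✶ Q (n ∸ suc l)) ✶ gauss n (suc l) ⊞ (gauss n (suc l) ⊞ Q (2 + l) ✶ gauss n (2 + l))
      ≈⟨ ⊞-congʳ (gauss n (suc l) ⊞ Q (2 + l) ✶ gauss n (2 + l)) (⊞-congˡ (Q (n ∸ l) ✶ gauss n l) middle) ⟩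
    Q (n ∸ l) ✶ gauss n l ⊞ (Q (n ∸ l) ✶ Q (suc l)) ✶ gauss n (suc l) ⊞ (gauss n (suc l) ⊞ Q (2 + l) ✶ gauss n (2 + l))
      ≈⟨ pascal-right (Q (n ∸ l)) (Q (suc l)) (gauss n l) (gauss n (suc l)) (Q (2 + l)) (gauss n (2 + l)) ⟨
    Q (n ∸ l) ✶ gauss (suc n) (suc l) ⊞ gauss (suc n) (2 + l) ∎
    where
    open ≈-Reasoning
    middle : (Q (2 + l) ✶ Q (n ∸ suc l)) ✶ gauss n (suc l) ≈ (Q (n ∸ l) ✶ Q (suc l)) ✶ gauss n (suc l)
    middle with suc l ℕ.≤? n
    ... | yes l<n = ✶-congʳ _ (≈-trans (QQ (2 + l) (n ∸ suc l)) (≈-trans (mono-exp 1ℤ (cong (_* s) eq)) (≈-sym (QQ (n ∸ l) (suc l)))))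
      where
      eq : 2 + l + (n ∸ suc l) ≡ n ∸ l + suc l
      eq = trans (cong suc (ℕ.m+[n∸m]≡n l<n)) (sym (trans (ℕ.+-suc (n ∸ l) l) (cong suc (ℕ.m∸n+n≡m (ℕ.<⇒≤ l<n)))))
    -- The subtractions are truncated here and the two exponents differ, but the binomial is 0.
    ... | no l≮n = ≈-trans (✶-congˡ _ zer) (≈-trans (✶-zeroʳ _) (≈-sym (≈-trans (✶-congˡ _ zer) (✶-zeroʳ _))))
      where zer = gauss-> n (suc l) (ℕ.≰⇒> l≮n)

  poch : ℕ → Series
  poch = Prod (factor -1ℤ s s)

  factor≈ : ∀ l → factor -1ℤ s s l ≈ const 1ℤ ⊞ neg (Q (suc l))
  factor≈ l = ⊞-cong one≈const (mono-neg (s + l * s))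

  -- The factorial formula freed of division. The induction splits with the defining Pascal rule and
  -- puts the two halves together by 1 - xy = (1 - x) + x (1 - y).
  gauss-factorial : ∀ l k → poch l ✶ poch k ✶ gauss (l + k) l ≈ poch (l + k)
  gauss-factorial zero    k rewrite gauss-zero k = ≈-trans (✶-identityʳ _) (✶-identityˡ _)
  gauss-factorial (suc l) zero rewrite ℕ.+-identityʳ l = ≈-trans (✶-congˡ _ (gauss-diag (suc l))) (≈-trans (✶-identityʳ _) (✶-identityʳ _))
  gauss-factorial (suc l) (suc k) = begin
    poch (suc l) ✶ poch (suc k) ✶ gauss (suc (l + suc k)) (suc l)
      ≈⟨ ✶-congʳ (gauss (suc (l + suc k)) (suc l)) (✶-cong f≈ g≈) ⟩
    (poch l ✶ (const 1ℤ ⊞ neg x)) ✶ (poch k ✶ (const 1ℤ ⊞ neg y)) ✶ (gauss (l + suc k) l ⊞ x ✶ gauss (l + suc k) (suc l))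
      ≈⟨ factorial-step (poch l) (poch k) x y (gauss (l + suc k) l) (gauss (l + suc k) (suc l)) ⟩
    (const 1ℤ ⊞ neg x) ✶ (poch l ✶ (poch k ✶ (const 1ℤ ⊞ neg y)) ✶ gauss (l + suc k) l) ⊞
    x ✶ (const 1ℤ ⊞ neg y) ✶ ((poch l ✶ (const 1ℤ ⊞ neg x)) ✶ poch k ✶ gauss (l + suc k) (suc l))
      ≈⟨ ⊞-cong (✶-congˡ _ (≈-trans (✶-congʳ _ (✶-congˡ _ (≈-sym g≈))) (gauss-factorial l (suc k))))
                (✶-congˡ _ (≈-trans (✶-congʳ _ (✶-congʳ _ (≈-sym f≈))) IH₂)) ⟩
    (const 1ℤ ⊞ neg x) ✶ poch (l + suc k) ⊞ x ✶ (const 1ℤ ⊞ neg y) ✶ poch (l + suc k)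
      ≈⟨ factorial-collect x y (poch (l + suc k)) ⟩
    poch (l + suc k) ✶ (const 1ℤ ⊞ neg (x ✶ y))
      ≈⟨ ✶-congˡ _ (⊞-congˡ (const 1ℤ) (neg-cong (QQ (suc l) (suc k)))) ⟩
    poch (l + suc k) ✶ (const 1ℤ ⊞ neg (Q (suc (l + suc k))))
      ≈⟨ ✶-congˡ _ (≈-sym (factor≈ (l + suc k))) ⟩
    poch (suc (l + suc k)) ∎
    where
    open ≈-Reasoning
    x = Q (suc l)
    y = Q (suc k)
    f≈ : poch (suc l) ≈ poch l ✶ (const 1ℤ ⊞ neg x)
    f≈ = ✶-congˡ (poch l) (factor≈ l)
    g≈ : poch (suc k) ≈ poch k ✶ (const 1ℤ ⊞ neg y)
    g≈ = ✶-congˡ (poch k) (factor≈ k)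
    IH₂ : poch (suc l) ✶ poch k ✶ gauss (l + suc k) (suc l) ≈ poch (l + suc k)
    IH₂ rewrite ℕ.+-suc l k = gauss-factorial (suc l) k

  module _ .{{_ : NonZero s}} where

    E∞ : Series
    E∞ = P -1ℤ s s

    E∞-at-0 : E∞ 0 ≡ 1ℤ
    E∞-at-0 = at-0 s
      where
      at-0 : ∀ s .{{_ : NonZero s}} → P -1ℤ s s 0 ≡ 1ℤ
      at-0 (suc s) = P-at-0 -1ℤ s (suc s)

    -- Once `l` and `k` reach `m`, all three q-factorials of `gauss-factorial` equal `E∞` modulo
    -- `q^m`; one `E∞` is then cancelled.
    gauss-limit : ∀ m l k → m ≤ l → m ≤ k → E∞ ✶ gauss (l + k) l ≈[ m ] one
    gauss-limit m l k m≤l m≤k = ✶-cancelˡ[] E∞ E∞-at-0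
      (≈[]-trans (≈⇒≈[] (≈-sym (✶-assoc E∞ E∞ _)))
      (≈[]-trans (✶-cong[] (✶-cong[] (≈[]-≤ m≤l (P-≈[] -1ℤ s s l)) (≈[]-≤ m≤k (P-≈[] -1ℤ s s k))) ≈[]-refl)
      (≈[]-trans (≈⇒≈[] (gauss-factorial l k))
      (≈[]-trans (≈[]-sym (≈[]-≤ (ℕ.≤-trans m≤l (ℕ.m≤m+n l k)) (P-≈[] -1ℤ s s (l + k)))) (≈⇒≈[] (≈-sym (✶-identityʳ E∞)))))))

-- Exponents of theta series

tri : ℕ → ℕ
tri zero    = 0
tri (suc n) = suc n + tri n

-- Triangular numbers n(n+1)/2 on ℤ, symmetric under n ↦ -1 - n. Exponents stay natural numbers;
-- identities between them are proved on their doubles in ℤ, where no halving occurs, and brought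
-- back by `double-injective`.
T : ℤ → ℕ
T (+ n)    = tri n
T -[1+ n ] = tri n

⟦2tri⟧ : ∀ n → + 2 ℤ.* + tri n ≡ + n ℤ.* (+ n ℤ.+ 1ℤ)
⟦2tri⟧ zero    = refl
⟦2tri⟧ (suc n) = begin
  + 2 ℤ.* + (suc n + tri n)            ≡⟨ cong (λ y → + 2 ℤ.* y) (ℤ.pos-+ (suc n) (tri n)) ⟩
  + 2 ℤ.* (+ suc n ℤ.+ + tri n)        ≡⟨ ℤ.*-distribˡ-+ (+ 2) (+ suc n) (+ tri n) ⟩
  + 2 ℤ.* + suc n ℤ.+ + 2 ℤ.* + tri n  ≡⟨ cong (λ y → + 2 ℤ.* + suc n ℤ.+ y) (⟦2tri⟧ n) ⟩
  + 2 ℤ.* + suc n ℤ.+ + n ℤ.* (+ n ℤ.+ 1ℤ) ≡⟨ lemma (+ n) ⟩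
  + suc n ℤ.* (+ suc n ℤ.+ 1ℤ)         ∎
  where
  open ≡-Reasoning
  lemma : ∀ n → + 2 ℤ.* (1ℤ ℤ.+ n) ℤ.+ n ℤ.* (n ℤ.+ 1ℤ) ≡ (1ℤ ℤ.+ n) ℤ.* (1ℤ ℤ.+ n ℤ.+ 1ℤ)
  lemma = ℤ-Solver.solve-∀

⟦2T⟧ : ∀ n → + 2 ℤ.* + T n ≡ n ℤ.* (n ℤ.+ 1ℤ)
⟦2T⟧ (+ n)    = ⟦2tri⟧ n
⟦2T⟧ -[1+ n ] = trans (⟦2tri⟧ n) (lemma (+ n))
  where
  lemma : ∀ n → n ℤ.* (n ℤ.+ 1ℤ) ≡ (ℤ.- (1ℤ ℤ.+ n)) ℤ.* (ℤ.- (1ℤ ℤ.+ n) ℤ.+ 1ℤ)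
  lemma = ℤ-Solver.solve-∀

-- i n(n+1)/2 + j n(n-1)/2, the exponent of Jacobi's theta function.
e : ℕ → ℕ → ℤ → ℕ
e i j n = i * T n + j * T (ℤ.- n)

double-injective : ∀ {x y} → + 2 ℤ.* + x ≡ + 2 ℤ.* + y → x ≡ y
double-injective {x} {y} p = ℤ.+-injective (ℤ.*-cancelˡ-≡ (+ 2) (+ x) (+ y) p)

⟦2e⟧ : ∀ i j n → + 2 ℤ.* + e i j n ≡ + i ℤ.* (n ℤ.* (n ℤ.+ 1ℤ)) ℤ.+ + j ℤ.* (n ℤ.* (n ℤ.- 1ℤ))
⟦2e⟧ i j n = begin
  + 2 ℤ.* + (i * T n + j * T (ℤ.- n)) ≡⟨ cong (λ y → + 2 ℤ.* y) (trans (ℤ.pos-+ (i * T n) _) (cong₂ ℤ._+_ (ℤ.pos-* i _) (ℤ.pos-* j _))) ⟩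
  + 2 ℤ.* (+ i ℤ.* + T n ℤ.+ + j ℤ.* + T (ℤ.- n)) ≡⟨ lemma (+ i) (+ j) (+ T n) (+ T (ℤ.- n)) ⟩
  + i ℤ.* (+ 2 ℤ.* + T n) ℤ.+ + j ℤ.* (+ 2 ℤ.* + T (ℤ.- n)) ≡⟨ cong₂ (λ x y → + i ℤ.* x ℤ.+ + j ℤ.* y) (⟦2T⟧ n) (⟦2T⟧ (ℤ.- n)) ⟩
  + i ℤ.* (n ℤ.* (n ℤ.+ 1ℤ)) ℤ.+ + j ℤ.* (ℤ.- n ℤ.* (ℤ.- n ℤ.+ 1ℤ)) ≡⟨ lemma′ (+ i) (+ j) n ⟩
  + i ℤ.* (n ℤ.* (n ℤ.+ 1ℤ)) ℤ.+ + j ℤ.* (n ℤ.* (n ℤ.- 1ℤ)) ∎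
  where
  open ≡-Reasoning
  lemma : ∀ i j t u → + 2 ℤ.* (i ℤ.* t ℤ.+ j ℤ.* u) ≡ i ℤ.* (+ 2 ℤ.* t) ℤ.+ j ℤ.* (+ 2 ℤ.* u)
  lemma = ℤ-Solver.solve-∀
  lemma′ : ∀ i j n → i ℤ.* (n ℤ.* (n ℤ.+ 1ℤ)) ℤ.+ j ℤ.* (ℤ.- n ℤ.* (ℤ.- n ℤ.+ 1ℤ)) ≡ i ℤ.* (n ℤ.* (n ℤ.+ 1ℤ)) ℤ.+ j ℤ.* (n ℤ.* (n ℤ.- 1ℤ))
  lemma′ = ℤ-Solver.solve-∀

⟦2+⟧ : ∀ x y → + 2 ℤ.* + (x + y) ≡ + 2 ℤ.* + x ℤ.+ + 2 ℤ.* + y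
⟦2+⟧ x y = trans (cong (λ z → + 2 ℤ.* z) (ℤ.pos-+ x y)) (ℤ.*-distribˡ-+ (+ 2) (+ x) (+ y))

suc-⊖ : ∀ l b → suc l ⊖ b ≡ l ⊖ b ℤ.+ 1ℤ
suc-⊖ l b = trans (sym (ℤ.m-n≡m⊖n (suc l) b)) (trans (lemma (+ l) (+ b)) (cong (λ y → y ℤ.+ 1ℤ) (ℤ.m-n≡m⊖n l b)))
  where
  lemma : ∀ l b → 1ℤ ℤ.+ l ℤ.- b ≡ l ℤ.- b ℤ.+ 1ℤ
  lemma = ℤ-Solver.solve-∀

-- The two Pascal rules of the Gaussian binomials, seen on the exponents.
e-sucˡ : ∀ i j a b l → l ≤ a + b →
         (a + b ∸ l) * (i + j) + e i j (suc l ⊖ b) ≡ (i + a * (i + j)) + e i j (l ⊖ b)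
e-sucˡ i j a b l l≤ = double-injective (begin
  + 2 ℤ.* + ((a + b ∸ l) * (i + j) + e i j (suc l ⊖ b))
    ≡⟨ trans (⟦2+⟧ ((a + b ∸ l) * (i + j)) (e i j (suc l ⊖ b))) (cong₂ (λ x y → + 2 ℤ.* x ℤ.+ y) (ℤ.pos-* (a + b ∸ l) (i + j))
         (trans (⟦2e⟧ i j (suc l ⊖ b)) (cong f (trans (sym (ℤ.m-n≡m⊖n (suc l) b)) refl)))) ⟩
  + 2 ℤ.* (+ (a + b ∸ l) ℤ.* (+ i ℤ.+ + j)) ℤ.+ f (1ℤ ℤ.+ + l ℤ.- + b)
    ≡⟨ cong (λ x → + 2 ℤ.* (x ℤ.* (+ i ℤ.+ + j)) ℤ.+ f (1ℤ ℤ.+ + l ℤ.- + b))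
         (trans (sym (ℤ.⊖-≥ l≤)) (trans (sym (ℤ.m-n≡m⊖n (a + b) l)) (cong (λ x → x ℤ.- + l) (ℤ.pos-+ a b)))) ⟩
  + 2 ℤ.* ((+ a ℤ.+ + b ℤ.- + l) ℤ.* (+ i ℤ.+ + j)) ℤ.+ f (1ℤ ℤ.+ + l ℤ.- + b)
    ≡⟨ lemma (+ i) (+ j) (+ a) (+ b) (+ l) ⟩
  + 2 ℤ.* (+ i ℤ.+ + a ℤ.* (+ i ℤ.+ + j)) ℤ.+ f (+ l ℤ.- + b)
    ≡⟨ cong₂ (λ x y → + 2 ℤ.* x ℤ.+ y)
         (sym (trans (ℤ.pos-+ i _) (cong (λ x → + i ℤ.+ x) (ℤ.pos-* a (i + j)))))
         (trans (cong f (ℤ.m-n≡m⊖n l b)) (sym (⟦2e⟧ i j (l ⊖ b)))) ⟩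
  + 2 ℤ.* + (i + a * (i + j)) ℤ.+ + 2 ℤ.* + e i j (l ⊖ b)
    ≡⟨ ⟦2+⟧ (i + a * (i + j)) (e i j (l ⊖ b)) ⟨
  + 2 ℤ.* + ((i + a * (i + j)) + e i j (l ⊖ b)) ∎)
  where
  open ≡-Reasoning
  f : ℤ → ℤ
  f n = + i ℤ.* (n ℤ.* (n ℤ.+ 1ℤ)) ℤ.+ + j ℤ.* (n ℤ.* (n ℤ.- 1ℤ))
  lemma : ∀ i j a b l →
    + 2 ℤ.* ((a ℤ.+ b ℤ.- l) ℤ.* (i ℤ.+ j)) ℤ.+ (i ℤ.* ((1ℤ ℤ.+ l ℤ.- b) ℤ.* (1ℤ ℤ.+ l ℤ.- b ℤ.+ 1ℤ)) ℤ.+ j ℤ.* ((1ℤ ℤ.+ l ℤ.- b) ℤ.* (1ℤ ℤ.+ l ℤ.- b ℤ.- 1ℤ)))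
    ≡ + 2 ℤ.* (i ℤ.+ a ℤ.* (i ℤ.+ j)) ℤ.+ (i ℤ.* ((l ℤ.- b) ℤ.* (l ℤ.- b ℤ.+ 1ℤ)) ℤ.+ j ℤ.* ((l ℤ.- b) ℤ.* (l ℤ.- b ℤ.- 1ℤ)))
  lemma = ℤ-Solver.solve-∀

e-sucʳ : ∀ i j b l → l * (i + j) + e i j (l ⊖ suc b) ≡ (j + b * (i + j)) + e i j (l ⊖ b)
e-sucʳ i j b l = double-injective (begin
  + 2 ℤ.* + (l * (i + j) + e i j (l ⊖ suc b))
    ≡⟨ trans (⟦2+⟧ (l * (i + j)) (e i j (l ⊖ suc b))) (cong₂ (λ x y → + 2 ℤ.* x ℤ.+ y) (ℤ.pos-* l (i + j))
         (trans (⟦2e⟧ i j (l ⊖ suc b)) (cong f (sym (ℤ.m-n≡m⊖n l (suc b)))))) ⟩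
  + 2 ℤ.* (+ l ℤ.* (+ i ℤ.+ + j)) ℤ.+ f (+ l ℤ.- (1ℤ ℤ.+ + b))
    ≡⟨ lemma (+ i) (+ j) (+ b) (+ l) ⟩
  + 2 ℤ.* (+ j ℤ.+ + b ℤ.* (+ i ℤ.+ + j)) ℤ.+ f (+ l ℤ.- + b)
    ≡⟨ cong₂ (λ x y → + 2 ℤ.* x ℤ.+ y)
         (sym (trans (ℤ.pos-+ j _) (cong (λ x → + j ℤ.+ x) (ℤ.pos-* b (i + j)))))
         (trans (cong f (ℤ.m-n≡m⊖n l b)) (sym (⟦2e⟧ i j (l ⊖ b)))) ⟩
  + 2 ℤ.* + (j + b * (i + j)) ℤ.+ + 2 ℤ.* + e i j (l ⊖ b)
    ≡⟨ ⟦2+⟧ (j + b * (i + j)) (e i j (l ⊖ b)) ⟨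
  + 2 ℤ.* + ((j + b * (i + j)) + e i j (l ⊖ b)) ∎)
  where
  open ≡-Reasoning
  f : ℤ → ℤ
  f n = + i ℤ.* (n ℤ.* (n ℤ.+ 1ℤ)) ℤ.+ + j ℤ.* (n ℤ.* (n ℤ.- 1ℤ))
  lemma : ∀ i j b l →
    + 2 ℤ.* (l ℤ.* (i ℤ.+ j)) ℤ.+ (i ℤ.* ((l ℤ.- (1ℤ ℤ.+ b)) ℤ.* (l ℤ.- (1ℤ ℤ.+ b) ℤ.+ 1ℤ)) ℤ.+ j ℤ.* ((l ℤ.- (1ℤ ℤ.+ b)) ℤ.* (l ℤ.- (1ℤ ℤ.+ b) ℤ.- 1ℤ)))
    ≡ + 2 ℤ.* (j ℤ.+ b ℤ.* (i ℤ.+ j)) ℤ.+ (i ℤ.* ((l ℤ.- b) ℤ.* (l ℤ.- b ℤ.+ 1ℤ)) ℤ.+ j ℤ.* ((l ℤ.- b) ℤ.* (l ℤ.- b ℤ.- 1ℤ)))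
  lemma = ℤ-Solver.solve-∀

n≤tri : ∀ n → n ≤ tri n
n≤tri zero    = z≤n
n≤tri (suc n) = ℕ.m≤m+n (suc n) (tri n)

-- Makes the levels finite. The `suc` is attained when `j` is 0, as n = -1 then has exponent 0.
e-growth : ∀ i j .{{_ : NonZero i}} n → ∣ n ∣ ≤ suc (e i j n)
e-growth i j (+ n)    = ℕ.m≤n⇒m≤1+n (ℕ.≤-trans (n≤tri n) (ℕ.≤-trans (ℕ.m≤n*m (tri n) i) (ℕ.m≤m+n _ _)))
e-growth i j -[1+ n ] = s≤s (ℕ.≤-trans (n≤tri n) (ℕ.≤-trans (ℕ.m≤n*m (tri n) i) (ℕ.m≤m+n _ _)))

box : ℕ → List ℤ
box N = map (_⊖ N) (downFrom (suc (N + N)))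

box-unique : ∀ N → Unique (box N)
box-unique N = Unique.map⁺ (λ {l} {k} p → ℤ.+-injective (ℤ+cancel (trans (ℤ.m-n≡m⊖n l N) (trans p (sym (ℤ.m-n≡m⊖n k N))))))
  (Unique.downFrom⁺ (suc (N + N)))
  where
  ℤ+cancel : ∀ {x y} → x ℤ.- + N ≡ y ℤ.- + N → x ≡ y
  ℤ+cancel {x} {y} p = ℤ+.∙-cancelʳ (ℤ.- (+ N)) x y p

∈-box : ∀ N n → ∣ n ∣ ≤ N → n ∈ box N
∈-box N (+ n) n≤N = subst (_∈ box N) (trans (sym (ℤ.m-n≡m⊖n (N + n) N)) (trans (cong (λ y → y ℤ.- + N) (ℤ.pos-+ N n)) (lemma (+ N) (+ n))))
  (∈-map⁺ (_⊖ N) (∈-downFrom⁺ (s≤s (ℕ.+-monoʳ-≤ N n≤N))))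
  where
  lemma : ∀ N n → N ℤ.+ n ℤ.- N ≡ n
  lemma = ℤ-Solver.solve-∀
∈-box N -[1+ n ] n<N = subst (_∈ box N) (trans (ℤ.⊖-< (ℕ.∸-monoʳ-< {N} {suc n} {0} (s≤s z≤n) n<N)) (cong (λ k → ℤ.- (+ k)) (ℕ.m∸[m∸n]≡n n<N)))
  (∈-map⁺ (_⊖ N) (∈-downFrom⁺ (s≤s (ℕ.≤-trans (ℕ.m∸n≤m N (suc n)) (ℕ.m≤m+n N N)))))

Levels-box : (E : ℤ → ℕ) → (∀ n → ∣ n ∣ ≤ suc (E n)) → Levels E
Levels-box E growth .lev m      = filter (λ n → E n ℕ.≟ m) (box (suc m))
Levels-box E growth .unique m   = Unique.filter⁺ (λ n → E n ℕ.≟ m) (box-unique (suc m))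
Levels-box E growth .sound {m} n∈ = proj₂ (∈-filter⁻ (λ n → E n ℕ.≟ m) {xs = box (suc m)} n∈)
Levels-box E growth .complete {m} {n} refl = ∈-filter⁺ (λ k → E k ℕ.≟ E n) (∈-box (suc (E n)) n (growth n)) refl

Levels-e : ∀ i j .{{_ : NonZero i}} → Levels (e i j)
Levels-e i j = Levels-box (e i j) (e-growth i j)

-- The finite and the infinite triple product

Sum : (ℕ → Series) → ℕ → Series
Sum f zero    = 0S
Sum f (suc N) = f N ⊞ Sum f N

Sum-at : ∀ f N n → Sum f N n ≡ sumL (λ l → f l n) (downFrom N)
Sum-at f zero    n = refl
Sum-at f (suc N) n = trans (⊞-at (f N) (Sum f N) n) (cong (λ y → f N n ℤ.+ y) (Sum-at f N n))

Sum-cong : ∀ {f g} → (∀ l → f l ≈ g l) → ∀ N → Sum f N ≈ Sum g N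
Sum-cong p zero    = ≈-refl
Sum-cong p (suc N) = ⊞-cong (p N) (Sum-cong p N)

Sum-cong[] : ∀ {m f g} N → (∀ l → l < N → f l ≈[ m ] g l) → Sum f N ≈[ m ] Sum g N
Sum-cong[] zero    p = ≈[]-refl
Sum-cong[] (suc N) p = ⊞-cong[] (p N ℕ.≤-refl) (Sum-cong[] N (λ l l<N → p l (ℕ.m≤n⇒m≤1+n l<N)))

Sum-⊞ : ∀ f g N → Sum (λ l → f l ⊞ g l) N ≈ Sum f N ⊞ Sum g N
Sum-⊞ f g zero    = ≈-sym (⊞-identityʳ 0S)
Sum-⊞ f g (suc N) = ≈-trans (⊞-congˡ (f N ⊞ g N) (Sum-⊞ f g N)) (⊞-interchange (f N) (g N) (Sum f N) (Sum g N))

Sum-✶ : ∀ F f N → F ✶ Sum f N ≈ Sum (λ l → F ✶ f l) N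
Sum-✶ F f zero    = ✶-zeroʳ F
Sum-✶ F f (suc N) = ≈-trans (𝕊.distribˡ F (f N) (Sum f N)) (⊞-congˡ (F ✶ f N) (Sum-✶ F f N))

Sum-first : ∀ f N → Sum f (suc N) ≈ f 0 ⊞ Sum (f ∘ suc) N
Sum-first f zero    = ≈-refl
Sum-first f (suc N) = ≈-trans (⊞-congˡ (f (suc N)) (Sum-first f N)) (⊞-left-comm (f (suc N)) (f 0) (Sum (f ∘ suc) N))

scale-✶ : ∀ c F G → F ✶ scale c G ≈ scale c (F ✶ G)
scale-✶ c F G = begin
  F ✶ scale c G       ≈⟨ ✶-congˡ F (✶-const c G) ⟨
  F ✶ (const c ✶ G)   ≈⟨ ✶-comm F _ ⟩
  (const c ✶ G) ✶ F   ≈⟨ ✶-assoc (const c) G F ⟩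
  const c ✶ (G ✶ F)   ≈⟨ ✶-const c _ ⟩
  scale c (G ✶ F)     ≈⟨ scale-cong c (✶-comm G F) ⟩
  scale c (F ✶ G)     ∎
  where open ≈-Reasoning

scale-≡ : ∀ {c d} F → c ≡ d → scale c F ≈ scale d F
scale-≡ F refl = ≈-refl

scale-scale : ∀ c d F → scale c (scale d F) ≈ scale (c ℤ.* d) F
scale-scale c d F n = trans (scale-at c (scale d F) n) (trans (cong (λ y → c ℤ.* y) (scale-at d F n)) (trans (sym (ℤ.*-assoc c d (F n))) (sym (scale-at (c ℤ.* d) F n))))

scale-+ : ∀ c d F → scale (c ℤ.+ d) F ≈ scale c F ⊞ scale d F
scale-+ c d F n = trans (scale-at (c ℤ.+ d) F n) (trans (ℤ.*-distribʳ-+ (F n) c d)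
  (trans (cong₂ ℤ._+_ (sym (scale-at c F n)) (sym (scale-at d F n))) (sym (⊞-at (scale c F) (scale d F) n))))

scale-⊞ : ∀ c F G → scale c (F ⊞ G) ≈ scale c F ⊞ scale c G
scale-⊞ c F G n = trans (scale-at c (F ⊞ G) n) (trans (cong (λ y → c ℤ.* y) (⊞-at F G n)) (trans (ℤ.*-distribˡ-+ c (F n) (G n))
  (trans (cong₂ ℤ._+_ (sym (scale-at c F n)) (sym (scale-at c G n))) (sym (⊞-at (scale c F) (scale c G) n)))))

scale-0S : ∀ c {F} → F ≈ 0S → scale c F ≈ 0S
scale-0S c {F} z n = trans (scale-at c F n) (trans (cong (λ y → c ℤ.* y) (z n)) (ℤ.*-zeroʳ c))

scale-cong[] : ∀ c {m F G} → F ≈[ m ] G → scale c F ≈[ m ] scale c G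
scale-cong[] c {F = F} {G} p n n<m = trans (scale-at c F n) (trans (cong (λ y → c ℤ.* y) (p n n<m)) (sym (scale-at c G n)))

Sum-scale : ∀ c f N → Sum (λ l → scale c (f l)) N ≈ scale c (Sum f N)
Sum-scale c f zero    = ≈-sym (scale-0S c ≈-refl)
Sum-scale c f (suc N) = ≈-trans (⊞-congˡ (scale c (f N)) (Sum-scale c f N)) (≈-sym (scale-⊞ c (f N) (Sum f N)))

-- coefficient a b l is the coefficient of z^(l - b) in Π_{k<a} (1 + z q^(i+sk)) Π_{k<b} (1 + z⁻¹ q^(j+sk)), s = i + j.
module Jacobi (i j : ℕ) where

  s : ℕ
  s = i + j

  open Gauss s

  coefficient : ℕ → ℕ → ℕ → Series
  coefficient a b l = gauss (a + b) l ✶ mono 1ℤ (e i j (l ⊖ b))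

  coefficient-> : ∀ a b l → a + b < l → coefficient a b l ≈ 0S
  coefficient-> a b l lt = ≈-trans (✶-congʳ _ (gauss-> (a + b) l lt)) (✶-zeroˡ _)

  x y : ℕ → Series
  x a = mono 1ℤ (i + a * s)
  y b = mono 1ℤ (j + b * s)

  coefficient-sucˡ : ∀ a b l → coefficient (suc a) b (suc l) ≈ coefficient a b (suc l) ⊞ x a ✶ coefficient a b l
  coefficient-sucˡ a b l = begin
    gauss (suc (a + b)) (suc l) ✶ M′                                ≈⟨ ✶-congʳ M′ (gauss-pascal (a + b) l) ⟩
    (Q (a + b ∸ l) ✶ gauss (a + b) l ⊞ gauss (a + b) (suc l)) ✶ M′  ≈⟨ [ag+h]m (Q (a + b ∸ l)) (gauss (a + b) l) (gauss (a + b) (suc l)) M′ ⟩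
    gauss (a + b) (suc l) ✶ M′ ⊞ (Q (a + b ∸ l) ✶ M′) ✶ gauss (a + b) l ≈⟨ ⊞-congˡ (gauss (a + b) (suc l) ✶ M′) middle ⟩
    gauss (a + b) (suc l) ✶ M′ ⊞ (x a ✶ M) ✶ gauss (a + b) l        ≈⟨ ⊞-congˡ (gauss (a + b) (suc l) ✶ M′) (≈-sym (x[gm] (x a) (gauss (a + b) l) M)) ⟩
    gauss (a + b) (suc l) ✶ M′ ⊞ x a ✶ (gauss (a + b) l ✶ M)        ∎
    where
    open ≈-Reasoning
    M  = mono 1ℤ (e i j (l ⊖ b))
    M′ = mono 1ℤ (e i j (suc l ⊖ b))
    middle : (Q (a + b ∸ l) ✶ M′) ✶ gauss (a + b) l ≈ (x a ✶ M) ✶ gauss (a + b) l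
    middle with l ℕ.≤? a + b
    ... | yes l≤ = ✶-congʳ _ (≈-trans (mono-mono 1ℤ _ 1ℤ _) (≈-trans (mono-exp 1ℤ (e-sucˡ i j a b l l≤)) (≈-sym (mono-mono 1ℤ _ 1ℤ _))))
    ... | no l≰ = ≈-trans (✶-congˡ _ zer) (≈-trans (✶-zeroʳ _) (≈-sym (≈-trans (✶-congˡ _ zer) (✶-zeroʳ _))))
      where zer = gauss-> (a + b) l (ℕ.≰⇒> l≰)

  coefficient-sucˡ-0 : ∀ a b → coefficient (suc a) b 0 ≈ coefficient a b 0
  coefficient-sucˡ-0 a b = ✶-congʳ _ (λ n → cong (λ G → G n) (sym (gauss-zero (a + b))))

  gauss-cong : ∀ {n n′} l → n ≡ n′ → gauss n l ≈ gauss n′ l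
  gauss-cong l refl = ≈-refl

  coefficient-sucʳ : ∀ a b l → coefficient a (suc b) (suc l) ≈ y b ✶ coefficient a b (suc l) ⊞ coefficient a b l
  coefficient-sucʳ a b l = begin
    gauss (a + suc b) (suc l) ✶ mono 1ℤ (e i j (suc l ⊖ suc b))      ≈⟨ ✶-cong (gauss-cong (suc l) (ℕ.+-suc a b)) (mono-exp 1ℤ (cong (e i j) (ℤ.[1+m]⊖[1+n]≡m⊖n l b))) ⟩
    (gauss (a + b) l ⊞ Q (suc l) ✶ gauss (a + b) (suc l)) ✶ M        ≈⟨ ✶-congʳ M (𝕊.+-comm (gauss (a + b) l) _) ⟩
    (Q (suc l) ✶ gauss (a + b) (suc l) ⊞ gauss (a + b) l) ✶ M        ≈⟨ [ag+h]m (Q (suc l)) (gauss (a + b) (suc l)) (gauss (a + b) l) M ⟩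
    gauss (a + b) l ✶ M ⊞ (Q (suc l) ✶ M) ✶ gauss (a + b) (suc l)    ≈⟨ 𝕊.+-comm (gauss (a + b) l ✶ M) _ ⟩
    (Q (suc l) ✶ M) ✶ gauss (a + b) (suc l) ⊞ gauss (a + b) l ✶ M    ≈⟨ ⊞-congʳ (gauss (a + b) l ✶ M) (✶-congʳ (gauss (a + b) (suc l)) middle) ⟩
    (y b ✶ mono 1ℤ (e i j (suc l ⊖ b))) ✶ gauss (a + b) (suc l) ⊞ gauss (a + b) l ✶ M ≈⟨ ⊞-congʳ (gauss (a + b) l ✶ M) (≈-sym (x[gm] (y b) (gauss (a + b) (suc l)) (mono 1ℤ (e i j (suc l ⊖ b))))) ⟩
    y b ✶ coefficient a b (suc l) ⊞ coefficient a b l ∎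
    where
    open ≈-Reasoning
    M = mono 1ℤ (e i j (l ⊖ b))
    middle : Q (suc l) ✶ M ≈ y b ✶ mono 1ℤ (e i j (suc l ⊖ b))
    middle = ≈-trans (mono-mono 1ℤ _ 1ℤ _) (≈-trans (mono-exp 1ℤ (trans
      (cong (λ n → suc l * s + e i j n) (sym (ℤ.[1+m]⊖[1+n]≡m⊖n l b))) (e-sucʳ i j b (suc l)))) (≈-sym (mono-mono 1ℤ _ 1ℤ _)))

  coefficient-sucʳ-0 : ∀ a b → coefficient a (suc b) 0 ≈ y b ✶ coefficient a b 0
  coefficient-sucʳ-0 a b = begin
    gauss (a + suc b) 0 ✶ mono 1ℤ (e i j (0 ⊖ suc b))    ≈⟨ ✶-congʳ _ (λ n → cong (λ G → G n) (gauss-zero (a + suc b))) ⟩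
    one ✶ mono 1ℤ (e i j (0 ⊖ suc b))                    ≈⟨ ✶-identityˡ _ ⟩
    mono 1ℤ (e i j (0 ⊖ suc b))                          ≈⟨ mono-exp 1ℤ (e-sucʳ i j b 0) ⟩
    mono 1ℤ ((j + b * s) + e i j (0 ⊖ b))                ≈⟨ mono-mono 1ℤ _ 1ℤ _ ⟨
    y b ✶ mono 1ℤ (e i j (0 ⊖ b))                        ≈⟨ ✶-congˡ (y b) (≈-sym (≈-trans (✶-congʳ _ (λ n → cong (λ G → G n) (gauss-zero (a + b)))) (✶-identityˡ _))) ⟩
    y b ✶ coefficient a b 0                              ∎
    where open ≈-Reasoning

  -- The finite product with `z^n` replaced by `ω n`. The weight n ↦ εⁿ evaluates it at z = ε, and n
  -- ↦ (-1)ⁿ n applies z d/dz at z = -1; thus no Laurent polynomials are needed.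
  weighted : (ℤ → ℤ) → ℕ → ℕ → Series
  weighted ω a b = Sum (λ l → scale (ω (l ⊖ b)) (coefficient a b l)) (suc (a + b))

  weighted-cong : ∀ {ω ω′} → (∀ n → ω n ≡ ω′ n) → ∀ a b → weighted ω a b ≈ weighted ω′ a b
  weighted-cong p a b = Sum-cong (λ l → scale-≡ (coefficient a b l) (p (l ⊖ b))) (suc (a + b))

  weighted-+ : ∀ c ω d ω′ a b → weighted (λ n → c ℤ.* ω n ℤ.+ d ℤ.* ω′ n) a b ≈ scale c (weighted ω a b) ⊞ scale d (weighted ω′ a b)
  weighted-+ c ω d ω′ a b = ≈-trans
    (Sum-cong (λ l → ≈-trans (scale-+ (c ℤ.* ω (l ⊖ b)) (d ℤ.* ω′ (l ⊖ b)) (coefficient a b l))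
                             (⊞-cong (≈-sym (scale-scale c (ω (l ⊖ b)) (coefficient a b l))) (≈-sym (scale-scale d (ω′ (l ⊖ b)) (coefficient a b l))))) N)
    (≈-trans (Sum-⊞ (λ l → scale c (scale (ω (l ⊖ b)) (coefficient a b l))) (λ l → scale d (scale (ω′ (l ⊖ b)) (coefficient a b l))) N)
             (⊞-cong (Sum-scale c (λ l → scale (ω (l ⊖ b)) (coefficient a b l)) N) (Sum-scale d (λ l → scale (ω′ (l ⊖ b)) (coefficient a b l)) N)))
    where N = suc (a + b)

  private
    scale-⊞-✶ : ∀ c F G H → scale c (F ⊞ G ✶ H) ≈ scale c F ⊞ G ✶ scale c H
    scale-⊞-✶ c F G H = ≈-trans (scale-⊞ c F (G ✶ H)) (⊞-congˡ (scale c F) (≈-sym (scale-✶ c G H)))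

    Sum-vanish-last : ∀ f N → f N ≈ 0S → Sum f (suc N) ≈ Sum f N
    Sum-vanish-last f N z = ≈-trans (⊞-congʳ (Sum f N) z) (⊞-identityˡ _)

  -- Multiplication by the new factor 1 + z `x a` raises the exponent of z by one in its second
  -- term, which shifts the argument of the weight.
  weighted-sucˡ : ∀ ω a b → weighted ω (suc a) b ≈ weighted ω a b ⊞ x a ✶ weighted (λ n → ω (n ℤ.+ 1ℤ)) a b
  weighted-sucˡ ω a b = begin
    Sum (λ l → scale (ω (l ⊖ b)) (coefficient (suc a) b l)) (suc N)
      ≈⟨ Sum-first (λ l → scale (ω (l ⊖ b)) (coefficient (suc a) b l)) N ⟩
    scale (ω (0 ⊖ b)) (coefficient (suc a) b 0) ⊞ Sum (λ l → scale (ω (suc l ⊖ b)) (coefficient (suc a) b (suc l))) N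
      ≈⟨ ⊞-cong (scale-cong _ (coefficient-sucˡ-0 a b)) (≈-trans (Sum-cong step N) (Sum-⊞ (f ∘ suc) (λ l → x a ✶ g l) N)) ⟩
    f 0 ⊞ (Sum (f ∘ suc) N ⊞ Sum (λ l → x a ✶ g l) N)
      ≈⟨ 𝕊.+-assoc (f 0) (Sum (f ∘ suc) N) _ ⟨
    (f 0 ⊞ Sum (f ∘ suc) N) ⊞ Sum (λ l → x a ✶ g l) N
      ≈⟨ ⊞-cong (≈-trans (≈-sym (Sum-first f N)) (Sum-vanish-last f N (scale-0S _ (coefficient-> a b N ℕ.≤-refl)))) (≈-sym (Sum-✶ (x a) g N)) ⟩
    weighted ω a b ⊞ x a ✶ weighted (λ n → ω (n ℤ.+ 1ℤ)) a b ∎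
    where
    open ≈-Reasoning
    N = suc (a + b)
    f g : ℕ → Series
    f l = scale (ω (l ⊖ b)) (coefficient a b l)
    g l = scale (ω (l ⊖ b ℤ.+ 1ℤ)) (coefficient a b l)
    step : ∀ l → scale (ω (suc l ⊖ b)) (coefficient (suc a) b (suc l)) ≈ f (suc l) ⊞ x a ✶ g l
    step l = ≈-trans (scale-cong _ (coefficient-sucˡ a b l)) (≈-trans (scale-⊞-✶ _ _ _ _)
      (⊞-congˡ (f (suc l)) (✶-congˡ (x a) (scale-≡ (coefficient a b l) (cong ω (suc-⊖ l b))))))

  weighted-sucʳ : ∀ ω a b → weighted ω a (suc b) ≈ weighted ω a b ⊞ y b ✶ weighted (λ n → ω (n ℤ.- 1ℤ)) a b
  weighted-sucʳ ω a b = begin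
    Sum h (suc (a + suc b))
      ≈⟨ (λ n → cong (λ N → Sum h (suc N) n) (ℕ.+-suc a b)) ⟩
    Sum h (suc N)
      ≈⟨ Sum-first h N ⟩
    h 0 ⊞ Sum (h ∘ suc) N
      ≈⟨ ⊞-cong step-0 (≈-trans (Sum-cong step N) (Sum-⊞ (λ l → y b ✶ g (suc l)) f N)) ⟩
    y b ✶ g 0 ⊞ (Sum (λ l → y b ✶ g (suc l)) N ⊞ Sum f N)
      ≈⟨ 𝕊.+-assoc (y b ✶ g 0) (Sum (λ l → y b ✶ g (suc l)) N) _ ⟨
    (y b ✶ g 0 ⊞ Sum (λ l → y b ✶ g (suc l)) N) ⊞ Sum f N
      ≈⟨ ⊞-cong (≈-trans (≈-sym (Sum-first (λ l → y b ✶ g l) N)) (≈-trans (≈-sym (Sum-✶ (y b) g (suc N))) (✶-congˡ (y b)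
           (Sum-vanish-last g N (scale-0S _ (coefficient-> a b N ℕ.≤-refl)))))) (≈-refl {Sum f N}) ⟩
    y b ✶ Sum g N ⊞ Sum f N
      ≈⟨ 𝕊.+-comm (y b ✶ Sum g N) (Sum f N) ⟩
    weighted ω a b ⊞ y b ✶ weighted (λ n → ω (n ℤ.- 1ℤ)) a b ∎
    where
    open ≈-Reasoning
    N = suc (a + b)
    f g h : ℕ → Series
    f l = scale (ω (l ⊖ b)) (coefficient a b l)
    g l = scale (ω (l ⊖ b ℤ.- 1ℤ)) (coefficient a b l)
    h l = scale (ω (l ⊖ suc b)) (coefficient a (suc b) l)
    ⊖-suc : ∀ l → l ⊖ suc b ≡ l ⊖ b ℤ.- 1ℤ
    ⊖-suc l = trans (sym (ℤ.m-n≡m⊖n l (suc b))) (trans (lemma (+ l) (+ b)) (cong (λ y → y ℤ.- 1ℤ) (ℤ.m-n≡m⊖n l b)))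
      where
      lemma : ∀ l b → l ℤ.- (1ℤ ℤ.+ b) ≡ l ℤ.- b ℤ.- 1ℤ
      lemma = ℤ-Solver.solve-∀
    step-0 : h 0 ≈ y b ✶ g 0
    step-0 = ≈-trans (scale-cong _ (coefficient-sucʳ-0 a b)) (≈-trans (≈-sym (scale-✶ _ (y b) _))
      (✶-congˡ (y b) (scale-≡ (coefficient a b 0) (cong ω (⊖-suc 0)))))
    step : ∀ l → h (suc l) ≈ y b ✶ g (suc l) ⊞ f l
    step l = ≈-trans (scale-cong _ (≈-trans (coefficient-sucʳ a b l) (𝕊.+-comm (y b ✶ coefficient a b (suc l)) _)))
      (≈-trans (scale-⊞-✶ _ (coefficient a b l) (y b) (coefficient a b (suc l)))
      (≈-trans (𝕊.+-comm (scale (ω (suc l ⊖ suc b)) (coefficient a b l)) _)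
      (⊞-cong (✶-congˡ (y b) (scale-≡ (coefficient a b (suc l)) (cong ω (⊖-suc (suc l)))))
              (scale-≡ (coefficient a b l) (cong ω (ℤ.[1+m]⊖[1+n]≡m⊖n l b))))))

  weighted-00 : ∀ ω → weighted ω 0 0 ≈ scale (ω 0ℤ) one
  weighted-00 ω = ≈-trans (𝕊.+-identityʳ _) (scale-cong (ω 0ℤ) (≈-trans (✶-identityˡ _)
    (≈-trans (mono-exp 1ℤ (cong₂ _+_ (ℕ.*-zeroʳ i) (ℕ.*-zeroʳ j))) mono-0-1)))

  module Limit .{{_ : NonZero i}} where

    private instance
      s≢0 : NonZero s
      s≢0 = nz i j
        where
        nz : ∀ i j .{{_ : NonZero i}} → NonZero (i + j)
        nz (suc i) j = _

    -- If the exponent is at least `m`, both sides vanish modulo `q^m`. Otherwise `e-growth` keeps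
    -- `l` within `m` of `N`, so `l` and `2N - l` are both at least `m` and the binomial has reached
    -- its limit 1/`E∞`.
    term-limit : ∀ m N l → m + m ≤ N → l ≤ N + N → E∞ ✶ coefficient N N l ≈[ m ] mono 1ℤ (e i j (l ⊖ N))
    term-limit m N l 2m≤N l≤2N with e i j (l ⊖ N) ℕ.<? m
    ... | no e≮m = λ n n<m → trans
            (trans (trans (sym (✶-assoc E∞ (gauss (N + N) l) M n)) (✶-comm (E∞ ✶ gauss (N + N) l) M n))
                   (mono-✶-< 1ℤ (e i j (l ⊖ N)) _ n (ℕ.<-≤-trans n<m (ℕ.≮⇒≥ e≮m))))
            (sym (mono-< 1ℤ (e i j (l ⊖ N)) n (ℕ.<-≤-trans n<m (ℕ.≮⇒≥ e≮m))))
      where M = mono 1ℤ (e i j (l ⊖ N))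
    ... | yes e<m = ≈[]-trans (≈⇒≈[] (≈-sym (✶-assoc E∞ (gauss (N + N) l) _)))
            (≈[]-trans (✶-cong[] {F = E∞ ✶ gauss (N + N) l} {F′ = one} near ≈[]-refl) (≈⇒≈[] (✶-identityˡ _)))
      where
      close : ∣ l ⊖ N ∣ ≤ m
      close = ℕ.≤-trans (e-growth i j (l ⊖ N)) e<m
      N≤l+m : N ≤ l + m
      N≤l+m with ℕ.≤-total N l
      ... | inj₁ N≤l = ℕ.≤-trans N≤l (ℕ.m≤m+n l m)
      ... | inj₂ l≤N = ℕ.≤-trans (ℕ.m≤n+m∸n N l) (ℕ.+-monoʳ-≤ l (subst (_≤ m) (ℤ.∣⊖∣-≤ l≤N) close))
      l≤N+m : l ≤ N + m
      l≤N+m with ℕ.≤-total N l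
      ... | inj₂ l≤N = ℕ.≤-trans l≤N (ℕ.m≤m+n N m)
      ... | inj₁ N≤l = ℕ.≤-trans (ℕ.m≤n+m∸n l N) (ℕ.+-monoʳ-≤ N (subst (_≤ m) (cong ∣_∣ (ℤ.⊖-≥ N≤l)) close))
      m≤l : m ≤ l
      m≤l = ℕ.+-cancelʳ-≤ m m l (ℕ.≤-trans 2m≤N N≤l+m)
      m≤k : m ≤ N + N ∸ l
      m≤k = ℕ.+-cancelˡ-≤ l m _ (subst (l + m ≤_) (sym (ℕ.m+[n∸m]≡n l≤2N))
              (ℕ.≤-trans (ℕ.+-monoˡ-≤ m l≤N+m) (ℕ.≤-trans (ℕ.≤-reflexive (ℕ.+-assoc N m m)) (ℕ.+-monoʳ-≤ N 2m≤N))))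
      near : E∞ ✶ gauss (N + N) l ≈[ m ] one
      near = subst (λ n → E∞ ✶ gauss n l ≈[ m ] one) (ℕ.m+[n∸m]≡n l≤2N) (gauss-limit m l (N + N ∸ l) m≤l m≤k)

    weighted-limit : ∀ ω m N → m + m ≤ N → m < N → E∞ ✶ weighted ω N N ≈[ m ] Θ (Levels-e i j) ω
    weighted-limit ω m N 2m≤N m<N = ≈[]-trans (≈⇒≈[] (Sum-✶ E∞ (λ l → scale (ω (l ⊖ N)) (coefficient N N l)) (suc (N + N))))
      (≈[]-trans (Sum-cong[] (suc (N + N)) λ l l<1+2N → ≈[]-trans (≈⇒≈[] (scale-✶ (ω (l ⊖ N)) E∞ (coefficient N N l)))
        (scale-cong[] (ω (l ⊖ N)) (term-limit m N l 2m≤N (ℕ.≤-pred l<1+2N))))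
      λ n n<m → trans (Sum-at (λ l → scale (ω (l ⊖ N)) (mono 1ℤ (e i j (l ⊖ N)))) (suc (N + N)) n) (trans (sumL-cong (downFrom (suc (N + N))) (λ {l} _ → scale-mono (ω (l ⊖ N)) (e i j (l ⊖ N)) n))
        (trans (sym (sumL-map (λ k → mono (ω k) (e i j k) n) (_⊖ N) (downFrom (suc (N + N)))))
        (Θ-covering (Levels-e i j) ω n (box N) (box-unique N) (λ k eq → ∈-box N k (ℕ.≤-trans (e-growth i j k) (ℕ.≤-trans (s≤s (ℕ.≤-reflexive eq)) (ℕ.≤-trans n<m (ℕ.<⇒≤ m<N)))))))))

-- The weight n ↦ εⁿ for ε = ±1. Going down also multiplies by ε, which is its own inverse.
record Character (ε : ℤ) (ω : ℤ → ℤ) : Set where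
  field
    at-0    : ω 0ℤ ≡ 1ℤ
    at-suc  : ∀ n → ω (n ℤ.+ 1ℤ) ≡ ε ℤ.* ω n
    at-pred : ∀ n → ω (n ℤ.- 1ℤ) ≡ ε ℤ.* ω n

opaque
  sgn : ℤ → ℤ
  sgn n = -1ℤ ℤ.^ ∣ n ∣

  sgn-def : ∀ n → sgn n ≡ -1ℤ ℤ.^ ∣ n ∣
  sgn-def n = refl

  sgn-0 : sgn 0ℤ ≡ 1ℤ
  sgn-0 = refl

  sgn-+1 : ∀ n → sgn (n ℤ.+ 1ℤ) ≡ -1ℤ ℤ.* sgn n
  sgn-+1 (+ n) rewrite ℕ.+-comm n 1 = refl
  sgn-+1 -[1+ zero ]  = refl
  sgn-+1 -[1+ suc n ] = lemma (-1ℤ ℤ.^ n)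
    where
    lemma : ∀ x → -1ℤ ℤ.* x ≡ -1ℤ ℤ.* (-1ℤ ℤ.* (-1ℤ ℤ.* x))
    lemma = ℤ-Solver.solve-∀

sgn-−1 : ∀ n → sgn (n ℤ.- 1ℤ) ≡ -1ℤ ℤ.* sgn n
sgn-−1 n = begin
  sgn (n ℤ.- 1ℤ)                               ≡⟨ lemma (sgn (n ℤ.- 1ℤ)) ⟩
  -1ℤ ℤ.* (-1ℤ ℤ.* sgn (n ℤ.- 1ℤ))             ≡⟨ cong (λ y → -1ℤ ℤ.* y) (sgn-+1 (n ℤ.- 1ℤ)) ⟨
  -1ℤ ℤ.* sgn (n ℤ.- 1ℤ ℤ.+ 1ℤ)                ≡⟨ cong (λ k → -1ℤ ℤ.* sgn k) (lemma′ n) ⟩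
  -1ℤ ℤ.* sgn n                                ∎
  where
  open ≡-Reasoning
  lemma : ∀ x → x ≡ -1ℤ ℤ.* (-1ℤ ℤ.* x)
  lemma = ℤ-Solver.solve-∀
  lemma′ : ∀ n → n ℤ.- 1ℤ ℤ.+ 1ℤ ≡ n
  lemma′ = ℤ-Solver.solve-∀

sgn-character : Character -1ℤ sgn
sgn-character = record { at-0 = sgn-0 ; at-suc = sgn-+1 ; at-pred = sgn-−1 }

trivial : ℤ → ℤ
trivial _ = 1ℤ

trivial-character : Character 1ℤ trivial
trivial-character = record { at-0 = refl ; at-suc = λ _ → refl ; at-pred = λ _ → refl }

scale≈mono-✶ : ∀ ε k F → mono 1ℤ k ✶ scale ε F ≈ mono ε k ✶ F
scale≈mono-✶ ε k F = begin
  mono 1ℤ k ✶ scale ε F       ≈⟨ ✶-congˡ (mono 1ℤ k) (✶-const ε F) ⟨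
  mono 1ℤ k ✶ (const ε ✶ F)   ≈⟨ ✶-assoc _ _ F ⟨
  (mono 1ℤ k ✶ const ε) ✶ F   ≈⟨ ✶-congʳ F (≈-trans (mono-mono 1ℤ k ε 0)
                                   (λ n → cong₂ (λ c j → mono c j n) (ℤ.*-identityˡ ε) (ℕ.+-identityʳ k))) ⟩
  mono ε k ✶ F                ∎
  where open ≈-Reasoning

module _ (i j : ℕ) where

  open Jacobi i j

  weighted-scale : ∀ c ω a b → weighted (λ n → c ℤ.* ω n) a b ≈ scale c (weighted ω a b)
  weighted-scale c ω a b = ≈-trans (weighted-cong {λ n → c ℤ.* ω n} {λ n → c ℤ.* ω n ℤ.+ 0ℤ ℤ.* ω n} (λ n → sym (trans (cong (λ y → c ℤ.* ω n ℤ.+ y) (ℤ.*-zeroˡ (ω n))) (ℤ.+-identityʳ _))) a b)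
    (≈-trans (weighted-+ c ω 0ℤ ω a b) (≈-trans (⊞-congˡ (scale c (weighted ω a b)) (λ n → scale-at 0ℤ _ n)) (⊞-identityʳ _)))

  module _ {ε ω} (χ : Character ε ω) where

    open Character χ

    private
      extend : ∀ k {F G H} → F ≈ G ✶ H → F ⊞ mono 1ℤ k ✶ scale ε F ≈ (G ✶ (one ⊞ mono ε k)) ✶ H
      extend k {F} {G} {H} F≈ = begin
        F ⊞ mono 1ℤ k ✶ scale ε F              ≈⟨ ⊞-congˡ F (scale≈mono-✶ ε k F) ⟩
        F ⊞ mono ε k ✶ F                       ≈⟨ ⊞-cong F≈ (✶-congˡ (mono ε k) F≈) ⟩
        G ✶ H ⊞ mono ε k ✶ (G ✶ H)             ≈⟨ factor-out G H (mono ε k) ⟩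
        (G ✶ (const 1ℤ ⊞ mono ε k)) ✶ H        ≈⟨ ✶-congʳ H (✶-congˡ G (⊞-congʳ (mono ε k) (≈-sym one≈const))) ⟩
        (G ✶ (one ⊞ mono ε k)) ✶ H             ∎
        where open ≈-Reasoning

    -- For a character the shifted weight is ε times the weight itself, so each recursion step pulls
    -- out one whole factor.
    finite-triple-product : ∀ a b → weighted ω a b ≈ Prod (factor ε i s) a ✶ Prod (factor ε j s) b
    finite-triple-product zero zero = ≈-trans (weighted-00 ω) (≈-trans (scale-≡ one at-0)
      (≈-trans (λ n → trans (scale-at 1ℤ one n) (ℤ.*-identityˡ _)) (≈-sym (✶-identityˡ one))))
    finite-triple-product (suc a) b = ≈-trans (weighted-sucˡ ω a b) (≈-trans
      (⊞-congˡ (weighted ω a b) (✶-congˡ (x a) (≈-trans (weighted-cong at-suc a b) (weighted-scale ε ω a b))))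
      (extend (i + a * s) (finite-triple-product a b)))
    finite-triple-product zero (suc b) = ≈-trans (weighted-sucʳ ω 0 b) (≈-trans
      (⊞-congˡ (weighted ω 0 b) (✶-congˡ (y b) (≈-trans (weighted-cong at-pred 0 b) (weighted-scale ε ω 0 b))))
      (≈-trans (extend (j + b * s) (≈-trans (finite-triple-product 0 b) (✶-comm one _))) (✶-comm _ one)))

    module _ .{{_ : NonZero i}} where

      private instance
        s≢0 : NonZero s
        s≢0 = nz i j
          where
          nz : ∀ i j .{{_ : NonZero i}} → NonZero (i + j)
          nz (suc i) j = _

      triple-product : Θ (Levels-e i j) ω ≈ P -1ℤ s s ✶ (P ε i s ✶ P ε j s)
      triple-product = ≈[]⇒≈ λ m → let N = suc (m + m) ; m≤N = ℕ.m≤n⇒m≤1+n (ℕ.m≤m+n m m) in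
        ≈[]-trans (≈[]-sym (Limit.weighted-limit ω m N (ℕ.n≤1+n _) (s≤s (ℕ.m≤m+n m m))))
        (✶-cong[] ≈[]-refl (≈[]-trans (≈⇒≈[] (finite-triple-product N N))
          (✶-cong[] (≈[]-≤ m≤N (≈[]-sym (P-≈[] ε i s N))) (≈[]-≤ m≤N (≈[]-sym (P-≈[] ε j s N))))))

-- Jacobi's identity for f₁³

f : ℕ → Series
f k = P -1ℤ k k

-- Only the weight n ↦ n sees the cube: its partner weight 1 is killed by the factor 1 - z⁻¹ at z = 1.
module _ where

  open Jacobi 1 0

  private
    N⁻ : ℕ → Series
    N⁻ = Prod (factor -1ℤ 1 1)

    linear : ℤ → ℤ
    linear n = sgn n ℤ.* n

    sgn-vanishes : ∀ a b → weighted sgn a (suc b) ≈ 0S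
    sgn-vanishes a b = ≈-trans (finite-triple-product 1 0 sgn-character a (suc b))
      (≈-trans (✶-congˡ _ (zero-factor b)) (✶-zeroʳ _))
      where
      zero-factor : ∀ b → Prod (factor -1ℤ 0 1) (suc b) ≈ 0S
      zero-factor zero    = ≈-trans (✶-identityˡ _) (≈-trans (⊞-congʳ (mono -1ℤ 0) one≈const) (≈-trans (≈-sym (mono-+ 1ℤ -1ℤ 0)) (mono-0 0)))
      zero-factor (suc b) = ≈-trans (✶-congʳ _ (zero-factor b)) (✶-zeroˡ _)

    up : ∀ n → linear (n ℤ.+ 1ℤ) ≡ -1ℤ ℤ.* linear n ℤ.+ -1ℤ ℤ.* sgn n
    up n = trans (cong (λ c → c ℤ.* (n ℤ.+ 1ℤ)) (sgn-+1 n)) (lemma (sgn n) n)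
      where
      lemma : ∀ c n → -1ℤ ℤ.* c ℤ.* (n ℤ.+ 1ℤ) ≡ -1ℤ ℤ.* (c ℤ.* n) ℤ.+ -1ℤ ℤ.* c
      lemma = ℤ-Solver.solve-∀

    down : ∀ n → linear (n ℤ.- 1ℤ) ≡ -1ℤ ℤ.* linear n ℤ.+ 1ℤ ℤ.* sgn n
    down n = trans (cong (λ c → c ℤ.* (n ℤ.- 1ℤ)) (sgn-−1 n)) (lemma (sgn n) n)
      where
      lemma : ∀ c n → -1ℤ ℤ.* c ℤ.* (n ℤ.- 1ℤ) ≡ -1ℤ ℤ.* (c ℤ.* n) ℤ.+ 1ℤ ℤ.* c
      lemma = ℤ-Solver.solve-∀

    step : ∀ k c {F G H V Z} → F ≈ G ✶ H → Z ≈ 0S → V ≈ scale -1ℤ F ⊞ scale c Z →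
           F ⊞ mono 1ℤ k ✶ V ≈ (G ✶ (one ⊞ mono -1ℤ k)) ✶ H
    step k c {F} {G} {H} {V} {Z} F≈ Z≈ V≈ = begin
      F ⊞ mono 1ℤ k ✶ V                ≈⟨ ⊞-congˡ F (✶-congˡ (mono 1ℤ k) (≈-trans V≈ (≈-trans (⊞-congˡ (scale -1ℤ F) (scale-0S c Z≈)) (⊞-identityʳ _)))) ⟩
      F ⊞ mono 1ℤ k ✶ scale -1ℤ F      ≈⟨ ⊞-congˡ F (scale≈mono-✶ -1ℤ k F) ⟩
      F ⊞ mono -1ℤ k ✶ F               ≈⟨ ⊞-cong F≈ (✶-congˡ (mono -1ℤ k) F≈) ⟩
      G ✶ H ⊞ mono -1ℤ k ✶ (G ✶ H)     ≈⟨ factor-out G H (mono -1ℤ k) ⟩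
      (G ✶ (const 1ℤ ⊞ mono -1ℤ k)) ✶ H ≈⟨ ✶-congʳ H (✶-congˡ G (⊞-congʳ (mono -1ℤ k) (≈-sym one≈const))) ⟩
      (G ✶ (one ⊞ mono -1ℤ k)) ✶ H     ∎
      where open ≈-Reasoning

    -- The product rule for z d/dz at z = -1: the factor 1 + z⁻¹ vanishes there, so only the term
    -- that differentiates it survives, and its derivative is 1. The other factors become the two
    -- products.
    finite-cube : ∀ a b → weighted linear a (suc b) ≈ N⁻ a ✶ N⁻ b
    finite-cube zero zero = begin
      weighted linear 0 1
        ≈⟨ weighted-sucʳ linear 0 0 ⟩
      weighted linear 0 0 ⊞ mono 1ℤ 0 ✶ weighted (λ n → linear (n ℤ.- 1ℤ)) 0 0
        ≈⟨ ⊞-cong (≈-trans (weighted-00 linear) (λ n → trans (scale-at (linear 0ℤ) one n) (cong (λ c → c ℤ.* one n) (ℤ.*-zeroʳ (sgn 0ℤ)))))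
             (✶-cong mono-0-1 (≈-trans (weighted-00 (λ n → linear (n ℤ.- 1ℤ)))
                (≈-trans (scale-≡ one (trans (cong (λ c → c ℤ.* -1ℤ) (sgn-def -1ℤ)) refl)) (λ n → trans (scale-at 1ℤ one n) (ℤ.*-identityˡ _))))) ⟩
      0S ⊞ one ✶ one
        ≈⟨ ⊞-identityˡ _ ⟩
      one ✶ one ∎
      where open ≈-Reasoning
    finite-cube (suc a) b = ≈-trans (weighted-sucˡ linear a (suc b))
      (step (1 + a * 1) -1ℤ (finite-cube a b) (sgn-vanishes a b)
        (≈-trans (weighted-cong up a (suc b)) (weighted-+ -1ℤ linear -1ℤ sgn a (suc b))))
    finite-cube zero (suc b) = ≈-trans (weighted-sucʳ linear 0 (suc b))
      (≈-trans (step (suc b * 1) 1ℤ (≈-trans (finite-cube 0 b) (✶-comm one _)) (sgn-vanishes 0 b)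
        (≈-trans (weighted-cong down 0 (suc b)) (weighted-+ -1ℤ linear 1ℤ sgn 0 (suc b)))) (✶-comm _ one))

    linear-product : Θ (Levels-e 1 0) linear ≈ f 1 ✶ (f 1 ✶ f 1)
    linear-product = ≈[]⇒≈ λ m → let N = m + m in
      ≈[]-trans (≈[]-sym (Limit.weighted-limit linear m (suc N) (ℕ.n≤1+n _) (s≤s (ℕ.m≤m+n m m))))
      (✶-cong[] ≈[]-refl (≈[]-trans (≈⇒≈[] (finite-cube (suc N) N))
        (✶-cong[] (≈[]-≤ (ℕ.m≤n⇒m≤1+n (ℕ.m≤m+n m m)) (≈[]-sym (P-≈[] -1ℤ 1 1 (suc N)))) (≈[]-≤ (ℕ.m≤m+n m m) (≈[]-sym (P-≈[] -1ℤ 1 1 N))))))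

    sgn-zero : Θ (Levels-e 1 0) sgn ≈ 0S
    sgn-zero = ≈[]⇒≈ λ m → let N = suc (m + m) in
      ≈[]-trans (≈[]-sym (Limit.weighted-limit sgn m N (ℕ.n≤1+n _) (s≤s (ℕ.m≤m+n m m))))
      (≈⇒≈[] (≈-trans (✶-congˡ _ (sgn-vanishes N (m + m))) (✶-zeroʳ _)))

  -- Since the unweighted alternating sum is 0, n may be replaced by 2n + 1 at the cost of a factor
  -- 2. The 2 also reflects that n and -1 - n contribute equally.
  jacobi-cube : Θ (Levels-e 1 0) (λ n → sgn n ℤ.* (+ 2 ℤ.* n ℤ.+ 1ℤ)) ≈ scale (+ 2) (f 1 ✶ (f 1 ✶ f 1))
  jacobi-cube = begin
    Θ L (λ n → sgn n ℤ.* (+ 2 ℤ.* n ℤ.+ 1ℤ))    ≈⟨ Θ-cong L (λ n → lemma (sgn n) n) ⟩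
    Θ L (λ n → + 2 ℤ.* linear n ℤ.+ sgn n)      ≈⟨ Θ-+ L (λ n → + 2 ℤ.* linear n) sgn ⟩
    Θ L (λ n → + 2 ℤ.* linear n) ⊞ Θ L sgn      ≈⟨ ⊞-cong (≈-trans (Θ-* L (+ 2) linear) (scale-cong (+ 2) linear-product)) sgn-zero ⟩
    scale (+ 2) (f 1 ✶ (f 1 ✶ f 1)) ⊞ 0S        ≈⟨ ⊞-identityʳ _ ⟩
    scale (+ 2) (f 1 ✶ (f 1 ✶ f 1))             ∎
    where
    open ≈-Reasoning
    L = Levels-e 1 0
    lemma : ∀ c n → c ℤ.* (+ 2 ℤ.* n ℤ.+ 1ℤ) ≡ + 2 ℤ.* (c ℤ.* n) ℤ.+ c
    lemma = ℤ-Solver.solve-∀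

-- Theta series as eta quotients

sum≡sumL : ∀ (g : ℕ → ℤ) N → sum-syntax N (λ i → g (toℕ i)) ≡ sumL g (upTo N)
sum≡sumL g N = trans (go g N) (sumL-applyUpTo id N)
  where
  go : ∀ (g : ℕ → ℤ) N → sum-syntax N (λ i → g (toℕ i)) ≡ sumL id (applyUpTo g N)
  go g zero    = refl
  go g (suc N) = cong (λ y → g 0 ℤ.+ y) (go (g ∘ suc) N)
  sumL-applyUpTo : ∀ (h : ℕ → ℕ) N → sumL id (applyUpTo (g ∘ h) N) ≡ sumL g (applyUpTo h N)
  sumL-applyUpTo h zero    = refl
  sumL-applyUpTo h (suc N) = cong (λ y → g (h 0) ℤ.+ y) (sumL-applyUpTo (h ∘ suc) N)

sumL-upTo : ∀ (g : ℕ → ℤ) N → sumL g (upTo N) ≡ sumL g (downFrom N)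
sumL-upTo g N = sumL-set g (Unique.upTo⁺ N) (Unique.downFrom⁺ N) (∈-downFrom⁺ ∘ ∈-upTo⁻) (∈-upTo⁺ ∘ ∈-downFrom⁻)

⟦e-diag⟧ : ∀ j n → + e j j n ≡ + j ℤ.* n ℤ.^ 2
⟦e-diag⟧ j n = ℤ.*-cancelˡ-≡ (+ 2) _ _ (trans (⟦2e⟧ j j n) (lemma (+ j) n))
  where
  lemma : ∀ j n → j ℤ.* (n ℤ.* (n ℤ.+ 1ℤ)) ℤ.+ j ℤ.* (n ℤ.* (n ℤ.- 1ℤ)) ≡ + 2 ℤ.* (j ℤ.* (n ℤ.* (n ℤ.* 1ℤ)))
  lemma = ℤ-Solver.solve-∀

e-diag-growth : ∀ j .{{_ : NonZero j}} n → ∣ n ∣ ≤ e j j n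
e-diag-growth j (+ n)    = ℕ.≤-trans (n≤tri n) (ℕ.≤-trans (ℕ.m≤n*m (tri n) j) (ℕ.m≤m+n _ _))
e-diag-growth j -[1+ n ] = ℕ.≤-trans (n≤tri (suc n)) (ℕ.≤-trans (ℕ.m≤n*m (tri (suc n)) j) (ℕ.m≤n+m _ _))

-- The summation range from -m to m covers the whole level, since |n| never exceeds the exponent
-- jn².
φ≈Θ : ∀ j .{{_ : NonZero j}} → φ[-q^ j ] ≈ Θ (Levels-e j j) sgn
φ≈Θ j m = begin
  sum-syntax (suc (2 * m)) (λ i → φ-term j m (toℕ i ⊖ m))            ≡⟨ sum≡sumL (λ l → φ-term j m (l ⊖ m)) (suc (2 * m)) ⟩
  sumL (λ l → φ-term j m (l ⊖ m)) (upTo (suc (2 * m)))               ≡⟨ sumL-upTo (λ l → φ-term j m (l ⊖ m)) (suc (2 * m)) ⟩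
  sumL (λ l → φ-term j m (l ⊖ m)) (downFrom (suc (2 * m)))           ≡⟨ cong (λ N → sumL (λ l → φ-term j m (l ⊖ m)) (downFrom (suc N))) (cong (λ y → m + y) (ℕ.+-identityʳ m)) ⟩
  sumL (λ l → φ-term j m (l ⊖ m)) (downFrom (suc (m + m)))           ≡⟨ sumL-map (φ-term j m) (_⊖ m) (downFrom (suc (m + m))) ⟨
  sumL (φ-term j m) (box m)                                          ≡⟨ sumL-cong (box m) (λ {n} _ → term n) ⟩
  sumL (λ n → mono (sgn n) (e j j n) m) (box m)                      ≡⟨ Θ-covering (Levels-e j j) sgn m (box m) (box-unique m)
                                                                          (λ n eq → ∈-box m n (subst (∣ n ∣ ≤_) eq (e-diag-growth j n))) ⟩
  Θ (Levels-e j j) sgn m                                             ∎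
  where
  open ≡-Reasoning
  term : ∀ n → φ-term j m n ≡ mono (sgn n) (e j j n) m
  term n with + j ℤ.* n ℤ.^ 2 ℤ.≟ + m
  ... | yes p = trans (sym (sgn-def n)) (trans (sym (mono-diag (sgn n) m)) (cong (λ k → mono (sgn n) k m) (sym (ℤ.+-injective (trans (⟦e-diag⟧ j n) p)))))
  ... | no ¬p = sym (mono-off (sgn n) (e j j n) m (λ eq → ¬p (trans (sym (⟦e-diag⟧ j n)) (cong +_ eq))))

P-double : ∀ k .{{_ : NonZero k}} → P -1ℤ k (k + k) ✶ f (k + k) ≈ f k
P-double k = ≈-sym (≈-trans (P-regroup -1ℤ k k 2) (✶-cong
  (≈-trans (✶-identityˡ _) (λ n → cong₂ (λ i s → P -1ℤ i s n) (ℕ.+-identityʳ k) (cong (λ y → k + y) (ℕ.+-identityʳ k))))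
  (λ n → cong₂ (λ i s → P -1ℤ i s n) (cong (λ y → k + y) (ℕ.+-identityʳ k)) (cong (λ y → k + y) (ℕ.+-identityʳ k)))))

φ-product : ∀ k .{{_ : NonZero k}} → φ[-q^ k ] ✶ f (k + k) ≈ f k ✶ f k
φ-product k = begin
  φ[-q^ k ] ✶ f (k + k)                                                ≈⟨ ✶-congʳ _ (≈-trans (φ≈Θ k) (triple-product k k sgn-character)) ⟩
  f (k + k) ✶ (P -1ℤ k (k + k) ✶ P -1ℤ k (k + k)) ✶ f (k + k)          ≈⟨ square-split (P -1ℤ k (k + k)) (f (k + k)) ⟩
  (P -1ℤ k (k + k) ✶ f (k + k)) ✶ (P -1ℤ k (k + k) ✶ f (k + k))        ≈⟨ ✶-cong (P-double k) (P-double k) ⟩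
  f k ✶ f k                                                            ∎
  where open ≈-Reasoning

-- 2 ψ(q^k), each exponent k n(n+1)/2 being hit by n and by -1 - n.
2ψ : ∀ k .{{_ : NonZero k}} → Series
2ψ k = Θ (Levels-e k 0) trivial

2ψ-product : ∀ k .{{_ : NonZero k}} → 2ψ k ✶ f k ≈ const (+ 2) ✶ (f (k + k) ✶ f (k + k))
2ψ-product k = begin
  2ψ k ✶ f k                                                   ≈⟨ ✶-congʳ _ (triple-product k 0 trivial-character) ⟩
  P -1ℤ (k + 0) (k + 0) ✶ (P 1ℤ k (k + 0) ✶ P 1ℤ 0 (k + 0)) ✶ f k ≈⟨ (λ n → cong (λ s → (P -1ℤ s s ✶ (P 1ℤ k s ✶ P 1ℤ 0 s) ✶ f k) n) (ℕ.+-identityʳ k)) ⟩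
  f k ✶ (P 1ℤ k k ✶ P 1ℤ 0 k) ✶ f k                            ≈⟨ ✶-congʳ (f k) (✶-congˡ (f k) (✶-congˡ (P 1ℤ k k) P-0)) ⟩
  f k ✶ (P 1ℤ k k ✶ (const (+ 2) ✶ P 1ℤ k k)) ✶ f k            ≈⟨ ψ-product (f k) (P 1ℤ k k) ⟩
  const (+ 2) ✶ ((P 1ℤ k k ✶ f k) ✶ (P 1ℤ k k ✶ f k))          ≈⟨ ✶-congˡ _ (✶-cong (P-square k k) (P-square k k)) ⟩
  const (+ 2) ✶ (f (k + k) ✶ f (k + k))                        ∎
  where
  open ≈-Reasoning
  P-0 : P 1ℤ 0 k ≈ const (+ 2) ✶ P 1ℤ k k
  P-0 = ≈-trans (P-peel 1ℤ 0 k) (✶-congʳ (P 1ℤ k k) (≈-trans (⊞-congʳ (mono 1ℤ 0) one≈const) (≈-sym (mono-+ 1ℤ 1ℤ 0))))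

pentagonal : f 1 ≈ Θ (Levels-e 2 1) sgn
pentagonal = ≈-trans (P-regroup -1ℤ 1 1 3) (≈-trans (≈-trans (✶-congʳ _ (≈-trans (✶-congʳ _ (✶-identityˡ _)) (✶-comm _ _))) (✶-comm _ _))
  (≈-sym (triple-product 2 1 sgn-character)))

-- The exponents are (5n² + n)/2 and (5n² + 3n)/2. By their products, `α` and `β` are f₁ times the
-- two Rogers-Ramanujan functions.
α β : Series
α = Θ (Levels-e 3 2) sgn
β = Θ (Levels-e 4 1) sgn

α-product : α ≈ f 5 ✶ (P -1ℤ 3 5 ✶ P -1ℤ 2 5)
α-product = triple-product 3 2 sgn-character

β-product : β ≈ f 5 ✶ (P -1ℤ 4 5 ✶ P -1ℤ 1 5)
β-product = triple-product 4 1 sgn-character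

αβ≈f₁f₅ : α ✶ β ≈ f 1 ✶ f 5
αβ≈f₁f₅ = ≈-trans (✶-cong α-product β-product) (≈-trans (αβ-product (f 5) (P -1ℤ 1 5) (P -1ℤ 2 5) (P -1ℤ 3 5) (P -1ℤ 4 5))
  (✶-congʳ (f 5) (≈-sym (≈-trans (P-regroup -1ℤ 1 1 5) (✶-congʳ _ (✶-congʳ _ (✶-congʳ _ (✶-congʳ _ (✶-congʳ _ one≈const)))))))))

G : Series
G = Θ (Levels-e 3 2) trivial ✶ Θ (Levels-e 4 1) trivial

-- The two theta series supply the factors 1 + q^k with k not divisible by 5; the remaining class
-- comes from f₁₀, which is f₅ times the factors with 5 ∣ k. Multiplied by f₁ the full product is
-- f₂.
G-eta : G ✶ f 10 ✶ f 1 ≈ f 2 ✶ (f 5 ✶ (f 5 ✶ f 5))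
G-eta = begin
  G ✶ f 10 ✶ f 1
    ≈⟨ ✶-congʳ (f 1) (✶-cong (✶-cong (triple-product 3 2 trivial-character) (triple-product 4 1 trivial-character)) (≈-sym (P-square 5 5))) ⟩
  f 5 ✶ (P 1ℤ 3 5 ✶ P 1ℤ 2 5) ✶ (f 5 ✶ (P 1ℤ 4 5 ✶ P 1ℤ 1 5)) ✶ (P 1ℤ 5 5 ✶ f 5) ✶ f 1
    ≈⟨ G-product (f 5) (P 1ℤ 1 5) (P 1ℤ 2 5) (P 1ℤ 3 5) (P 1ℤ 4 5) (P 1ℤ 5 5) (f 1) ⟩
  ((const 1ℤ ✶ P 1ℤ 1 5 ✶ P 1ℤ 2 5 ✶ P 1ℤ 3 5 ✶ P 1ℤ 4 5 ✶ P 1ℤ 5 5) ✶ f 1) ✶ (f 5 ✶ (f 5 ✶ f 5))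
    ≈⟨ ✶-congʳ _ (≈-trans (✶-congʳ (f 1) (≈-sym (≈-trans (P-regroup 1ℤ 1 1 5) (✶-congʳ _ (✶-congʳ _ (✶-congʳ _ (✶-congʳ _ (✶-congʳ _ one≈const)))))))) (P-square 1 1)) ⟩
  f 2 ✶ (f 5 ✶ (f 5 ✶ f 5)) ∎
  where open ≈-Reasoning

K : Series
K = Θ (Levels-e 7 3) sgn ✶ Θ (Levels-e 9 1) sgn

-- The two theta series supply the factors 1 - q^k for k ≡ 1, 3, 7, 9 modulo 10. The missing odd
-- class 5 comes from f₅, and all even k from f₂.
K-eta : K ✶ f 5 ✶ f 2 ≈ f 1 ✶ (f 10 ✶ (f 10 ✶ f 10))
K-eta = begin
  K ✶ f 5 ✶ f 2
    ≈⟨ ✶-congʳ (f 2) (✶-cong (✶-cong (triple-product 7 3 sgn-character) (triple-product 9 1 sgn-character)) (≈-sym (P-double 5))) ⟩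
  f 10 ✶ (P -1ℤ 7 10 ✶ P -1ℤ 3 10) ✶ (f 10 ✶ (P -1ℤ 9 10 ✶ P -1ℤ 1 10)) ✶ (P -1ℤ 5 10 ✶ f 10) ✶ f 2
    ≈⟨ K-product (f 10) (P -1ℤ 1 10) (P -1ℤ 3 10) (P -1ℤ 7 10) (P -1ℤ 9 10) (P -1ℤ 5 10) (f 2) ⟩
  (const 1ℤ ✶ P -1ℤ 1 10 ✶ P -1ℤ 3 10 ✶ P -1ℤ 5 10 ✶ P -1ℤ 7 10 ✶ P -1ℤ 9 10) ✶ f 2 ✶ (f 10 ✶ (f 10 ✶ f 10))
    ≈⟨ ✶-congʳ _ (≈-trans (✶-congʳ (f 2) (≈-sym (≈-trans (P-regroup -1ℤ 1 2 5) (✶-congʳ _ (✶-congʳ _ (✶-congʳ _ (✶-congʳ _ (✶-congʳ _ one≈const)))))))) (P-double 1)) ⟩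
  f 1 ✶ (f 10 ✶ (f 10 ✶ f 10)) ∎
  where open ≈-Reasoning

-- Signs and the tiling of ℤ² into five cosets

opaque
  unfolding sgn

  sgn-+2 : ∀ n → sgn (n ℤ.+ + 2) ≡ sgn n
  sgn-+2 n = begin
    sgn (n ℤ.+ + 2)                ≡⟨ cong sgn (ℤ.+-assoc n 1ℤ 1ℤ) ⟨
    sgn (n ℤ.+ 1ℤ ℤ.+ 1ℤ)          ≡⟨ sgn-+1 (n ℤ.+ 1ℤ) ⟩
    -1ℤ ℤ.* sgn (n ℤ.+ 1ℤ)         ≡⟨ cong (λ y → -1ℤ ℤ.* y) (sgn-+1 n) ⟩
    -1ℤ ℤ.* (-1ℤ ℤ.* sgn n)        ≡⟨ lemma (sgn n) ⟩
    sgn n                          ∎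
    where
    open ≡-Reasoning
    lemma : ∀ x → -1ℤ ℤ.* (-1ℤ ℤ.* x) ≡ x
    lemma = ℤ-Solver.solve-∀

sgn-+2* : ∀ n k → sgn (n ℤ.+ + 2 ℤ.* k) ≡ sgn n
sgn-+2* n (+ k) = go n k
  where
  go : ∀ n k → sgn (n ℤ.+ + 2 ℤ.* + k) ≡ sgn n
  go n zero    = cong sgn (ℤ.+-identityʳ n)
  go n (suc k) = trans (cong sgn (lemma n (+ k))) (trans (sgn-+2 (n ℤ.+ + 2 ℤ.* + k)) (go n k))
    where
    lemma : ∀ n k → n ℤ.+ + 2 ℤ.* (1ℤ ℤ.+ k) ≡ n ℤ.+ + 2 ℤ.* k ℤ.+ + 2
    lemma = ℤ-Solver.solve-∀
sgn-+2* n -[1+ k ] = trans (sym (sgn-+2* (n ℤ.+ + 2 ℤ.* -[1+ k ]) (+ suc k))) (cong sgn (lemma n (+ suc k)))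
  where
  lemma : ∀ n k → n ℤ.+ + 2 ℤ.* (ℤ.- k) ℤ.+ + 2 ℤ.* k ≡ n
  lemma = ℤ-Solver.solve-∀

sgn-parity : ∀ {x} y k → x ≡ y ℤ.+ + 2 ℤ.* k → sgn x ≡ sgn y
sgn-parity y k refl = sgn-+2* y k

sgn-parity′ : ∀ {x} y k → x ≡ y ℤ.+ 1ℤ ℤ.+ + 2 ℤ.* k → sgn x ≡ -1ℤ ℤ.* sgn y
sgn-parity′ y k eq = trans (sgn-parity (y ℤ.+ 1ℤ) k eq) (sgn-+1 y)

divMod-unique : ∀ (r r′ : ℕ) s s′ → r < 5 → r′ < 5 → + r ℤ.+ s ℤ.* + 5 ≡ + r′ ℤ.+ s′ ℤ.* + 5 → s ≡ s′ × r ≡ r′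
divMod-unique r r′ s s′ r<5 r′<5 eq = s≡s′ , r≡r′
  where
  open ≡-Reasoning
  diff : (s ℤ.- s′) ℤ.* + 5 ≡ r′ ⊖ r
  diff = begin
    (s ℤ.- s′) ℤ.* + 5                           ≡⟨ lemma (+ r) s s′ ⟩
    (+ r ℤ.+ s ℤ.* + 5) ℤ.- s′ ℤ.* + 5 ℤ.- + r   ≡⟨ cong (λ y → y ℤ.- s′ ℤ.* + 5 ℤ.- + r) eq ⟩
    (+ r′ ℤ.+ s′ ℤ.* + 5) ℤ.- s′ ℤ.* + 5 ℤ.- + r ≡⟨ lemma′ (+ r′) (+ r) s′ ⟩
    + r′ ℤ.- + r                                 ≡⟨ ℤ.m-n≡m⊖n r′ r ⟩
    r′ ⊖ r                                       ∎
    where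
    lemma : ∀ r s s′ → (s ℤ.- s′) ℤ.* + 5 ≡ (r ℤ.+ s ℤ.* + 5) ℤ.- s′ ℤ.* + 5 ℤ.- r
    lemma = ℤ-Solver.solve-∀
    lemma′ : ∀ r′ r s′ → (r′ ℤ.+ s′ ℤ.* + 5) ℤ.- s′ ℤ.* + 5 ℤ.- r ≡ r′ ℤ.- r
    lemma′ = ℤ-Solver.solve-∀
  small : ∣ s ℤ.- s′ ∣ < 1
  small = ℕ.*-cancelʳ-< 5 ∣ s ℤ.- s′ ∣ 1 (subst (_< 5) (trans (cong ∣_∣ (sym diff)) (ℤ.abs-* (s ℤ.- s′) (+ 5)))
    (ℕ.≤-<-trans (ℤ.∣m⊝n∣≤m⊔n r′ r) (ℕ.⊔-lub r′<5 r<5)))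
  s≡s′ : s ≡ s′
  s≡s′ = ℤ.i-j≡0⇒i≡j s s′ (ℤ.∣i∣≡0⇒i≡0 (ℕ.n<1⇒n≡0 small))
  r≡r′ : r ≡ r′
  r≡r′ = ℤ.+-injective (ℤ+.∙-cancelʳ (s ℤ.* + 5) (+ r) (+ r′) (trans eq (cong (λ y → + r′ ℤ.+ y ℤ.* + 5) (sym s≡s′))))

-- ℤ² is tiled by the translates of five points by the lattice spanned by (2 , 1) and (-1 , 2); the form x² + y² is multiplied by 5 there.
σ : ℕ → ℤ × ℤ → ℤ × ℤ
σ r (s , t) = + 2 ℤ.* s ℤ.- t , s ℤ.+ + 2 ℤ.* t ℤ.+ + r

-- The lattice spanned by (2 , 1) and (-1 , 2) is the kernel of 2x + y modulo 5, and the
-- representative (0 , r) has value r.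
class : ℤ × ℤ → ℕ
class (x , y) = (+ 2 ℤ.* x ℤ.+ y) ℤ.%ℕ 5

τ : ℤ × ℤ → ℤ × ℤ
τ (x , y) = (+ 2 ℤ.* x ℤ.+ y) ℤ./ℕ 5 , + 2 ℤ.* ((+ 2 ℤ.* x ℤ.+ y) ℤ./ℕ 5) ℤ.- x

class<5 : ∀ p → class p < 5
class<5 (x , y) = ℤ.n%ℕd<d (+ 2 ℤ.* x ℤ.+ y) 5

στ : ∀ p → σ (class p) (τ p) ≡ p
στ (x , y) = cong₂ _,_ (lemma s x) (begin
  s ℤ.+ + 2 ℤ.* (+ 2 ℤ.* s ℤ.- x) ℤ.+ + r   ≡⟨ lemma₁ s x (+ r) ⟩
  + r ℤ.+ s ℤ.* + 5 ℤ.- + 2 ℤ.* x           ≡⟨ cong (λ z → z ℤ.- + 2 ℤ.* x) (ℤ.a≡a%ℕn+[a/ℕn]*n (+ 2 ℤ.* x ℤ.+ y) 5) ⟨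
  + 2 ℤ.* x ℤ.+ y ℤ.- + 2 ℤ.* x             ≡⟨ lemma₂ x y ⟩
  y                                         ∎)
  where
  open ≡-Reasoning
  s = (+ 2 ℤ.* x ℤ.+ y) ℤ./ℕ 5
  r = (+ 2 ℤ.* x ℤ.+ y) ℤ.%ℕ 5
  lemma : ∀ s x → + 2 ℤ.* s ℤ.- (+ 2 ℤ.* s ℤ.- x) ≡ x
  lemma = ℤ-Solver.solve-∀
  lemma₁ : ∀ s x r → s ℤ.+ + 2 ℤ.* (+ 2 ℤ.* s ℤ.- x) ℤ.+ r ≡ r ℤ.+ s ℤ.* + 5 ℤ.- + 2 ℤ.* x
  lemma₁ = ℤ-Solver.solve-∀
  lemma₂ : ∀ x y → + 2 ℤ.* x ℤ.+ y ℤ.- + 2 ℤ.* x ≡ y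
  lemma₂ = ℤ-Solver.solve-∀

σ-divMod : ∀ r p → r < 5 → let (x , y) = σ r p in (+ 2 ℤ.* x ℤ.+ y) ℤ./ℕ 5 ≡ proj₁ p × class (σ r p) ≡ r
σ-divMod r (s , t) r<5 = divMod-unique _ r _ s (ℤ.n%ℕd<d w 5) r<5
  (trans (sym (ℤ.a≡a%ℕn+[a/ℕn]*n w 5)) (lemma s t (+ r)))
  where
  w = + 2 ℤ.* (+ 2 ℤ.* s ℤ.- t) ℤ.+ (s ℤ.+ + 2 ℤ.* t ℤ.+ + r)
  lemma : ∀ s t r → + 2 ℤ.* (+ 2 ℤ.* s ℤ.- t) ℤ.+ (s ℤ.+ + 2 ℤ.* t ℤ.+ r) ≡ r ℤ.+ s ℤ.* + 5
  lemma = ℤ-Solver.solve-∀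

classσ : ∀ r p → r < 5 → class (σ r p) ≡ r
classσ r p r<5 = proj₂ (σ-divMod r p r<5)

τσ : ∀ r p → r < 5 → τ (σ r p) ≡ p
τσ r (s , t) r<5 = trans (cong (λ z → z , + 2 ℤ.* z ℤ.- (+ 2 ℤ.* s ℤ.- t)) (proj₁ (σ-divMod r (s , t) r<5))) (cong (s ,_) (lemma s t))
  where
  lemma : ∀ s t → + 2 ℤ.* s ℤ.- (+ 2 ℤ.* s ℤ.- t) ≡ t
  lemma = ℤ-Solver.solve-∀

module Tiling {E : ℤ × ℤ → ℕ} (lv : Levels E) (C : ℤ × ℤ → ℤ) where

  slice : ∀ r → r < 5 → Levels (E ∘ σ r)
  slice = Levels-slice lv class τ σ στ τσ classσ

  slice-Θ : ∀ r (r<5 : r < 5) {E′ : ℤ × ℤ → ℕ} (lv′ : Levels E′) (μ ν : ℤ × ℤ → ℤ × ℤ) →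
            (∀ p → μ (ν p) ≡ p) → (∀ p → ν (μ p) ≡ p) → (∀ p → E (σ r (μ p)) ≡ E′ p) →
            ∀ {C′} → (∀ p → C (σ r (μ p)) ≡ C′ p) → Θ (slice r r<5) (C ∘ σ r) ≈ Θ lv′ C′
  slice-Θ r r<5 lv′ μ ν μν νμ E≡ C≡ = ≈-trans (Θ-reindex (slice r r<5) lv′ μ ν μν νμ E≡ (C ∘ σ r)) (Θ-cong lv′ C≡)

  0<5 : 0 < 5
  0<5 = s≤s z≤n
  1<5 : 1 < 5
  1<5 = s≤s 0<4
    where
    0<4 : 0 < 4
    0<4 = s≤s z≤n
  2<5 : 2 < 5
  2<5 = s≤s (s≤s (s≤s z≤n))
  3<5 : 3 < 5
  3<5 = s≤s (s≤s (s≤s (s≤s z≤n)))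
  4<5 : 4 < 5
  4<5 = s≤s (s≤s (s≤s (s≤s (s≤s z≤n))))

  tiling : ∀ {F₀ F₁ F₂ F₃ F₄} →
           Θ (slice 0 0<5) (C ∘ σ 0) ≈ F₀ → Θ (slice 1 1<5) (C ∘ σ 1) ≈ F₁ → Θ (slice 2 2<5) (C ∘ σ 2) ≈ F₂ →
           Θ (slice 3 3<5) (C ∘ σ 3) ≈ F₃ → Θ (slice 4 4<5) (C ∘ σ 4) ≈ F₄ →
           Θ lv C ≈ F₀ ⊞ (F₁ ⊞ (F₂ ⊞ (F₃ ⊞ F₄)))
  tiling {F₀} {F₁} {F₂} {F₃} {F₄} p₀ p₁ p₂ p₃ p₄ m = begin
    sumL C (lev lv m)
      ≡⟨ sumL-split C class (lev lv m) class<5 ⟩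
    S 0 ℤ.+ (S 1 ℤ.+ (S 2 ℤ.+ (S 3 ℤ.+ (S 4 ℤ.+ 0ℤ))))
      ≡⟨ cong₂ ℤ._+_ (at 0 0<5 p₀) (cong₂ ℤ._+_ (at 1 1<5 p₁) (cong₂ ℤ._+_ (at 2 2<5 p₂)
           (cong₂ ℤ._+_ (at 3 3<5 p₃) (trans (ℤ.+-identityʳ _) (at 4 4<5 p₄))))) ⟩
    F₀ m ℤ.+ (F₁ m ℤ.+ (F₂ m ℤ.+ (F₃ m ℤ.+ F₄ m)))
      ≡⟨ trans (⊞-at F₀ _ m) (cong (λ y → F₀ m ℤ.+ y) (trans (⊞-at F₁ _ m) (cong (λ y → F₁ m ℤ.+ y)
           (trans (⊞-at F₂ _ m) (cong (λ y → F₂ m ℤ.+ y) (⊞-at F₃ F₄ m)))))) ⟨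
    (F₀ ⊞ (F₁ ⊞ (F₂ ⊞ (F₃ ⊞ F₄)))) m ∎
    where
    open ≡-Reasoning
    S : ℕ → ℤ
    S r = sumL C (filter (λ p → class p ℕ.≟ r) (lev lv m))
    at : ∀ r r<5 {F} → Θ (slice r r<5) (C ∘ σ r) ≈ F → S r ≡ F m
    at r r<5 p = trans (Θ-slices lv class τ σ class<5 στ τσ classσ slice C m r r<5) (p m)

-- Changes of variable bringing the summands of the five classes of the tiling to a common form.
id² swap² : ℤ × ℤ → ℤ × ℤ
id² p = p
swap² (a , b) = b , a

μ₂ ν₂ μ₃ ν₃ μ₄ ν₄ : ℤ × ℤ → ℤ × ℤ
μ₂ (a , b) = ℤ.- 1ℤ ℤ.- b , ℤ.- 1ℤ ℤ.- a
ν₂ (s , t) = ℤ.- 1ℤ ℤ.- t , ℤ.- 1ℤ ℤ.- s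
μ₃ (a , b) = ℤ.- 1ℤ ℤ.- a , b ℤ.- 1ℤ
ν₃ (s , t) = ℤ.- 1ℤ ℤ.- s , t ℤ.+ 1ℤ
μ₄ (a , b) = a ℤ.- 1ℤ , ℤ.- + 2 ℤ.- b
ν₄ (s , t) = s ℤ.+ 1ℤ , ℤ.- + 2 ℤ.- t

private
  -1-[-1-a] : ∀ a → ℤ.- 1ℤ ℤ.- (ℤ.- 1ℤ ℤ.- a) ≡ a
  -1-[-1-a] = ℤ-Solver.solve-∀
  -2-[-2-a] : ∀ a → ℤ.- + 2 ℤ.- (ℤ.- + 2 ℤ.- a) ≡ a
  -2-[-2-a] = ℤ-Solver.solve-∀
  a+1-1 : ∀ a → a ℤ.+ 1ℤ ℤ.- 1ℤ ≡ a
  a+1-1 = ℤ-Solver.solve-∀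
  a-1+1 : ∀ a → a ℤ.- 1ℤ ℤ.+ 1ℤ ≡ a
  a-1+1 = ℤ-Solver.solve-∀

μν₂ : ∀ p → μ₂ (ν₂ p) ≡ p
μν₂ (s , t) = cong₂ _,_ (-1-[-1-a] s) (-1-[-1-a] t)
νμ₂ : ∀ p → ν₂ (μ₂ p) ≡ p
νμ₂ (a , b) = cong₂ _,_ (-1-[-1-a] a) (-1-[-1-a] b)
μν₃ : ∀ p → μ₃ (ν₃ p) ≡ p
μν₃ (s , t) = cong₂ _,_ (-1-[-1-a] s) (a+1-1 t)
νμ₃ : ∀ p → ν₃ (μ₃ p) ≡ p
νμ₃ (a , b) = cong₂ _,_ (-1-[-1-a] a) (a-1+1 b)
μν₄ : ∀ p → μ₄ (ν₄ p) ≡ p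
μν₄ (s , t) = cong₂ _,_ (a+1-1 s) (-2-[-2-a] t)
νμ₄ : ∀ p → ν₄ (μ₄ p) ≡ p
νμ₄ (a , b) = cong₂ _,_ (a-1+1 a) (-2-[-2-a] b)

open +-*-Solver using (Polynomial; solve; con; _:+_; _:*_; _:-_; :-_; _:=_)

private
  g : ℕ → ℕ → ℤ → ℤ
  g i j n = + i ℤ.* (n ℤ.* (n ℤ.+ 1ℤ)) ℤ.+ + j ℤ.* (n ℤ.* (n ℤ.- 1ℤ))

  G⟨_,_⟩ : ℕ → ℕ → ∀ {k} → Polynomial k → Polynomial k
  G⟨ i , j ⟩ x = con (+ i) :* (x :* (x :+ con 1ℤ)) :+ con (+ j) :* (x :* (x :- con 1ℤ))

  Xₚ : ∀ {k} → Polynomial k → Polynomial k → Polynomial k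
  Xₚ s t = con (+ 2) :* s :- t

  Yₚ : ℕ → ∀ {k} → Polynomial k → Polynomial k → Polynomial k
  Yₚ r s t = s :+ con (+ 2) :* t :+ con (+ r)

  -1−_ -2−_ : ∀ {k} → Polynomial k → Polynomial k
  -1− x = :- con 1ℤ :- x
  -2− x = :- con (+ 2) :- x

antisymmetric⇒0 : ∀ {E : ℤ × ℤ → ℕ} (lv : Levels E) C → (∀ p → E (swap² p) ≡ E p) → (∀ p → C (swap² p) ≡ ℤ.- C p) → Θ lv C ≈ 0S
antisymmetric⇒0 lv C E-sym C-anti m = half (trans (Θ-reindex lv lv swap² swap² (λ _ → refl) (λ _ → refl) E-sym C m)
  (trans (Θ-cong lv C-anti m) (trans (Θ-neg lv C m) (neg-at (Θ lv C) m))))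
  where
  lemma : ∀ x → + 2 ℤ.* x ≡ x ℤ.- ℤ.- x
  lemma = ℤ-Solver.solve-∀
  half : ∀ {x} → x ≡ ℤ.- x → x ≡ 0ℤ
  half {x} p = ℤ.*-cancelˡ-≡ (+ 2) x 0ℤ (trans (lemma x) (ℤ.i≡j⇒i-j≡0 p))

-- Sums over pairs of odd squares: ψ² and the Wronskian

module OddTiling (C : ℤ × ℤ → ℤ) where

  E E′ E₁ : ℤ × ℤ → ℕ
  E  (m , n) = e 1 0 m + e 1 0 n
  E′ (a , b) = e 3 2 a + e 4 1 b
  E₁ (s , t) = 1 + (e 5 0 s + e 5 0 t)

  lv : Levels E
  lv = Levels-× (Levels-e 1 0) (Levels-e 1 0)

  lv′ : Levels E′
  lv′ = Levels-× (Levels-e 3 2) (Levels-e 4 1)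

  lv₁ : Levels E₁
  lv₁ = Levels-+ (Levels-× (Levels-e 5 0) (Levels-e 5 0)) 1

  private
    E-class : ∀ p q → g 1 0 (proj₁ p) ℤ.+ g 1 0 (proj₂ p) ≡ g 3 2 (proj₁ q) ℤ.+ g 4 1 (proj₂ q) → E p ≡ E′ q
    E-class (m , n) (a , b) eq = double-injective (trans (trans (⟦2+⟧ (e 1 0 m) (e 1 0 n)) (cong₂ ℤ._+_ (⟦2e⟧ 1 0 m) (⟦2e⟧ 1 0 n)))
      (trans eq (sym (trans (⟦2+⟧ (e 3 2 a) (e 4 1 b)) (cong₂ ℤ._+_ (⟦2e⟧ 3 2 a) (⟦2e⟧ 4 1 b))))))

  E₀≡ : ∀ p → E (σ 0 (swap² p)) ≡ E′ p
  E₀≡ (a , b) = E-class (σ 0 (swap² (a , b))) (a , b) (solve 2 (λ a b → G⟨ 1 , 0 ⟩ (Xₚ b a) :+ G⟨ 1 , 0 ⟩ (Yₚ 0 b a) := G⟨ 3 , 2 ⟩ a :+ G⟨ 4 , 1 ⟩ b) refl a b)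

  E₂≡ : ∀ p → E (σ 2 (μ₂ p)) ≡ E′ p
  E₂≡ (a , b) = E-class (σ 2 (μ₂ (a , b))) (a , b) (solve 2 (λ a b → G⟨ 1 , 0 ⟩ (Xₚ (-1− b) (-1− a)) :+ G⟨ 1 , 0 ⟩ (Yₚ 2 (-1− b) (-1− a)) := G⟨ 3 , 2 ⟩ a :+ G⟨ 4 , 1 ⟩ b) refl a b)

  E₃≡ : ∀ p → E (σ 3 (μ₃ p)) ≡ E′ p
  E₃≡ (a , b) = E-class (σ 3 (μ₃ (a , b))) (a , b) (solve 2 (λ a b → G⟨ 1 , 0 ⟩ (Xₚ (-1− a) (b :- con 1ℤ)) :+ G⟨ 1 , 0 ⟩ (Yₚ 3 (-1− a) (b :- con 1ℤ)) := G⟨ 3 , 2 ⟩ a :+ G⟨ 4 , 1 ⟩ b) refl a b)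

  E₄≡ : ∀ p → E (σ 4 (μ₄ p)) ≡ E′ p
  E₄≡ (a , b) = E-class (σ 4 (μ₄ (a , b))) (a , b) (solve 2 (λ a b → G⟨ 1 , 0 ⟩ (Xₚ (a :- con 1ℤ) (-2− b)) :+ G⟨ 1 , 0 ⟩ (Yₚ 4 (a :- con 1ℤ) (-2− b)) := G⟨ 3 , 2 ⟩ a :+ G⟨ 4 , 1 ⟩ b) refl a b)

  E₁≡ : ∀ p → E (σ 1 (id² p)) ≡ E₁ p
  E₁≡ (s , t) = double-injective (begin
    + 2 ℤ.* + (e 1 0 m + e 1 0 n)                           ≡⟨ trans (⟦2+⟧ (e 1 0 m) (e 1 0 n)) (cong₂ ℤ._+_ (⟦2e⟧ 1 0 m) (⟦2e⟧ 1 0 n)) ⟩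
    _                                                       ≡⟨ solve 2 (λ s t → G⟨ 1 , 0 ⟩ (Xₚ s t) :+ G⟨ 1 , 0 ⟩ (Yₚ 1 s t) :=
                                                                 con (+ 2) :+ (G⟨ 5 , 0 ⟩ s :+ G⟨ 5 , 0 ⟩ t)) refl s t ⟩
    _                                                       ≡⟨ trans (⟦2+⟧ 1 (e 5 0 s + e 5 0 t)) (cong (λ y → + 2 ℤ.+ y) (trans (⟦2+⟧ (e 5 0 s) (e 5 0 t))
                                                                 (cong₂ ℤ._+_ (⟦2e⟧ 5 0 s) (⟦2e⟧ 5 0 t)))) ⟨
    + 2 ℤ.* + (1 + (e 5 0 s + e 5 0 t))                     ∎)
    where
    open ≡-Reasoning
    m = + 2 ℤ.* s ℤ.- t
    n = s ℤ.+ + 2 ℤ.* t ℤ.+ 1ℤ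

  open Tiling lv C

  -- In terms of U = 4m + 2n + 3 and V = 4n - 2m + 1 the exponent is (U² + V² - 10)/40. Class 1
  -- consists of the points where 5 divides U and V. In each other class {U , V} is {±(10b + 3) ,
  -- ±(10a + 1)}, so these four classes carry the same exponents and merge into one sum.
  odd-tiling : ∀ {C′} → (∀ p → C (σ 0 (swap² p)) ≡ C′ p) → (∀ p → C (σ 2 (μ₂ p)) ≡ C′ p) →
               (∀ p → C (σ 3 (μ₃ p)) ≡ C′ p) → (∀ p → C (σ 4 (μ₄ p)) ≡ C′ p) →
               Θ lv C ≈ scale (+ 4) (Θ lv′ C′) ⊞ Θ lv₁ (C ∘ σ 1)
  odd-tiling {C′} p₀ p₂ p₃ p₄ n = trans (tiling
    (slice-Θ 0 0<5 lv′ swap² swap² (λ _ → refl) (λ _ → refl) E₀≡ p₀)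
    (slice-Θ 1 1<5 lv₁ id² id² (λ _ → refl) (λ _ → refl) E₁≡ (λ _ → refl))
    (slice-Θ 2 2<5 lv′ μ₂ ν₂ μν₂ νμ₂ E₂≡ p₂)
    (slice-Θ 3 3<5 lv′ μ₃ ν₃ μν₃ νμ₃ E₃≡ p₃)
    (slice-Θ 4 4<5 lv′ μ₄ ν₄ μν₄ νμ₄ E₄≡ p₄) n)
    (trans (trans (⊞-at F _ n) (cong (λ y → F n ℤ.+ y) (trans (⊞-at F₁ _ n) (cong (λ y → F₁ n ℤ.+ y)
             (trans (⊞-at F _ n) (cong (λ y → F n ℤ.+ y) (⊞-at F F n)))))))
    (trans (lemma (F n) (F₁ n)) (sym (trans (⊞-at (scale (+ 4) F) F₁ n) (cong (λ y → y ℤ.+ F₁ n) (scale-at (+ 4) F n))))))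
    where
    F  = Θ lv′ C′
    F₁ = Θ lv₁ (C ∘ σ 1)
    lemma : ∀ x y → x ℤ.+ (y ℤ.+ (x ℤ.+ (x ℤ.+ x))) ≡ + 4 ℤ.* x ℤ.+ y
    lemma = ℤ-Solver.solve-∀

-- With constant weight the four merging classes give 4`G`, and class 1 reproduces the double sum at
-- q⁵.
ψ-relation : 2ψ 1 ✶ 2ψ 1 ≈ scale (+ 4) G ⊞ mono 1ℤ 1 ✶ (2ψ 5 ✶ 2ψ 5)
ψ-relation = begin
  2ψ 1 ✶ 2ψ 1                              ≈⟨ Θ-✶ (Levels-e 1 0) (Levels-e 1 0) trivial trivial ⟩
  Θ lv C                                   ≈⟨ odd-tiling (λ _ → refl) (λ _ → refl) (λ _ → refl) (λ _ → refl) ⟩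
  scale (+ 4) (Θ lv′ C) ⊞ Θ lv₁ C          ≈⟨ ⊞-cong (scale-cong (+ 4) (≈-sym (Θ-✶ (Levels-e 3 2) (Levels-e 4 1) trivial trivial)))
                                                (≈-trans (Θ-shift (Levels-× (Levels-e 5 0) (Levels-e 5 0)) 1 C)
                                                  (✶-congˡ (mono 1ℤ 1) (≈-sym (Θ-✶ (Levels-e 5 0) (Levels-e 5 0) trivial trivial)))) ⟩
  scale (+ 4) G ⊞ mono 1ℤ 1 ✶ (2ψ 5 ✶ 2ψ 5) ∎
  where
  open ≈-Reasoning
  C : ℤ × ℤ → ℤ
  C _ = 1ℤ
  open OddTiling C

-- The derivation q d/dq.
θ : Series → Series
θ F n = + n ℤ.* F n

θ-Θ : ∀ {I : Set} {E : I → ℕ} (lv : Levels E) C → θ (Θ lv C) ≈ Θ lv (λ i → + E i ℤ.* C i)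
θ-Θ lv C n = trans (sym (sumL-* (+ n) C (lev lv n))) (sumL-cong (lev lv n) (λ {i} i∈ → cong (λ k → + k ℤ.* C i) (sym (sound lv i∈))))

private
  quad : ℤ → ℤ → ℤ
  quad m n = (+ 4 ℤ.* m ℤ.+ + 2 ℤ.* n ℤ.+ + 3) ℤ.^ 2 ℤ.- (+ 4 ℤ.* n ℤ.- + 2 ℤ.* m ℤ.+ 1ℤ) ℤ.^ 2

  w w′ wt : ℤ × ℤ → ℤ
  w (m , n) = sgn m ℤ.* sgn n ℤ.* quad m n
  w′ (a , b) = sgn a ℤ.* sgn b ℤ.* ((+ 10 ℤ.* b ℤ.+ + 3) ℤ.^ 2 ℤ.- (+ 10 ℤ.* a ℤ.+ 1ℤ) ℤ.^ 2)
  wt (m , n) = sgn m ℤ.* (+ 2 ℤ.* m ℤ.+ 1ℤ) ℤ.* (sgn n ℤ.* (+ 2 ℤ.* n ℤ.+ 1ℤ))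

  Uₚ Vₚ : ∀ {k} → Polynomial k → Polynomial k → Polynomial k
  Uₚ m n = con (+ 4) :* m :+ con (+ 2) :* n :+ con (+ 3)
  Vₚ m n = con (+ 4) :* n :- con (+ 2) :* m :+ con 1ℤ

  sq : ∀ {k} → Polynomial k → Polynomial k
  sq x = x :* (x :* con 1ℤ)

  w-at : ∀ p {c d} → sgn (proj₁ p) ≡ c → sgn (proj₂ p) ≡ d → w p ≡ c ℤ.* d ℤ.* quad (proj₁ p) (proj₂ p)
  w-at (m , n) p q = cong₂ (λ c d → c ℤ.* d ℤ.* quad m n) p q

  -- `quad` is U² - V². Classes 0 and 2 have U = ±(10b + 3); in classes 3 and 4 it is V that takes
  -- this form, and the resulting change of sign is undone by the parity of m + n. Hence one weight
  -- `w′` serves all four.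
  w₀≡ : ∀ p → w (σ 0 (swap² p)) ≡ w′ p
  w₀≡ (a , b) = trans (w-at (σ 0 (swap² (a , b)))
      (sgn-parity a (b ℤ.- a) (solve 2 (λ a b → Xₚ b a := a :+ con (+ 2) :* (b :- a)) refl a b))
      (sgn-parity b a (solve 2 (λ a b → Yₚ 0 b a := b :+ con (+ 2) :* a) refl a b)))
    (solve 4 (λ c d a b → c :* d :* (sq (Uₚ (Xₚ b a) (Yₚ 0 b a)) :- sq (Vₚ (Xₚ b a) (Yₚ 0 b a))) :=
      c :* d :* (sq (con (+ 10) :* b :+ con (+ 3)) :- sq (con (+ 10) :* a :+ con 1ℤ))) refl (sgn a) (sgn b) a b)

  w₂≡ : ∀ p → w (σ 2 (μ₂ p)) ≡ w′ p
  w₂≡ (a , b) = trans (w-at (σ 2 (μ₂ (a , b)))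
      (sgn-parity′ a (ℤ.- 1ℤ ℤ.- b) (solve 2 (λ a b → Xₚ (-1− b) (-1− a) := a :+ con 1ℤ :+ con (+ 2) :* (-1− b)) refl a b))
      (sgn-parity′ b (ℤ.- 1ℤ ℤ.- a ℤ.- b) (solve 2 (λ a b → Yₚ 2 (-1− b) (-1− a) := b :+ con 1ℤ :+ con (+ 2) :* (-1− a :- b)) refl a b)))
    (solve 4 (λ c d a b → con -1ℤ :* c :* (con -1ℤ :* d) :* (sq (Uₚ (Xₚ (-1− b) (-1− a)) (Yₚ 2 (-1− b) (-1− a))) :- sq (Vₚ (Xₚ (-1− b) (-1− a)) (Yₚ 2 (-1− b) (-1− a)))) :=
      c :* d :* (sq (con (+ 10) :* b :+ con (+ 3)) :- sq (con (+ 10) :* a :+ con 1ℤ))) refl (sgn a) (sgn b) a b)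

  w₃≡ : ∀ p → w (σ 3 (μ₃ p)) ≡ w′ p
  w₃≡ (a , b) = trans (w-at (σ 3 (μ₃ (a , b)))
      (sgn-parity′ b (ℤ.- 1ℤ ℤ.- a ℤ.- b) (solve 2 (λ a b → Xₚ (-1− a) (b :- con 1ℤ) := b :+ con 1ℤ :+ con (+ 2) :* (-1− a :- b)) refl a b))
      (sgn-parity a (b ℤ.- a) (solve 2 (λ a b → Yₚ 3 (-1− a) (b :- con 1ℤ) := a :+ con (+ 2) :* (b :- a)) refl a b)))
    (solve 4 (λ c d a b → con -1ℤ :* d :* c :* (sq (Uₚ (Xₚ (-1− a) (b :- con 1ℤ)) (Yₚ 3 (-1− a) (b :- con 1ℤ))) :- sq (Vₚ (Xₚ (-1− a) (b :- con 1ℤ)) (Yₚ 3 (-1− a) (b :- con 1ℤ)))) :=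
      c :* d :* (sq (con (+ 10) :* b :+ con (+ 3)) :- sq (con (+ 10) :* a :+ con 1ℤ))) refl (sgn a) (sgn b) a b)

  w₄≡ : ∀ p → w (σ 4 (μ₄ p)) ≡ w′ p
  w₄≡ (a , b) = trans (w-at (σ 4 (μ₄ (a , b)))
      (sgn-parity b a (solve 2 (λ a b → Xₚ (a :- con 1ℤ) (-2− b) := b :+ con (+ 2) :* a) refl a b))
      (sgn-parity′ a (ℤ.- 1ℤ ℤ.- b) (solve 2 (λ a b → Yₚ 4 (a :- con 1ℤ) (-2− b) := a :+ con 1ℤ :+ con (+ 2) :* (-1− b)) refl a b)))
    (solve 4 (λ c d a b → d :* (con -1ℤ :* c) :* (sq (Uₚ (Xₚ (a :- con 1ℤ) (-2− b)) (Yₚ 4 (a :- con 1ℤ) (-2− b))) :- sq (Vₚ (Xₚ (a :- con 1ℤ) (-2− b)) (Yₚ 4 (a :- con 1ℤ) (-2− b)))) :=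
      c :* d :* (sq (con (+ 10) :* b :+ con (+ 3)) :- sq (con (+ 10) :* a :+ con 1ℤ))) refl (sgn a) (sgn b) a b)

  -- On class 1, U² and V² are (10s + 5)² and (10t + 5)², which the swap exchanges. The class that
  -- has no counterpart in αβ therefore contributes nothing.
  w₁-anti : ∀ p → w (σ 1 (swap² p)) ≡ ℤ.- w (σ 1 p)
  w₁-anti (s , t) = begin
    w (σ 1 (t , s))                               ≡⟨ w₁ t s ⟩
    -1ℤ ℤ.* (sgn s ℤ.* sgn t) ℤ.* ((+ 10 ℤ.* t ℤ.+ + 5) ℤ.^ 2 ℤ.- (+ 10 ℤ.* s ℤ.+ + 5) ℤ.^ 2) ≡⟨ lemma (sgn s) (sgn t) ((+ 10 ℤ.* t ℤ.+ + 5) ℤ.^ 2) ((+ 10 ℤ.* s ℤ.+ + 5) ℤ.^ 2) ⟩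
    ℤ.- (-1ℤ ℤ.* (sgn t ℤ.* sgn s) ℤ.* ((+ 10 ℤ.* s ℤ.+ + 5) ℤ.^ 2 ℤ.- (+ 10 ℤ.* t ℤ.+ + 5) ℤ.^ 2)) ≡⟨ cong ℤ.-_ (w₁ s t) ⟨
    ℤ.- w (σ 1 (s , t))                           ∎
    where
    open ≡-Reasoning
    lemma : ∀ a b x y → -1ℤ ℤ.* (a ℤ.* b) ℤ.* (x ℤ.- y) ≡ ℤ.- (-1ℤ ℤ.* (b ℤ.* a) ℤ.* (y ℤ.- x))
    lemma = ℤ-Solver.solve-∀
    w₁ : ∀ s t → w (σ 1 (s , t)) ≡ -1ℤ ℤ.* (sgn t ℤ.* sgn s) ℤ.* ((+ 10 ℤ.* s ℤ.+ + 5) ℤ.^ 2 ℤ.- (+ 10 ℤ.* t ℤ.+ + 5) ℤ.^ 2)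
    w₁ s t = trans (w-at (σ 1 (s , t))
        (sgn-parity t (s ℤ.- t) (solve 2 (λ s t → Xₚ s t := t :+ con (+ 2) :* (s :- t)) refl s t))
        (sgn-parity′ s t (solve 2 (λ s t → Yₚ 1 s t := s :+ con 1ℤ :+ con (+ 2) :* t) refl s t)))
      (solve 4 (λ c d s t → d :* (con -1ℤ :* c) :* (sq (Uₚ (Xₚ s t) (Yₚ 1 s t)) :- sq (Vₚ (Xₚ s t) (Yₚ 1 s t))) :=
        con -1ℤ :* (d :* c) :* (sq (con (+ 10) :* s :+ con (+ 5)) :- sq (con (+ 10) :* t :+ con (+ 5)))) refl (sgn s) (sgn t) s t)

  w-split : ∀ p → w p ≡ + 8 ℤ.* wt p ℤ.+ + 3 ℤ.* (sgn (proj₁ p) ℤ.* sgn (proj₂ p) ℤ.* ((+ 2 ℤ.* proj₁ p ℤ.+ 1ℤ) ℤ.^ 2 ℤ.- (+ 2 ℤ.* proj₂ p ℤ.+ 1ℤ) ℤ.^ 2))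
  w-split (m , n) = solve 4 (λ c d m n → c :* d :* (sq (Uₚ m n) :- sq (Vₚ m n)) :=
    con (+ 8) :* (c :* (con (+ 2) :* m :+ con 1ℤ) :* (d :* (con (+ 2) :* n :+ con 1ℤ))) :+
    con (+ 3) :* (c :* d :* (sq (con (+ 2) :* m :+ con 1ℤ) :- sq (con (+ 2) :* n :+ con 1ℤ)))) refl (sgn m) (sgn n) m n

  -- As (10b + 3)² = 40 `e 4 1 b` + 9 and (10a + 1)² = 40 `e 3 2 a` + 1, the weight acts as q d/dq
  -- on `β` minus q d/dq on `α`, up to the constant 8.
  w′-split : ∀ p → w′ p ≡ + 40 ℤ.* (sgn (proj₁ p) ℤ.* (+ e 4 1 (proj₂ p) ℤ.* sgn (proj₂ p))) ℤ.+
                     (-[1+ 39 ] ℤ.* (+ e 3 2 (proj₁ p) ℤ.* sgn (proj₁ p) ℤ.* sgn (proj₂ p)) ℤ.+ + 8 ℤ.* (sgn (proj₁ p) ℤ.* sgn (proj₂ p)))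
  w′-split (a , b) = begin
    w′ (a , b)
      ≡⟨ solve 4 (λ c d a b → c :* d :* (sq (con (+ 10) :* b :+ con (+ 3)) :- sq (con (+ 10) :* a :+ con 1ℤ)) :=
           con (+ 20) :* (c :* (G⟨ 4 , 1 ⟩ b :* d)) :+ (con -[1+ 19 ] :* (G⟨ 3 , 2 ⟩ a :* c :* d) :+ con (+ 8) :* (c :* d))) refl (sgn a) (sgn b) a b ⟩
    _ ≡⟨ cong₂ (λ x y → + 20 ℤ.* (sgn a ℤ.* (x ℤ.* sgn b)) ℤ.+ (-[1+ 19 ] ℤ.* (y ℤ.* sgn a ℤ.* sgn b) ℤ.+ + 8 ℤ.* (sgn a ℤ.* sgn b)))
           (⟦2e⟧ 4 1 b) (⟦2e⟧ 3 2 a) ⟨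
    + 20 ℤ.* (sgn a ℤ.* (+ 2 ℤ.* + e 4 1 b ℤ.* sgn b)) ℤ.+ (-[1+ 19 ] ℤ.* (+ 2 ℤ.* + e 3 2 a ℤ.* sgn a ℤ.* sgn b) ℤ.+ + 8 ℤ.* (sgn a ℤ.* sgn b))
      ≡⟨ solve 4 (λ c d x y → con (+ 20) :* (c :* (con (+ 2) :* x :* d)) :+ (con -[1+ 19 ] :* (con (+ 2) :* y :* c :* d) :+ con (+ 8) :* (c :* d)) :=
           con (+ 40) :* (c :* (x :* d)) :+ (con -[1+ 39 ] :* (y :* c :* d) :+ con (+ 8) :* (c :* d))) refl (sgn a) (sgn b) (+ e 4 1 b) (+ e 3 2 a) ⟩
    _ ∎
    where open ≡-Reasoning

f₁³ : Series
f₁³ = f 1 ✶ (f 1 ✶ f 1)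

-- Both sides evaluate Σ ± (u² - v²) q^((u² + v² - 10)/40) over the odd (x , y), where u = 2x + y and v = 2y - x: the left one because
-- u² - v² = 8xy + 3(x² - y²), the right one because the class of u modulo 5 splits the sum.
wronskian-relation : scale (+ 32) (f₁³ ✶ f₁³) ≈ scale (+ 4) (scale (+ 40) (α ✶ θ β) ⊞ (scale -[1+ 39 ] (θ α ✶ β) ⊞ scale (+ 8) (α ✶ β)))
wronskian-relation = ≈-trans (≈-sym left) right
  where
  open ≈-Reasoning
  open OddTiling w
  asym : ℤ × ℤ → ℤ
  asym (m , n) = sgn m ℤ.* sgn n ℤ.* ((+ 2 ℤ.* m ℤ.+ 1ℤ) ℤ.^ 2 ℤ.- (+ 2 ℤ.* n ℤ.+ 1ℤ) ℤ.^ 2)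
  asym-anti : ∀ p → asym (swap² p) ≡ ℤ.- asym p
  asym-anti (m , n) = lemma (sgn m) (sgn n) ((+ 2 ℤ.* m ℤ.+ 1ℤ) ℤ.^ 2) ((+ 2 ℤ.* n ℤ.+ 1ℤ) ℤ.^ 2)
    where
    lemma : ∀ a b x y → b ℤ.* a ℤ.* (y ℤ.- x) ≡ ℤ.- (a ℤ.* b ℤ.* (x ℤ.- y))
    lemma = ℤ-Solver.solve-∀
  scale-2-✶ : ∀ F → scale (+ 2) F ✶ scale (+ 2) F ≈ scale (+ 4) (F ✶ F)
  scale-2-✶ F = ≈-trans (scale-✶ (+ 2) (scale (+ 2) F) F) (≈-trans (scale-cong (+ 2) (≈-trans (✶-comm _ F) (scale-✶ (+ 2) F F))) (scale-scale (+ 2) (+ 2) (F ✶ F)))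
  left : Θ lv w ≈ scale (+ 32) (f₁³ ✶ f₁³)
  left = begin
    Θ lv w
      ≈⟨ Θ-cong lv w-split ⟩
    Θ lv (λ p → + 8 ℤ.* wt p ℤ.+ + 3 ℤ.* asym p)
      ≈⟨ Θ-+ lv (λ p → + 8 ℤ.* wt p) (λ p → + 3 ℤ.* asym p) ⟩
    Θ lv (λ p → + 8 ℤ.* wt p) ⊞ Θ lv (λ p → + 3 ℤ.* asym p)
      ≈⟨ ⊞-cong (Θ-* lv (+ 8) wt) (≈-trans (Θ-* lv (+ 3) asym) (scale-0S (+ 3) (antisymmetric⇒0 lv asym (λ (m , n) → ℕ.+-comm (e 1 0 n) (e 1 0 m)) asym-anti))) ⟩
    scale (+ 8) (Θ lv wt) ⊞ 0S
      ≈⟨ ⊞-identityʳ _ ⟩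
    scale (+ 8) (Θ lv wt)
      ≈⟨ scale-cong (+ 8) (≈-sym (Θ-✶ (Levels-e 1 0) (Levels-e 1 0) cube cube)) ⟩
    scale (+ 8) (Θ (Levels-e 1 0) cube ✶ Θ (Levels-e 1 0) cube)
      ≈⟨ scale-cong (+ 8) (≈-trans (✶-cong jacobi-cube jacobi-cube) (scale-2-✶ f₁³)) ⟩
    scale (+ 8) (scale (+ 4) (f₁³ ✶ f₁³))
      ≈⟨ scale-scale (+ 8) (+ 4) _ ⟩
    scale (+ 32) (f₁³ ✶ f₁³) ∎
    where
    cube : ℤ → ℤ
    cube n = sgn n ℤ.* (+ 2 ℤ.* n ℤ.+ 1ℤ)
  right : Θ lv w ≈ scale (+ 4) (scale (+ 40) (α ✶ θ β) ⊞ (scale -[1+ 39 ] (θ α ✶ β) ⊞ scale (+ 8) (α ✶ β)))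
  right = begin
    Θ lv w
      ≈⟨ odd-tiling w₀≡ w₂≡ w₃≡ w₄≡ ⟩
    scale (+ 4) (Θ lv′ w′) ⊞ Θ lv₁ (w ∘ σ 1)
      ≈⟨ ⊞-congˡ (scale (+ 4) (Θ lv′ w′)) (antisymmetric⇒0 lv₁ (w ∘ σ 1) (λ (s , t) → cong suc (ℕ.+-comm (e 5 0 t) (e 5 0 s))) w₁-anti) ⟩
    scale (+ 4) (Θ lv′ w′) ⊞ 0S
      ≈⟨ ⊞-identityʳ _ ⟩
    scale (+ 4) (Θ lv′ w′)
      ≈⟨ scale-cong (+ 4) (≈-trans (Θ-cong lv′ w′-split) (≈-trans (Θ-+ lv′ (λ p → + 40 ℤ.* c₁ p) (λ p → -[1+ 39 ] ℤ.* c₂ p ℤ.+ + 8 ℤ.* c₃ p))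
           (⊞-cong (≈-trans (Θ-* lv′ (+ 40) c₁) (scale-cong (+ 40) αθβ))
             (≈-trans (Θ-+ lv′ (λ p → -[1+ 39 ] ℤ.* c₂ p) (λ p → + 8 ℤ.* c₃ p))
               (⊞-cong (≈-trans (Θ-* lv′ -[1+ 39 ] c₂) (scale-cong -[1+ 39 ] θαβ)) (≈-trans (Θ-* lv′ (+ 8) c₃) (scale-cong (+ 8) αβ))))))) ⟩
    scale (+ 4) (scale (+ 40) (α ✶ θ β) ⊞ (scale -[1+ 39 ] (θ α ✶ β) ⊞ scale (+ 8) (α ✶ β))) ∎
    where
    c₁ c₂ c₃ : ℤ × ℤ → ℤ
    c₁ (a , b) = sgn a ℤ.* (+ e 4 1 b ℤ.* sgn b)
    c₂ (a , b) = + e 3 2 a ℤ.* sgn a ℤ.* sgn b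
    c₃ (a , b) = sgn a ℤ.* sgn b
    αθβ : Θ lv′ c₁ ≈ α ✶ θ β
    αθβ = ≈-sym (≈-trans (✶-congˡ α (θ-Θ (Levels-e 4 1) sgn)) (Θ-✶ (Levels-e 3 2) (Levels-e 4 1) sgn (λ b → + e 4 1 b ℤ.* sgn b)))
    θαβ : Θ lv′ c₂ ≈ θ α ✶ β
    θαβ = ≈-sym (≈-trans (✶-congʳ β (θ-Θ (Levels-e 3 2) sgn)) (Θ-✶ (Levels-e 3 2) (Levels-e 4 1) (λ a → + e 3 2 a ℤ.* sgn a) sgn))
    αβ : Θ lv′ c₃ ≈ α ✶ β
    αβ = ≈-sym (Θ-✶ (Levels-e 3 2) (Levels-e 4 1) sgn sgn)

-- Sums of two squares: φ(-q)²

module φ-Tiling where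

  open +-*-Solver using (Polynomial; solve; con; _:+_; _:*_; _:-_; :-_; _:=_)

  private
    C : ℤ × ℤ → ℤ
    C (m , n) = sgn m ℤ.* sgn n

    C⁻ : ℤ × ℤ → ℤ
    C⁻ p = ℤ.- C p

    E E₀ E₁ : ℤ × ℤ → ℕ
    E  (m , n) = e 1 1 m + e 1 1 n
    E₀ (s , t) = e 5 5 s + e 5 5 t
    E₁ (a , b) = 1 + (e 7 3 a + e 9 1 b)

    lv : Levels E
    lv = Levels-× (Levels-e 1 1) (Levels-e 1 1)

    lv₀ : Levels E₀
    lv₀ = Levels-× (Levels-e 5 5) (Levels-e 5 5)

    lv₁ : Levels E₁
    lv₁ = Levels-+ (Levels-× (Levels-e 7 3) (Levels-e 9 1)) 1

    E₀-class : ∀ p q → g 1 1 (proj₁ p) ℤ.+ g 1 1 (proj₂ p) ≡ g 5 5 (proj₁ q) ℤ.+ g 5 5 (proj₂ q) → E p ≡ E₀ q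
    E₀-class (m , n) (s , t) eq = double-injective (trans (trans (⟦2+⟧ (e 1 1 m) (e 1 1 n)) (cong₂ ℤ._+_ (⟦2e⟧ 1 1 m) (⟦2e⟧ 1 1 n)))
      (trans eq (sym (trans (⟦2+⟧ (e 5 5 s) (e 5 5 t)) (cong₂ ℤ._+_ (⟦2e⟧ 5 5 s) (⟦2e⟧ 5 5 t))))))

    E₁-class : ∀ p q → g 1 1 (proj₁ p) ℤ.+ g 1 1 (proj₂ p) ≡ + 2 ℤ.+ (g 7 3 (proj₁ q) ℤ.+ g 9 1 (proj₂ q)) → E p ≡ E₁ q
    E₁-class (m , n) (a , b) eq = double-injective (trans (trans (⟦2+⟧ (e 1 1 m) (e 1 1 n)) (cong₂ ℤ._+_ (⟦2e⟧ 1 1 m) (⟦2e⟧ 1 1 n)))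
      (trans eq (sym (trans (⟦2+⟧ 1 (e 7 3 a + e 9 1 b)) (cong (λ y → + 2 ℤ.+ y) (trans (⟦2+⟧ (e 7 3 a) (e 9 1 b)) (cong₂ ℤ._+_ (⟦2e⟧ 7 3 a) (⟦2e⟧ 9 1 b))))))))

    Exp : ∀ {k} → Polynomial k → Polynomial k → Polynomial k
    Exp a b = con (+ 2) :+ (G⟨ 7 , 3 ⟩ a :+ G⟨ 9 , 1 ⟩ b)

    μ₂′ ν₂′ μ₃′ ν₃′ μ₄′ ν₄′ : ℤ × ℤ → ℤ × ℤ
    μ₂′ (a , b) = b , ℤ.- 1ℤ ℤ.- a
    ν₂′ (s , t) = ℤ.- 1ℤ ℤ.- t , s
    μ₃′ (a , b) = ℤ.- 1ℤ ℤ.- b , a ℤ.- 1ℤ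
    ν₃′ (s , t) = t ℤ.+ 1ℤ , ℤ.- 1ℤ ℤ.- s
    μ₄′ (a , b) = ℤ.- 1ℤ ℤ.- a , ℤ.- + 2 ℤ.- b
    ν₄′ (s , t) = ℤ.- 1ℤ ℤ.- s , ℤ.- + 2 ℤ.- t

    sgn-product⁺ : ∀ p {c d} → sgn (proj₁ p) ≡ c → sgn (proj₂ p) ≡ -1ℤ ℤ.* d → C p ≡ ℤ.- (c ℤ.* d)
    sgn-product⁺ p {c} {d} eq eq′ = trans (cong₂ ℤ._*_ eq eq′) (lemma c d)
      where
      lemma : ∀ c d → c ℤ.* (-1ℤ ℤ.* d) ≡ ℤ.- (c ℤ.* d)
      lemma = ℤ-Solver.solve-∀

    sgn-product⁻ : ∀ p {c d} → sgn (proj₁ p) ≡ -1ℤ ℤ.* c → sgn (proj₂ p) ≡ d → C p ≡ ℤ.- (c ℤ.* d)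
    sgn-product⁻ p {c} {d} eq eq′ = trans (cong₂ ℤ._*_ eq eq′) (lemma c d)
      where
      lemma : ∀ c d → -1ℤ ℤ.* c ℤ.* d ≡ ℤ.- (c ℤ.* d)
      lemma = ℤ-Solver.solve-∀

    C⁻-swap : ∀ {x} a b → x ≡ ℤ.- (sgn b ℤ.* sgn a) → x ≡ C⁻ (a , b)
    C⁻-swap a b eq = trans eq (cong ℤ.-_ (ℤ.*-comm (sgn b) (sgn a)))

    E₀≡ : ∀ p → E (σ 0 (id² p)) ≡ E₀ p
    E₀≡ (s , t) = E₀-class (σ 0 (s , t)) (s , t) (solve 2 (λ s t → G⟨ 1 , 1 ⟩ (Xₚ s t) :+ G⟨ 1 , 1 ⟩ (Yₚ 0 s t) := G⟨ 5 , 5 ⟩ s :+ G⟨ 5 , 5 ⟩ t) refl s t)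

    E₁≡ : ∀ p → E (σ 1 (id² p)) ≡ E₁ p
    E₁≡ (a , b) = E₁-class (σ 1 (a , b)) (a , b) (solve 2 (λ a b → G⟨ 1 , 1 ⟩ (Xₚ a b) :+ G⟨ 1 , 1 ⟩ (Yₚ 1 a b) := Exp a b) refl a b)

    E₂≡ : ∀ p → E (σ 2 (μ₂′ p)) ≡ E₁ p
    E₂≡ (a , b) = E₁-class (σ 2 (μ₂′ (a , b))) (a , b) (solve 2 (λ a b → G⟨ 1 , 1 ⟩ (Xₚ b (-1− a)) :+ G⟨ 1 , 1 ⟩ (Yₚ 2 b (-1− a)) := Exp a b) refl a b)

    E₃≡ : ∀ p → E (σ 3 (μ₃′ p)) ≡ E₁ p
    E₃≡ (a , b) = E₁-class (σ 3 (μ₃′ (a , b))) (a , b) (solve 2 (λ a b → G⟨ 1 , 1 ⟩ (Xₚ (-1− b) (a :- con 1ℤ)) :+ G⟨ 1 , 1 ⟩ (Yₚ 3 (-1− b) (a :- con 1ℤ)) := Exp a b) refl a b)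

    E₄≡ : ∀ p → E (σ 4 (μ₄′ p)) ≡ E₁ p
    E₄≡ (a , b) = E₁-class (σ 4 (μ₄′ (a , b))) (a , b) (solve 2 (λ a b → G⟨ 1 , 1 ⟩ (Xₚ (-1− a) (-2− b)) :+ G⟨ 1 , 1 ⟩ (Yₚ 4 (-1− a) (-2− b)) := Exp a b) refl a b)

    C₀≡ : ∀ p → C (σ 0 (id² p)) ≡ C p
    C₀≡ (s , t) = trans (cong₂ ℤ._*_
      (sgn-parity t (s ℤ.- t) (solve 2 (λ s t → Xₚ s t := t :+ con (+ 2) :* (s :- t)) refl s t))
      (sgn-parity s t (solve 2 (λ s t → Yₚ 0 s t := s :+ con (+ 2) :* t) refl s t))) (ℤ.*-comm (sgn t) (sgn s))

    C₁≡ : ∀ p → C (σ 1 (id² p)) ≡ C⁻ p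
    C₁≡ (a , b) = C⁻-swap a b (sgn-product⁺ (σ 1 (a , b))
      (sgn-parity b (a ℤ.- b) (solve 2 (λ a b → Xₚ a b := b :+ con (+ 2) :* (a :- b)) refl a b))
      (sgn-parity′ a b (solve 2 (λ a b → Yₚ 1 a b := a :+ con 1ℤ :+ con (+ 2) :* b) refl a b)))

    C₂≡ : ∀ p → C (σ 2 (μ₂′ p)) ≡ C⁻ p
    C₂≡ (a , b) = sgn-product⁻ (σ 2 (μ₂′ (a , b)))
      (sgn-parity′ a b (solve 2 (λ a b → Xₚ b (-1− a) := a :+ con 1ℤ :+ con (+ 2) :* b) refl a b))
      (sgn-parity b (ℤ.- a) (solve 2 (λ a b → Yₚ 2 b (-1− a) := b :+ con (+ 2) :* (:- a)) refl a b))

    C₃≡ : ∀ p → C (σ 3 (μ₃′ p)) ≡ C⁻ p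
    C₃≡ (a , b) = sgn-product⁻ (σ 3 (μ₃′ (a , b)))
      (sgn-parity′ a (ℤ.- 1ℤ ℤ.- b ℤ.- a) (solve 2 (λ a b → Xₚ (-1− b) (a :- con 1ℤ) := a :+ con 1ℤ :+ con (+ 2) :* (-1− b :- a)) refl a b))
      (sgn-parity b (a ℤ.- b) (solve 2 (λ a b → Yₚ 3 (-1− b) (a :- con 1ℤ) := b :+ con (+ 2) :* (a :- b)) refl a b))

    C₄≡ : ∀ p → C (σ 4 (μ₄′ p)) ≡ C⁻ p
    C₄≡ (a , b) = C⁻-swap a b (sgn-product⁺ (σ 4 (μ₄′ (a , b)))
      (sgn-parity b (ℤ.- a) (solve 2 (λ a b → Xₚ (-1− a) (-2− b) := b :+ con (+ 2) :* (:- a)) refl a b))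
      (sgn-parity′ a (ℤ.- 1ℤ ℤ.- b ℤ.- a) (solve 2 (λ a b → Yₚ 4 (-1− a) (-2− b) := a :+ con 1ℤ :+ con (+ 2) :* (-1− b :- a)) refl a b)))

    open Tiling lv C

  -- Class 0 is the lattice itself, on which m² + n² = 5(s² + t²). On class 1 the form is 1 + (5s² +
  -- 2s) + (5t² + 4t), the exponents of q`K`, and m + n has the parity opposite to s + t, whence the
  -- minus sign. Classes 2 to 4 are images of class 1 under symmetries of the form.
  φ-relation : φ[-q^ 1 ] ✶ φ[-q^ 1 ] ≈ φ[-q^ 5 ] ✶ φ[-q^ 5 ] ⊞ scale -[1+ 3 ] (mono 1ℤ 1 ✶ K)
  φ-relation = begin
    φ[-q^ 1 ] ✶ φ[-q^ 1 ]                    ≈⟨ ✶-cong (φ≈Θ 1) (φ≈Θ 1) ⟩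
    Θ (Levels-e 1 1) sgn ✶ Θ (Levels-e 1 1) sgn ≈⟨ Θ-✶ (Levels-e 1 1) (Levels-e 1 1) sgn sgn ⟩
    Θ lv C                                   ≈⟨ tiling
      (slice-Θ 0 0<5 lv₀ id² id² (λ _ → refl) (λ _ → refl) E₀≡ C₀≡)
      (slice-Θ 1 1<5 lv₁ id² id² (λ _ → refl) (λ _ → refl) E₁≡ C₁≡)
      (slice-Θ 2 2<5 lv₁ μ₂′ ν₂′ (λ (s , t) → cong (s ,_) (-1-[-1-a] t)) (λ (a , b) → cong (_, b) (-1-[-1-a] a)) E₂≡ C₂≡)
      (slice-Θ 3 3<5 lv₁ μ₃′ ν₃′ (λ (s , t) → cong₂ _,_ (-1-[-1-a] s) (a+1-1 t)) (λ (a , b) → cong₂ _,_ (a-1+1 a) (-1-[-1-a] b)) E₃≡ C₃≡)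
      (slice-Θ 4 4<5 lv₁ μ₄′ ν₄′ (λ (s , t) → cong₂ _,_ (-1-[-1-a] s) (-2-[-2-a] t)) (λ (a , b) → cong₂ _,_ (-1-[-1-a] a) (-2-[-2-a] b)) E₄≡ C₄≡) ⟩
    Θ lv₀ C ⊞ (F ⊞ (F ⊞ (F ⊞ F)))            ≈⟨ ⊞-cong (≈-trans (≈-sym (Θ-✶ (Levels-e 5 5) (Levels-e 5 5) sgn sgn)) (≈-sym (✶-cong (φ≈Θ 5) (φ≈Θ 5)))) four ⟩
    φ[-q^ 5 ] ✶ φ[-q^ 5 ] ⊞ scale -[1+ 3 ] (mono 1ℤ 1 ✶ K) ∎
    where
    open ≈-Reasoning
    F = Θ lv₁ C⁻
    F≈ : F ≈ neg (mono 1ℤ 1 ✶ K)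
    F≈ = ≈-trans (Θ-neg lv₁ C) (neg-cong (≈-trans (Θ-shift (Levels-× (Levels-e 7 3) (Levels-e 9 1)) 1 C)
      (✶-congˡ (mono 1ℤ 1) (≈-sym (Θ-✶ (Levels-e 7 3) (Levels-e 9 1) sgn sgn)))))
    four : F ⊞ (F ⊞ (F ⊞ F)) ≈ scale -[1+ 3 ] (mono 1ℤ 1 ✶ K)
    four n = trans (trans (⊞-at F _ n) (cong (λ y → F n ℤ.+ y) (trans (⊞-at F _ n) (cong (λ y → F n ℤ.+ y) (⊞-at F F n)))))
      (trans (cong (λ y → y ℤ.+ (y ℤ.+ (y ℤ.+ y))) (trans (F≈ n) (neg-at _ n))) (trans (lemma ((mono 1ℤ 1 ✶ K) n)) (sym (scale-at -[1+ 3 ] _ n))))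
      where
      lemma : ∀ x → ℤ.- x ℤ.+ (ℤ.- x ℤ.+ (ℤ.- x ℤ.+ ℤ.- x)) ≡ -[1+ 3 ] ℤ.* x
      lemma = ℤ-Solver.solve-∀

open φ-Tiling using (φ-relation)

-- Logarithmic derivatives and Lambert series

opaque
  unfolding _⊞_ neg scale mono _✶_

  θ-✶ : ∀ F G → θ (F ✶ G) ≈ θ F ✶ G ⊞ F ✶ θ G
  θ-✶ F G zero    = lemma (F 0) (G 0)
    where
    lemma : ∀ x y → + 0 ℤ.* (x ℤ.* y ℤ.+ 0ℤ) ≡ + 0 ℤ.* x ℤ.* y ℤ.+ 0ℤ ℤ.+ (x ℤ.* (+ 0 ℤ.* y) ℤ.+ 0ℤ)
    lemma = ℤ-Solver.solve-∀
  θ-✶ F G (suc n) = begin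
    + suc n ℤ.* (F 0 ℤ.* G (suc n) ℤ.+ (tail F · G) n)
      ≡⟨ lemma₁ (+ n) (F 0) (G (suc n)) ((tail F · G) n) ⟩
    F 0 ℤ.* (+ suc n ℤ.* G (suc n)) ℤ.+ (+ n ℤ.* (tail F · G) n ℤ.+ (tail F · G) n)
      ≡⟨ cong (λ y → F 0 ℤ.* (+ suc n ℤ.* G (suc n)) ℤ.+ (y ℤ.+ (tail F · G) n)) (θ-✶ (tail F) G n) ⟩
    F 0 ℤ.* (+ suc n ℤ.* G (suc n)) ℤ.+ ((θ (tail F) · G) n ℤ.+ (tail F · θ G) n ℤ.+ (tail F · G) n)
      ≡⟨ lemma₂ (F 0) (G (suc n)) (+ suc n ℤ.* G (suc n)) ((θ (tail F) · G) n) ((tail F · θ G) n) ((tail F · G) n) ⟩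
    + 0 ℤ.* F 0 ℤ.* G (suc n) ℤ.+ ((θ (tail F) · G) n ℤ.+ (tail F · G) n) ℤ.+ (F 0 ℤ.* (+ suc n ℤ.* G (suc n)) ℤ.+ (tail F · θ G) n)
      ≡⟨ cong (λ y → + 0 ℤ.* F 0 ℤ.* G (suc n) ℤ.+ y ℤ.+ (F 0 ℤ.* (+ suc n ℤ.* G (suc n)) ℤ.+ (tail F · θ G) n))
           (trans (sym (·-distribʳ G (θ (tail F)) (tail F) n)) (·-cong {G = G} (λ k → lemma₃ (+ k) (F (suc k))) (λ _ → refl) n)) ⟩
    + 0 ℤ.* F 0 ℤ.* G (suc n) ℤ.+ (tail (θ F) · G) n ℤ.+ (F 0 ℤ.* (+ suc n ℤ.* G (suc n)) ℤ.+ (tail F · θ G) n) ∎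
    where
    open ≡-Reasoning
    lemma₁ : ∀ n a b x → (1ℤ ℤ.+ n) ℤ.* (a ℤ.* b ℤ.+ x) ≡ a ℤ.* ((1ℤ ℤ.+ n) ℤ.* b) ℤ.+ (n ℤ.* x ℤ.+ x)
    lemma₁ = ℤ-Solver.solve-∀
    lemma₂ : ∀ a b c x y z → a ℤ.* c ℤ.+ (x ℤ.+ y ℤ.+ z) ≡ + 0 ℤ.* a ℤ.* b ℤ.+ (x ℤ.+ z) ℤ.+ (a ℤ.* c ℤ.+ y)
    lemma₂ = ℤ-Solver.solve-∀
    lemma₃ : ∀ k x → k ℤ.* x ℤ.+ x ≡ (1ℤ ℤ.+ k) ℤ.* x
    lemma₃ = ℤ-Solver.solve-∀

  θ-factor-mono : ∀ d → θ (one ⊞ mono -1ℤ d) ≈ mono (ℤ.- (+ d)) d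
  θ-factor-mono d n with d ℕ.≟ n
  ... | yes refl = trans (cong (λ y → + d ℤ.* (one d ℤ.+ y)) (mono-diag -1ℤ d)) (trans (at d) (sym (mono-diag (ℤ.- (+ d)) d)))
    where
    at : ∀ d → + d ℤ.* (one d ℤ.+ -1ℤ) ≡ ℤ.- (+ d)
    at zero    = refl
    at (suc d) = lemma (+ suc d)
      where
      lemma : ∀ x → x ℤ.* -1ℤ ≡ ℤ.- x
      lemma = ℤ-Solver.solve-∀
  ... | no d≢n = trans (cong (λ y → + n ℤ.* (one n ℤ.+ y)) (mono-off -1ℤ d n d≢n)) (trans (at n) (sym (mono-off _ d n d≢n)))
    where
    at : ∀ n → + n ℤ.* (one n ℤ.+ 0ℤ) ≡ 0ℤ
    at zero    = refl
    at (suc n) = ℤ.*-zeroʳ (+ suc n)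

θ-cong[] : ∀ {m F G} → F ≈[ m ] G → θ F ≈[ m ] θ G
θ-cong[] p n n<m = cong (λ y → + n ℤ.* y) (p n n<m)

-- For `d` positive, the expansion of 1/(1 - q^d), written with a divisibility test so that Lambert
-- series are visibly divisor sums.
geo : ℕ → Series
geo d m = if does (d ∣? m) then 1ℤ else 0ℤ

geo-yes : ∀ {d m} → d ∣ m → geo d m ≡ 1ℤ
geo-yes {d} {m} d∣m with d ∣? m
... | yes _   = refl
... | no  d∤m = ⊥-elim (d∤m d∣m)

geo-no : ∀ {d m} → ¬ d ∣ m → geo d m ≡ 0ℤ
geo-no {d} {m} d∤m with d ∣? m
... | yes d∣m = ⊥-elim (d∤m d∣m)
... | no  _   = refl

geo-cong : ∀ {d m d′ m′} → (d ∣ m → d′ ∣ m′) → (d′ ∣ m′ → d ∣ m) → geo d m ≡ geo d′ m′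
geo-cong {d} {m} p q with d ∣? m
... | yes d∣m = sym (geo-yes (p d∣m))
... | no  d∤m = sym (geo-no (d∤m ∘ q))

geo-< : ∀ d m → m < d → geo d m ≡ one m
geo-< d zero    _   = geo-yes (d ∣0)
geo-< d (suc m) m<d = geo-no (λ d∣m → ℕ.<⇒≱ m<d (∣⇒≤ d∣m))

geometric : ∀ d .{{_ : NonZero d}} → (one ⊞ mono -1ℤ d) ✶ geo d ≈ one
geometric d m = trans (trans (✶-congʳ (geo d) (⊞-congʳ (mono -1ℤ d) one≈const) m)
  (trans (geometric-end (mono -1ℤ d) (geo d) m) (⊞-at (geo d) _ m))) rest
  where
  rest : geo d m ℤ.+ (mono -1ℤ d ✶ geo d) m ≡ one m
  rest with d ℕ.≤? m
  ... | no d≰m = trans (cong₂ ℤ._+_ (geo-< d m (ℕ.≰⇒> d≰m)) (mono-✶-< -1ℤ d (geo d) m (ℕ.≰⇒> d≰m))) (ℤ.+-identityʳ _)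
  ... | yes d≤m with m ∸ d | ℕ.m+[n∸m]≡n d≤m
  ...   | k | refl = trans (cong₂ ℤ._+_ (geo-cong {d} {d + k} {d} {k} (λ p → ∣m+n∣m⇒∣n p ∣-refl) (∣m∣n⇒∣m+n ∣-refl)) (mono-✶-+ -1ℤ d (geo d) k))
           (trans (lemma (geo d k)) (sym (one-pos d k)))
    where
    lemma : ∀ x → x ℤ.+ -1ℤ ℤ.* x ≡ 0ℤ
    lemma = ℤ-Solver.solve-∀
    one-pos : ∀ d k .{{_ : NonZero d}} → one (d + k) ≡ 0ℤ
    one-pos (suc d) k = refl

-- d q^d / (1 - q^d)
lambert : ℕ → Series
lambert d m = + d ℤ.* (geo d m ℤ.- one m)

lambert-factor : ∀ d .{{_ : NonZero d}} → θ (one ⊞ mono -1ℤ d) ≈ neg ((one ⊞ mono -1ℤ d) ✶ lambert d)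
lambert-factor d = ≈-trans (θ-factor-mono d) (≈-sym (begin
  neg (F ✶ lambert d)                          ≈⟨ neg-cong (✶-congˡ F (λ m → trans (cong (λ y → + d ℤ.* y) (sym (trans (⊞-at (geo d) (neg one) m) (cong (λ y → geo d m ℤ.+ y) (neg-at one m))))) (sym (scale-at (+ d) _ m)))) ⟩
  neg (F ✶ scale (+ d) (geo d ⊞ neg one))      ≈⟨ neg-cong (scale-✶ (+ d) F (geo d ⊞ neg one)) ⟩
  neg (scale (+ d) (F ✶ (geo d ⊞ neg one)))    ≈⟨ neg-cong (scale-cong (+ d) (≈-trans (𝕊.distribˡ F (geo d) (neg one))
                                                    (≈-trans (⊞-cong (geometric d) (≈-trans (≈-trans (✶-comm F _) (≈-sym (neg-distribˡ one F))) (neg-cong (✶-identityˡ F)))) 1-[1-x]))) ⟩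
  neg (scale (+ d) (mono 1ℤ d))                ≈⟨ neg-cong (scale-mono (+ d) d) ⟩
  neg (mono (+ d) d)                           ≈⟨ neg-mono (+ d) d ⟩
  mono (ℤ.- (+ d)) d                           ∎))
  where
  open ≈-Reasoning
  F = one ⊞ mono -1ℤ d
  open import Algebra.Properties.Ring 𝕊.ring using () renaming (-‿distribˡ-* to neg-distribˡ)
  1-[1-x] : one ⊞ neg F ≈ mono 1ℤ d
  1-[1-x] n = trans (⊞-at one (neg F) n) (trans (cong (λ y → one n ℤ.+ y) (trans (neg-at F n) (cong ℤ.-_ (trans (⊞-at one _ n) (cong (λ y → one n ℤ.+ y) (trans (mono-neg d n) (neg-at (mono 1ℤ d) n)))))))
    (lemma (one n) (mono 1ℤ d n)))
    where
    lemma : ∀ x y → x ℤ.+ ℤ.- (x ℤ.+ ℤ.- y) ≡ y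
    lemma = ℤ-Solver.solve-∀
  neg-mono : ∀ c k → neg (mono c k) ≈ mono (ℤ.- c) k
  neg-mono c k n with k ℕ.≟ n
  ... | yes refl = trans (neg-at (mono c k) k) (trans (cong ℤ.-_ (mono-diag c k)) (sym (mono-diag (ℤ.- c) k)))
  ... | no k≢n   = trans (neg-at (mono c k) n) (trans (cong ℤ.-_ (mono-off c k n k≢n)) (sym (mono-off (ℤ.- c) k n k≢n)))

-- L is the logarithmic derivative of 1/F, up to q^m.
NegLog : ℕ → Series → Series → Set
NegLog m F L = θ F ≈[ m ] neg (F ✶ L)

NegLog-✶ : ∀ {m F G L M} → NegLog m F L → NegLog m G M → NegLog m (F ✶ G) (L ⊞ M)
NegLog-✶ {m} {F} {G} {L} {M} p q = ≈[]-trans (≈⇒≈[] (θ-✶ F G)) (≈[]-trans (⊞-cong[] (✶-cong[] {G = G} p ≈[]-refl) (✶-cong[] {F = F} ≈[]-refl q))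
  (≈⇒≈[] (log-step F G L M)))

neg-cong[] : ∀ {m F G} → F ≈[ m ] G → neg F ≈[ m ] neg G
neg-cong[] {F = F} {G} p n n<m = trans (neg-at F n) (trans (cong ℤ.-_ (p n n<m)) (sym (neg-at G n)))

NegLog-cong : ∀ {m F G L} → F ≈[ m ] G → NegLog m F L → NegLog m G L
NegLog-cong {L = L} p q = ≈[]-trans (θ-cong[] (≈[]-sym p)) (≈[]-trans q (neg-cong[] (✶-cong[] {G = L} p ≈[]-refl)))

NegLog-Prod : ∀ {m} i s .{{_ : NonZero i}} N → NegLog m (Prod (factor -1ℤ i s) N) (Sum (λ k → lambert (i + k * s)) N)
NegLog-Prod i s zero    = ≈⇒≈[] (λ n → trans (θ-one n) (sym (trans (neg-at _ n) (cong ℤ.-_ (✶-zeroʳ one n)))))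
  where
  θ-one : ∀ n → + n ℤ.* one n ≡ 0ℤ
  θ-one zero    = refl
  θ-one (suc n) = ℤ.*-zeroʳ (+ suc n)
NegLog-Prod {m} i s (suc N) = ≈[]-trans (NegLog-✶ {F = Prod (factor -1ℤ i s) N} (NegLog-Prod i s N) (≈⇒≈[] (lambert-factor (i + N * s) {{nz i N s}})))
  (neg-cong[] (≈⇒≈[] (✶-congˡ (Prod (factor -1ℤ i s) (suc N)) (𝕊.+-comm _ (lambert (i + N * s))))))
  where
  nz : ∀ i N s .{{_ : NonZero i}} → NonZero (i + N * s)
  nz (suc i) N s = _

NegLog-P : ∀ i s .{{_ : NonZero i}} .{{_ : NonZero s}} N → NegLog N (P -1ℤ i s) (Sum (λ k → lambert (i + k * s)) N)
NegLog-P i s N = NegLog-cong (≈[]-sym (P-≈[] -1ℤ i s N)) (NegLog-Prod i s N)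

-- The Legendre symbol modulo 5
χ : ℕ → ℤ
χ 0 = 0ℤ
χ 1 = 1ℤ
χ 2 = -1ℤ
χ 3 = -1ℤ
χ 4 = 1ℤ
χ (suc (suc (suc (suc (suc n))))) = χ n

χ-periodic : ∀ r k → χ (r + k * 5) ≡ χ r
χ-periodic r zero    = cong χ (ℕ.+-identityʳ r)
χ-periodic r (suc k) = trans (cong χ (lemma r k)) (χ-periodic r k)
  where
  lemma : ∀ r k → r + (5 + k * 5) ≡ 5 + (r + k * 5)
  lemma = ℕ-Solver.solve-∀

χ-double : ∀ n → χ (2 * n) ≡ -1ℤ ℤ.* χ n
χ-double 0 = refl
χ-double 1 = refl
χ-double 2 = refl
χ-double 3 = refl
χ-double 4 = refl
χ-double (suc (suc (suc (suc (suc n))))) = trans (cong χ (lemma n)) (χ-double n)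
  where
  lemma : ∀ n → 2 * (5 + n) ≡ 10 + 2 * n
  lemma = ℕ-Solver.solve-∀

χlambert : ℕ → Series
χlambert d = scale (χ d) (lambert d)

lambert-small : ∀ d → lambert d ≈[ d ] 0S
lambert-small d m m<d = trans (cong (λ y → + d ℤ.* (y ℤ.- one m)) (geo-< d m m<d)) (trans (cong (λ y → + d ℤ.* y) (ℤ.+-inverseʳ (one m))) (ℤ.*-zeroʳ (+ d)))

-- H m = Σ_{d ∣ m} χ(d) d for m ≥ 1
H : Series
H m = Sum χlambert (suc m) m

H≈[] : ∀ N M → N ≤ M → H ≈[ N ] Sum χlambert M
H≈[] N M N≤M m m<N = sym (go (M ∸ suc m) M (sym (ℕ.m+[n∸m]≡n (ℕ.≤-trans m<N N≤M))))
  where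
  go : ∀ k M → M ≡ suc m + k → Sum χlambert M m ≡ H m
  go zero    M refl rewrite ℕ.+-identityʳ m = refl
  go (suc k) M refl rewrite ℕ.+-suc m k = trans (⊞-at (χlambert (suc (m + k))) _ m) (trans (cong₂ ℤ._+_
    (trans (scale-at (χ (suc (m + k))) _ m) (trans (cong (λ y → χ (suc (m + k)) ℤ.* y) (lambert-small (suc (m + k)) m (s≤s (ℕ.m≤m+n m k)))) (ℤ.*-zeroʳ (χ (suc (m + k))))))
    (go k (suc (m + k)) refl)) (ℤ.+-identityˡ _))

Sum-χlambert : ∀ N → Sum χlambert (N * 5) ≈
  Sum (λ k → lambert (4 + k * 5)) N ⊞ (neg (Sum (λ k → lambert (3 + k * 5)) N) ⊞ (neg (Sum (λ k → lambert (2 + k * 5)) N) ⊞ Sum (λ k → lambert (1 + k * 5)) N))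
Sum-χlambert zero n = sym (trans (⊞-at 0S _ n) (trans (ℤ.+-identityˡ _) (trans (⊞-at (neg 0S) _ n) (trans (cong₂ ℤ._+_ (neg-at 0S n) (trans (⊞-at (neg 0S) 0S n) (trans (ℤ.+-identityʳ _) (neg-at 0S n)))) refl))))
Sum-χlambert (suc N) n = begin
  (χlambert (4 + N * 5) ⊞ (χlambert (3 + N * 5) ⊞ (χlambert (2 + N * 5) ⊞ (χlambert (1 + N * 5) ⊞ (χlambert (N * 5) ⊞ Sum χlambert (N * 5)))))) n
    ≡⟨ trans (⊞-at _ _ n) (cong₂ ℤ._+_ (at 4) (trans (⊞-at _ _ n) (cong₂ ℤ._+_ (at 3) (trans (⊞-at _ _ n) (cong₂ ℤ._+_ (at 2)
        (trans (⊞-at _ _ n) (cong₂ ℤ._+_ (at 1) (trans (⊞-at _ _ n) (cong₂ ℤ._+_ (at 0) (trans (Sum-χlambert N n) (four (L 4) (L 3) (L 2) (L 1)))))))))))) ⟩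
  1ℤ ℤ.* l 4 ℤ.+ (-1ℤ ℤ.* l 3 ℤ.+ (-1ℤ ℤ.* l 2 ℤ.+ (1ℤ ℤ.* l 1 ℤ.+ (0ℤ ℤ.* l 0 ℤ.+ (L 4 n ℤ.+ (ℤ.- L 3 n ℤ.+ (ℤ.- L 2 n ℤ.+ L 1 n)))))))
    ≡⟨ lemma (l 0) (l 1) (l 2) (l 3) (l 4) (L 1 n) (L 2 n) (L 3 n) (L 4 n) ⟩
  l 4 ℤ.+ L 4 n ℤ.+ (ℤ.- (l 3 ℤ.+ L 3 n) ℤ.+ (ℤ.- (l 2 ℤ.+ L 2 n) ℤ.+ (l 1 ℤ.+ L 1 n)))
    ≡⟨ cong₂ (λ x y → x ℤ.+ y) (⊞-at (lambert (4 + N * 5)) (L 4) n) (cong₂ (λ x y → ℤ.- x ℤ.+ y) (⊞-at (lambert (3 + N * 5)) (L 3) n)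
         (cong₂ (λ x y → ℤ.- x ℤ.+ y) (⊞-at (lambert (2 + N * 5)) (L 2) n) (⊞-at (lambert (1 + N * 5)) (L 1) n))) ⟨
  L′ 4 n ℤ.+ (ℤ.- L′ 3 n ℤ.+ (ℤ.- L′ 2 n ℤ.+ L′ 1 n))
    ≡⟨ four (L′ 4) (L′ 3) (L′ 2) (L′ 1) ⟨
  (L′ 4 ⊞ (neg (L′ 3) ⊞ (neg (L′ 2) ⊞ L′ 1))) n ∎
  where
  open ≡-Reasoning
  L L′ : ℕ → Series
  L  r = Sum (λ k → lambert (r + k * 5)) N
  L′ r = Sum (λ k → lambert (r + k * 5)) (suc N)
  l : ℕ → ℤ
  l r = lambert (r + N * 5) n
  at : ∀ r → χlambert (r + N * 5) n ≡ χ r ℤ.* l r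
  at r = trans (scale-at (χ (r + N * 5)) _ n) (cong (λ c → c ℤ.* l r) (χ-periodic r N))
  four : ∀ A B C D → (A ⊞ (neg B ⊞ (neg C ⊞ D))) n ≡ A n ℤ.+ (ℤ.- B n ℤ.+ (ℤ.- C n ℤ.+ D n))
  four A B C D = trans (⊞-at A _ n) (cong (λ y → A n ℤ.+ y) (trans (⊞-at (neg B) _ n) (cong₂ ℤ._+_ (neg-at B n)
    (trans (⊞-at (neg C) D n) (cong (λ y → y ℤ.+ D n) (neg-at C n))))))
  lemma : ∀ l₀ l₁ l₂ l₃ l₄ a b c d → 1ℤ ℤ.* l₄ ℤ.+ (-1ℤ ℤ.* l₃ ℤ.+ (-1ℤ ℤ.* l₂ ℤ.+ (1ℤ ℤ.* l₁ ℤ.+ (0ℤ ℤ.* l₀ ℤ.+ (d ℤ.+ (ℤ.- c ℤ.+ (ℤ.- b ℤ.+ a))))))) ≡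
          l₄ ℤ.+ d ℤ.+ (ℤ.- (l₃ ℤ.+ c) ℤ.+ (ℤ.- (l₂ ℤ.+ b) ℤ.+ (l₁ ℤ.+ a)))
  lemma = ℤ-Solver.solve-∀

-- The Wronskian is αβ times the difference of the logarithmic derivatives. The common f₅ drops out;
-- the factors of exponent ±2 modulo 5 come from `α` and those of exponent ±1 from `β` with the
-- opposite sign, which together make χ.
wronskian-log-derivative : β ✶ θ α ⊞ neg (α ✶ θ β) ≈ (f 1 ✶ f 5) ✶ H
wronskian-log-derivative = ≈[]⇒≈ λ N → let L = λ r → Sum (λ k → lambert (r + k * 5)) N in
  ≈[]-trans (⊞-cong[] (✶-cong[] {F = β} ≈[]-refl (logα N)) (neg-cong[] (✶-cong[] {F = α} ≈[]-refl (logβ N))))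
  (≈[]-trans (≈⇒≈[] (wronskian-log α β (L 5) (L 1) (L 2) (L 3) (L 4)))
  (✶-cong[] (≈⇒≈[] αβ≈f₁f₅) (≈[]-trans (≈⇒≈[] (≈-sym (Sum-χlambert N))) (≈[]-sym (H≈[] N (N * 5) (ℕ.m≤m*n N 5))))))
  where
  logα : ∀ N → NegLog N α (Sum (λ k → lambert (5 + k * 5)) N ⊞ (Sum (λ k → lambert (3 + k * 5)) N ⊞ Sum (λ k → lambert (2 + k * 5)) N))
  logα N = NegLog-cong (≈⇒≈[] (≈-sym α-product)) (NegLog-✶ {F = f 5} (NegLog-P 5 5 N) (NegLog-✶ {F = P -1ℤ 3 5} (NegLog-P 3 5 N) (NegLog-P 2 5 N)))
  logβ : ∀ N → NegLog N β (Sum (λ k → lambert (5 + k * 5)) N ⊞ (Sum (λ k → lambert (4 + k * 5)) N ⊞ Sum (λ k → lambert (1 + k * 5)) N))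
  logβ N = NegLog-cong (≈⇒≈[] (≈-sym β-product)) (NegLog-✶ {F = f 5} (NegLog-P 5 5 N) (NegLog-✶ {F = P -1ℤ 4 5} (NegLog-P 4 5 N) (NegLog-P 1 5 N)))

B : Series
B = const 1ℤ ⊞ neg (const (+ 5) ✶ H)

f-at-0 : ∀ k .{{_ : NonZero k}} → f k 0 ≡ 1ℤ
f-at-0 (suc k) = P-at-0 -1ℤ k (suc k)

const-✶ : ∀ c F → scale c F ≈ const c ✶ F
const-✶ c F = ≈-sym (✶-const c F)

const-cancel : ∀ c .{{_ : ℤ.NonZero c}} {F G} → const c ✶ F ≈ const c ✶ G → F ≈ G
const-cancel c {F} {G} p n = ℤ.*-cancelˡ-≡ c (F n) (G n) (trans (trans (sym (scale-at c F n)) (const-✶ c F n)) (trans (p n) (trans (✶-const c G n) (scale-at c G n))))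

-- `wronskian-relation` amounts to 32 f₁⁶ = 32 (αβ - 5W) with W = f₁ f₅ `H`, so that f₁⁶ = f₁ f₅
-- `B`; 32 and one f₁ are cancelled.
B-eta : f 5 ✶ B ≈ f 1 ✶ (f 1 ✶ (f 1 ✶ (f 1 ✶ f 1)))
B-eta = ✶-cancelˡ (f 1) (f-at-0 1) (const-cancel (+ 32) (begin
  const (+ 32) ✶ (f 1 ✶ (f 5 ✶ B))
    ≈⟨ ✶-congˡ _ (≈-sym (wronskian-end (f 1) (f 5) H)) ⟩
  const (+ 32) ✶ (f 1 ✶ f 5 ⊞ neg (const (+ 5) ✶ (f 1 ✶ f 5 ✶ H)))
    ≈⟨ ✶-congˡ _ (⊞-cong (≈-sym αβ≈f₁f₅) (neg-cong (✶-congˡ (const (+ 5)) (≈-sym wronskian-log-derivative)))) ⟩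
  const (+ 32) ✶ (α ✶ β ⊞ neg (const (+ 5) ✶ (β ✶ θ α ⊞ neg (α ✶ θ β))))
    ≈⟨ wronskian-collect α β (θ α) (θ β) ⟨
  const (+ 4) ✶ (const (+ 40) ✶ (α ✶ θ β) ⊞ (const -[1+ 39 ] ✶ (θ α ✶ β) ⊞ const (+ 8) ✶ (α ✶ β)))
    ≈⟨ ≈-trans (✶-const (+ 4) _) (scale-cong (+ 4) (⊞-cong (✶-const (+ 40) _) (⊞-cong (✶-const -[1+ 39 ] _) (✶-const (+ 8) _)))) ⟩
  scale (+ 4) (scale (+ 40) (α ✶ θ β) ⊞ (scale -[1+ 39 ] (θ α ✶ β) ⊞ scale (+ 8) (α ✶ β)))
    ≈⟨ wronskian-relation ⟨
  scale (+ 32) (f₁³ ✶ f₁³)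
    ≈⟨ const-✶ (+ 32) _ ⟩
  const (+ 32) ✶ (f₁³ ✶ f₁³)
    ≈⟨ ✶-congˡ _ (sixth-power (f 1)) ⟩
  const (+ 32) ✶ (f 1 ✶ (f 1 ✶ (f 1 ✶ (f 1 ✶ (f 1 ✶ f 1))))) ∎))
  where open ≈-Reasoning

-- Arithmetic of the divisor sum H

5∣⇒χ≡0 : ∀ d → 5 ∣ d → χ d ≡ 0ℤ
5∣⇒χ≡0 _ (divides k refl) = χ-periodic 0 k

one-* : ∀ k m .{{_ : NonZero k}} → one (k * m) ≡ one m
one-* k       zero    = cong one (ℕ.*-zeroʳ k)
one-* (suc k) (suc m) = refl

prime-∣-cancel : ∀ {p d} m → Prime p → ¬ p ∣ d → d ∣ p * m → d ∣ m
prime-∣-cancel {p} {d} m p-prime p∤d (divides q eq) with euclidsLemma q d p-prime (divides m (trans (sym eq) (ℕ.*-comm p m)))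
... | inj₂ p∣d = ⊥-elim (p∤d p∣d)
... | inj₁ (divides q′ refl) = divides q′ (ℕ.*-cancelˡ-≡ m (q′ * d) p {{prime⇒nonZero p-prime}} (trans eq (lemma q′ p d)))
  where
  lemma : ∀ q p d → q * p * d ≡ p * (q * d)
  lemma = ℕ-Solver.solve-∀

H-at : ∀ m M → m < M → H m ≡ sumL (λ d → χ d ℤ.* lambert d m) (downFrom M)
H-at m M m<M = trans (H≈[] (suc m) M m<M m ℕ.≤-refl) (trans (Sum-at χlambert M m) (sumL-cong (downFrom M) (λ {d} _ → scale-at (χ d) (lambert d) m)))

-- Divisors that are multiples of 5 carry χ = 0, and any other number divides 5m exactly when it
-- divides m.
H-5* : ∀ m → H (5 * m) ≡ H m
H-5* m = trans (H-at (5 * m) M ℕ.≤-refl) (trans (sumL-cong (downFrom M) (λ {d} _ → term d)) (sym (H-at m M (s≤s (ℕ.m≤n*m m 5)))))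
  where
  M = suc (5 * m)
  term : ∀ d → χ d ℤ.* lambert d (5 * m) ≡ χ d ℤ.* lambert d m
  term d with 5 ∣? d
  ... | yes 5∣d = trans (cong (λ c → c ℤ.* lambert d (5 * m)) (5∣⇒χ≡0 d 5∣d)) (sym (cong (λ c → c ℤ.* lambert d m) (5∣⇒χ≡0 d 5∣d)))
  ... | no  5∤d = cong (λ y → χ d ℤ.* (+ d ℤ.* y)) (cong₂ ℤ._-_ (geo-cong (prime-∣-cancel m (from-yes (prime? 5)) 5∤d) (∣n⇒∣m*n 5)) (one-* 5 m))

sumL-even-odd : ∀ (g : ℕ → ℤ) L → sumL g (downFrom (2 * L)) ≡ sumL (λ e → g (2 * e)) (downFrom L) ℤ.+ sumL (λ e → g (suc (2 * e))) (downFrom L)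
sumL-even-odd g zero    = refl
sumL-even-odd g (suc L) = begin
  sumL g (downFrom (2 * suc L))                          ≡⟨ cong (λ n → sumL g (downFrom n)) (ℕ.*-suc 2 L) ⟩
  g (suc (2 * L)) ℤ.+ (g (2 * L) ℤ.+ sumL g (downFrom (2 * L)))        ≡⟨ cong (λ y → g (suc (2 * L)) ℤ.+ (g (2 * L) ℤ.+ y)) (sumL-even-odd g L) ⟩
  g (suc (2 * L)) ℤ.+ (g (2 * L) ℤ.+ (sumL (λ e → g (2 * e)) (downFrom L) ℤ.+ sumL (λ e → g (suc (2 * e))) (downFrom L)))
    ≡⟨ lemma (g (suc (2 * L))) (g (2 * L)) (sumL (λ e → g (2 * e)) (downFrom L)) (sumL (λ e → g (suc (2 * e))) (downFrom L)) ⟩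
  g (2 * L) ℤ.+ sumL (λ e → g (2 * e)) (downFrom L) ℤ.+ (g (suc (2 * L)) ℤ.+ sumL (λ e → g (suc (2 * e))) (downFrom L)) ∎
  where
  open ≡-Reasoning
  lemma : ∀ a b c d → a ℤ.+ (b ℤ.+ (c ℤ.+ d)) ≡ b ℤ.+ c ℤ.+ (a ℤ.+ d)
  lemma = ℤ-Solver.solve-∀

-- The divisors of 2m are the divisors d of m and their doubles. As χ(2d) 2d = -2 χ(d) d, the total
-- is (1 - 2) `H m`.
H-2* : ∀ m → ¬ 2 ∣ m → H (2 * m) ≡ ℤ.- H m
H-2* m 2∤m = begin
  H (2 * m)
    ≡⟨ trans (H-at (2 * m) (2 * L) 2m<2L) (sumL-even-odd (t (2 * m)) L) ⟩
  sumL (λ e → t (2 * m) (2 * e)) (downFrom L) ℤ.+ sumL (λ e → t (2 * m) (suc (2 * e))) (downFrom L)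
    ≡⟨ cong₂ ℤ._+_ (trans (sumL-cong (downFrom L) (λ {e} _ → even e)) (sumL-* -[1+ 1 ] (t m) (downFrom L))) (sumL-cong (downFrom L) (λ {e} _ → odd e)) ⟩
  -[1+ 1 ] ℤ.* sumL (t m) (downFrom L) ℤ.+ sumL (λ e → t m (suc (2 * e))) (downFrom L)
    ≡⟨ cong₂ (λ x y → -[1+ 1 ] ℤ.* x ℤ.+ y) (sym (H-at m L ℕ.≤-refl)) (sym odd-part) ⟩
  -[1+ 1 ] ℤ.* H m ℤ.+ H m
    ≡⟨ lemma (H m) ⟩
  ℤ.- H m ∎
  where
  open ≡-Reasoning
  L = suc m
  t : ℕ → ℕ → ℤ
  t m d = χ d ℤ.* lambert d m
  2m<2L : 2 * m < 2 * L
  2m<2L = ℕ.*-monoʳ-< 2 (ℕ.n<1+n m)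
  lemma : ∀ x → -[1+ 1 ] ℤ.* x ℤ.+ x ≡ ℤ.- x
  lemma = ℤ-Solver.solve-∀
  one-odd : one m ≡ 0ℤ
  one-odd = go m 2∤m
    where
    go : ∀ m → ¬ 2 ∣ m → one m ≡ 0ℤ
    go zero    p = ⊥-elim (p (2 ∣0))
    go (suc m) _ = refl
  even : ∀ e → t (2 * m) (2 * e) ≡ -[1+ 1 ] ℤ.* t m e
  even e = trans (cong₂ (λ x y → x ℤ.* (y ℤ.* (geo (2 * e) (2 * m) ℤ.- one (2 * m)))) (χ-double e) (ℤ.pos-* 2 e))
    (trans (cong₂ (λ x y → -1ℤ ℤ.* χ e ℤ.* (+ 2 ℤ.* + e ℤ.* (x ℤ.- y))) (geo-cong {2 * e} {2 * m} {e} {m} (*-cancelˡ-∣ 2) (*-monoʳ-∣ 2)) (one-* 2 m))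
    (lemma′ (χ e) (+ e) (geo e m) (one m)))
    where
    lemma′ : ∀ c e x y → -1ℤ ℤ.* c ℤ.* (+ 2 ℤ.* e ℤ.* (x ℤ.- y)) ≡ -[1+ 1 ] ℤ.* (c ℤ.* (e ℤ.* (x ℤ.- y)))
    lemma′ = ℤ-Solver.solve-∀
  odd : ∀ e → t (2 * m) (suc (2 * e)) ≡ t m (suc (2 * e))
  odd e = cong (λ y → χ (suc (2 * e)) ℤ.* (+ suc (2 * e) ℤ.* y)) (cong₂ ℤ._-_ (geo-cong (prime-∣-cancel m (from-yes (prime? 2)) 2∤odd) (∣n⇒∣m*n 2)) (one-* 2 m))
    where
    2∤odd : ¬ 2 ∣ suc (2 * e)
    2∤odd 2∣ = ℕ.<⇒≱ (s≤s (s≤s z≤n)) (∣⇒≤ (∣m+n∣m⇒∣n (subst (2 ∣_) (ℕ.+-comm 1 (2 * e)) 2∣) (m∣m*n e)))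
  odd-part : H m ≡ sumL (λ e → t m (suc (2 * e))) (downFrom L)
  odd-part = trans (H-at m (2 * L) (ℕ.≤-trans (s≤s (ℕ.m≤n*m m 2)) 2m<2L)) (trans (sumL-even-odd (t m) L)
    (trans (cong (λ y → y ℤ.+ sumL (λ e → t m (suc (2 * e))) (downFrom L)) (trans (sumL-cong (downFrom L) (λ {e} _ → even0 e)) (sumL-0 (downFrom L)))) (ℤ.+-identityˡ _)))
    where
    even0 : ∀ e → t m (2 * e) ≡ 0ℤ
    even0 e = trans (cong₂ (λ x y → χ (2 * e) ℤ.* (+ (2 * e) ℤ.* (x ℤ.- y))) (geo-no (λ 2e∣m → 2∤m (∣-trans (m∣m*n e) 2e∣m))) one-odd)
      (trans (cong (λ y → χ (2 * e) ℤ.* y) (ℤ.*-zeroʳ (+ (2 * e)))) (ℤ.*-zeroʳ (χ (2 * e))))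

-- The substitution q ↦ q^k

Levels-id : Levels {ℕ} id
Levels-id .lev m          = m ∷ []
Levels-id .unique m       = [] ∷ []
Levels-id .sound (here p) = p
Levels-id .complete p     = here p

Θ-id : ∀ F → Θ Levels-id F ≈ F
Θ-id F m = ℤ.+-identityʳ (F m)

module _ (k : ℕ) .{{_ : NonZero k}} where

  Levels-dil : ∀ {I : Set} {E : I → ℕ} → Levels E → Levels (λ i → E i * k)
  Levels-dil lv .lev m with k ∣? m
  ... | yes (divides q _) = lev lv q
  ... | no  _             = []
  Levels-dil lv .unique m with k ∣? m
  ... | yes (divides q _) = unique lv q
  ... | no  _             = []
  Levels-dil lv .sound {m} i∈ with k ∣? m | i∈
  ... | yes (divides q eq) | i∈ = trans (cong (λ y → y * k) (sound lv i∈)) (sym eq)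
  Levels-dil {E = E} lv .complete {m} {i} eq with k ∣? m
  ... | yes (divides q eq′) = complete lv (ℕ.*-cancelʳ-≡ (E i) q k (trans eq eq′))
  ... | no  k∤m             = ⊥-elim (k∤m (divides (E i) (sym eq)))

  -- F(q) ↦ F(q^k)
  dil : Series → Series
  dil F = Θ (Levels-dil Levels-id) F

  dil-Θ : ∀ {I : Set} {E : I → ℕ} (lv : Levels E) C → dil (Θ lv C) ≈ Θ (Levels-dil lv) C
  dil-Θ lv C m with k ∣? m
  ... | yes (divides q _) = ℤ.+-identityʳ _
  ... | no  _             = refl

  dil-* : ∀ F n → dil F (n * k) ≡ F n
  dil-* F n with k ∣? n * k
  ... | yes (divides q eq) = trans (ℤ.+-identityʳ (F q)) (cong F (sym (ℕ.*-cancelʳ-≡ n q k eq)))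
  ... | no  k∤             = ⊥-elim (k∤ (divides n refl))

  dil-off : ∀ F m → ¬ k ∣ m → dil F m ≡ 0ℤ
  dil-off F m k∤m with k ∣? m
  ... | yes k∣m = ⊥-elim (k∤m k∣m)
  ... | no  _   = refl

  dil-cong[] : ∀ {m F G} → F ≈[ m ] G → dil F ≈[ m ] dil G
  dil-cong[] {m} {F} {G} p n n<m with k ∣? n
  ... | yes (divides q refl) = cong (λ y → y ℤ.+ 0ℤ) (p q (ℕ.≤-<-trans (ℕ.m≤m*n q k) n<m))
  ... | no  _                = refl

  dil-cong : ∀ {F G} → F ≈ G → dil F ≈ dil G
  dil-cong p = Θ-cong (Levels-dil Levels-id) p

  dil-⊞ : ∀ F G → dil (F ⊞ G) ≈ dil F ⊞ dil G
  dil-⊞ F G = ≈-trans (Θ-cong (Levels-dil Levels-id) (⊞-at F G)) (Θ-+ (Levels-dil Levels-id) F G)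

  dil-mono : ∀ c j → dil (mono c j) ≈ mono c (j * k)
  dil-mono c j m with k ∣? m
  ... | no k∤m = sym (mono-off c (j * k) m (λ { refl → k∤m (divides j refl) }))
  ... | yes (divides q refl) with j ℕ.≟ q
  ...   | yes refl = trans (ℤ.+-identityʳ _) (trans (mono-diag c j) (sym (mono-diag c (j * k))))
  ...   | no  j≢q  = trans (ℤ.+-identityʳ _) (trans (mono-off c j q j≢q) (sym (mono-off c (j * k) (q * k) (j≢q ∘ ℕ.*-cancelʳ-≡ j q k))))

  dil-one : dil one ≈ one
  dil-one = ≈-trans (dil-cong one≈const) (≈-trans (dil-mono 1ℤ 0) (≈-sym one≈const))

  -- A series is its own theta series over its exponents; the product then runs over pairs of
  -- exponents, and scaling a sum scales both summands.
  dil-✶ : ∀ F G → dil (F ✶ G) ≈ dil F ✶ dil G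
  dil-✶ F G = begin
    dil (F ✶ G)                                          ≈⟨ dil-cong (✶-cong (≈-sym (Θ-id F)) (≈-sym (Θ-id G))) ⟩
    dil (Θ Levels-id F ✶ Θ Levels-id G)                  ≈⟨ dil-cong (Θ-✶ Levels-id Levels-id F G) ⟩
    dil (Θ (Levels-× Levels-id Levels-id) FG)            ≈⟨ dil-Θ (Levels-× Levels-id Levels-id) FG ⟩
    Θ (Levels-dil (Levels-× Levels-id Levels-id)) FG     ≈⟨ Θ-reindex (Levels-dil (Levels-× Levels-id Levels-id)) (Levels-× (Levels-dil Levels-id) (Levels-dil Levels-id))
                                                              id id (λ _ → refl) (λ _ → refl) (λ (i , j) → ℕ.*-distribʳ-+ k i j) FG ⟩
    Θ (Levels-× (Levels-dil Levels-id) (Levels-dil Levels-id)) FG ≈⟨ Θ-✶ (Levels-dil Levels-id) (Levels-dil Levels-id) F G ⟨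
    dil F ✶ dil G                                        ∎
    where
    open ≈-Reasoning
    FG : ℕ × ℕ → ℤ
    FG (i , j) = F i ℤ.* G j

  dil-Prod : ∀ d N → dil (Prod d N) ≈ Prod (λ l → dil (d l)) N
  dil-Prod d zero    = dil-one
  dil-Prod d (suc N) = ≈-trans (dil-✶ (Prod d N) (d N)) (✶-congʳ (dil (d N)) (dil-Prod d N))

  dil-f : ∀ j .{{_ : NonZero j}} → dil (f j) ≈ f (j * k)
  dil-f j = ≈[]⇒≈ λ N → ≈[]-trans (dil-cong[] (P-≈[] -1ℤ j j N)) (≈[]-trans (≈⇒≈[] (≈-trans (dil-Prod (factor -1ℤ j j) N)
    (Prod-cong (λ l → ≈-trans (dil-⊞ one _) (⊞-cong dil-one (≈-trans (dil-mono -1ℤ (j + l * j)) (mono-exp -1ℤ (exponent j l k))))) N)))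
    (≈[]-sym (P-≈[] -1ℤ (j * k) (j * k) {{ℕ.m*n≢0 j k}} N)))
    where
    exponent : ∀ j l k → (j + l * j) * k ≡ j * k + l * (j * k)
    exponent = ℕ-Solver.solve-∀

-- Dissection by the residues of the exponents modulo 5

Supp : ℕ → Series → Set
Supp r F = ∀ n → n % 5 ≢ r → F n ≡ 0ℤ

·-vanish : ∀ n F G → (∀ i j → i + j ≡ n → F i ℤ.* G j ≡ 0ℤ) → (F · G) n ≡ 0ℤ
·-vanish zero    F G p = trans (ℤ.+-identityʳ _) (p 0 0 refl)
·-vanish (suc n) F G p = cong₂ ℤ._+_ (p 0 (suc n) refl) (·-vanish n (tail F) G (λ i j eq → p (suc i) j (cong suc eq)))

opaque
  unfolding _✶_ _⊞_ neg

  infixl 7 _✶ˢ_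
  infixl 6 _⊞ˢ_

  _✶ˢ_ : ∀ {r s F G} → Supp r F → Supp s G → Supp ((r + s) % 5) (F ✶ G)
  _✶ˢ_ {r} {s} {F} {G} p q n n≢ = ·-vanish n F G vanish
    where
    vanish : ∀ i j → i + j ≡ n → F i ℤ.* G j ≡ 0ℤ
    vanish i j refl with i % 5 ℕ.≟ r | j % 5 ℕ.≟ s
    ... | no i≢r | _      = cong (λ x → x ℤ.* G j) (p i i≢r)
    ... | yes _  | no j≢s = trans (cong (λ x → F i ℤ.* x) (q j j≢s)) (ℤ.*-zeroʳ (F i))
    ... | yes i≡r | yes j≡s = ⊥-elim (n≢ (trans (%-distribˡ-+ i j 5) (cong₂ (λ x y → (x + y) % 5) i≡r j≡s)))

  _⊞ˢ_ : ∀ {r F G} → Supp r F → Supp r G → Supp r (F ⊞ G)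
  (p ⊞ˢ q) n n≢ = cong₂ ℤ._+_ (p n n≢) (q n n≢)

  negˢ : ∀ {r F} → Supp r F → Supp r (neg F)
  negˢ p n n≢ = cong ℤ.-_ (p n n≢)

constˢ : ∀ c → Supp 0 (const c)
constˢ c n n≢ = mono-off c 0 n (λ { refl → n≢ refl })

Supp-cong : ∀ {r F G} → F ≈ G → Supp r F → Supp r G
Supp-cong F≈G p n n≢ = trans (sym (F≈G n)) (p n n≢)

dilˢ : ∀ F → Supp 0 (dil 5 F)
dilˢ F n n≢ = dil-off 5 F n λ { (divides q refl) → n≢ (m*n%n≡0 q 5) }

-- Covers the projection to one class of exponents, the twist by χ and the restriction to exponents
-- prime to 5.
twist : (ℕ → ℤ) → Series → Series
twist c F n = c (n % 5) ℤ.* F n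

twist-cong : ∀ c {F G} → F ≈ G → twist c F ≈ twist c G
twist-cong c p n = cong (λ y → c (n % 5) ℤ.* y) (p n)

twist-Supp : ∀ c {r F} → Supp r F → twist c F ≈ scale (c r) F
twist-Supp c {r} {F} p n with n % 5 ℕ.≟ r
... | yes refl = sym (scale-at (c (n % 5)) F n)
... | no  n≢   = trans (cong (λ y → c (n % 5) ℤ.* y) (p n n≢)) (trans (ℤ.*-zeroʳ (c (n % 5))) (sym (trans (scale-at (c r) F n) (trans (cong (λ y → c r ℤ.* y) (p n n≢)) (ℤ.*-zeroʳ (c r))))))

twist-⊞ : ∀ c F G → twist c (F ⊞ G) ≈ twist c F ⊞ twist c G
twist-⊞ c F G n = trans (cong (λ y → c (n % 5) ℤ.* y) (⊞-at F G n)) (trans (ℤ.*-distribˡ-+ (c (n % 5)) (F n) (G n)) (sym (⊞-at (twist c F) (twist c G) n)))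

twist-split : ∀ c {F₀ F₁ F₂ F₃ F₄} → Supp 0 F₀ → Supp 1 F₁ → Supp 2 F₂ → Supp 3 F₃ → Supp 4 F₄ →
              twist c (F₀ ⊞ (F₁ ⊞ (F₂ ⊞ (F₃ ⊞ F₄)))) ≈ scale (c 0) F₀ ⊞ (scale (c 1) F₁ ⊞ (scale (c 2) F₂ ⊞ (scale (c 3) F₃ ⊞ scale (c 4) F₄)))
twist-split c {F₀} {F₁} {F₂} {F₃} {F₄} p₀ p₁ p₂ p₃ p₄ =
  ≈-trans (twist-⊞ c F₀ _) (⊞-cong (twist-Supp c p₀) (≈-trans (twist-⊞ c F₁ _) (⊞-cong (twist-Supp c p₁)
  (≈-trans (twist-⊞ c F₂ _) (⊞-cong (twist-Supp c p₂) (≈-trans (twist-⊞ c F₃ F₄) (⊞-cong (twist-Supp c p₃) (twist-Supp c p₄))))))))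

opaque
  unfolding _✶_

  -- Multiplication by a series in q⁵ does not move exponents between classes modulo 5. So f₅ can be
  -- carried through a dissection and cancelled afterwards.
  twist-✶ : ∀ c G F → Supp 0 G → twist c (G ✶ F) ≈ G ✶ twist c F
  twist-✶ c G F p n = trans (sym (·-weight n G F (c (n % 5)) )) (·-cong-terms n G (λ j → c (n % 5) ℤ.* F j) (twist c F) agree)
    where
    ·-weight : ∀ n G F x → (G · (λ j → x ℤ.* F j)) n ≡ x ℤ.* (G · F) n
    ·-weight zero    G F x = lemma (G 0) (F 0) x
      where
      lemma : ∀ g f x → g ℤ.* (x ℤ.* f) ℤ.+ 0ℤ ≡ x ℤ.* (g ℤ.* f ℤ.+ 0ℤ)
      lemma = ℤ-Solver.solve-∀
    ·-weight (suc n) G F x = trans (cong (λ y → G 0 ℤ.* (x ℤ.* F (suc n)) ℤ.+ y) (·-weight n (tail G) F x)) (lemma (G 0) (F (suc n)) x ((tail G · F) n))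
      where
      lemma : ∀ g f x y → g ℤ.* (x ℤ.* f) ℤ.+ x ℤ.* y ≡ x ℤ.* (g ℤ.* f ℤ.+ y)
      lemma = ℤ-Solver.solve-∀
    ·-cong-terms : ∀ n G F F′ → (∀ i j → i + j ≡ n → G i ℤ.* F j ≡ G i ℤ.* F′ j) → (G · F) n ≡ (G · F′) n
    ·-cong-terms zero    G F F′ q = cong (λ y → y ℤ.+ 0ℤ) (q 0 0 refl)
    ·-cong-terms (suc n) G F F′ q = cong₂ ℤ._+_ (q 0 (suc n) refl) (·-cong-terms n (tail G) F F′ (λ i j eq → q (suc i) j (cong suc eq)))
    agree : ∀ i j → i + j ≡ n → G i ℤ.* (c (n % 5) ℤ.* F j) ≡ G i ℤ.* (c (j % 5) ℤ.* F j)
    agree i j refl with i % 5 ℕ.≟ 0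
    ... | no i≢0  = trans (cong (λ y → y ℤ.* (c ((i + j) % 5) ℤ.* F j)) (p i i≢0)) (sym (cong (λ y → y ℤ.* (c (j % 5) ℤ.* F j)) (p i i≢0)))
    ... | yes i≡0 = cong (λ r → G i ℤ.* (c r ℤ.* F j)) (trans (cong (_% 5) (trans (cong (λ y → y + j) (trans (m≡m%n+[m/n]*n i 5) (cong (λ y → y + i / 5 * 5) i≡0))) (ℕ.+-comm (i / 5 * 5) j)))
                      ([m+kn]%n≡m%n j (i / 5) 5))

δ : ℕ → ℕ → ℤ
δ r s with r ℕ.≟ s
... | yes _ = 1ℤ
... | no  _ = 0ℤ

pick : ℕ → Series → Series
pick r = twist (δ r)

pickˢ : ∀ r F → Supp r (pick r F)
pickˢ r F n n≢ with r ℕ.≟ n % 5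
... | yes refl = ⊥-elim (n≢ refl)
... | no  _    = refl

pick-at : ∀ r F n → n % 5 ≡ r → pick r F n ≡ F n
pick-at r F n refl with n % 5 ℕ.≟ n % 5
... | yes _  = ℤ.*-identityˡ (F n)
... | no  ≢ = ⊥-elim (≢ refl)

Θ-empty : ∀ {I : Set} {E : I → ℕ} (lv : Levels E) C m → (∀ i → E i ≢ m) → Θ lv C m ≡ 0ℤ
Θ-empty lv C m p with lev lv m in eq
... | []    = refl
... | i ∷ _ = ⊥-elim (p i (sound lv (subst (i ∈_) (sym eq) (here refl))))

residue : ∀ x r k → r < 5 → + x ≡ + r ℤ.+ k ℤ.* + 5 → x % 5 ≡ r
residue x r k r<5 eq = proj₂ (divMod-unique (x % 5) r (+ (x / 5)) k (m%n<n x 5) r<5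
  (trans (sym (trans (cong +_ (m≡m%n+[m/n]*n x 5)) (trans (ℤ.pos-+ (x % 5) _) (cong (λ y → + (x % 5) ℤ.+ y) (ℤ.pos-* (x / 5) 5))))) eq))

open +-*-Solver using (solve; con; _:+_; _:*_; _:-_; :-_; _:=_)

-- The 5-dissection of f₁

private
  -- The residue of (3n² + n)/2 in terms of n modulo 5. The values 3 and 4 are missed, and 1 occurs
  -- for n ≡ 4 only.
  pent-residue : ℕ → ℕ
  pent-residue 0 = 0
  pent-residue 1 = 2
  pent-residue 2 = 2
  pent-residue 3 = 0
  pent-residue _ = 1

  -- The residue of n(n+1)/2, which is never 2; this gap is what forces `dissection-relation`.
  tri-residue : ℕ → ℕ
  tri-residue 0 = 0
  tri-residue 1 = 1
  tri-residue 2 = 3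
  tri-residue 3 = 1
  tri-residue _ = 0

  -- 6 ≡ 1 modulo 5 turns 2E, a polynomial in n, into the residue of E.
  residue-2e : ∀ i j n r k → r < 5 → + 3 ℤ.* g i j n ≡ + r ℤ.+ k ℤ.* + 5 → e i j n % 5 ≡ r
  residue-2e i j n r k r<5 eq = residue E r (k ℤ.- + E) r<5
    (trans (lemma (+ E)) (trans (cong (λ y → + 3 ℤ.* y ℤ.- + E ℤ.* + 5) (⟦2e⟧ i j n)) (trans (cong (λ y → y ℤ.- + E ℤ.* + 5) eq) (lemma′ (+ r) k (+ E)))))
    where
    E = e i j n
    lemma : ∀ E → E ≡ + 3 ℤ.* (+ 2 ℤ.* E) ℤ.- E ℤ.* + 5
    lemma = ℤ-Solver.solve-∀
    lemma′ : ∀ r k E → r ℤ.+ k ℤ.* + 5 ℤ.- E ℤ.* + 5 ≡ r ℤ.+ (k ℤ.- E) ℤ.* + 5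
    lemma′ = ℤ-Solver.solve-∀

  pent-class : ∀ r s → r < 5 → e 2 1 (+ r ℤ.+ s ℤ.* + 5) % 5 ≡ pent-residue r
  pent-class r s r<5 = go r r<5
    where
    E = λ r → e 2 1 (+ r ℤ.+ s ℤ.* + 5)
    go : ∀ r → r < 5 → E r % 5 ≡ pent-residue r
    -- In each case the quadratic in `s` is the quotient by 5 of three times the doubled exponent
    -- less its residue.
    go 0 _ = residue-2e 2 1 (+ 0 ℤ.+ s ℤ.* + 5) 0 ((+ 45) ℤ.* s ℤ.* s ℤ.+ (+ 3) ℤ.* s) (s≤s z≤n) (solve 1 (λ s → con (+ 3) :* G⟨ 2 , 1 ⟩ (con (+ 0) :+ s :* con (+ 5)) := con (+ 0) :+ (con (+ 45) :* s :* s :+ con (+ 3) :* s) :* con (+ 5)) refl s)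
    go 1 _ = residue-2e 2 1 (+ 1 ℤ.+ s ℤ.* + 5) 2 ((+ 45) ℤ.* s ℤ.* s ℤ.+ (+ 21) ℤ.* s ℤ.+ (+ 2)) (s≤s (s≤s (s≤s z≤n))) (solve 1 (λ s → con (+ 3) :* G⟨ 2 , 1 ⟩ (con (+ 1) :+ s :* con (+ 5)) := con (+ 2) :+ (con (+ 45) :* s :* s :+ con (+ 21) :* s :+ con (+ 2)) :* con (+ 5)) refl s)
    go 2 _ = residue-2e 2 1 (+ 2 ℤ.+ s ℤ.* + 5) 2 ((+ 45) ℤ.* s ℤ.* s ℤ.+ (+ 39) ℤ.* s ℤ.+ (+ 8)) (s≤s (s≤s (s≤s z≤n))) (solve 1 (λ s → con (+ 3) :* G⟨ 2 , 1 ⟩ (con (+ 2) :+ s :* con (+ 5)) := con (+ 2) :+ (con (+ 45) :* s :* s :+ con (+ 39) :* s :+ con (+ 8)) :* con (+ 5)) refl s)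
    go 3 _ = residue-2e 2 1 (+ 3 ℤ.+ s ℤ.* + 5) 0 ((+ 45) ℤ.* s ℤ.* s ℤ.+ (+ 57) ℤ.* s ℤ.+ (+ 18)) (s≤s z≤n) (solve 1 (λ s → con (+ 3) :* G⟨ 2 , 1 ⟩ (con (+ 3) :+ s :* con (+ 5)) := con (+ 0) :+ (con (+ 45) :* s :* s :+ con (+ 57) :* s :+ con (+ 18)) :* con (+ 5)) refl s)
    go 4 _ = residue-2e 2 1 (+ 4 ℤ.+ s ℤ.* + 5) 1 ((+ 45) ℤ.* s ℤ.* s ℤ.+ (+ 75) ℤ.* s ℤ.+ (+ 31)) (s≤s (s≤s z≤n)) (solve 1 (λ s → con (+ 3) :* G⟨ 2 , 1 ⟩ (con (+ 4) :+ s :* con (+ 5)) := con (+ 1) :+ (con (+ 45) :* s :* s :+ con (+ 75) :* s :+ con (+ 31)) :* con (+ 5)) refl s)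
    go (suc (suc (suc (suc (suc _))))) (s≤s (s≤s (s≤s (s≤s (s≤s ())))))

  tri-class : ∀ r s → r < 5 → e 1 0 (+ r ℤ.+ s ℤ.* + 5) % 5 ≡ tri-residue r
  tri-class r s r<5 = go r r<5
    where
    E = λ r → e 1 0 (+ r ℤ.+ s ℤ.* + 5)
    go : ∀ r → r < 5 → E r % 5 ≡ tri-residue r
    go 0 _ = residue-2e 1 0 (+ 0 ℤ.+ s ℤ.* + 5) 0 ((+ 15) ℤ.* s ℤ.* s ℤ.+ (+ 3) ℤ.* s) (s≤s z≤n) (solve 1 (λ s → con (+ 3) :* G⟨ 1 , 0 ⟩ (con (+ 0) :+ s :* con (+ 5)) := con (+ 0) :+ (con (+ 15) :* s :* s :+ con (+ 3) :* s) :* con (+ 5)) refl s)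
    go 1 _ = residue-2e 1 0 (+ 1 ℤ.+ s ℤ.* + 5) 1 ((+ 15) ℤ.* s ℤ.* s ℤ.+ (+ 9) ℤ.* s ℤ.+ (+ 1)) (s≤s (s≤s z≤n)) (solve 1 (λ s → con (+ 3) :* G⟨ 1 , 0 ⟩ (con (+ 1) :+ s :* con (+ 5)) := con (+ 1) :+ (con (+ 15) :* s :* s :+ con (+ 9) :* s :+ con (+ 1)) :* con (+ 5)) refl s)
    go 2 _ = residue-2e 1 0 (+ 2 ℤ.+ s ℤ.* + 5) 3 ((+ 15) ℤ.* s ℤ.* s ℤ.+ (+ 15) ℤ.* s ℤ.+ (+ 3)) (s≤s (s≤s (s≤s (s≤s z≤n)))) (solve 1 (λ s → con (+ 3) :* G⟨ 1 , 0 ⟩ (con (+ 2) :+ s :* con (+ 5)) := con (+ 3) :+ (con (+ 15) :* s :* s :+ con (+ 15) :* s :+ con (+ 3)) :* con (+ 5)) refl s)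
    go 3 _ = residue-2e 1 0 (+ 3 ℤ.+ s ℤ.* + 5) 1 ((+ 15) ℤ.* s ℤ.* s ℤ.+ (+ 21) ℤ.* s ℤ.+ (+ 7)) (s≤s (s≤s z≤n)) (solve 1 (λ s → con (+ 3) :* G⟨ 1 , 0 ⟩ (con (+ 3) :+ s :* con (+ 5)) := con (+ 1) :+ (con (+ 15) :* s :* s :+ con (+ 21) :* s :+ con (+ 7)) :* con (+ 5)) refl s)
    go 4 _ = residue-2e 1 0 (+ 4 ℤ.+ s ℤ.* + 5) 0 ((+ 15) ℤ.* s ℤ.* s ℤ.+ (+ 27) ℤ.* s ℤ.+ (+ 12)) (s≤s z≤n) (solve 1 (λ s → con (+ 3) :* G⟨ 1 , 0 ⟩ (con (+ 4) :+ s :* con (+ 5)) := con (+ 0) :+ (con (+ 15) :* s :* s :+ con (+ 27) :* s :+ con (+ 12)) :* con (+ 5)) refl s)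
    go (suc (suc (suc (suc (suc _))))) (s≤s (s≤s (s≤s (s≤s (s≤s ())))))

  e-%5 : ∀ i j (c : ℕ → ℕ) → (∀ r s → r < 5 → e i j (+ r ℤ.+ s ℤ.* + 5) % 5 ≡ c r) → ∀ n → e i j n % 5 ≡ c (n ℤ.%ℕ 5)
  e-%5 i j c p n = trans (cong (λ n → e i j n % 5) (ℤ.a≡a%ℕn+[a/ℕn]*n n 5)) (p (n ℤ.%ℕ 5) (n ℤ./ℕ 5) (ℤ.n%ℕd<d n 5))

f₁-off : ∀ r → (∀ k → pent-residue k ≢ r) → ∀ n → n % 5 ≡ r → f 1 n ≡ 0ℤ
f₁-off r p n refl = trans (pentagonal n) (Θ-empty (Levels-e 2 1) sgn n (λ k eq → p (k ℤ.%ℕ 5) (trans (sym (e-%5 2 1 pent-residue pent-class k)) (cong (_% 5) eq))))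

f₁³-off : ∀ n → n % 5 ≡ 2 → f₁³ n ≡ 0ℤ
f₁³-off n n≡2 = ℤ.*-cancelˡ-≡ (+ 2) (f₁³ n) 0ℤ (trans (sym (scale-at (+ 2) f₁³ n)) (trans (sym (jacobi-cube n))
  (Θ-empty (Levels-e 1 0) _ n (λ k eq → never (k ℤ.%ℕ 5) (trans (sym (e-%5 1 0 tri-residue tri-class k)) (trans (cong (_% 5) eq) n≡2))))))
  where
  never : ∀ r → tri-residue r ≢ 2
  never 0 ()
  never 1 ()
  never 2 ()
  never 3 ()
  never (suc (suc (suc (suc _)))) ()

-- The exponents of f₁ congruent to 1 modulo 5 come from n = -1 - 5s, and they reproduce f₁ itself, dilated.
pick-1-f₁ : pick 1 (f 1) ≈ neg (mono 1ℤ 1 ✶ f 25)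
pick-1-f₁ = ≈-trans pick≈ (≈-trans (Θ-neg lv₁ sgn) (neg-cong (≈-trans (Θ-shift (Levels-dil 25 (Levels-e 2 1)) 1 sgn)
  (✶-congˡ (mono 1ℤ 1) (≈-trans (≈-sym (dil-Θ 25 (Levels-e 2 1) sgn)) (≈-trans (dil-cong 25 (≈-sym pentagonal)) (dil-f 25 1)))))))
  where
  E₁ : ℤ → ℕ
  E₁ s = 1 + e 2 1 s * 25
  lv₁ : Levels E₁
  lv₁ = Levels-+ (Levels-dil 25 (Levels-e 2 1)) 1
  ρ : ℤ → ℤ
  ρ s = + 4 ℤ.+ (ℤ.- 1ℤ ℤ.- s) ℤ.* + 5
  Eρ : ∀ s → e 2 1 (ρ s) ≡ E₁ s
  Eρ s = double-injective (trans (⟦2e⟧ 2 1 (ρ s)) (trans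
    (solve 1 (λ s → G⟨ 2 , 1 ⟩ (con (+ 4) :+ (:- con 1ℤ :- s) :* con (+ 5)) := con (+ 2) :+ G⟨ 2 , 1 ⟩ s :* con (+ 25)) refl s)
    (sym (trans (⟦2+⟧ 1 (e 2 1 s * 25)) (cong (λ y → + 2 ℤ.+ y) (trans (cong (λ y → + 2 ℤ.* y) (ℤ.pos-* (e 2 1 s) 25))
      (trans (sym (ℤ.*-assoc (+ 2) (+ e 2 1 s) (+ 25))) (cong (λ y → y ℤ.* + 25) (⟦2e⟧ 2 1 s)))))))))
  sgnρ : ∀ s → sgn (ρ s) ≡ ℤ.- sgn s
  sgnρ s = trans (sgn-parity′ s (ℤ.- 1ℤ ℤ.- + 3 ℤ.* s) (solve 1 (λ s → con (+ 4) :+ (:- con 1ℤ :- s) :* con (+ 5) := s :+ con 1ℤ :+ con (+ 2) :* (:- con 1ℤ :- con (+ 3) :* s)) refl s))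
    (ℤ.-1*i≡-i (sgn s))
  E₁%5 : ∀ s → E₁ s % 5 ≡ 1
  E₁%5 s = trans (cong (λ y → suc y % 5) (sym (ℕ.*-assoc (e 2 1 s) 5 5))) ([m+kn]%n≡m%n 1 (e 2 1 s * 5) 5)
  ρ-inj : ∀ {s t} → ρ s ≡ ρ t → s ≡ t
  ρ-inj {s} {t} eq = trans (lemma s) (trans (cong (λ y → ℤ.- 1ℤ ℤ.- y) (proj₁ (divMod-unique 4 4 (ℤ.- 1ℤ ℤ.- s) (ℤ.- 1ℤ ℤ.- t) ℕ.≤-refl ℕ.≤-refl eq))) (sym (lemma t)))
    where
    lemma : ∀ s → s ≡ ℤ.- 1ℤ ℤ.- (ℤ.- 1ℤ ℤ.- s)
    lemma = ℤ-Solver.solve-∀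
  only-4 : ∀ r → r < 5 → pent-residue r ≡ 1 → r ≡ 4
  only-4 4 _ _ = refl
  only-4 (suc (suc (suc (suc (suc _))))) (s≤s (s≤s (s≤s (s≤s (s≤s ()))))) _
  in-ρ : ∀ k → e 2 1 k % 5 ≡ 1 → ∃ λ s → k ≡ ρ s
  in-ρ k p = ℤ.- 1ℤ ℤ.- k ℤ./ℕ 5 , trans (ℤ.a≡a%ℕn+[a/ℕn]*n k 5)
    (cong₂ (λ r s → + r ℤ.+ s ℤ.* + 5) (only-4 _ (ℤ.n%ℕd<d k 5) (trans (sym (e-%5 2 1 pent-residue pent-class k)) p)) (lemma (k ℤ./ℕ 5)))
    where
    lemma : ∀ s → s ≡ ℤ.- 1ℤ ℤ.- (ℤ.- 1ℤ ℤ.- s)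
    lemma = ℤ-Solver.solve-∀
  pick≈ : pick 1 (f 1) ≈ Θ lv₁ (λ s → ℤ.- sgn s)
  pick≈ n = go (n % 5 ℕ.≟ 1)
    where
    go : Dec (n % 5 ≡ 1) → pick 1 (f 1) n ≡ Θ lv₁ (λ s → ℤ.- sgn s) n
    go (no n≢1)  = trans (pickˢ 1 (f 1) n n≢1) (sym (Θ-empty lv₁ _ n (λ s eq → n≢1 (trans (cong (_% 5) (sym eq)) (E₁%5 s)))))
    go (yes n≡1) = trans (pick-at 1 (f 1) n n≡1) (trans (pentagonal n) (trans
      (sumL-set sgn (unique (Levels-e 2 1) n) (Unique.map⁺ ρ-inj (unique lv₁ n)) into outof)
      (trans (sumL-map sgn ρ (lev lv₁ n)) (sumL-cong (lev lv₁ n) (λ {s} _ → sgnρ s)))))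
      where
      into : ∀ {k} → k ∈ lev (Levels-e 2 1) n → k ∈ map ρ (lev lv₁ n)
      into {k} k∈ with in-ρ k (trans (cong (_% 5) (sound (Levels-e 2 1) {n} k∈)) n≡1)
      ... | s , refl = ∈-map⁺ ρ (complete lv₁ {n} {s} (trans (sym (Eρ s)) (sound (Levels-e 2 1) {n} k∈)))
      outof : ∀ {k} → k ∈ map ρ (lev lv₁ n) → k ∈ lev (Levels-e 2 1) n
      outof k∈ with ∈-map⁻ ρ k∈
      ... | s , s∈ , refl = complete (Levels-e 2 1) {n} (trans (Eρ s) (sound lv₁ s∈))

a e₁ b₂ : Series
a  = pick 0 (f 1)
e₁ = pick 1 (f 1)
b₂ = pick 2 (f 1)

f₁-dissection : f 1 ≈ a ⊞ (e₁ ⊞ b₂)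
f₁-dissection n = trans (go (n % 5) refl (m%n<n n 5)) (sym (trans (⊞-at a (e₁ ⊞ b₂) n) (cong (λ y → a n ℤ.+ y) (⊞-at e₁ b₂ n))))
  where
  at0 : ∀ r → n % 5 ≢ r → pick r (f 1) n ≡ 0ℤ
  at0 r = pickˢ r (f 1) n
  go : ∀ r → n % 5 ≡ r → r < 5 → f 1 n ≡ a n ℤ.+ (e₁ n ℤ.+ b₂ n)
  go 0 eq _ = sym (trans (cong₂ ℤ._+_ (pick-at 0 (f 1) n eq) (cong₂ ℤ._+_ (at0 1 (λ p → ℕ.0≢1+n (trans (sym eq) p))) (at0 2 (λ p → ℕ.0≢1+n (trans (sym eq) p))))) (ℤ.+-identityʳ _))
  go 1 eq _ = sym (trans (cong₂ ℤ._+_ (at0 0 (λ p → ℕ.1+n≢0 (trans (sym eq) p))) (cong₂ ℤ._+_ (pick-at 1 (f 1) n eq) (at0 2 (λ p → ℕ.0≢1+n (ℕ.suc-injective (trans (sym eq) p)))))) (trans (ℤ.+-identityˡ _) (ℤ.+-identityʳ _)))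
  go 2 eq _ = sym (trans (cong₂ ℤ._+_ (at0 0 (λ p → ℕ.1+n≢0 (trans (sym eq) p))) (cong₂ ℤ._+_ (at0 1 (λ p → ℕ.1+n≢0 (ℕ.suc-injective (trans (sym eq) p)))) (pick-at 2 (f 1) n eq))) (trans (ℤ.+-identityˡ _) (ℤ.+-identityˡ _)))
  go 3 eq _ = trans (f₁-off 3 (λ { 0 () ; 1 () ; 2 () ; 3 () ; (suc (suc (suc (suc _)))) () }) n eq) (sym (cong₂ ℤ._+_ (at0 0 (λ p → ℕ.1+n≢0 (trans (sym eq) p))) (cong₂ ℤ._+_ (at0 1 (λ p → ℕ.1+n≢0 (ℕ.suc-injective (trans (sym eq) p)))) (at0 2 (λ p → ℕ.1+n≢0 (ℕ.suc-injective (ℕ.suc-injective (trans (sym eq) p))))))))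
  go 4 eq _ = trans (f₁-off 4 (λ { 0 () ; 1 () ; 2 () ; 3 () ; (suc (suc (suc (suc _)))) () }) n eq) (sym (cong₂ ℤ._+_ (at0 0 (λ p → ℕ.1+n≢0 (trans (sym eq) p))) (cong₂ ℤ._+_ (at0 1 (λ p → ℕ.1+n≢0 (ℕ.suc-injective (trans (sym eq) p)))) (at0 2 (λ p → ℕ.1+n≢0 (ℕ.suc-injective (ℕ.suc-injective (trans (sym eq) p))))))))
  go (suc (suc (suc (suc (suc _))))) _ (s≤s (s≤s (s≤s (s≤s (s≤s ())))))

a-at-0 : a 0 ≡ 1ℤ
a-at-0 = trans (pick-at 0 (f 1) 0 refl) (f-at-0 1)

scale-1 : ∀ F → scale 1ℤ F ≈ F
scale-1 F n = trans (scale-at 1ℤ F n) (ℤ.*-identityˡ (F n))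

-- No exponent of f₁³ is 2 modulo 5, and 3 a (e₁² + a b₂) is the part of f₁³ on that class.
dissection-relation : e₁ ✶ e₁ ⊞ a ✶ b₂ ≈ 0S
dissection-relation = ✶-cancelˡ a a-at-0 (≈-trans (const-cancel (+ 3) (≈-trans (≈-sym (W₂-factor a e₁ b₂)) (≈-trans W₂≈0 (≈-sym (✶-zeroʳ _))))) (≈-sym (✶-zeroʳ a)))
  where
  aˢ : Supp 0 a
  aˢ = pickˢ 0 (f 1)
  eˢ : Supp 1 e₁
  eˢ = pickˢ 1 (f 1)
  bˢ : Supp 2 b₂
  bˢ = pickˢ 2 (f 1)
  W₂≈0 : W₂ a e₁ b₂ ≈ 0S
  W₂≈0 = begin
    W₂ a e₁ b₂      ≈⟨ ≈-trans (⊞-cong (Z (W₀ a e₁ b₂)) (⊞-cong (Z (W₁ a e₁ b₂)) (⊞-cong (scale-1 _) (⊞-cong (Z (W₃ a e₁ b₂)) (Z (W₄ a e₁ b₂))))))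
                         (≈-trans (⊞-identityˡ _) (≈-trans (⊞-identityˡ _) (≈-trans (⊞-congˡ (W₂ a e₁ b₂) (⊞-identityˡ _)) (⊞-identityʳ _)))) ⟨
    scale 0ℤ (W₀ a e₁ b₂) ⊞ (scale 0ℤ (W₁ a e₁ b₂) ⊞ (scale 1ℤ (W₂ a e₁ b₂) ⊞ (scale 0ℤ (W₃ a e₁ b₂) ⊞ scale 0ℤ (W₄ a e₁ b₂))))
                    ≈⟨ twist-split (δ 2)
                         (constˢ (+ 1) ✶ˢ aˢ ✶ˢ aˢ ✶ˢ aˢ ⊞ˢ constˢ (+ 3) ✶ˢ eˢ ✶ˢ bˢ ✶ˢ bˢ)
                         (constˢ (+ 3) ✶ˢ aˢ ✶ˢ aˢ ✶ˢ eˢ ⊞ˢ constˢ (+ 1) ✶ˢ bˢ ✶ˢ bˢ ✶ˢ bˢ)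
                         (constˢ (+ 3) ✶ˢ aˢ ✶ˢ aˢ ✶ˢ bˢ ⊞ˢ constˢ (+ 3) ✶ˢ aˢ ✶ˢ eˢ ✶ˢ eˢ)
                         (constˢ (+ 6) ✶ˢ aˢ ✶ˢ eˢ ✶ˢ bˢ ⊞ˢ constˢ (+ 1) ✶ˢ eˢ ✶ˢ eˢ ✶ˢ eˢ)
                         (constˢ (+ 3) ✶ˢ aˢ ✶ˢ bˢ ✶ˢ bˢ ⊞ˢ constˢ (+ 3) ✶ˢ eˢ ✶ˢ eˢ ✶ˢ bˢ) ⟨
    pick 2 (W₀ a e₁ b₂ ⊞ (W₁ a e₁ b₂ ⊞ (W₂ a e₁ b₂ ⊞ (W₃ a e₁ b₂ ⊞ W₄ a e₁ b₂))))
                    ≈⟨ twist-cong (δ 2) (≈-sym (≈-trans (✶-cong f₁-dissection (✶-cong f₁-dissection f₁-dissection)) (cube-split a e₁ b₂))) ⟩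
    pick 2 f₁³      ≈⟨ vanish ⟩
    0S              ∎
    where
    open ≈-Reasoning
    Z : ∀ F → scale 0ℤ F ≈ 0S
    Z F n = scale-at 0ℤ F n
    vanish : pick 2 f₁³ ≈ 0S
    vanish n = go (n % 5 ℕ.≟ 2)
      where
      go : Dec (n % 5 ≡ 2) → pick 2 f₁³ n ≡ 0ℤ
      go (yes p) = trans (pick-at 2 f₁³ n p) (f₁³-off n p)
      go (no p)  = pickˢ 2 f₁³ n p

-- Norm and conorm of f₁, and the arithmetic of D

infixr 8 _^5
_^5 : Series → Series
F ^5 = F ✶ (F ✶ (F ✶ (F ✶ F)))

✶-left-comm : ∀ F G H → F ✶ (G ✶ H) ≈ G ✶ (F ✶ H)
✶-left-comm = ✶-Properties.x∙yz≈y∙xz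

neg-involutive : ∀ F → neg (neg F) ≈ F
neg-involutive F n = trans (neg-at (neg F) n) (trans (cong ℤ.-_ (neg-at F n)) (ℤ.neg-involutive (F n)))

-- The signs of the classical form f₁ = `a` - `e₅` - `b₅`, in which `e₅` = q f₂₅ and `e₅`² = `a`
-- `b₅`.
e₅ b₅ : Series
e₅ = neg e₁
b₅ = neg b₂

private
  aˢ : Supp 0 a
  aˢ = pickˢ 0 (f 1)
  eˢ : Supp 1 e₅
  eˢ = negˢ (pickˢ 1 (f 1))
  bˢ : Supp 2 b₅
  bˢ = negˢ (pickˢ 2 (f 1))

  Y₀ˢ : Supp 0 (Y₀ a e₅ b₅)
  Y₀ˢ = constˢ (+ 5) ✶ˢ eˢ ✶ˢ eˢ ✶ˢ eˢ ✶ˢ eˢ ✶ˢ eˢ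
  Y₁ˢ : Supp 1 (Y₁ a e₅ b₅)
  Y₁ˢ = constˢ (+ 1) ✶ˢ aˢ ✶ˢ aˢ ✶ˢ aˢ ✶ˢ aˢ ✶ˢ eˢ ⊞ˢ constˢ (-[1+ 2 ]) ✶ˢ eˢ ✶ˢ eˢ ✶ˢ eˢ ✶ˢ eˢ ✶ˢ bˢ
  Y₂ˢ : Supp 2 (Y₂ a e₅ b₅)
  Y₂ˢ = constˢ (+ 1) ✶ˢ aˢ ✶ˢ aˢ ✶ˢ aˢ ✶ˢ eˢ ✶ˢ eˢ ⊞ˢ constˢ (+ 2) ✶ˢ eˢ ✶ˢ eˢ ✶ˢ eˢ ✶ˢ bˢ ✶ˢ bˢ
  Y₃ˢ : Supp 3 (Y₃ a e₅ b₅)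
  Y₃ˢ = constˢ (+ 2) ✶ˢ aˢ ✶ˢ aˢ ✶ˢ eˢ ✶ˢ eˢ ✶ˢ eˢ ⊞ˢ constˢ (-[1+ 0 ]) ✶ˢ eˢ ✶ˢ eˢ ✶ˢ bˢ ✶ˢ bˢ ✶ˢ bˢ
  Y₄ˢ : Supp 4 (Y₄ a e₅ b₅)
  Y₄ˢ = constˢ (+ 3) ✶ˢ aˢ ✶ˢ eˢ ✶ˢ eˢ ✶ˢ eˢ ✶ˢ eˢ ⊞ˢ constˢ (+ 1) ✶ˢ eˢ ✶ˢ bˢ ✶ˢ bˢ ✶ˢ bˢ ✶ˢ bˢ
  Z₀ˢ : Supp 0 (Z₀ a e₅ b₅)
  Z₀ˢ = constˢ (+ 1) ✶ˢ aˢ ✶ˢ aˢ ✶ˢ aˢ ✶ˢ aˢ ✶ˢ aˢ ⊞ˢ constˢ (-[1+ 10 ]) ✶ˢ eˢ ✶ˢ eˢ ✶ˢ eˢ ✶ˢ eˢ ✶ˢ eˢ ⊞ˢ constˢ (-[1+ 0 ]) ✶ˢ bˢ ✶ˢ bˢ ✶ˢ bˢ ✶ˢ bˢ ✶ˢ bˢ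
  Z₁ˢ : Supp 1 (Z₁ a e₅ b₅)
  Z₁ˢ = constˢ (-[1+ 4 ]) ✶ˢ aˢ ✶ˢ aˢ ✶ˢ aˢ ✶ˢ aˢ ✶ˢ eˢ ⊞ˢ constˢ (+ 15) ✶ˢ eˢ ✶ˢ eˢ ✶ˢ eˢ ✶ˢ eˢ ✶ˢ bˢ
  Z₂ˢ : Supp 2 (Z₂ a e₅ b₅)
  Z₂ˢ = constˢ (+ 5) ✶ˢ aˢ ✶ˢ aˢ ✶ˢ aˢ ✶ˢ eˢ ✶ˢ eˢ ⊞ˢ constˢ (+ 10) ✶ˢ eˢ ✶ˢ eˢ ✶ˢ eˢ ✶ˢ bˢ ✶ˢ bˢ
  Z₃ˢ : Supp 3 (Z₃ a e₅ b₅)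
  Z₃ˢ = constˢ (+ 10) ✶ˢ aˢ ✶ˢ aˢ ✶ˢ eˢ ✶ˢ eˢ ✶ˢ eˢ ⊞ˢ constˢ (-[1+ 4 ]) ✶ˢ eˢ ✶ˢ eˢ ✶ˢ bˢ ✶ˢ bˢ ✶ˢ bˢ
  Z₄ˢ : Supp 4 (Z₄ a e₅ b₅)
  Z₄ˢ = constˢ (-[1+ 14 ]) ✶ˢ aˢ ✶ˢ eˢ ✶ˢ eˢ ✶ˢ eˢ ✶ˢ eˢ ⊞ˢ constˢ (-[1+ 4 ]) ✶ˢ eˢ ✶ˢ bˢ ✶ˢ bˢ ✶ˢ bˢ ✶ˢ bˢ

  f₁≈ : f 1 ≈ a ⊞ (neg e₅ ⊞ neg b₅)
  f₁≈ = ≈-trans f₁-dissection (⊞-congˡ a (⊞-cong (≈-sym (neg-involutive e₁)) (≈-sym (neg-involutive b₂))))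

  relation : e₅ ✶ e₅ ⊞ neg (a ✶ b₅) ≈ 0S
  relation = ≈-trans (neg-square a e₁ b₂) dissection-relation

  drop-relation : ∀ F K → F ⊞ (e₅ ✶ e₅ ⊞ neg (a ✶ b₅)) ✶ K ≈ F
  drop-relation F K = ≈-trans (⊞-congˡ F (≈-trans (✶-congʳ K relation) (✶-zeroˡ K))) (⊞-identityʳ F)

  f₅ˢ : Supp 0 (f 5)
  f₅ˢ = Supp-cong (dil-f 5 1) (dilˢ (f 1))

  scale-0 : ∀ F → scale 0ℤ F ≈ 0S
  scale-0 F n = scale-at 0ℤ F n

  e₅≈ : e₅ ≈ mono 1ℤ 1 ✶ f 25
  e₅≈ = ≈-trans (neg-cong pick-1-f₁) (neg-involutive _)

^5-cong : ∀ {F G} → F ≈ G → F ^5 ≈ G ^5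
^5-cong p = ✶-cong p (✶-cong p (✶-cong p (✶-cong p p)))

dil-^5 : ∀ k .{{_ : NonZero k}} F → dil k (F ^5) ≈ dil k F ^5
dil-^5 k F = step (step (step (dil-✶ k F F)))
  where
  step : ∀ {G H} → dil k G ≈ H → dil k (F ✶ G) ≈ dil k F ✶ H
  step {G} p = ≈-trans (dil-✶ k F G) (✶-congˡ (dil k F) p)

B-at : ∀ n → B n ≡ one n ℤ.- + 5 ℤ.* H n
B-at n = trans (⊞-at (const 1ℤ) _ n) (cong₂ ℤ._+_ (sym (one≈const n)) (trans (neg-at _ n) (cong ℤ.-_ (trans (✶-const (+ 5) H n) (scale-at (+ 5) H n)))))

f₁⁵-split : f 1 ^5 ≈ Z₀ a e₅ b₅ ⊞ (Z₁ a e₅ b₅ ⊞ (Z₂ a e₅ b₅ ⊞ (Z₃ a e₅ b₅ ⊞ Z₄ a e₅ b₅)))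
f₁⁵-split = ≈-trans (^5-cong f₁≈) (≈-trans (quintic a e₅ b₅) (drop-relation _ (K₁ a e₅ b₅)))

pick-0-B : pick 0 B ≈ dil 5 B
pick-0-B n = go (n % 5 ℕ.≟ 0)
  where
  go : Dec (n % 5 ≡ 0) → pick 0 B n ≡ dil 5 B n
  go (no n≢0)  = trans (pickˢ 0 B n n≢0) (sym (dilˢ B n n≢0))
  go (yes n≡0) = trans (pick-at 0 B n n≡0) (multiple n (n / 5) (trans (m≡m%n+[m/n]*n n 5) (cong (λ y → y + n / 5 * 5) n≡0)))
    where
    multiple : ∀ n q → n ≡ q * 5 → B n ≡ dil 5 B n
    multiple _ q refl = trans (trans (B-at (q * 5)) (trans (cong₂ (λ x y → x ℤ.- + 5 ℤ.* y) (trans (cong one (ℕ.*-comm q 5)) (one-* 5 q)) (trans (cong H (ℕ.*-comm q 5)) (H-5* q))) (sym (B-at q)))) (sym (dil-* 5 B q))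

-- `Z₀` is the class 0 part of f₁⁵ = f₅ `B`. By H(5n) = H(n) this part is f₅ B(q⁵), and f₂₅ B(q⁵) =
-- f₅⁵ is `B-eta` at q⁵.
norm : f 25 ✶ Z₀ a e₅ b₅ ≈ f 5 ✶ f 5 ^5
norm = begin
  f 25 ✶ Z₀ a e₅ b₅            ≈⟨ ✶-congˡ (f 25) Z₀≈ ⟩
  f 25 ✶ (f 5 ✶ dil 5 B)       ≈⟨ ✶-left-comm (f 25) (f 5) (dil 5 B) ⟩
  f 5 ✶ (f 25 ✶ dil 5 B)       ≈⟨ ✶-congˡ (f 5) (✶-congʳ (dil 5 B) (dil-f 5 5)) ⟨
  f 5 ✶ (dil 5 (f 5) ✶ dil 5 B) ≈⟨ ✶-congˡ (f 5) (≈-trans (≈-sym (dil-✶ 5 (f 5) B)) (≈-trans (dil-cong 5 B-eta) (dil-^5 5 (f 1)))) ⟩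
  f 5 ✶ dil 5 (f 1) ^5         ≈⟨ ✶-congˡ (f 5) (^5-cong (dil-f 5 1)) ⟩
  f 5 ✶ f 5 ^5                 ∎
  where
  open ≈-Reasoning
  Z₀≈ : Z₀ a e₅ b₅ ≈ f 5 ✶ dil 5 B
  Z₀≈ = begin
    Z₀ a e₅ b₅            ≈⟨ ≈-trans (⊞-cong (scale-1 _) (⊞-cong (scale-0 _) (⊞-cong (scale-0 _) (⊞-cong (scale-0 _) (scale-0 _)))))
                               (≈-trans (⊞-congˡ _ (≈-trans (⊞-identityˡ _) (≈-trans (⊞-identityˡ _) (⊞-identityˡ _)))) (⊞-identityʳ _)) ⟨
    scale 1ℤ (Z₀ a e₅ b₅) ⊞ (scale 0ℤ (Z₁ a e₅ b₅) ⊞ (scale 0ℤ (Z₂ a e₅ b₅) ⊞ (scale 0ℤ (Z₃ a e₅ b₅) ⊞ scale 0ℤ (Z₄ a e₅ b₅))))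
                          ≈⟨ twist-split (δ 0) Z₀ˢ Z₁ˢ Z₂ˢ Z₃ˢ Z₄ˢ ⟨
    pick 0 (Z₀ a e₅ b₅ ⊞ (Z₁ a e₅ b₅ ⊞ (Z₂ a e₅ b₅ ⊞ (Z₃ a e₅ b₅ ⊞ Z₄ a e₅ b₅))))
                          ≈⟨ twist-cong (δ 0) (≈-trans (≈-sym f₁⁵-split) (≈-sym B-eta)) ⟩
    pick 0 (f 5 ✶ B)      ≈⟨ twist-✶ (δ 0) (f 5) B f₅ˢ ⟩
    f 5 ✶ pick 0 B        ≈⟨ ✶-congˡ (f 5) pick-0-B ⟩
    f 5 ✶ dil 5 B         ∎

module Quotient (C : Series) (C-eta : f 1 ✶ C ≈ f 5 ^5) where

  D : Series
  D = mono 1ℤ 1 ✶ C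

  -- Norm and conorm give 1/f₁ = f₂₅ `Pol` / f₅⁶, Ramanujan's 5-dissection of the generating
  -- function of partitions, here multiplied by f₅⁶.
  C-split : f 5 ✶ C ≈ f 25 ✶ Pol a e₅ b₅
  C-split = ✶-cancelˡ (f 1) (f-at-0 1) (begin
    f 1 ✶ (f 5 ✶ C)              ≈⟨ ✶-left-comm (f 1) (f 5) C ⟩
    f 5 ✶ (f 1 ✶ C)              ≈⟨ ✶-congˡ (f 5) C-eta ⟩
    f 5 ✶ f 5 ^5                 ≈⟨ norm ⟨
    f 25 ✶ Z₀ a e₅ b₅            ≈⟨ ✶-congˡ (f 25) (≈-trans (✶-congʳ (Pol a e₅ b₅) f₁≈) (≈-trans (conorm a e₅ b₅) (drop-relation _ (K₂ a e₅ b₅)))) ⟨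
    f 25 ✶ (f 1 ✶ Pol a e₅ b₅)   ≈⟨ ✶-left-comm (f 25) (f 1) _ ⟩
    f 1 ✶ (f 25 ✶ Pol a e₅ b₅)   ∎)
    where open ≈-Reasoning

  -- The factor q in `D` is what completes f₂₅ to `e₅`, so that the dissection becomes homogeneous
  -- of degree 5.
  D-split : f 5 ✶ D ≈ Y₀ a e₅ b₅ ⊞ (Y₁ a e₅ b₅ ⊞ (Y₂ a e₅ b₅ ⊞ (Y₃ a e₅ b₅ ⊞ Y₄ a e₅ b₅)))
  D-split = begin
    f 5 ✶ (mono 1ℤ 1 ✶ C)              ≈⟨ ✶-left-comm (f 5) (mono 1ℤ 1) C ⟩
    mono 1ℤ 1 ✶ (f 5 ✶ C)              ≈⟨ ✶-congˡ (mono 1ℤ 1) C-split ⟩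
    mono 1ℤ 1 ✶ (f 25 ✶ Pol a e₅ b₅)   ≈⟨ ✶-assoc (mono 1ℤ 1) (f 25) _ ⟨
    (mono 1ℤ 1 ✶ f 25) ✶ Pol a e₅ b₅   ≈⟨ ✶-congʳ (Pol a e₅ b₅) e₅≈ ⟨
    e₅ ✶ Pol a e₅ b₅                   ≈⟨ conorm-split a e₅ b₅ ⟩
    Y₀ a e₅ b₅ ⊞ (Y₁ a e₅ b₅ ⊞ (Y₂ a e₅ b₅ ⊞ (Y₃ a e₅ b₅ ⊞ Y₄ a e₅ b₅))) ∎
    where open ≈-Reasoning

  private
    χ² : ℕ → ℤ
    χ² r = χ r ℤ.* χ r

    -- Multiplied by f₅, both series are dissected: `B` into the parts `Z`, `D` into the parts `Y`.
    -- Here `χ²` only removes class 0, and `Z-collect` compares the rest.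
    twisted : twist χ² B ≈ scale -[1+ 4 ] (twist χ D)
    twisted = ✶-cancelˡ (f 5) (f-at-0 5) (begin
      f 5 ✶ twist χ² B          ≈⟨ twist-✶ χ² (f 5) B f₅ˢ ⟨
      twist χ² (f 5 ✶ B)        ≈⟨ twist-cong χ² (≈-trans B-eta f₁⁵-split) ⟩
      twist χ² (Z₀ a e₅ b₅ ⊞ (Z₁ a e₅ b₅ ⊞ (Z₂ a e₅ b₅ ⊞ (Z₃ a e₅ b₅ ⊞ Z₄ a e₅ b₅))))
                                ≈⟨ twist-split χ² Z₀ˢ Z₁ˢ Z₂ˢ Z₃ˢ Z₄ˢ ⟩
      scale 0ℤ (Z₀ a e₅ b₅) ⊞ (scale 1ℤ (Z₁ a e₅ b₅) ⊞ (scale 1ℤ (Z₂ a e₅ b₅) ⊞ (scale 1ℤ (Z₃ a e₅ b₅) ⊞ scale 1ℤ (Z₄ a e₅ b₅))))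
                                ≈⟨ ≈-trans (⊞-cong (scale-0 _) (⊞-cong (scale-1 _) (⊞-cong (scale-1 _) (⊞-cong (scale-1 _) (scale-1 _))))) (⊞-identityˡ _) ⟩
      Z₁ a e₅ b₅ ⊞ (Z₂ a e₅ b₅ ⊞ (Z₃ a e₅ b₅ ⊞ Z₄ a e₅ b₅))
                                ≈⟨ Z-collect a e₅ b₅ ⟩
      const -[1+ 4 ] ✶ (Y₁ a e₅ b₅ ⊞ (const -1ℤ ✶ Y₂ a e₅ b₅ ⊞ (const -1ℤ ✶ Y₃ a e₅ b₅ ⊞ Y₄ a e₅ b₅)))
                                ≈⟨ ✶-congˡ (const -[1+ 4 ]) (≈-sym (≈-trans (⊞-cong (scale-0 _) (⊞-cong (scale-1 _) (⊞-cong (const-✶ -1ℤ _) (⊞-cong (const-✶ -1ℤ _) (scale-1 _))))) (⊞-identityˡ _))) ⟩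
      const -[1+ 4 ] ✶ (scale 0ℤ (Y₀ a e₅ b₅) ⊞ (scale 1ℤ (Y₁ a e₅ b₅) ⊞ (scale -1ℤ (Y₂ a e₅ b₅) ⊞ (scale -1ℤ (Y₃ a e₅ b₅) ⊞ scale 1ℤ (Y₄ a e₅ b₅)))))
                                ≈⟨ ✶-congˡ (const -[1+ 4 ]) (twist-split χ Y₀ˢ Y₁ˢ Y₂ˢ Y₃ˢ Y₄ˢ) ⟨
      const -[1+ 4 ] ✶ twist χ (Y₀ a e₅ b₅ ⊞ (Y₁ a e₅ b₅ ⊞ (Y₂ a e₅ b₅ ⊞ (Y₃ a e₅ b₅ ⊞ Y₄ a e₅ b₅))))
                                ≈⟨ ✶-congˡ (const -[1+ 4 ]) (≈-trans (twist-cong χ (≈-sym D-split)) (twist-✶ χ (f 5) D f₅ˢ)) ⟩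
      const -[1+ 4 ] ✶ (f 5 ✶ twist χ D)
                                ≈⟨ ✶-const -[1+ 4 ] _ ⟩
      scale -[1+ 4 ] (f 5 ✶ twist χ D)
                                ≈⟨ scale-✶ -[1+ 4 ] (f 5) (twist χ D) ⟨
      f 5 ✶ scale -[1+ 4 ] (twist χ D) ∎)
      where open ≈-Reasoning

  D-χH : ∀ n → n % 5 ≢ 0 → D n ≡ χ (n % 5) ℤ.* H n
  D-χH n n≢0 = go (n % 5) refl (m%n<n n 5)
    where
    at : χ² (n % 5) ℤ.* H n ≡ χ (n % 5) ℤ.* D n
    at = ℤ.*-cancelˡ-≡ -[1+ 4 ] _ _ (begin
      -[1+ 4 ] ℤ.* (χ² (n % 5) ℤ.* H n)          ≡⟨ lemma (χ² (n % 5)) (H n) ⟩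
      χ² (n % 5) ℤ.* (0ℤ ℤ.- + 5 ℤ.* H n)        ≡⟨ cong (λ x → χ² (n % 5) ℤ.* (x ℤ.- + 5 ℤ.* H n)) (one-pos n n≢0) ⟨
      χ² (n % 5) ℤ.* (one n ℤ.- + 5 ℤ.* H n)     ≡⟨ cong (λ x → χ² (n % 5) ℤ.* x) (B-at n) ⟨
      twist χ² B n                               ≡⟨ twisted n ⟩
      scale -[1+ 4 ] (twist χ D) n               ≡⟨ scale-at -[1+ 4 ] _ n ⟩
      -[1+ 4 ] ℤ.* (χ (n % 5) ℤ.* D n)           ∎)
      where
      open ≡-Reasoning
      lemma : ∀ c h → -[1+ 4 ] ℤ.* (c ℤ.* h) ≡ c ℤ.* (0ℤ ℤ.- + 5 ℤ.* h)
      lemma = ℤ-Solver.solve-∀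
      one-pos : ∀ n → n % 5 ≢ 0 → one n ≡ 0ℤ
      one-pos zero    p = ⊥-elim (p refl)
      one-pos (suc n) p = refl
    unit : ∀ x h d → x ℤ.* x ≡ 1ℤ → x ℤ.* x ℤ.* h ≡ x ℤ.* d → d ≡ x ℤ.* h
    unit x h d x²≡1 eq = begin
      d                        ≡⟨ ℤ.*-identityˡ d ⟨
      1ℤ ℤ.* d                 ≡⟨ cong (λ y → y ℤ.* d) x²≡1 ⟨
      x ℤ.* x ℤ.* d            ≡⟨ ℤ.*-assoc x x d ⟩
      x ℤ.* (x ℤ.* d)          ≡⟨ cong (λ y → x ℤ.* y) eq ⟨
      x ℤ.* (x ℤ.* x ℤ.* h)    ≡⟨ cong (λ y → x ℤ.* (y ℤ.* h)) x²≡1 ⟩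
      x ℤ.* (1ℤ ℤ.* h)         ≡⟨ cong (λ y → x ℤ.* y) (ℤ.*-identityˡ h) ⟩
      x ℤ.* h                  ∎
      where open ≡-Reasoning
    go : ∀ r → n % 5 ≡ r → r < 5 → D n ≡ χ (n % 5) ℤ.* H n
    go r eq r<5 = unit (χ (n % 5)) (H n) (D n) (trans (cong χ² eq) (χ²≡1 r (λ r≡0 → n≢0 (trans eq r≡0)) r<5)) at
      where
      χ²≡1 : ∀ r → r ≢ 0 → r < 5 → χ² r ≡ 1ℤ
      χ²≡1 0 r≢0 _ = ⊥-elim (r≢0 refl)
      χ²≡1 1 _ _ = refl
      χ²≡1 2 _ _ = refl
      χ²≡1 3 _ _ = refl
      χ²≡1 4 _ _ = refl
      χ²≡1 (suc (suc (suc (suc (suc _))))) _ (s≤s (s≤s (s≤s (s≤s (s≤s ())))))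

  -- The class 0 part of f₅ `D` is the single term `Y₀` = 5`e₅`⁵ = 5q⁵ f₂₅⁵, and q⁵ f₂₅⁵ = f₅ D(q⁵).
  D-5* : ∀ n → D (5 * n) ≡ + 5 ℤ.* D n
  D-5* n = trans (cong D (ℕ.*-comm 5 n)) (trans (sym (pick-at 0 D (n * 5) (m*n%n≡0 n 5)))
    (trans (picked (n * 5)) (trans (scale-at (+ 5) (dil 5 D) (n * 5)) (cong (λ y → + 5 ℤ.* y) (dil-* 5 D n)))))
    where
    open ≈-Reasoning
    Q₁ = mono 1ℤ 1
    Q⁵ : Q₁ ^5 ≈ mono 1ℤ 5
    Q⁵ = ≈-trans (✶-congˡ Q₁ (≈-trans (✶-congˡ Q₁ (≈-trans (✶-congˡ Q₁ (mono-mono 1ℤ 1 1ℤ 1)) (mono-mono 1ℤ 1 1ℤ 2))) (mono-mono 1ℤ 1 1ℤ 3))) (mono-mono 1ℤ 1 1ℤ 4)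
    dil-D : f 5 ✶ dil 5 D ≈ mono 1ℤ 5 ✶ f 25 ^5
    dil-D = begin
      f 5 ✶ dil 5 D                    ≈⟨ ✶-congˡ (f 5) (≈-trans (dil-✶ 5 Q₁ C) (✶-congʳ (dil 5 C) (dil-mono 5 1ℤ 1))) ⟩
      f 5 ✶ (mono 1ℤ 5 ✶ dil 5 C)      ≈⟨ ✶-left-comm (f 5) (mono 1ℤ 5) (dil 5 C) ⟩
      mono 1ℤ 5 ✶ (f 5 ✶ dil 5 C)      ≈⟨ ✶-congˡ (mono 1ℤ 5) (≈-trans (✶-congʳ (dil 5 C) (≈-sym (dil-f 5 1))) (≈-trans (≈-sym (dil-✶ 5 (f 1) C))
                                            (≈-trans (dil-cong 5 C-eta) (≈-trans (dil-^5 5 (f 5)) (^5-cong (dil-f 5 5)))))) ⟩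
      mono 1ℤ 5 ✶ f 25 ^5              ∎
    picked : pick 0 D ≈ scale (+ 5) (dil 5 D)
    picked = ✶-cancelˡ (f 5) (f-at-0 5) (begin
      f 5 ✶ pick 0 D            ≈⟨ ≈-trans (≈-sym (twist-✶ (δ 0) (f 5) D f₅ˢ)) (twist-cong (δ 0) D-split) ⟩
      pick 0 (Y₀ a e₅ b₅ ⊞ (Y₁ a e₅ b₅ ⊞ (Y₂ a e₅ b₅ ⊞ (Y₃ a e₅ b₅ ⊞ Y₄ a e₅ b₅))))
                                ≈⟨ twist-split (δ 0) Y₀ˢ Y₁ˢ Y₂ˢ Y₃ˢ Y₄ˢ ⟩
      scale 1ℤ (Y₀ a e₅ b₅) ⊞ (scale 0ℤ (Y₁ a e₅ b₅) ⊞ (scale 0ℤ (Y₂ a e₅ b₅) ⊞ (scale 0ℤ (Y₃ a e₅ b₅) ⊞ scale 0ℤ (Y₄ a e₅ b₅))))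
                                ≈⟨ ≈-trans (⊞-cong (scale-1 _) (⊞-cong (scale-0 _) (⊞-cong (scale-0 _) (⊞-cong (scale-0 _) (scale-0 _)))))
                                     (≈-trans (⊞-congˡ _ (≈-trans (⊞-identityˡ _) (≈-trans (⊞-identityˡ _) (⊞-identityˡ _)))) (⊞-identityʳ _)) ⟩
      Y₀ a e₅ b₅                ≈⟨ (let p = e₅≈ in ✶-cong (✶-cong (✶-cong (✶-cong (✶-congˡ (const (+ 5)) p) p) p) p) p) ⟩
      Y₀ a (Q₁ ✶ f 25) b₅        ≈⟨ Y₀-power a Q₁ (f 25) b₅ ⟩
      const (+ 5) ✶ (Q₁ ^5 ✶ f 25 ^5) ≈⟨ ✶-congˡ (const (+ 5)) (≈-trans (✶-congʳ (f 25 ^5) Q⁵) (≈-sym dil-D)) ⟩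
      const (+ 5) ✶ (f 5 ✶ dil 5 D)  ≈⟨ ✶-const (+ 5) _ ⟩
      scale (+ 5) (f 5 ✶ dil 5 D)    ≈⟨ scale-✶ (+ 5) (f 5) (dil 5 D) ⟨
      f 5 ✶ scale (+ 5) (dil 5 D)    ∎)

-- Cores, hooks and bead sets

NonIncreasing : List ℕ → Set
NonIncreasing = AllPairs _≥_

conj-∷-≤ : ∀ {x} xs j → j ≤ x → conjugatePart (x ∷ xs) j ≡ suc (conjugatePart xs j)
conj-∷-≤ xs j j≤x = cong length (List.filter-accept (j ℕ.≤?_) j≤x)

conj-∷-> : ∀ {x} xs j → x < j → conjugatePart (x ∷ xs) j ≡ conjugatePart xs j
conj-∷-> xs j x<j = cong length (List.filter-reject (j ℕ.≤?_) (ℕ.<⇒≱ x<j))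

conj-0 : ∀ {xs} j → All (_< j) xs → conjugatePart xs j ≡ 0
conj-0 j []           = refl
conj-0 {x ∷ xs} j (x<j ∷ all) = trans (conj-∷-> xs j x<j) (conj-0 j all)

conj≤length : ∀ xs j → conjugatePart xs j ≤ length xs
conj≤length xs j = List.length-filter (j ℕ.≤?_) xs

-- The hooks of the first row of x ∷ xs are the numbers x - j + conjugatePart xs (1 + j), j < x.
RowOK : ℕ → List ℕ → Set
RowOK x xs = ∀ j → j < x → ¬ 5 ∣ (x ∸ j + conjugatePart xs (suc j))

RowsOK : List ℕ → Set
RowsOK []       = ⊤
RowsOK (x ∷ xs) = RowOK x xs × RowsOK xs

hook-zero : ∀ x xs (j : Fin x) → hook (x ∷ xs) zero j ≡ + (x ∸ toℕ j + conjugatePart xs (suc (toℕ j)))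
hook-zero x xs j = begin
  + x ℤ.+ + conjugatePart (x ∷ xs) (suc k) ℤ.- + 1 ℤ.- + suc k ℤ.+ 1ℤ
    ≡⟨ cong (λ c → + x ℤ.+ + c ℤ.- + 1 ℤ.- + suc k ℤ.+ 1ℤ) (conj-∷-≤ xs (suc k) k<x) ⟩
  + x ℤ.+ (1ℤ ℤ.+ + c) ℤ.- + 1 ℤ.- (1ℤ ℤ.+ + k) ℤ.+ 1ℤ
    ≡⟨ lemma (+ x) (+ c) (+ k) ⟩
  + x ℤ.- + k ℤ.+ + c
    ≡⟨ cong (λ y → y ℤ.+ + c) (trans (ℤ.m-n≡m⊖n x k) (ℤ.⊖-≥ (ℕ.<⇒≤ k<x))) ⟩
  + (x ∸ k) ℤ.+ + c
    ≡⟨ ℤ.pos-+ (x ∸ k) c ⟨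
  + (x ∸ k + c) ∎
  where
  open ≡-Reasoning
  k = toℕ j
  c = conjugatePart xs (suc k)
  k<x : k < x
  k<x = Fin.toℕ<n j
  lemma : ∀ x c k → x ℤ.+ (1ℤ ℤ.+ c) ℤ.- + 1 ℤ.- (1ℤ ℤ.+ k) ℤ.+ 1ℤ ≡ x ℤ.- k ℤ.+ c
  lemma = ℤ-Solver.solve-∀

-- A new first row raises the row index and the height of the column by one each, and the two
-- cancel. Thus the core condition can be checked row by row.
hook-suc : ∀ x xs (i : Fin (length xs)) (j : Fin (lookup xs i)) → lookup xs i ≤ x → hook (x ∷ xs) (suc i) j ≡ hook xs i j
hook-suc x xs i j ≤x = begin
  + l ℤ.+ + conjugatePart (x ∷ xs) (suc k) ℤ.- + suc (suc (toℕ i)) ℤ.- + suc k ℤ.+ 1ℤ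
    ≡⟨ cong (λ c → + l ℤ.+ + c ℤ.- + suc (suc (toℕ i)) ℤ.- + suc k ℤ.+ 1ℤ) (conj-∷-≤ xs (suc k) (ℕ.≤-trans (Fin.toℕ<n j) ≤x)) ⟩
  + l ℤ.+ (1ℤ ℤ.+ + c) ℤ.- (1ℤ ℤ.+ + suc (toℕ i)) ℤ.- + suc k ℤ.+ 1ℤ
    ≡⟨ lemma (+ l) (+ c) (+ suc (toℕ i)) (+ suc k) ⟩
  hook xs i j ∎
  where
  open ≡-Reasoning
  l = lookup xs i
  k = toℕ j
  c = conjugatePart xs (suc k)
  lemma : ∀ l c i k → l ℤ.+ (1ℤ ℤ.+ c) ℤ.- (1ℤ ℤ.+ i) ℤ.- k ℤ.+ 1ℤ ≡ l ℤ.+ c ℤ.- i ℤ.- k ℤ.+ 1ℤ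
  lemma = ℤ-Solver.solve-∀

lookup≤ : ∀ {x xs} → All (_≤ x) xs → ∀ i → lookup xs i ≤ x
lookup≤ (p ∷ ps) zero    = p
lookup≤ (p ∷ ps) (suc i) = lookup≤ ps i

core⇒rows : ∀ {xs} → NonIncreasing xs → IsCore 5 xs → RowsOK xs
core⇒rows []        core = tt
core⇒rows {x ∷ xs} (x≥ ∷ dec) core =
  (λ j j<x 5∣ → core zero (fromℕ< j<x) (subst (λ h → 5 ∣ ℤ.∣ h ∣)
    (sym (trans (hook-zero x xs (fromℕ< j<x)) (cong (λ k → + (x ∸ k + conjugatePart xs (suc k))) (Fin.toℕ-fromℕ< j<x)))) 5∣)) ,
  core⇒rows dec (λ i j 5∣ → core (suc i) j (subst (λ h → 5 ∣ ℤ.∣ h ∣) (sym (hook-suc x xs i j (lookup≤ x≥ i))) 5∣))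

rows⇒core : ∀ {xs} → NonIncreasing xs → RowsOK xs → IsCore 5 xs
rows⇒core {x ∷ xs} (x≥ ∷ dec) (row , rows) zero    j 5∣ = row (toℕ j) (Fin.toℕ<n j) (subst (λ h → 5 ∣ ℤ.∣ h ∣) (hook-zero x xs j) 5∣)
rows⇒core {x ∷ xs} (x≥ ∷ dec) (row , rows) (suc i) j 5∣ = rows⇒core dec rows i j (subst (λ h → 5 ∣ ℤ.∣ h ∣) (hook-suc x xs i j (lookup≤ x≥ i)) 5∣)

-- First-column hook lengths
beads : List ℕ → List ℕ
beads []       = []
beads (x ∷ xs) = x + length xs ∷ beads xs

-- The empty positions of the abacus, one for each column: `gap∉beads` and `nonbead-is-gap` identify
-- them with the complement of the bead set. By `row-gap` the hooks of a new first row are its bead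
-- minus the gaps.
gap : List ℕ → ℕ → ℕ
gap xs j = length xs ∸ conjugatePart xs (suc j) + j

row-gap : ∀ x xs j → j < x → (x ∸ j + conjugatePart xs (suc j)) + gap xs j ≡ x + length xs
row-gap x xs j j<x = begin
  (x ∸ j + c) + (l ∸ c + j)   ≡⟨ lemma (x ∸ j) c (l ∸ c) j ⟩
  (x ∸ j + j) + (l ∸ c + c)   ≡⟨ cong₂ _+_ (ℕ.m∸n+n≡m (ℕ.<⇒≤ j<x)) (ℕ.m∸n+n≡m (conj≤length xs (suc j))) ⟩
  x + l                       ∎
  where
  open ≡-Reasoning
  c = conjugatePart xs (suc j)
  l = length xs
  lemma : ∀ a c b j → (a + c) + (b + j) ≡ (a + j) + (b + c)
  lemma = ℕ-Solver.solve-∀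

beads-< : ∀ {x xs} → All (_≤ x) xs → All (_< x + length xs) (beads xs)
beads-< []                  = []
beads-< {x} {y ∷ ys} (y≤x ∷ all) = subst (y + length ys <_) (sym (ℕ.+-suc x (length ys))) (s≤s (ℕ.+-monoˡ-≤ (length ys) y≤x)) ∷
  All.map (λ b< → ℕ.<-trans b< (ℕ.+-monoʳ-< x (ℕ.n<1+n (length ys)))) (beads-< all)

gap-∷-< : ∀ {y} ys j → j < y → gap (y ∷ ys) j ≡ gap ys j
gap-∷-< ys j j<y = cong (λ c → suc (length ys) ∸ c + j) (conj-∷-≤ ys (suc j) j<y)

gap-∷-≥ : ∀ {y} ys j → All (_≤ y) ys → y ≤ j → gap (y ∷ ys) j ≡ suc (length ys) + j
gap-∷-≥ {y} ys j all y≤j = cong (λ c → suc (length ys) ∸ c + j) (conj-0 {y ∷ ys} (suc j) (s≤s y≤j ∷ All.map (λ z≤y → s≤s (ℕ.≤-trans z≤y y≤j)) all))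

gap∉beads : ∀ {xs} → NonIncreasing xs → ∀ j → gap xs j ∉ beads xs
gap∉beads {y ∷ ys} (y≥ ∷ dec) j p with j ℕ.<? y
... | yes j<y = go (subst (_∈ beads (y ∷ ys)) (gap-∷-< ys j j<y) p)
  where
  go : gap ys j ∉ beads (y ∷ ys)
  go (here eq)  = ℕ.<-irrefl eq (ℕ.≤-<-trans (ℕ.+-monoˡ-≤ j (ℕ.m∸n≤m (length ys) (conjugatePart ys (suc j)))) (subst (_< y + length ys) (ℕ.+-comm j (length ys)) (ℕ.+-monoˡ-< (length ys) j<y)))
  go (there q) = gap∉beads dec j q
... | no j≮y = ℕ.<-irrefl refl (ℕ.<-trans (lookup-< p) (subst (λ g → y + length ys < g) (sym eq) (s≤s (subst (_≤ length ys + j) (ℕ.+-comm (length ys) y) (ℕ.+-monoʳ-≤ (length ys) y≤j)))))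
  where
  y≤j = ℕ.≮⇒≥ j≮y
  eq = gap-∷-≥ ys j y≥ y≤j
  lookup-< : gap (y ∷ ys) j ∈ beads (y ∷ ys) → gap (y ∷ ys) j < y + length ys
  lookup-< (here e)  = ⊥-elim (ℕ.<-irrefl (trans (sym e) eq) (s≤s (subst (_≤ length ys + j) (ℕ.+-comm (length ys) y) (ℕ.+-monoʳ-≤ (length ys) y≤j))))
  lookup-< (there q) = All.lookup (beads-< y≥) q

-- Below the first bead the gap already belongs to the remaining rows. Above it the columns lie
-- beyond all parts, where the gaps are consecutive numbers.
nonbead-is-gap : ∀ x {xs} → All (_≤ x) xs → NonIncreasing xs → ∀ g → g < x + length xs → g ∉ beads xs → ∃ λ j → j < x × gap xs j ≡ g
nonbead-is-gap x []                 []         g g< g∉ = g , subst (g <_) (ℕ.+-identityʳ x) g< , refl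
nonbead-is-gap x {y ∷ ys} (y≤x ∷ all) (y≥ ∷ dec) g g< g∉ with ℕ.<-cmp g (y + length ys)
... | tri≈ _ eq _ = ⊥-elim (g∉ (here eq))

... | tri< g<b _ _ with nonbead-is-gap y y≥ dec g g<b (g∉ ∘ there)
...   | j , j<y , eq = j , ℕ.<-≤-trans j<y y≤x , trans (gap-∷-< ys j j<y) eq
nonbead-is-gap x {y ∷ ys} (y≤x ∷ all) (y≥ ∷ dec) g g< g∉ | tri> _ _ b<g = j , j<x , trans (gap-∷-≥ ys j y≥ y≤j) eq
  where
  l = suc (length ys)
  j = g ∸ l
  l≤g : l ≤ g
  l≤g = ℕ.≤-trans (s≤s (ℕ.m≤n+m (length ys) y)) b<g
  eq : l + j ≡ g
  eq = ℕ.m+[n∸m]≡n l≤g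
  j<x : j < x
  j<x = ℕ.+-cancelˡ-< l j x (subst (_< l + x) (sym eq) (subst (g <_) (ℕ.+-comm x l) g<))
  y≤j : y ≤ j
  y≤j = ℕ.+-cancelˡ-≤ l y j (subst (l + y ≤_) (sym eq) (subst (_≤ g) (cong suc (ℕ.+-comm y (length ys))) b<g))

-- No bead can be moved down by 5. Looking for `b ∸ 5` in the tail only is right because bead lists
-- decrease.
Closed : List ℕ → Set
Closed []       = ⊤
Closed (b ∷ bs) = (5 ≤ b → b ∸ 5 ∈ bs) × Closed bs

closed-∈ : ∀ {bs b} → Closed bs → b ∈ bs → 5 ≤ b → b ∸ 5 ∈ bs
closed-∈ (p , _)  (here refl) 5≤b = there (p 5≤b)
closed-∈ (_ , cl) (there b∈)  5≤b = there (closed-∈ cl b∈ 5≤b)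

closed-* : ∀ {bs} → Closed bs → ∀ k g → 5 * k + g ∈ bs → g ∈ bs
closed-* cl zero    g p = p
closed-* {bs} cl (suc k) g p = closed-* cl k g (subst (_∈ bs) (trans (cong (_∸ 5) (lemma k g)) (ℕ.m+n∸m≡n 5 (5 * k + g)))
  (closed-∈ cl p (subst (5 ≤_) (sym (lemma k g)) (ℕ.m≤m+n 5 _))))
  where
  lemma : ∀ k g → 5 * suc k + g ≡ 5 + (5 * k + g)
  lemma = ℕ-Solver.solve-∀

-- If the position 5 below a bead were empty, it would be a gap, and its column would give a hook of
-- length exactly 5.
rows⇒closed : ∀ {xs} → NonIncreasing xs → RowsOK xs → Closed (beads xs)
rows⇒closed []                   _            = tt
rows⇒closed {x ∷ xs} (x≥ ∷ dec) (row , rows) = head , rows⇒closed dec rows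
  where
  b = x + length xs
  head : 5 ≤ b → b ∸ 5 ∈ beads xs
  head 5≤b with _∈?_ ℕ._≟_ (b ∸ 5) (beads xs)
  ... | yes p = p
  ... | no ∉ with nonbead-is-gap x x≥ dec (b ∸ 5) (ℕ.∸-monoʳ-< {b} {5} {0} (s≤s z≤n) 5≤b) ∉
  ...   | j , j<x , eq = ⊥-elim (row j j<x (divides 1 (ℕ.+-cancelʳ-≡ (b ∸ 5) _ 5 (trans (cong (λ y → (x ∸ j + conjugatePart xs (suc j)) + y) (sym eq))
            (trans (row-gap x xs j j<x) (sym (ℕ.m+[n∸m]≡n 5≤b)))))))

-- A hook divisible by 5 places a gap at a positive multiple of 5 below the bead. Descending in
-- steps of 5 from a bead of a closed set meets only beads.
closed⇒rows : ∀ {xs} → NonIncreasing xs → Closed (beads xs) → RowsOK xs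
closed⇒rows []                   _           = tt
closed⇒rows {x ∷ xs} (x≥ ∷ dec) (head , cl) = row , closed⇒rows dec cl
  where
  b = x + length xs
  row : RowOK x xs
  row j j<x (divides zero eq) = ℕ.<-irrefl (sym eq) (ℕ.<-≤-trans (ℕ.m<n⇒0<n∸m j<x) (ℕ.m≤m+n _ _))
  row j j<x (divides (suc k) eq) = gap∉beads dec j (closed-* cl k (gap xs j) (subst (_∈ beads xs) b-5 (head (subst (5 ≤_) (sym b≡) (ℕ.m≤m+n 5 _)))))
    where
    b≡ : b ≡ 5 + (5 * k + gap xs j)
    b≡ = trans (sym (row-gap x xs j j<x)) (trans (cong (λ y → y + gap xs j) eq) (lemma k (gap xs j)))
      where
      lemma : ∀ k g → suc k * 5 + g ≡ 5 + (5 * k + g)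
      lemma = ℕ-Solver.solve-∀
    b-5 : b ∸ 5 ≡ 5 * k + gap xs j
    b-5 = trans (cong (_∸ 5) b≡) (ℕ.m+n∸m≡n 5 _)

-- Partitions padded with zero parts, which fix the number of beads

pad : ℕ → List ℕ → List ℕ
pad k xs = xs ++ replicate k 0

conj-pad : ∀ k xs j → conjugatePart (pad k xs) (suc j) ≡ conjugatePart xs (suc j)
conj-pad k xs j = trans (cong length (List.filter-++ (suc j ℕ.≤?_) xs (replicate k 0)))
  (trans (List.length-++ (filter (suc j ℕ.≤?_) xs)) (trans (cong (λ y → conjugatePart xs (suc j) + y) (zeros k)) (ℕ.+-identityʳ _)))
  where
  zeros : ∀ k → conjugatePart (replicate k 0) (suc j) ≡ 0
  zeros k = conj-0 {replicate k 0} (suc j) (All.replicate⁺ k (s≤s z≤n))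

rows-pad : ∀ k xs → RowsOK xs → RowsOK (pad k xs)
rows-pad zero    []       _            = tt
rows-pad (suc k) []       _            = (λ j ()) , rows-pad k [] tt
rows-pad k       (x ∷ xs) (row , rows) = (λ j j<x → subst (λ c → ¬ 5 ∣ (x ∸ j + c)) (sym (conj-pad k xs j)) (row j j<x)) , rows-pad k xs rows

rows-unpad : ∀ k xs → RowsOK (pad k xs) → RowsOK xs
rows-unpad k []       _            = tt
rows-unpad k (x ∷ xs) (row , rows) = (λ j j<x → subst (λ c → ¬ 5 ∣ (x ∸ j + c)) (conj-pad k xs j) (row j j<x)) , rows-unpad k xs rows

nonIncreasing-pad : ∀ k {xs} → NonIncreasing xs → NonIncreasing (pad k xs)
nonIncreasing-pad k dec = AllPairs.++⁺ dec (zeros k) (All.tabulate (λ _ → All.replicate⁺ k z≤n))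
  where
  zeros : ∀ k → NonIncreasing (replicate k 0)
  zeros zero    = []
  zeros (suc k) = All.replicate⁺ k z≤n ∷ zeros k

strip : List ℕ → List ℕ
strip = filter (0 ℕ.<?_)

strip-pad : ∀ k {xs} → All (0 <_) xs → strip (pad k xs) ≡ xs
strip-pad k {xs} pos = trans (List.filter-++ (0 ℕ.<?_) xs (replicate k 0)) (trans (cong₂ _++_ (List.filter-all (0 ℕ.<?_) pos) (zeros k)) (List.++-identityʳ xs))
  where
  zeros : ∀ k → strip (replicate k 0) ≡ []
  zeros k = List.filter-none (0 ℕ.<?_) (All.replicate⁺ k λ ())

pad-strip : ∀ {xs} → NonIncreasing xs → xs ≡ pad (length xs ∸ length (strip xs)) (strip xs)
pad-strip []                        = refl
pad-strip {suc x ∷ xs} (x≥ ∷ dec) = cong (suc x ∷_) (pad-strip dec)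
pad-strip {zero ∷ xs}  (x≥ ∷ dec) = trans (cong (0 ∷_) (zeros x≥)) (sym (trans (cong (λ s → pad (suc (length xs) ∸ length s) s) (List.filter-none (0 ℕ.<?_) (All.map (λ z≤0 0<z → ℕ.<⇒≱ 0<z z≤0) x≥))) refl))
  where
  zeros : ∀ {ys} → All (_≤ 0) ys → ys ≡ replicate (length ys) 0
  zeros []            = refl
  zeros (z≤n ∷ all) = cong (0 ∷_) (zeros all)

sum-pad : ∀ k xs → sum (pad k xs) ≡ sum xs
sum-pad zero    []       = refl
sum-pad (suc k) []       = sum-pad k []
sum-pad k       (x ∷ xs) = cong (λ y → x + y) (sum-pad k xs)

length-beads : ∀ xs → length (beads xs) ≡ length xs
length-beads []       = refl
length-beads (x ∷ xs) = cong suc (length-beads xs)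

beads-injective : ∀ {xs ys} → beads xs ≡ beads ys → xs ≡ ys
beads-injective {[]}     {[]}     _  = refl
beads-injective {x ∷ xs} {y ∷ ys} eq with List.∷-injective eq
... | eq₁ , eq₂ with beads-injective {xs} {ys} eq₂
...   | refl = cong (_∷ xs) (ℕ.+-cancelʳ-≡ (length xs) x y eq₁)

-- n(n-1)/2, the sum of the beads 0, ..., n - 1 of the empty partition; `tri` is n(n+1)/2.
triangle : ℕ → ℕ
triangle zero    = 0
triangle (suc n) = n + triangle n

sum-beads : ∀ xs → sum (beads xs) ≡ sum xs + triangle (length xs)
sum-beads []       = refl
sum-beads (x ∷ xs) = trans (cong (λ y → x + length xs + y) (sum-beads xs)) (lemma x (length xs) (sum xs) (triangle (length xs)))
  where
  lemma : ∀ x l s t → x + l + (s + t) ≡ x + s + (l + t)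
  lemma = ℕ-Solver.solve-∀

Decreasing : List ℕ → Set
Decreasing = AllPairs _>_

beads-decreasing : ∀ {xs} → NonIncreasing xs → Decreasing (beads xs)
beads-decreasing []         = []
beads-decreasing (x≥ ∷ dec) = beads-< x≥ ∷ beads-decreasing dec

unbeads : List ℕ → List ℕ
unbeads []       = []
unbeads (b ∷ bs) = b ∸ length bs ∷ unbeads bs

length-unbeads : ∀ bs → length (unbeads bs) ≡ length bs
length-unbeads []       = refl
length-unbeads (b ∷ bs) = cong suc (length-unbeads bs)

length≤ : ∀ {b bs} → All (_< b) bs → Decreasing bs → length bs ≤ b
length≤ []        []         = z≤n
length≤ (p ∷ _) (ps ∷ dec) = ℕ.≤-trans (s≤s (length≤ ps dec)) p

beads-unbeads : ∀ {bs} → Decreasing bs → beads (unbeads bs) ≡ bs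
beads-unbeads []                     = refl
beads-unbeads {b ∷ bs} (ps ∷ dec) = cong₂ _∷_ (trans (cong (λ l → b ∸ length bs + l) (length-unbeads bs)) (ℕ.m∸n+n≡m (length≤ ps dec))) (beads-unbeads dec)

unbeads-≤ : ∀ {b bs} → All (_< b) bs → Decreasing bs → All (_≤ b ∸ length bs) (unbeads bs)
unbeads-≤ []      []         = []
unbeads-≤ {suc b} {c ∷ bs} (s≤s c≤b ∷ _) (ps ∷ dec) = step ∷ All.map (λ p → ℕ.≤-trans p step) (unbeads-≤ ps dec)
  where
  step : c ∸ length bs ≤ b ∸ length bs
  step = ℕ.∸-monoˡ-≤ (length bs) c≤b

unbeads-nonIncreasing : ∀ {bs} → Decreasing bs → NonIncreasing (unbeads bs)
unbeads-nonIncreasing []         = []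
unbeads-nonIncreasing (ps ∷ dec) = unbeads-≤ ps dec ∷ unbeads-nonIncreasing dec

-- The five runners of the abacus

hit : ℕ → ℕ → ℕ
hit r s with r ℕ.≟ s
... | yes _ = 1
... | no  _ = 0

hit-refl : ∀ r → hit r r ≡ 1
hit-refl r with r ℕ.≟ r
... | yes _ = refl
... | no ≢  = ⊥-elim (≢ refl)

count : ℕ → List ℕ → ℕ
count r []       = 0
count r (b ∷ bs) = hit r (b % 5) + count r bs

count-≤ : ∀ r b bs → count r bs ≤ count r (b ∷ bs)
count-≤ r b bs = ℕ.m≤n+m (count r bs) (hit r (b % 5))

5+/5 : ∀ k → (5 + k) / 5 ≡ suc (k / 5)
5+/5 k = trans (m/n≡1+[m∸n]/n {5 + k} {5} (ℕ.m≤m+n 5 k)) (cong (λ y → suc (y / 5)) (ℕ.m+n∸m≡n 5 k))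

5+%5 : ∀ k → (5 + k) % 5 ≡ k % 5
5+%5 k = trans (cong (_% 5) (ℕ.+-comm 5 k)) ([m+n]%n≡m%n k 5)

-- A closed bead set fills each runner from the bottom without holes, so a position is occupied
-- exactly when its height is less than the number of beads on its runner. This and `top-bead` are
-- proved by one induction, in which each needs the other for the tail.
∈⇒count : ∀ {bs x} → Closed bs → Decreasing bs → x ∈ bs → x / 5 < count (x % 5) bs
count⇒∈ : ∀ {bs x} → Closed bs → Decreasing bs → x / 5 < count (x % 5) bs → x ∈ bs
-- The topmost bead sits right above the other beads of its runner.
top-bead : ∀ {b bs} → Closed (b ∷ bs) → Decreasing (b ∷ bs) → b / 5 ≡ count (b % 5) bs
top-bead {b} {bs} (head , cl) (ps ∷ dec) = ℕ.≤-antisym (upper b head) (ℕ.≮⇒≥ (λ lt → ℕ.<-irrefl refl (All.lookup ps (count⇒∈ cl dec lt))))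
  where
  upper : ∀ b → (5 ≤ b → b ∸ 5 ∈ bs) → b / 5 ≤ count (b % 5) bs
  upper b head with 5 ℕ.≤? b
  ... | no 5≰b = ℕ.≤-trans (ℕ.≤-reflexive (m<n⇒m/n≡0 (ℕ.≰⇒> 5≰b))) z≤n
  ... | yes 5≤b with b ∸ 5 | ℕ.m+[n∸m]≡n 5≤b | head 5≤b
  ...   | k | refl | k∈ = subst₂ (λ x r → x ≤ count r bs) (sym (5+/5 k)) (sym (5+%5 k)) (∈⇒count cl dec k∈)

∈⇒count {b ∷ bs} cl@(_ , _) dec (here refl) = subst (λ h → b / 5 < h + count (b % 5) bs) (sym (hit-refl (b % 5))) (s≤s (ℕ.≤-reflexive (top-bead cl dec)))
∈⇒count {b ∷ bs} {x} (_ , cl) (_ ∷ dec) (there x∈) = ℕ.<-≤-trans (∈⇒count cl dec x∈) (count-≤ (x % 5) b bs)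

count⇒∈ {b ∷ bs} {x} cl@(_ , cl′) dec@(_ ∷ dec′) lt with x % 5 ℕ.≟ b % 5
... | no _    = there (count⇒∈ cl′ dec′ lt)
... | yes eq with ℕ.m≤n⇒m<n∨m≡n (ℕ.≤-pred lt)
...   | inj₁ lt′ = there (count⇒∈ cl′ dec′ lt′)
...   | inj₂ eq′ = here (trans (m≡m%n+[m/n]*n x 5) (trans (cong₂ (λ r q → r + q * 5) eq (trans eq′ (trans (cong (λ r → count r bs) eq) (sym (top-bead cl dec))))) (sym (m≡m%n+[m/n]*n b 5))))

decreasing-ext : ∀ {bs cs} → Decreasing bs → Decreasing cs → (∀ {x} → x ∈ bs → x ∈ cs) → (∀ {x} → x ∈ cs → x ∈ bs) → bs ≡ cs
decreasing-ext {[]}     {[]}     _ _ p q = refl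
decreasing-ext {[]}     {c ∷ cs} _ _ p q with () ← q (here refl)
decreasing-ext {b ∷ bs} {[]}     _ _ p q with () ← p (here refl)
decreasing-ext {b ∷ bs} {c ∷ cs} (b> ∷ db) (c> ∷ dc) p q with b≡c
  where
  le : ∀ {x y ys} → All (_< y) ys → x ∈ y ∷ ys → x ≤ y
  le _   (here refl) = ℕ.≤-refl
  le all (there x∈)  = ℕ.<⇒≤ (All.lookup all x∈)
  b≡c : b ≡ c
  b≡c = ℕ.≤-antisym (le c> (p (here refl))) (le b> (q (here refl)))
... | refl = cong (b ∷_) (decreasing-ext db dc (λ x∈ → strip-head b> x∈ (p (there x∈))) (λ x∈ → strip-head c> x∈ (q (there x∈))))
  where
  strip-head : ∀ {x ys zs} → All (_< b) ys → x ∈ ys → x ∈ b ∷ zs → x ∈ zs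
  strip-head all x∈ (here refl) = ⊥-elim (ℕ.<-irrefl refl (All.lookup all x∈))
  strip-head all x∈ (there y∈)  = y∈

counts-determine : ∀ {bs cs} → Closed bs → Decreasing bs → Closed cs → Decreasing cs → (∀ r → r < 5 → count r bs ≡ count r cs) → bs ≡ cs
counts-determine clb db clc dc eq = decreasing-ext db dc
  (λ {x} x∈ → count⇒∈ clc dc (subst (x / 5 <_) (eq (x % 5) (m%n<n x 5)) (∈⇒count clb db x∈)))
  (λ {x} x∈ → count⇒∈ clb db (subst (x / 5 <_) (sym (eq (x % 5) (m%n<n x 5))) (∈⇒count clc dc x∈)))

sum₅ : (ℕ → ℕ) → ℕ
sum₅ g = g 0 + (g 1 + (g 2 + (g 3 + g 4)))

sum₅-cong : ∀ {g h} → (∀ r → r < 5 → g r ≡ h r) → sum₅ g ≡ sum₅ h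
sum₅-cong p = cong₂ _+_ (p 0 (s≤s z≤n)) (cong₂ _+_ (p 1 (s≤s (s≤s z≤n))) (cong₂ _+_ (p 2 (s≤s (s≤s (s≤s z≤n))))
  (cong₂ _+_ (p 3 (s≤s (s≤s (s≤s (s≤s z≤n))))) (p 4 (s≤s (s≤s (s≤s (s≤s (s≤s z≤n)))))))))

sum₅-+ : ∀ (g h : ℕ → ℕ) → sum₅ (λ r → g r + h r) ≡ sum₅ g + sum₅ h
sum₅-+ g h = lemma (g 0) (g 1) (g 2) (g 3) (g 4) (h 0) (h 1) (h 2) (h 3) (h 4)
  where
  lemma : ∀ a b c d e a′ b′ c′ d′ e′ → a + a′ + (b + b′ + (c + c′ + (d + d′ + (e + e′)))) ≡ a + (b + (c + (d + e))) + (a′ + (b′ + (c′ + (d′ + e′))))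
  lemma = ℕ-Solver.solve-∀

sum₅-hit : ∀ (g : ℕ → ℕ) s → s < 5 → sum₅ (λ r → hit r s * g r) ≡ g s
sum₅-hit g 0 _ = trans (ℕ.+-identityʳ _) (ℕ.+-identityʳ _)
sum₅-hit g 1 _ = trans (ℕ.+-identityʳ _) (ℕ.+-identityʳ _)
sum₅-hit g 2 _ = trans (ℕ.+-identityʳ _) (ℕ.+-identityʳ _)
sum₅-hit g 3 _ = trans (ℕ.+-identityʳ _) (ℕ.+-identityʳ _)
sum₅-hit g 4 _ = ℕ.+-identityʳ _
sum₅-hit g (suc (suc (suc (suc (suc _))))) (s≤s (s≤s (s≤s (s≤s (s≤s ())))))

length≡sum₅ : ∀ bs → length bs ≡ sum₅ (λ r → count r bs)
length≡sum₅ []       = refl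
length≡sum₅ (b ∷ bs) = sym (trans (sum₅-+ (λ r → hit r (b % 5)) (λ r → count r bs)) (cong₂ _+_
  (trans (sum₅-cong {λ r → hit r (b % 5)} (λ r _ → sym (ℕ.*-identityʳ _))) (sum₅-hit (λ _ → 1) (b % 5) (m%n<n b 5))) (sym (length≡sum₅ bs))))

-- The sum of the lowest `c` positions r, r + 5, r + 10, ... of runner `r`.
runner : ℕ → ℕ → ℕ
runner r c = r * c + 5 * triangle c

-- Induction on the beads: `top-bead` places the largest one at the next free height of its runner,
-- which is exactly the increment of `runner`.
sum≡runners : ∀ {bs} → Closed bs → Decreasing bs → sum bs ≡ sum₅ (λ r → runner r (count r bs))
sum≡runners {[]}     _ _ = refl
sum≡runners {b ∷ bs} cl dec = sym (begin
  sum₅ (λ r → runner r (hit r (b % 5) + count r bs))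
    ≡⟨ sum₅-cong {λ r → runner r (hit r (b % 5) + count r bs)} (λ r _ → step r) ⟩
  sum₅ (λ r → hit r (b % 5) * (r + count r bs * 5) + runner r (count r bs))
    ≡⟨ sum₅-+ (λ r → hit r (b % 5) * (r + count r bs * 5)) (λ r → runner r (count r bs)) ⟩
  sum₅ (λ r → hit r (b % 5) * (r + count r bs * 5)) + sum₅ (λ r → runner r (count r bs))
    ≡⟨ cong₂ _+_ (sum₅-hit (λ r → r + count r bs * 5) (b % 5) (m%n<n b 5)) (sym (sum≡runners (proj₂ cl) (AllPairs.tail dec))) ⟩
  b % 5 + count (b % 5) bs * 5 + sum bs
    ≡⟨ cong (λ q → b % 5 + q * 5 + sum bs) (top-bead cl dec) ⟨
  b % 5 + b / 5 * 5 + sum bs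
    ≡⟨ cong (_+ sum bs) (m≡m%n+[m/n]*n b 5) ⟨
  b + sum bs ∎)
  where
  open ≡-Reasoning
  step : ∀ r → runner r (hit r (b % 5) + count r bs) ≡ hit r (b % 5) * (r + count r bs * 5) + runner r (count r bs)
  step r with r ℕ.≟ b % 5
  ... | no _  = refl
  ... | yes _ = lemma r (count r bs) (triangle (count r bs))
    where
    lemma : ∀ r c t → r * suc c + 5 * (c + t) ≡ r + c * 5 + 0 + (r * c + 5 * t)
    lemma = ℕ-Solver.solve-∀

module Fill (c : ℕ → ℕ) where

  private
    Present : ℕ → Set
    Present x = x / 5 < c (x % 5)

    Present? : ∀ x → Dec (Present x)
    Present? x = x / 5 ℕ.<? c (x % 5)

    present : ℕ → ℕ → ℕ
    present K s with K ℕ.<? c s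
    ... | yes _ = 1
    ... | no  _ = 0

  -- The inverse of counting: among the lowest `K` rows, occupy every position whose height is less
  -- than the count prescribed for its runner.
  fill : ℕ → List ℕ
  fill K = filter Present? (downFrom (K * 5))

  fill-decreasing : ∀ K → Decreasing (fill K)
  fill-decreasing K = AllPairs.filter⁺ Present? (go (K * 5))
    where
    go : ∀ n → Decreasing (downFrom n)
    go zero    = []
    go (suc n) = All.tabulate ∈-downFrom⁻ ∷ go n

  fill-closed : ∀ K → Closed (fill K)
  fill-closed K = go (K * 5)
    where
    go : ∀ n → Closed (filter Present? (downFrom n))
    go zero    = tt
    go (suc n) with Present? n
    ... | no ¬p = subst Closed (sym (List.filter-reject Present? ¬p)) (go n)
    ... | yes p = subst Closed (sym (List.filter-accept Present? p)) ((λ 5≤n → ∈-filter⁺ Present? (∈-downFrom⁺ (ℕ.∸-monoʳ-< {n} {5} {0} (s≤s z≤n) 5≤n)) (below n p 5≤n)) , go n)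
      where
      below : ∀ n → Present n → 5 ≤ n → Present (n ∸ 5)
      below n p 5≤n with n ∸ 5 | ℕ.m+[n∸m]≡n 5≤n
      ... | k | refl = ℕ.<-trans (ℕ.n<1+n _) (subst₂ (λ x r → x < c r) (5+/5 k) (5+%5 k) p)

  private
    s+K5/5 : ∀ s K → s < 5 → (s + K * 5) / 5 ≡ K
    s+K5/5 s K s<5 = ℕ.*-cancelʳ-≡ _ K 5 (ℕ.+-cancelˡ-≡ s _ _ (trans (cong (_+ (s + K * 5) / 5 * 5) (sym (s+K5%5 s K s<5))) (sym (m≡m%n+[m/n]*n (s + K * 5) 5))))
      where
      s+K5%5 : ∀ s K → s < 5 → (s + K * 5) % 5 ≡ s
      s+K5%5 s K s<5 = trans ([m+kn]%n≡m%n s K 5) (m<n⇒m%n≡m s<5)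

    s+K5%5 : ∀ s K → s < 5 → (s + K * 5) % 5 ≡ s
    s+K5%5 s K s<5 = trans ([m+kn]%n≡m%n s K 5) (m<n⇒m%n≡m s<5)

    count-∷ : ∀ r s K xs → s < 5 → count r (filter Present? (s + K * 5 ∷ xs)) ≡ present K s * hit r s + count r (filter Present? xs)
    count-∷ r s K xs s<5 with K ℕ.<? c s
    ... | yes K<c = trans (cong (count r) (List.filter-accept Present? {s + K * 5} {xs} (subst₂ (λ x r → x < c r) (sym (s+K5/5 s K s<5)) (sym (s+K5%5 s K s<5)) K<c)))
            (cong (_+ count r (filter Present? xs)) (trans (cong (hit r) (s+K5%5 s K s<5)) (sym (ℕ.+-identityʳ (hit r s)))))
    ... | no K≮c = cong (count r) (List.filter-reject Present? {s + K * 5} {xs} (K≮c ∘ subst₂ (λ x r → x < c r) (s+K5/5 s K s<5) (s+K5%5 s K s<5)))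

    count-row : ∀ r K → r < 5 → count r (fill (suc K)) ≡ present K r + count r (fill K)
    count-row r K r<5 = trans row (select r r<5)
      where
      p = present K
      X = count r (fill K)
      row : count r (fill (suc K)) ≡ p 4 * hit r 4 + (p 3 * hit r 3 + (p 2 * hit r 2 + (p 1 * hit r 1 + (p 0 * hit r 0 + X))))
      row = trans (count-∷ r 4 K _ (s≤s (s≤s (s≤s (s≤s (s≤s z≤n)))))) (cong (λ y → p 4 * hit r 4 + y)
           (trans (count-∷ r 3 K _ (s≤s (s≤s (s≤s (s≤s z≤n))))) (cong (λ y → p 3 * hit r 3 + y)
           (trans (count-∷ r 2 K _ (s≤s (s≤s (s≤s z≤n)))) (cong (λ y → p 2 * hit r 2 + y)
           (trans (count-∷ r 1 K _ (s≤s (s≤s z≤n))) (cong (λ y → p 1 * hit r 1 + y) (count-∷ r 0 K _ (s≤s z≤n)))))))))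
      select : ∀ r → r < 5 → p 4 * hit r 4 + (p 3 * hit r 3 + (p 2 * hit r 2 + (p 1 * hit r 1 + (p 0 * hit r 0 + X)))) ≡ p r + X
      select 0 _ = lemma (p 4) (p 3) (p 2) (p 1) (p 0) X
        where
        lemma : ∀ a b c d e x → a * 0 + (b * 0 + (c * 0 + (d * 0 + (e * 1 + x)))) ≡ e + x
        lemma = ℕ-Solver.solve-∀
      select 1 _ = lemma (p 4) (p 3) (p 2) (p 1) (p 0) X
        where
        lemma : ∀ a b c d e x → a * 0 + (b * 0 + (c * 0 + (d * 1 + (e * 0 + x)))) ≡ d + x
        lemma = ℕ-Solver.solve-∀
      select 2 _ = lemma (p 4) (p 3) (p 2) (p 1) (p 0) X
        where
        lemma : ∀ a b c d e x → a * 0 + (b * 0 + (c * 1 + (d * 0 + (e * 0 + x)))) ≡ c + x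
        lemma = ℕ-Solver.solve-∀
      select 3 _ = lemma (p 4) (p 3) (p 2) (p 1) (p 0) X
        where
        lemma : ∀ a b c d e x → a * 0 + (b * 1 + (c * 0 + (d * 0 + (e * 0 + x)))) ≡ b + x
        lemma = ℕ-Solver.solve-∀
      select 4 _ = lemma (p 4) (p 3) (p 2) (p 1) (p 0) X
        where
        lemma : ∀ a b c d e x → a * 1 + (b * 0 + (c * 0 + (d * 0 + (e * 0 + x)))) ≡ a + x
        lemma = ℕ-Solver.solve-∀
      select (suc (suc (suc (suc (suc _))))) (s≤s (s≤s (s≤s (s≤s (s≤s ())))))

  count-fill : ∀ r K → r < 5 → c r ≤ K → count r (fill K) ≡ c r
  count-fill r K r<5 c≤K = trans (go K) (ℕ.m≥n⇒m⊓n≡n c≤K)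
    where
    go : ∀ K → count r (fill K) ≡ K ⊓ c r
    go zero    = refl
    go (suc K) = trans (count-row r K r<5) (trans (cong (λ y → present K r + y) (go K)) step)
      where
      step : present K r + K ⊓ c r ≡ suc K ⊓ c r
      step with K ℕ.<? c r
      ... | yes K<c = trans (cong suc (ℕ.m≤n⇒m⊓n≡m (ℕ.<⇒≤ K<c))) (sym (ℕ.m≤n⇒m⊓n≡m K<c))
      ... | no K≮c = trans (ℕ.m≥n⇒m⊓n≡n (ℕ.≮⇒≥ K≮c)) (sym (ℕ.m≥n⇒m⊓n≡n (ℕ.m≤n⇒m≤1+n (ℕ.≮⇒≥ K≮c))))

-- The bijection between 5-cores and bead counts

Tuple : Set
Tuple = ℕ × ℕ × ℕ × ℕ × ℕ

nth : Tuple → ℕ → ℕ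
nth (c₀ , c₁ , c₂ , c₃ , c₄) 0 = c₀
nth (c₀ , c₁ , c₂ , c₃ , c₄) 1 = c₁
nth (c₀ , c₁ , c₂ , c₃ , c₄) 2 = c₂
nth (c₀ , c₁ , c₂ , c₃ , c₄) 3 = c₃
nth (c₀ , c₁ , c₂ , c₃ , c₄) _ = c₄

counts : List ℕ → Tuple
counts bs = count 0 bs , count 1 bs , count 2 bs , count 3 bs , count 4 bs

nth-counts : ∀ bs r → r < 5 → nth (counts bs) r ≡ count r bs
nth-counts bs 0 _ = refl
nth-counts bs 1 _ = refl
nth-counts bs 2 _ = refl
nth-counts bs 3 _ = refl
nth-counts bs 4 _ = refl
nth-counts bs (suc (suc (suc (suc (suc _))))) (s≤s (s≤s (s≤s (s≤s (s≤s ())))))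

counts-cong : ∀ {bs cs} → (∀ r → r < 5 → count r bs ≡ nth cs r) → counts bs ≡ cs
counts-cong {bs} {c₀ , c₁ , c₂ , c₃ , c₄} p = cong₂ _,_ (p 0 (s≤s z≤n)) (cong₂ _,_ (p 1 (s≤s (s≤s z≤n))) (cong₂ _,_ (p 2 (s≤s (s≤s (s≤s z≤n))))
  (cong₂ _,_ (p 3 (s≤s (s≤s (s≤s (s≤s z≤n))))) (p 4 (s≤s (s≤s (s≤s (s≤s (s≤s z≤n)))))))))

Levels-tuple : Levels (λ (t : Tuple) → sum₅ (nth t))
Levels-tuple = Levels-× Levels-id (Levels-× Levels-id (Levels-× Levels-id (Levels-× Levels-id Levels-id)))

-- The size of the core. With n_r = c_r - M the summand of runner r is (5n_r² + (2r - 3)n_r)/2; as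
-- the n_r add up to 0, this is the formula of Garvan, Kim and Stanton. The term -3n_r/2 spread over
-- the runners makes each summand an exponent of a triple product.
weight : ℕ → Tuple → ℕ
weight M (c₀ , c₁ , c₂ , c₃ , c₄) = e 1 4 (c₀ ⊖ M) + (e 2 3 (c₁ ⊖ M) + (e 3 2 (c₂ ⊖ M) + (e 4 1 (c₃ ⊖ M) + e 5 0 (c₄ ⊖ M))))

⟦2triangle⟧ : ∀ n → + 2 ℤ.* + triangle n ≡ + n ℤ.* (+ n ℤ.- 1ℤ)
⟦2triangle⟧ zero    = refl
⟦2triangle⟧ (suc n) = trans (⟦2+⟧ n (triangle n)) (trans (cong (λ y → + 2 ℤ.* + n ℤ.+ y) (⟦2triangle⟧ n)) (lemma (+ n)))
  where
  lemma : ∀ n → + 2 ℤ.* n ℤ.+ n ℤ.* (n ℤ.- 1ℤ) ≡ (1ℤ ℤ.+ n) ℤ.* (1ℤ ℤ.+ n ℤ.- 1ℤ)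
  lemma = ℤ-Solver.solve-∀

⟦2sum₅⟧ : ∀ (g : ℕ → ℕ) → + 2 ℤ.* + sum₅ g ≡ + 2 ℤ.* + g 0 ℤ.+ (+ 2 ℤ.* + g 1 ℤ.+ (+ 2 ℤ.* + g 2 ℤ.+ (+ 2 ℤ.* + g 3 ℤ.+ + 2 ℤ.* + g 4)))
⟦2sum₅⟧ g = trans (⟦2+⟧ (g 0) _) (cong (λ y → + 2 ℤ.* + g 0 ℤ.+ y) (trans (⟦2+⟧ (g 1) _) (cong (λ y → + 2 ℤ.* + g 1 ℤ.+ y)
  (trans (⟦2+⟧ (g 2) _) (cong (λ y → + 2 ℤ.* + g 2 ℤ.+ y) (⟦2+⟧ (g 3) (g 4)))))))

⟦2runner⟧ : ∀ r c → + 2 ℤ.* + runner r c ≡ + 2 ℤ.* (+ r ℤ.* + c) ℤ.+ + 5 ℤ.* (+ c ℤ.* (+ c ℤ.- 1ℤ))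
⟦2runner⟧ r c = trans (⟦2+⟧ (r * c) (5 * triangle c)) (cong₂ ℤ._+_ (cong (λ y → + 2 ℤ.* y) (ℤ.pos-* r c))
  (trans (cong (λ y → + 2 ℤ.* y) (ℤ.pos-* 5 (triangle c))) (trans (lemma (+ triangle c)) (cong (λ y → + 5 ℤ.* y) (⟦2triangle⟧ c)))))
  where
  lemma : ∀ t → + 2 ℤ.* (+ 5 ℤ.* t) ≡ + 5 ℤ.* (+ 2 ℤ.* t)
  lemma = ℤ-Solver.solve-∀

-- Completing the square around the mean M of the five counts.
runners≡weight : ∀ M t → sum₅ (nth t) ≡ M * 5 → sum₅ (λ r → runner r (nth t r)) ≡ weight M t + triangle (M * 5)
runners≡weight M (c₀ , c₁ , c₂ , c₃ , c₄) total = double-injective (begin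
  + 2 ℤ.* + sum₅ (λ r → runner r (nth t r))
    ≡⟨ trans (⟦2sum₅⟧ (λ r → runner r (nth t r))) (cong₂ ℤ._+_ (⟦2runner⟧ 0 c₀) (cong₂ ℤ._+_ (⟦2runner⟧ 1 c₁) (cong₂ ℤ._+_ (⟦2runner⟧ 2 c₂) (cong₂ ℤ._+_ (⟦2runner⟧ 3 c₃) (⟦2runner⟧ 4 c₄))))) ⟩
  Rℤ 0 (+ c₀) ℤ.+ (Rℤ 1 (+ c₁) ℤ.+ (Rℤ 2 (+ c₂) ℤ.+ (Rℤ 3 (+ c₃) ℤ.+ Rℤ 4 (+ c₄))))
    -- The identity relies on the total being 5M, so the last count is eliminated before it is left
    -- to the solver.
    ≡⟨ cong (λ c → Rℤ 0 (+ c₀) ℤ.+ (Rℤ 1 (+ c₁) ℤ.+ (Rℤ 2 (+ c₂) ℤ.+ (Rℤ 3 (+ c₃) ℤ.+ Rℤ 4 c)))) c₄≡ ⟩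
  Rℤ 0 (+ c₀) ℤ.+ (Rℤ 1 (+ c₁) ℤ.+ (Rℤ 2 (+ c₂) ℤ.+ (Rℤ 3 (+ c₃) ℤ.+ Rℤ 4 c₄′)))
    ≡⟨ solve 5 (λ a b c d M → let z = M :* con (+ 5) :- (a :+ (b :+ (c :+ d))) in
         Rs 0 a :+ (Rs 1 b :+ (Rs 2 c :+ (Rs 3 d :+ Rs 4 z))) :=
         Gs 1 4 (a :- M) :+ (Gs 2 3 (b :- M) :+ (Gs 3 2 (c :- M) :+ (Gs 4 1 (d :- M) :+ Gs 5 0 (z :- M)))) :+ (M :* con (+ 5)) :* (M :* con (+ 5) :- con 1ℤ)) refl (+ c₀) (+ c₁) (+ c₂) (+ c₃) (+ M) ⟩
  Gℤ 1 4 (+ c₀ ℤ.- + M) ℤ.+ (Gℤ 2 3 (+ c₁ ℤ.- + M) ℤ.+ (Gℤ 3 2 (+ c₂ ℤ.- + M) ℤ.+ (Gℤ 4 1 (+ c₃ ℤ.- + M) ℤ.+ Gℤ 5 0 (c₄′ ℤ.- + M)))) ℤ.+ (+ M ℤ.* + 5) ℤ.* (+ M ℤ.* + 5 ℤ.- 1ℤ)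
    ≡⟨ cong₂ ℤ._+_ (cong₂ ℤ._+_ (to-e 1 4 c₀) (cong₂ ℤ._+_ (to-e 2 3 c₁) (cong₂ ℤ._+_ (to-e 3 2 c₂) (cong₂ ℤ._+_ (to-e 4 1 c₃)
         (trans (cong (λ c → Gℤ 5 0 (c ℤ.- + M)) (sym c₄≡)) (to-e 5 0 c₄))))))
         (trans (cong (λ L → L ℤ.* (L ℤ.- 1ℤ)) (sym (ℤ.pos-* M 5))) (sym (⟦2triangle⟧ (M * 5)))) ⟩
  Eℤ 1 4 c₀ ℤ.+ (Eℤ 2 3 c₁ ℤ.+ (Eℤ 3 2 c₂ ℤ.+ (Eℤ 4 1 c₃ ℤ.+ Eℤ 5 0 c₄))) ℤ.+ + 2 ℤ.* + triangle (M * 5)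
    ≡⟨ cong (λ y → y ℤ.+ + 2 ℤ.* + triangle (M * 5)) (trans (⟦2+⟧ (e 1 4 (c₀ ⊖ M)) _) (cong (λ y → Eℤ 1 4 c₀ ℤ.+ y)
         (trans (⟦2+⟧ (e 2 3 (c₁ ⊖ M)) _) (cong (λ y → Eℤ 2 3 c₁ ℤ.+ y) (trans (⟦2+⟧ (e 3 2 (c₂ ⊖ M)) _) (cong (λ y → Eℤ 3 2 c₂ ℤ.+ y) (⟦2+⟧ (e 4 1 (c₃ ⊖ M)) (e 5 0 (c₄ ⊖ M))))))))) ⟨
  + 2 ℤ.* + weight M t ℤ.+ + 2 ℤ.* + triangle (M * 5)
    ≡⟨ ⟦2+⟧ (weight M t) (triangle (M * 5)) ⟨
  + 2 ℤ.* + (weight M t + triangle (M * 5)) ∎)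
  where
  open ≡-Reasoning
  open +-*-Solver using (Polynomial; solve; con; _:+_; _:*_; _:-_; _:=_)
  t : Tuple
  t = c₀ , c₁ , c₂ , c₃ , c₄
  c₄′ : ℤ
  c₄′ = + M ℤ.* + 5 ℤ.- (+ c₀ ℤ.+ (+ c₁ ℤ.+ (+ c₂ ℤ.+ + c₃)))
  Rℤ : ℕ → ℤ → ℤ
  Rℤ r c = + 2 ℤ.* (+ r ℤ.* c) ℤ.+ + 5 ℤ.* (c ℤ.* (c ℤ.- 1ℤ))
  Gℤ : ℕ → ℕ → ℤ → ℤ
  Gℤ i j n = + i ℤ.* (n ℤ.* (n ℤ.+ 1ℤ)) ℤ.+ + j ℤ.* (n ℤ.* (n ℤ.- 1ℤ))
  Eℤ : ℕ → ℕ → ℕ → ℤ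
  Eℤ i j c = + 2 ℤ.* + e i j (c ⊖ M)
  Rs : ∀ {k} → ℕ → Polynomial k → Polynomial k
  Rs r c = con (+ 2) :* (con (+ r) :* c) :+ con (+ 5) :* (c :* (c :- con 1ℤ))
  Gs : ∀ {k} → ℕ → ℕ → Polynomial k → Polynomial k
  Gs i j n = con (+ i) :* (n :* (n :+ con 1ℤ)) :+ con (+ j) :* (n :* (n :- con 1ℤ))
  to-e : ∀ i j c → Gℤ i j (+ c ℤ.- + M) ≡ Eℤ i j c
  to-e i j c = trans (cong (Gℤ i j) (ℤ.m-n≡m⊖n c M)) (sym (⟦2e⟧ i j (c ⊖ M)))
  c₄≡ : + c₄ ≡ c₄′
  c₄≡ = trans (lemma (+ c₀) (+ c₁) (+ c₂) (+ c₃) (+ c₄)) (cong (λ L → L ℤ.- (+ c₀ ℤ.+ (+ c₁ ℤ.+ (+ c₂ ℤ.+ + c₃)))) (trans (sym cast) (trans (cong +_ total) (ℤ.pos-* M 5))))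
    where
    cast : + (c₀ + (c₁ + (c₂ + (c₃ + c₄)))) ≡ + c₀ ℤ.+ (+ c₁ ℤ.+ (+ c₂ ℤ.+ (+ c₃ ℤ.+ + c₄)))
    cast = trans (ℤ.pos-+ c₀ _) (cong (λ y → + c₀ ℤ.+ y) (trans (ℤ.pos-+ c₁ _) (cong (λ y → + c₁ ℤ.+ y) (trans (ℤ.pos-+ c₂ _) (cong (λ y → + c₂ ℤ.+ y) (ℤ.pos-+ c₃ c₄))))))
    lemma : ∀ a b c d e → e ≡ a ℤ.+ (b ℤ.+ (c ℤ.+ (d ℤ.+ e))) ℤ.- (a ℤ.+ (b ℤ.+ (c ℤ.+ d)))
    lemma = ℤ-Solver.solve-∀

length≤sum : ∀ {xs} → All (0 <_) xs → length xs ≤ sum xs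
length≤sum []        = z≤n
length≤sum (p ∷ pos) = ℕ.+-mono-≤ p (length≤sum pos)

map-unique : ∀ {A B : Set} (g : A → B) {xs} → Unique xs → (∀ {x y} → x ∈ xs → y ∈ xs → g x ≡ g y → x ≡ y) → Unique (map g xs)
map-unique g []          inj = []
map-unique g (fresh ∷ u) inj = All.map⁺ (All.tabulate (λ y∈ eq → All.lookup fresh y∈ (inj (here refl) (there y∈) eq))) ∷
                               map-unique g u (λ x∈ y∈ → inj (there x∈) (there y∈))

-- A partition of `n` has at most `n` parts, so `n≤5M` lets all of them be padded to the same 5M
-- beads. Equal total counts are what turn the cores of `n` into tuples of one fixed level.
module Cores (n M : ℕ) (n≤5M : n ≤ M * 5) where

  private
    l : ℕ
    l = M * 5

    padded : List ℕ → List ℕ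
    padded λs = pad (l ∸ length λs) λs

    Φ : List ℕ → Tuple
    Φ λs = counts (beads (padded λs))

    module _ {λs} (isP : IsPartition n λs) where

      open IsPartition isP

      dec : NonIncreasing λs
      dec = Linked⇒AllPairs (λ x≥y y≥z → ℕ.≤-trans y≥z x≥y) nonincreasing

      length≤l : length λs ≤ l
      length≤l = ℕ.≤-trans (length≤sum positive) (ℕ.≤-trans (ℕ.≤-reflexive total) n≤5M)

      length-padded : length (padded λs) ≡ l
      length-padded = trans (List.length-++ λs) (trans (cong (λ y → length λs + y) (List.length-replicate (l ∸ length λs))) (ℕ.m+[n∸m]≡n length≤l))

      sum-padded : sum (beads (padded λs)) ≡ n + triangle l
      sum-padded = trans (sum-beads (padded λs)) (cong₂ _+_ (trans (sum-pad (l ∸ length λs) λs) total) (cong triangle length-padded))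

      decreasing : Decreasing (beads (padded λs))
      decreasing = beads-decreasing (nonIncreasing-pad (l ∸ length λs) dec)

      closed : IsCore 5 λs → Closed (beads (padded λs))
      closed core = rows⇒closed (nonIncreasing-pad (l ∸ length λs) dec) (rows-pad (l ∸ length λs) λs (core⇒rows dec core))

      Φ-total : sum₅ (nth (Φ λs)) ≡ l
      Φ-total = trans (sym (length≡sum₅ (beads (padded λs)))) (trans (length-beads (padded λs)) length-padded)

      Φ-weight : IsCore 5 λs → weight M (Φ λs) ≡ n
      Φ-weight core = ℕ.+-cancelʳ-≡ (triangle l) (weight M (Φ λs)) n (trans (sym (runners≡weight M (Φ λs) Φ-total)) (trans (sym (sum≡runners (closed core) decreasing)) sum-padded))

    Φ-injective : ∀ {λs μs} → IsPartition n λs → IsCore 5 λs → IsPartition n μs → IsCore 5 μs → Φ λs ≡ Φ μs → λs ≡ μs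
    Φ-injective {λs} {μs} pλ cλ pμ cμ eq = trans (sym (strip-pad (l ∸ length λs) (IsPartition.positive pλ))) (trans (cong strip
      (beads-injective (counts-determine (closed pλ cλ) (decreasing pλ) (closed pμ cμ) (decreasing pμ)
        (λ r r<5 → trans (sym (nth-counts (beads (padded λs)) r r<5)) (trans (cong (λ t → nth t r) eq) (nth-counts (beads (padded μs)) r r<5))))))
      (strip-pad (l ∸ length μs) (IsPartition.positive pμ)))

    module Preimage (t : Tuple) (total : sum₅ (nth t) ≡ l) (wt : weight M t ≡ n) where

      open Fill (nth t)

      bs xs λs : List ℕ
      bs = fill l
      xs = unbeads bs
      λs = strip xs

      nth≤ : ∀ r → nth t r ≤ l
      nth≤ r = subst (nth t r ≤_) total (go t r)
        where
        go : ∀ t r → nth t r ≤ sum₅ (nth t)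
        go t@(a , b , c , d , e) 0 = ℕ.m≤m+n a _
        go t@(a , b , c , d , e) 1 = ℕ.≤-trans (ℕ.m≤m+n b _) (ℕ.m≤n+m _ a)
        go t@(a , b , c , d , e) 2 = ℕ.≤-trans (ℕ.m≤m+n c _) (ℕ.≤-trans (ℕ.m≤n+m _ b) (ℕ.m≤n+m _ a))
        go t@(a , b , c , d , e) 3 = ℕ.≤-trans (ℕ.m≤m+n d _) (ℕ.≤-trans (ℕ.m≤n+m _ c) (ℕ.≤-trans (ℕ.m≤n+m _ b) (ℕ.m≤n+m _ a)))
        go t@(a , b , c , d , e) (suc (suc (suc (suc _)))) = ℕ.≤-trans (ℕ.m≤n+m e d) (ℕ.≤-trans (ℕ.m≤n+m _ c) (ℕ.≤-trans (ℕ.m≤n+m _ b) (ℕ.m≤n+m _ a)))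

      count-bs : ∀ r → r < 5 → count r bs ≡ nth t r
      count-bs r r<5 = count-fill r l r<5 (nth≤ r)

      length-xs : length xs ≡ l
      length-xs = trans (length-unbeads bs) (trans (length≡sum₅ bs) (trans (sum₅-cong {λ r → count r bs} count-bs) total))

      beads-xs : beads xs ≡ bs
      beads-xs = beads-unbeads (fill-decreasing l)

      dec-xs : NonIncreasing xs
      dec-xs = unbeads-nonIncreasing (fill-decreasing l)

      padded-λs : padded λs ≡ xs
      padded-λs = sym (trans (pad-strip dec-xs) (cong (λ m → pad (m ∸ length λs) λs) length-xs))

      sum-xs : sum xs ≡ n
      sum-xs = ℕ.+-cancelʳ-≡ (triangle l) (sum xs) n (begin
        sum xs + triangle l                     ≡⟨ cong (λ m → sum xs + triangle m) length-xs ⟨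
        sum xs + triangle (length xs)           ≡⟨ sum-beads xs ⟨
        sum (beads xs)                          ≡⟨ cong sum beads-xs ⟩
        sum bs                                  ≡⟨ sum≡runners (fill-closed l) (fill-decreasing l) ⟩
        sum₅ (λ r → runner r (count r bs))      ≡⟨ sum₅-cong {λ r → runner r (count r bs)} (λ r r<5 → cong (runner r) (count-bs r r<5)) ⟩
        sum₅ (λ r → runner r (nth t r))         ≡⟨ runners≡weight M t total ⟩
        weight M t + triangle l                 ≡⟨ cong (_+ triangle l) wt ⟩
        n + triangle l                          ∎)
        where open ≡-Reasoning

      dec-λs : NonIncreasing λs
      dec-λs = AllPairs.filter⁺ (0 ℕ.<?_) dec-xs

      isPartition : IsPartition n λs
      isPartition = mkIsPartition (AllPairs⇒Linked dec-λs) (All.all-filter (0 ℕ.<?_) xs)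
        (trans (sym (sum-pad (l ∸ length λs) λs)) (trans (cong sum padded-λs) sum-xs))

      core : IsCore 5 λs
      core = rows⇒core dec-λs (rows-unpad (l ∸ length λs) λs (subst RowsOK (sym padded-λs) (closed⇒rows dec-xs (subst Closed (sym beads-xs) (fill-closed l)))))

      Φ-λs : Φ λs ≡ t
      Φ-λs = trans (cong (counts ∘ beads) padded-λs) (trans (cong counts beads-xs) (counts-cong {bs} count-bs))

  private
    cores : List (List ℕ)
    cores = filter (isCore? 5) (partitions n)

    ∈-cores : ∀ {λs} → λs ∈ cores → IsPartition n λs × IsCore 5 λs
    ∈-cores {λs} λ∈ with ∈-filter⁻ (isCore? 5) {xs = partitions n} λ∈
    ... | λ∈′ , core = Equivalence.to ∈-partitions λ∈′ , core

    tuples : List Tuple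
    tuples = filter (λ t → weight M t ℕ.≟ n) (lev Levels-tuple l)

    into : ∀ {t} → t ∈ map Φ cores → t ∈ tuples
    into t∈ with ∈-map⁻ Φ t∈
    ... | λs , λ∈ , refl = ∈-filter⁺ (λ t → weight M t ℕ.≟ n) (complete Levels-tuple (Φ-total (proj₁ (∈-cores λ∈)))) (Φ-weight (proj₁ (∈-cores λ∈)) (proj₂ (∈-cores λ∈)))

    outof : ∀ {t} → t ∈ tuples → t ∈ map Φ cores
    outof {t} t∈ with ∈-filter⁻ (λ t → weight M t ℕ.≟ n) {xs = lev Levels-tuple l} t∈
    ... | t∈′ , wt = subst (_∈ map Φ cores) Φ-λs (∈-map⁺ Φ (∈-filter⁺ (isCore? 5) (Equivalence.from ∈-partitions isPartition) core))
      where open Preimage t (sound Levels-tuple t∈′) wt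

  c₅≡tuples : c₅ n ≡ length tuples
  c₅≡tuples = trans (sym (List.length-map Φ cores)) (↭-length (∼bag⇒↭ (unique∧set⇒bag
    (map-unique Φ (Unique.filter⁺ (isCore? 5) (partitions-unique n)) (λ λ∈ μ∈ → Φ-injective (proj₁ (∈-cores λ∈)) (proj₂ (∈-cores λ∈)) (proj₁ (∈-cores μ∈)) (proj₂ (∈-cores μ∈))))
    (Unique.filter⁺ (λ t → weight M t ℕ.≟ n) (unique Levels-tuple l))
    (mk⇔ into outof))))

-- The generating function of 5-cores

conv : (ℕ → Series) → (ℕ → Series) → ℕ → Series
conv g h zero    = g 0 ✶ h 0
conv g h (suc l) = g 0 ✶ h (suc l) ⊞ conv (g ∘ suc) h l

conv-cong : ∀ {g g′ h h′} → (∀ l → g l ≈ g′ l) → (∀ l → h l ≈ h′ l) → ∀ l → conv g h l ≈ conv g′ h′ l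
conv-cong p q zero    = ✶-cong (p 0) (q 0)
conv-cong p q (suc l) = ⊞-cong (✶-cong (p 0) (q (suc l))) (conv-cong (p ∘ suc) q l)

conv-cong[] : ∀ {m g g′ h h′} → (∀ l → g l ≈[ m ] g′ l) → (∀ l → h l ≈[ m ] h′ l) → ∀ l → conv g h l ≈[ m ] conv g′ h′ l
conv-cong[] p q zero    = ✶-cong[] (p 0) (q 0)
conv-cong[] p q (suc l) = ⊞-cong[] (✶-cong[] (p 0) (q (suc l))) (conv-cong[] (p ∘ suc) q l)

conv-✶ : ∀ F A g h l → (F ✶ A) ✶ conv g h l ≈ conv (λ k → F ✶ g k) (λ k → A ✶ h k) l
conv-✶ F A g h zero    = ✶-interchange F A (g 0) (h 0)
conv-✶ F A g h (suc l) = ≈-trans (𝕊.distribˡ (F ✶ A) (g 0 ✶ h (suc l)) _) (⊞-cong (✶-interchange F A (g 0) (h (suc l))) (conv-✶ F A (g ∘ suc) h l))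

conv-linear : ∀ a b g g′ h l → conv (λ k → a ✶ g k ⊞ b ✶ g′ k) h l ≈ a ✶ conv g h l ⊞ b ✶ conv g′ h l
conv-linear a b g g′ h zero    = linear-term a b (g 0) (g′ 0) (h 0)
conv-linear a b g g′ h (suc l) = ≈-trans (⊞-cong (linear-term a b (g 0) (g′ 0) (h (suc l))) (conv-linear a b (g ∘ suc) (g′ ∘ suc) h l))
  (linear-collect a b (g 0 ✶ h (suc l)) (g′ 0 ✶ h (suc l)) (conv (g ∘ suc) h l) (conv (g′ ∘ suc) h l))

-- Multiplication by a + b z of the series in z with coefficients g
times : Series → Series → (ℕ → Series) → ℕ → Series
times a b g zero    = a ✶ g 0
times a b g (suc l) = a ✶ g (suc l) ⊞ b ✶ g l

times-cong : ∀ {a a′ b b′ g g′} → a ≈ a′ → b ≈ b′ → (∀ l → g l ≈ g′ l) → ∀ l → times a b g l ≈ times a′ b′ g′ l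
times-cong p q r zero    = ✶-cong p (r 0)
times-cong p q r (suc l) = ⊞-cong (✶-cong p (r (suc l))) (✶-cong q (r l))

conv-timesˡ : ∀ a b g h l → conv (times a b g) h l ≈ times a b (conv g h) l
conv-timesˡ a b g h zero    = ✶-assoc a (g 0) (h 0)
conv-timesˡ a b g h (suc l) = ≈-trans (⊞-cong (✶-assoc a (g 0) (h (suc l))) (conv-linear a b (g ∘ suc) g h l))
  (≈-trans (≈-sym (⊞-assoc (a ✶ (g 0 ✶ h (suc l))) _ _)) (⊞-congʳ (b ✶ conv g h l) (≈-sym (𝕊.distribˡ a (g 0 ✶ h (suc l)) (conv (g ∘ suc) h l)))))

conv-timesʳ : ∀ a b g h l → conv g (times a b h) l ≈ times a b (conv g h) l
conv-timesʳ a b g h zero    = ✶-left-comm (g 0) a (h 0)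
conv-timesʳ a b g h (suc zero) = ≈-trans (⊞-congˡ (g 0 ✶ (a ✶ h 1 ⊞ b ✶ h 0)) (conv-timesʳ a b (g ∘ suc) h 0))
  (times-collect₀ a b (g 0) (h 1) (h 0) (g 1 ✶ h 0))
conv-timesʳ a b g h (suc (suc l)) = ≈-trans (⊞-congˡ (g 0 ✶ (a ✶ h (2 + l) ⊞ b ✶ h (1 + l))) (conv-timesʳ a b (g ∘ suc) h (suc l)))
  (times-collect a b (g 0) (h (2 + l)) (h (1 + l)) (conv (g ∘ suc) h (suc l)) (conv (g ∘ suc) h l))

monomials : ∀ {I : Set} → (I → ℕ) → List I → Series
monomials E L m = sumL (λ i → mono 1ℤ (E i) m) L

module _ {I J : Set} (E : I → ℕ) (F : J → ℕ) where

  private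
    E+F : I × J → ℕ
    E+F (i , j) = E i + F j

  monomials-++ : ∀ {I : Set} (E : I → ℕ) L M → monomials E (L ++ M) ≈ monomials E L ⊞ monomials E M
  monomials-++ E L M m = trans (sumL-++ (λ i → mono 1ℤ (E i) m) L M) (sym (⊞-at (monomials E L) (monomials E M) m))

  mono-✶-monomials : ∀ i M → mono 1ℤ (E i) ✶ monomials F M ≈ monomials E+F (map (i ,_) M)
  mono-✶-monomials i []      = ✶-zeroʳ (mono 1ℤ (E i))
  mono-✶-monomials i (j ∷ M) = begin
    mono 1ℤ (E i) ✶ monomials F (j ∷ M)                                 ≈⟨ ✶-congˡ (mono 1ℤ (E i)) (λ m → sym (⊞-at (mono 1ℤ (F j)) (monomials F M) m)) ⟩
    mono 1ℤ (E i) ✶ (mono 1ℤ (F j) ⊞ monomials F M)                     ≈⟨ 𝕊.distribˡ (mono 1ℤ (E i)) (mono 1ℤ (F j)) (monomials F M) ⟩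
    mono 1ℤ (E i) ✶ mono 1ℤ (F j) ⊞ mono 1ℤ (E i) ✶ monomials F M       ≈⟨ ⊞-cong (mono-mono 1ℤ (E i) 1ℤ (F j)) (mono-✶-monomials i M) ⟩
    mono 1ℤ (E i + F j) ⊞ monomials E+F (map (i ,_) M)                  ≈⟨ ⊞-at (mono 1ℤ (E i + F j)) (monomials E+F (map (i ,_) M)) ⟩
    monomials E+F (map (i ,_) (j ∷ M))                                  ∎
    where open ≈-Reasoning

  monomials-× : ∀ L M → monomials E L ✶ monomials F M ≈ monomials E+F (cartesianProduct L M)
  monomials-× []      M = ✶-zeroˡ (monomials F M)
  monomials-× (i ∷ L) M = begin
    monomials E (i ∷ L) ✶ monomials F M                                 ≈⟨ ✶-congʳ (monomials F M) (λ m → sym (⊞-at (mono 1ℤ (E i)) (monomials E L) m)) ⟩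
    (mono 1ℤ (E i) ⊞ monomials E L) ✶ monomials F M                     ≈⟨ 𝕊.distribʳ (monomials F M) (mono 1ℤ (E i)) (monomials E L) ⟩
    mono 1ℤ (E i) ✶ monomials F M ⊞ monomials E L ✶ monomials F M       ≈⟨ ⊞-cong (mono-✶-monomials i M) (monomials-× L M) ⟩
    monomials E+F (map (i ,_) M) ⊞ monomials E+F (cartesianProduct L M) ≈⟨ monomials-++ E+F (map (i ,_) M) (cartesianProduct L M) ⟨
    monomials E+F (cartesianProduct (i ∷ L) M)                          ∎
    where open ≈-Reasoning

  conv-monomials : ∀ (f : ℕ → List I) (g : ℕ → List J) l → conv (λ k → monomials E (f k)) (λ k → monomials F (g k)) l ≈ monomials E+F (pairs f g l)
  conv-monomials f g zero    = monomials-× (f 0) (g 0)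
  conv-monomials f g (suc l) = ≈-trans (⊞-cong (monomials-× (f 0) (g (suc l))) (conv-monomials (f ∘ suc) g l))
    (≈-sym (monomials-++ E+F (cartesianProduct (f 0) (g (suc l))) (pairs (f ∘ suc) g l)))

-- `conv` multiplies series in z given by their coefficients, with z marking the number of beads.
-- The nesting matches that of `Levels-tuple`, so the coefficient of z^l runs over the tuples of
-- total `l`.
conv₅ : (g₁ g₂ g₃ g₄ g₅ : ℕ → Series) → ℕ → Series
conv₅ g₁ g₂ g₃ g₄ g₅ = conv g₁ (conv g₂ (conv g₃ (conv g₄ g₅)))

conv₅-cong : ∀ {g₁ g₂ g₃ g₄ g₅ h₁ h₂ h₃ h₄ h₅} → (∀ l → g₁ l ≈ h₁ l) → (∀ l → g₂ l ≈ h₂ l) → (∀ l → g₃ l ≈ h₃ l) → (∀ l → g₄ l ≈ h₄ l) → (∀ l → g₅ l ≈ h₅ l) →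
             ∀ l → conv₅ g₁ g₂ g₃ g₄ g₅ l ≈ conv₅ h₁ h₂ h₃ h₄ h₅ l
conv₅-cong p₁ p₂ p₃ p₄ p₅ = conv-cong p₁ (conv-cong p₂ (conv-cong p₃ (conv-cong p₄ p₅)))

module _ (a b : Series) (g₁ g₂ g₃ g₄ g₅ : ℕ → Series) where

  private
    R : ∀ g {h h′} → (∀ l → h l ≈ times a b h′ l) → ∀ l → conv g h l ≈ times a b (conv g h′) l
    R g {h} {h′} p l = ≈-trans (conv-cong (λ _ → ≈-refl {g _}) p l) (conv-timesʳ a b g h′ l)

  times₁ : ∀ l → conv₅ (times a b g₁) g₂ g₃ g₄ g₅ l ≈ times a b (conv₅ g₁ g₂ g₃ g₄ g₅) l
  times₁ = conv-timesˡ a b g₁ (conv g₂ (conv g₃ (conv g₄ g₅)))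

  times₂ : ∀ l → conv₅ g₁ (times a b g₂) g₃ g₄ g₅ l ≈ times a b (conv₅ g₁ g₂ g₃ g₄ g₅) l
  times₂ = R g₁ (conv-timesˡ a b g₂ (conv g₃ (conv g₄ g₅)))

  times₃ : ∀ l → conv₅ g₁ g₂ (times a b g₃) g₄ g₅ l ≈ times a b (conv₅ g₁ g₂ g₃ g₄ g₅) l
  times₃ = R g₁ (R g₂ (conv-timesˡ a b g₃ (conv g₄ g₅)))

  times₄ : ∀ l → conv₅ g₁ g₂ g₃ (times a b g₄) g₅ l ≈ times a b (conv₅ g₁ g₂ g₃ g₄ g₅) l
  times₄ = R g₁ (R g₂ (R g₃ (conv-timesˡ a b g₄ g₅)))

  times₅ : ∀ l → conv₅ g₁ g₂ g₃ g₄ (times a b g₅) l ≈ times a b (conv₅ g₁ g₂ g₃ g₄ g₅) l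
  times₅ = R g₁ (R g₂ (R g₃ (conv-timesʳ a b g₄ g₅)))

Jc : ℕ → ℕ → ℕ → ℕ → ℕ → Series
Jc i j = Jacobi.coefficient i j

infixr 2 _⟫_
_⟫_ : ∀ {g h k : ℕ → Series} → (∀ l → g l ≈ h l) → (∀ l → h l ≈ k l) → ∀ l → g l ≈ k l
(p ⟫ q) l = ≈-trans (p l) (q l)

Jc-sucˡ : ∀ i j a b l → Jc i j (suc a) b l ≈ times one (mono 1ℤ (i + a * (i + j))) (Jc i j a b) l
Jc-sucˡ i j a b zero    = ≈-trans (Jacobi.coefficient-sucˡ-0 i j a b) (≈-sym (✶-identityˡ _))
Jc-sucˡ i j a b (suc l) = ≈-trans (Jacobi.coefficient-sucˡ i j a b l) (⊞-congʳ _ (≈-sym (✶-identityˡ _)))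

Jc-sucʳ : ∀ i j a b l → Jc i j a (suc b) l ≈ times (mono 1ℤ (j + b * (i + j))) one (Jc i j a b) l
Jc-sucʳ i j a b zero    = Jacobi.coefficient-sucʳ-0 i j a b
Jc-sucʳ i j a b (suc l) = ≈-trans (Jacobi.coefficient-sucʳ i j a b l) (⊞-congˡ _ (≈-sym (✶-identityˡ _)))

unitary : ℕ → Series
unitary zero    = one
unitary (suc _) = 0S

Jc-00 : ∀ i j l → Jc i j 0 0 l ≈ unitary l
Jc-00 i j zero    = ≈-trans (✶-identityˡ _) (≈-trans (mono-exp 1ℤ (cong₂ _+_ (ℕ.*-zeroʳ i) (ℕ.*-zeroʳ j))) mono-0-1)
Jc-00 i j (suc l) = Jacobi.coefficient-> i j 0 0 (suc l) (s≤s z≤n)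

unitary-conv : ∀ {g h} → (∀ l → g l ≈ unitary l) → (∀ l → h l ≈ unitary l) → ∀ l → conv g h l ≈ unitary l
unitary-conv p q zero    = ≈-trans (✶-cong (p 0) (q 0)) (✶-identityˡ one)
unitary-conv {g} {h} p q (suc l) = ≈-trans (⊞-cong (≈-trans (✶-congˡ (g 0) (q (suc l))) (✶-zeroʳ (g 0))) (vanish l (p ∘ suc))) (⊞-identityʳ 0S)
  where
  vanish : ∀ l {g} → (∀ k → g k ≈ 0S) → conv g h l ≈ 0S
  vanish zero    z = ≈-trans (✶-congʳ (h 0) (z 0)) (✶-zeroˡ (h 0))
  vanish (suc l) z = ≈-trans (⊞-cong (≈-trans (✶-congʳ (h (suc l)) (z 0)) (✶-zeroˡ _)) (vanish l (z ∘ suc))) (⊞-identityʳ 0S)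

-- Π_k (1 + z q^k) factors over the residues of k modulo 5.
runner-product : ∀ M l → conv₅ (Jc 1 4 M M) (Jc 2 3 M M) (Jc 3 2 M M) (Jc 4 1 M M) (Jc 5 0 M M) l ≈ Jc 1 0 (M * 5) (M * 5) l
runner-product zero = unitary-conv (Jc-00 1 4) (unitary-conv (Jc-00 2 3) (unitary-conv (Jc-00 3 2) (unitary-conv (Jc-00 4 1) (Jc-00 5 0)))) ⟫ λ l → ≈-sym (Jc-00 1 0 l)
runner-product (suc M) =
  conv₅-cong (step 1 4) (step 2 3) (step 3 2) (step 4 1) (step 5 0) ⟫
  -- The ten new factors are pulled out by decreasing exponent, those with z before those with z⁻¹:
  -- this is the order in which `Jc 1 0` sheds them.
  times₅ one (x 5) _ _ _ _ _ ⟫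
  cong-x 4 (times₄ one (x 4) _ _ _ _ _ ⟫ cong-x 3 (times₃ one (x 3) _ _ _ _ _ ⟫ cong-x 2 (times₂ one (x 2) _ _ _ _ _ ⟫ cong-x 1 (times₁ one (x 1) _ _ _ _ _ ⟫ cong-x 0 (
  times₁ (y 4) one _ _ _ _ _ ⟫ cong-y 4 (times₂ (y 3) one _ _ _ _ _ ⟫ cong-y 3 (times₃ (y 2) one _ _ _ _ _ ⟫ cong-y 2 (times₄ (y 1) one _ _ _ _ _ ⟫ cong-y 1 (times₅ (y 0) one _ _ _ _ _ ⟫
  cong-y 0 (runner-product M))))))))))
  where
  x y : ℕ → Series
  x i = mono 1ℤ (i + M * 5)
  y j = mono 1ℤ (j + M * 5)
  step : ∀ i j l → Jc i j (suc M) (suc M) l ≈ times one (mono 1ℤ (i + M * (i + j))) (times (mono 1ℤ (j + M * (i + j))) one (Jc i j M M)) l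
  step i j = Jc-sucˡ i j M (suc M) ⟫ times-cong ≈-refl ≈-refl (Jc-sucʳ i j M M)
  cong-x : ∀ k {g b} → (∀ l → g l ≈ Jc 1 0 (k + M * 5) b l) → ∀ l → times one (x (suc k)) g l ≈ Jc 1 0 (suc (k + M * 5)) b l
  cong-x k {b = b} p = times-cong ≈-refl (mono-exp 1ℤ (cong suc (sym (ℕ.*-identityʳ (k + M * 5))))) p ⟫ λ l → ≈-sym (Jc-sucˡ 1 0 (k + M * 5) b l)
  cong-y : ∀ k {g} → (∀ l → g l ≈ Jc 1 0 (M * 5) (k + M * 5) l) → ∀ l → times (y k) one g l ≈ Jc 1 0 (M * 5) (suc (k + M * 5)) l
  cong-y k p = times-cong (mono-exp 1ℤ (sym (ℕ.*-identityʳ (k + M * 5)))) ≈-refl p ⟫ λ l → ≈-sym (Jc-sucʳ 1 0 (M * 5) (k + M * 5) l)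

-- For `l` beyond 2M the coefficient is 0 and the monomial is not, but then `l` is so far from `M`
-- that the exponent is at least `m`.
runner-limit : ∀ i j .{{_ : NonZero i}} → i + j ≡ 5 → ∀ m M → m + m ≤ M → ∀ l → f 5 ✶ Jc i j M M l ≈[ m ] monomials (λ c → e i j (c ⊖ M)) (l ∷ [])
runner-limit i j i+j≡5 m M 2m≤M l = ≈[]-trans (near (l ℕ.≤? M + M)) (λ n _ → sym (ℤ.+-identityʳ _))
  where
  f₅ : f 5 ≡ f (i + j)
  f₅ = cong f (sym i+j≡5)
  near : Dec (l ≤ M + M) → f 5 ✶ Jc i j M M l ≈[ m ] mono 1ℤ (e i j (l ⊖ M))
  near (yes l≤) = ≈[]-trans (≈⇒≈[] (✶-congʳ _ (λ n → cong (λ F → F n) f₅))) (Jacobi.Limit.term-limit i j m M l 2m≤M l≤)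
  near (no l≰) n n<m = trans (trans (✶-congˡ (f 5) (Jacobi.coefficient-> i j M M l l>) n) (✶-zeroʳ (f 5) n)) (sym (mono-< 1ℤ _ n (ℕ.<-≤-trans n<m m≤e)))
    where
    l> = ℕ.≰⇒> l≰
    M≤l : M ≤ l
    M≤l = ℕ.≤-trans (ℕ.m≤m+n M M) (ℕ.<⇒≤ l>)
    M<∣l-M∣ : M < ∣ l ⊖ M ∣
    M<∣l-M∣ = subst (M <_) (sym (cong ∣_∣ (ℤ.⊖-≥ M≤l))) (ℕ.+-cancelˡ-< M M (l ∸ M) (subst (M + M <_) (sym (ℕ.m+[n∸m]≡n M≤l)) l>))
    m≤e : m ≤ e i j (l ⊖ M)
    m≤e = ℕ.≤-trans (ℕ.≤-trans (ℕ.m≤m+n m m) 2m≤M) (ℕ.≤-pred (ℕ.≤-trans M<∣l-M∣ (e-growth i j (l ⊖ M))))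

C : Series
C n = + c₅ n

C≈tuples : ∀ M → C ≈[ M * 5 ] monomials (weight M) (lev Levels-tuple (M * 5))
C≈tuples M n n<5M = trans (cong +_ (Cores.c₅≡tuples n M (ℕ.<⇒≤ n<5M))) (go (lev Levels-tuple (M * 5)))
  where
  step : ∀ t L → + length (filter (λ t → weight M t ℕ.≟ n) (t ∷ L)) ≡ mono 1ℤ (weight M t) n ℤ.+ + length (filter (λ t → weight M t ℕ.≟ n) L)
  step t L = at (weight M t ℕ.≟ n)
    where
    at : Dec (weight M t ≡ n) → _
    at (yes p) = trans (cong (+_ ∘ length) (List.filter-accept (λ t → weight M t ℕ.≟ n) p)) (cong (λ c → c ℤ.+ + length (filter (λ t → weight M t ℕ.≟ n) L)) (sym (trans (cong (λ k → mono 1ℤ k n) p) (mono-diag 1ℤ n))))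
    at (no ¬p) = trans (cong (+_ ∘ length) (List.filter-reject (λ t → weight M t ℕ.≟ n) ¬p)) (trans (sym (ℤ.+-identityˡ _)) (cong (λ c → c ℤ.+ + length (filter (λ t → weight M t ℕ.≟ n) L)) (sym (mono-off 1ℤ (weight M t) n ¬p))))
  go : ∀ L → + length (filter (λ t → weight M t ℕ.≟ n) L) ≡ monomials (weight M) L n
  go []      = refl
  go (t ∷ L) = trans (step t L) (cong (λ y → mono 1ℤ (weight M t) n ℤ.+ y) (go L))

-- The central coefficient `prod M (M * 5)` is evaluated twice modulo `q^m`. Times f₅⁵ it is the sum
-- of `q^weight` over tuples of total 5M, hence `C`. Times f₁ it is 1, being also the constant term
-- in z of the whole product by `runner-product`. Eliminating it gives the quotient.
C-eta : f 1 ✶ C ≈ f 5 ^5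
C-eta = ≈[]⇒≈ λ m → let M = suc (m + m) ; l = M * 5 ; 2m≤M = ℕ.n≤1+n (m + m)
                        m≤l = ℕ.≤-trans (ℕ.≤-trans (ℕ.m≤m+n m m) 2m≤M) (ℕ.m≤m*n M 5) in
  ≈[]-trans (✶-cong[] {F = f 1} ≈[]-refl (≈[]-≤ m≤l (C≈tuples M)))
  (≈[]-trans (✶-cong[] {F = f 1} ≈[]-refl (≈[]-sym (tuples-limit m M 2m≤M)))
  (≈[]-trans (≈⇒≈[] (✶-left-comm (f 1) (f 5 ^5) _))
  (≈[]-trans (✶-cong[] {F = f 5 ^5} ≈[]-refl (centre m M 2m≤M)) (≈⇒≈[] (✶-identityʳ _)))))
  where
  prod : ℕ → ℕ → Series
  prod M = conv₅ (Jc 1 4 M M) (Jc 2 3 M M) (Jc 3 2 M M) (Jc 4 1 M M) (Jc 5 0 M M)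
  tuples-limit : ∀ m M → m + m ≤ M → f 5 ^5 ✶ prod M (M * 5) ≈[ m ] monomials (weight M) (lev Levels-tuple (M * 5))
  tuples-limit m M 2m≤M = ≈[]-trans (≈⇒≈[] (pull (M * 5))) (≈[]-trans
    (conv-cong[] (runner-limit 1 4 refl m M 2m≤M) (conv-cong[] (runner-limit 2 3 refl m M 2m≤M) (conv-cong[] (runner-limit 3 2 refl m M 2m≤M) (conv-cong[] (runner-limit 4 1 refl m M 2m≤M) (runner-limit 5 0 refl m M 2m≤M)))) (M * 5))
    (≈⇒≈[] (collect (M * 5))))
    where
    pull : ∀ l → f 5 ^5 ✶ prod M l ≈ conv₅ (λ k → f 5 ✶ Jc 1 4 M M k) (λ k → f 5 ✶ Jc 2 3 M M k) (λ k → f 5 ✶ Jc 3 2 M M k) (λ k → f 5 ✶ Jc 4 1 M M k) (λ k → f 5 ✶ Jc 5 0 M M k) l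
    pull = conv-✶ (f 5) _ _ _ ⟫ conv-cong (λ _ → ≈-refl) (conv-✶ (f 5) _ _ _ ⟫ conv-cong (λ _ → ≈-refl) (conv-✶ (f 5) _ _ _ ⟫ conv-cong (λ _ → ≈-refl) (conv-✶ (f 5) (f 5) _ _)))
    collect : ∀ l → _ ≈ monomials (weight M) (lev Levels-tuple l)
    collect = conv-cong (λ _ → ≈-refl) (conv-cong (λ _ → ≈-refl) (conv-cong (λ _ → ≈-refl) (conv-monomials _ _ _ _) ⟫ conv-monomials _ _ _ _) ⟫ conv-monomials _ _ _ _) ⟫ conv-monomials _ _ _ _
  centre : ∀ m M → m + m ≤ M → f 1 ✶ prod M (M * 5) ≈[ m ] one
  centre m M 2m≤M = ≈[]-trans (≈⇒≈[] (✶-congˡ (f 1) (runner-product M (M * 5)))) (≈[]-trans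
    (Jacobi.Limit.term-limit 1 0 m (M * 5) (M * 5) (ℕ.≤-trans 2m≤M (ℕ.m≤m*n M 5)) (ℕ.m≤m+n (M * 5) (M * 5)))
    (≈⇒≈[] (≈-trans (mono-exp 1ℤ (cong (e 1 0) (ℤ.n⊖n≡0 (M * 5)))) mono-0-1)))

-- The relation of level 10

open Quotient C C-eta

private
  q¹ : Series
  q¹ = mono 1ℤ 1

  φ₁ φ₅ : Series
  φ₁ = φ[-q^ 1 ]
  φ₅ = φ[-q^ 5 ]

-- `φ-relation` times f₂² f₅ f₁₀², which clears the denominators f₂² of φ(-q)², f₁₀² of φ(-q⁵)² and
-- f₂ f₅ of `K`.
φ-eta : f 1 ✶ (f 1 ✶ (f 1 ✶ f 1)) ✶ (f 5 ✶ (f 10 ✶ f 10)) ≈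
        (f 2 ✶ f 2) ✶ f 5 ^5 ⊞ const -[1+ 3 ] ✶ (q¹ ✶ (f 1 ✶ (f 2 ✶ f 10 ^5)))
φ-eta = begin
  f 1 ✶ (f 1 ✶ (f 1 ✶ f 1)) ✶ (f 5 ✶ (f 10 ✶ f 10))
    ≈⟨ φ-tidy′ (f 1) (f 5) (f 10) ⟨
  ((f 1 ✶ f 1) ✶ (f 1 ✶ f 1)) ✶ (f 5 ✶ (f 10 ✶ f 10))
    ≈⟨ ✶-congʳ _ (✶-cong (φ-product 1) (φ-product 1)) ⟨
  (φ₁ ✶ f 2) ✶ (φ₁ ✶ f 2) ✶ (f 5 ✶ (f 10 ✶ f 10))
    ≈⟨ φ-clear φ₁ (f 2) (f 5) (f 10) ⟨
  (φ₁ ✶ φ₁) ✶ ((f 2 ✶ f 2) ✶ (f 5 ✶ (f 10 ✶ f 10)))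
    ≈⟨ ✶-congʳ _ (≈-trans φ-relation (⊞-congˡ (φ₅ ✶ φ₅) (const-✶ -[1+ 3 ] (q¹ ✶ K)))) ⟩
  (φ₅ ✶ φ₅ ⊞ const -[1+ 3 ] ✶ (q¹ ✶ K)) ✶ ((f 2 ✶ f 2) ✶ (f 5 ✶ (f 10 ✶ f 10)))
    ≈⟨ φ-clear′ φ₅ K q¹ (f 2) (f 5) (f 10) ⟩
  ((φ₅ ✶ f 10) ✶ (φ₅ ✶ f 10)) ✶ (f 2 ✶ (f 2 ✶ f 5)) ⊞ const -[1+ 3 ] ✶ (q¹ ✶ (K ✶ f 5 ✶ f 2) ✶ (f 2 ✶ (f 10 ✶ f 10)))
    ≈⟨ ⊞-cong (✶-congʳ _ (✶-cong (φ-product 5) (φ-product 5))) (✶-congˡ (const -[1+ 3 ]) (✶-congʳ _ (✶-congˡ q¹ K-eta))) ⟩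
  ((f 5 ✶ f 5) ✶ (f 5 ✶ f 5)) ✶ (f 2 ✶ (f 2 ✶ f 5)) ⊞ const -[1+ 3 ] ✶ (q¹ ✶ (f 1 ✶ (f 10 ✶ (f 10 ✶ f 10))) ✶ (f 2 ✶ (f 10 ✶ f 10)))
    ≈⟨ φ-tidy (f 1) (f 2) (f 5) (f 10) q¹ ⟩
  (f 2 ✶ f 2) ✶ f 5 ^5 ⊞ const -[1+ 3 ] ✶ (q¹ ✶ (f 1 ✶ (f 2 ✶ f 10 ^5))) ∎
  where open ≈-Reasoning

-- `ψ-relation` times f₁² f₅² f₁₀, which clears the denominators f₁² of ψ(q)², f₅² of ψ(q⁵)² and f₁
-- f₁₀ of `G`. The 4 to be cancelled stems from squaring 2ψ.
ψ-eta : f 2 ✶ (f 2 ✶ (f 2 ✶ f 2)) ✶ ((f 5 ✶ f 5) ✶ f 10) ≈ f 1 ✶ (f 2 ✶ f 5 ^5) ⊞ q¹ ✶ ((f 1 ✶ f 1) ✶ f 10 ^5)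
ψ-eta = const-cancel (+ 4) (begin
  const (+ 4) ✶ (f 2 ✶ (f 2 ✶ (f 2 ✶ f 2)) ✶ ((f 5 ✶ f 5) ✶ f 10))
    ≈⟨ four-out′ (f 2) (f 5) (f 10) ⟨
  (const (+ 2) ✶ (f 2 ✶ f 2)) ✶ (const (+ 2) ✶ (f 2 ✶ f 2)) ✶ ((f 5 ✶ f 5) ✶ f 10)
    ≈⟨ ✶-congʳ _ (✶-cong (2ψ-product 1) (2ψ-product 1)) ⟨
  (2ψ 1 ✶ f 1) ✶ (2ψ 1 ✶ f 1) ✶ ((f 5 ✶ f 5) ✶ f 10)
    ≈⟨ ψ-clear (2ψ 1) (f 1) (f 5) (f 10) ⟨
  (2ψ 1 ✶ 2ψ 1) ✶ ((f 1 ✶ f 1) ✶ ((f 5 ✶ f 5) ✶ f 10))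
    ≈⟨ ✶-congʳ _ (≈-trans ψ-relation (⊞-congʳ (q¹ ✶ (2ψ 5 ✶ 2ψ 5)) (const-✶ (+ 4) G))) ⟩
  (const (+ 4) ✶ G ⊞ q¹ ✶ (2ψ 5 ✶ 2ψ 5)) ✶ ((f 1 ✶ f 1) ✶ ((f 5 ✶ f 5) ✶ f 10))
    ≈⟨ ψ-clear′ G q¹ (2ψ 5) (f 1) (f 5) (f 10) ⟩
  const (+ 4) ✶ ((G ✶ f 10 ✶ f 1) ✶ (f 1 ✶ (f 5 ✶ f 5))) ⊞ q¹ ✶ (((2ψ 5 ✶ f 5) ✶ (2ψ 5 ✶ f 5)) ✶ ((f 1 ✶ f 1) ✶ f 10))
    ≈⟨ ⊞-cong (✶-congˡ (const (+ 4)) (✶-congʳ _ G-eta)) (✶-congˡ q¹ (✶-congʳ _ (✶-cong (2ψ-product 5) (2ψ-product 5)))) ⟩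
  const (+ 4) ✶ ((f 2 ✶ (f 5 ✶ (f 5 ✶ f 5))) ✶ (f 1 ✶ (f 5 ✶ f 5))) ⊞ q¹ ✶ (((const (+ 2) ✶ (f 10 ✶ f 10)) ✶ (const (+ 2) ✶ (f 10 ✶ f 10))) ✶ ((f 1 ✶ f 1) ✶ f 10))
    ≈⟨ four-out (f 1) (f 2) (f 5) (f 10) q¹ ⟩
  const (+ 4) ✶ (f 1 ✶ (f 2 ✶ f 5 ^5) ⊞ q¹ ✶ ((f 1 ✶ f 1) ✶ f 10 ^5)) ∎)
  where open ≈-Reasoning

ā₅-eta : ā₅ ✶ (f 1 ✶ f 1) ✶ f 10 ^5 ≈ f 5 ^5 ✶ f 5 ^5 ✶ f 2
ā₅-eta = begin
  ā₅ ✶ (f 1 ✶ f 1) ✶ f 10 ^5       ≈⟨ ✶-congʳ _ (✶-congˡ ā₅ (φ-product 1)) ⟨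
  ā₅ ✶ (φ₁ ✶ f 2) ✶ f 10 ^5        ≈⟨ A-clear ā₅ φ₁ (f 2) (f 10) ⟩
  (ā₅ ✶ φ₁) ✶ (f 2 ✶ f 10 ^5)      ≈⟨ ✶-congʳ _ quotient ⟩
  φ₅ ^5 ✶ (f 2 ✶ f 10 ^5)          ≈⟨ A-clear′ φ₅ (f 2) (f 10) ⟩
  (φ₅ ✶ f 10) ^5 ✶ f 2             ≈⟨ ✶-congʳ (f 2) (^5-cong (φ-product 5)) ⟩
  (f 5 ✶ f 5) ^5 ✶ f 2             ≈⟨ A-clear″ (f 2) (f 5) ⟩
  f 5 ^5 ✶ f 5 ^5 ✶ f 2            ∎
  where
  open ≈-Reasoning
  power : ∀ F → F ^ˢ 5 ≈ F ^5
  power F = step (step (step (step (≈-trans (≈-sym (✶≈· F one)) (✶-identityʳ F)))))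
    where
    step : ∀ {X Y} → X ≈ Y → F · X ≈ F ✶ Y
    step {X} {Y} p = ≈-trans (≈-sym (✶≈· F X)) (✶-congˡ F p)
  quotient : ā₅ ✶ φ₁ ≈ φ₅ ^5
  quotient = ≈-trans (✶≈· ā₅ φ₁) (≈-trans ā₅-quotient (power φ₅))

unit-✶ : ∀ {F G : Series} → F 0 ≡ 1ℤ → G 0 ≡ 1ℤ → (F ✶ G) 0 ≡ 1ℤ
unit-✶ {F} {G} p q = trans (✶-at-0 F G) (cong₂ ℤ._*_ p q)

D₂ B₂ : Series
D₂ = dil 2 D
B₂ = dil 2 B

-- Besides the denominators f₁, f₂, f₅, f₁₀ of the four Eisenstein series and f₁² f₁₀⁵ of `ā₅`, it
-- has the factors that complete the left sides of `φ-eta` and `ψ-eta`.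
multiplier : Series
multiplier = f 1 ✶ (f 1 ✶ f 1) ✶ (f 2 ✶ f 2 ✶ (f 5 ✶ f 5 ✶ f 10 ^5))

multiplier-unit : multiplier 0 ≡ 1ℤ
multiplier-unit = unit-✶ (unit-✶ (f₀ 1) (unit-✶ (f₀ 1) (f₀ 1))) (unit-✶ (unit-✶ (f₀ 2) (f₀ 2)) (unit-✶ (unit-✶ (f₀ 5) (f₀ 5))
  (unit-✶ (f₀ 10) (unit-✶ (f₀ 10) (unit-✶ (f₀ 10) (unit-✶ (f₀ 10) (f₀ 10)))))))
  where
  f₀ : ∀ k .{{_ : NonZero k}} → f k 0 ≡ 1ℤ
  f₀ = f-at-0

dil-C-eta : f 2 ✶ dil 2 C ≈ f 10 ^5
dil-C-eta = ≈-trans (✶-congʳ (dil 2 C) (≈-sym (dil-f 2 1))) (≈-trans (≈-sym (dil-✶ 2 (f 1) C)) (≈-trans (dil-cong 2 C-eta) (≈-trans (dil-^5 2 (f 5)) (^5-cong (dil-f 2 5)))))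

dil-B-eta : f 10 ✶ B₂ ≈ f 2 ^5
dil-B-eta = ≈-trans (✶-congʳ B₂ (≈-sym (dil-f 2 5))) (≈-trans (≈-sym (dil-✶ 2 (f 5) B)) (≈-trans (dil-cong 2 B-eta) (≈-trans (dil-^5 2 (f 1)) (^5-cong (dil-f 2 1)))))

D₂≈ : D₂ ≈ q¹ ✶ q¹ ✶ dil 2 C
D₂≈ = ≈-trans (dil-✶ 2 q¹ C) (✶-congʳ (dil 2 C) (≈-trans (dil-mono 2 1ℤ 1) (≈-sym (mono-mono 1ℤ 1 1ℤ 1))))

eisenstein′ : ∀ C₂ B₂ → f 2 ✶ C₂ ≈ f 10 ^5 → f 10 ✶ B₂ ≈ f 2 ^5 →
              const (+ 5) ✶ ā₅ ≈ const (+ 15) ✶ D ⊞ (const (+ 20) ✶ (q¹ ✶ q¹ ✶ C₂) ⊞ (B ⊞ const (+ 4) ✶ B₂))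
eisenstein′ C₂ B₂ C₂-eta B₂-eta = ✶-cancelˡ multiplier {F} {F′} multiplier-unit product
  where
  F F′ : Series
  F  = const (+ 5) ✶ ā₅
  F′ = const (+ 15) ✶ D ⊞ (const (+ 20) ✶ (q¹ ✶ q¹ ✶ C₂) ⊞ (B ⊞ const (+ 4) ✶ B₂))
  product : multiplier ✶ F ≈ multiplier ✶ F′
  product = level-ten (f 1) (f 2) (f 5) (f 10) q¹ C C₂ B B₂ ā₅ φ-eta ψ-eta C-eta C₂-eta B-eta B₂-eta ā₅-eta

-- D and B are the Eisenstein series of weight 2 and character χ; the relation itself has level 10.
eisenstein : const (+ 5) ✶ ā₅ ≈ const (+ 15) ✶ D ⊞ (const (+ 20) ✶ D₂ ⊞ (B ⊞ const (+ 4) ✶ B₂))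
eisenstein = ≈-trans (eisenstein′ (dil 2 C) B₂ dil-C-eta dil-B-eta)
  (⊞-congˡ (const (+ 15) ✶ D) (⊞-congʳ (B ⊞ const (+ 4) ✶ B₂) (✶-congˡ (const (+ 20)) (≈-sym D₂≈))))

eisenstein-at : ∀ n → + 5 ℤ.* ā₅ n ≡ + 15 ℤ.* D n ℤ.+ + 20 ℤ.* D₂ n ℤ.+ (B n ℤ.+ + 4 ℤ.* B₂ n)
eisenstein-at n = begin
  + 5 ℤ.* ā₅ n                 ≡⟨ const-at (+ 5) ā₅ ⟨
  (const (+ 5) ✶ ā₅) n         ≡⟨ eisenstein n ⟩
  (const (+ 15) ✶ D ⊞ (const (+ 20) ✶ D₂ ⊞ (B ⊞ const (+ 4) ✶ B₂))) n
    ≡⟨ trans (⊞-at (const (+ 15) ✶ D) _ n) (cong₂ ℤ._+_ (const-at (+ 15) D) (trans (⊞-at (const (+ 20) ✶ D₂) _ n) (cong₂ ℤ._+_ (const-at (+ 20) D₂) (trans (⊞-at B _ n) (cong (λ y → B n ℤ.+ y) (const-at (+ 4) B₂)))))) ⟩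
  + 15 ℤ.* D n ℤ.+ (+ 20 ℤ.* D₂ n ℤ.+ (B n ℤ.+ + 4 ℤ.* B₂ n))
    ≡⟨ ℤ.+-assoc (+ 15 ℤ.* D n) _ _ ⟨
  + 15 ℤ.* D n ℤ.+ + 20 ℤ.* D₂ n ℤ.+ (B n ℤ.+ + 4 ℤ.* B₂ n) ∎
  where
  open ≡-Reasoning
  const-at : ∀ c F → (const c ✶ F) n ≡ c ℤ.* F n
  const-at c F = trans (✶-const c F n) (scale-at c F n)

-- The six congruence classes

D-suc : ∀ n → D (suc n) ≡ + c₅ n
D-suc n = trans (mono-✶-+ 1ℤ 1 C n) (ℤ.*-identityˡ _)

D-χ : ∀ {n} r x → χ r ≡ x → n % 5 ≡ r → r ≢ 0 → D n ≡ x ℤ.* H n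
D-χ {n} r x χr n≡r r≢0 = trans (D-χH n (λ n≡0 → r≢0 (trans (sym n≡r) n≡0))) (cong (λ c → c ℤ.* H n) (trans (cong χ n≡r) χr))

B-pos : ∀ {n} r → n % 5 ≡ r → r ≢ 0 → B n ≡ -[1+ 4 ] ℤ.* H n
B-pos {zero}  r n≡r r≢0 = ⊥-elim (r≢0 (sym n≡r))
B-pos {suc n} r _   _   = trans (B-at (suc n)) (lemma (H (suc n)))
  where
  lemma : ∀ h → 0ℤ ℤ.- + 5 ℤ.* h ≡ -[1+ 4 ] ℤ.* h
  lemma = ℤ-Solver.solve-∀

dil₂-odd : ∀ F n → ¬ 2 ∣ n → dil 2 F n ≡ 0ℤ
dil₂-odd F n = dil-off 2 F n

dil₂-even : ∀ F m → dil 2 F (2 * m) ≡ F m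
dil₂-even F m = trans (cong (dil 2 F) (ℕ.*-comm 2 m)) (dil-* 2 F m)

5-cancel : ∀ {x y} → + 5 ℤ.* x ≡ + 5 ℤ.* y → x ≡ y
5-cancel {x} {y} = ℤ.*-cancelˡ-≡ (+ 5) x y

ā₅-odd : ∀ n r x → χ r ≡ x → n % 5 ≡ r → r ≢ 0 → ¬ 2 ∣ n → + 5 ℤ.* ā₅ n ≡ + 15 ℤ.* (x ℤ.* H n) ℤ.- + 5 ℤ.* H n
ā₅-odd n r x χr n≡r r≢0 odd = trans (eisenstein-at n) (trans
  (cong₂ ℤ._+_ (cong₂ (λ u v → + 15 ℤ.* u ℤ.+ + 20 ℤ.* v) (D-χ r x χr n≡r r≢0) (dil₂-odd D n odd)) (cong₂ (λ u v → u ℤ.+ + 4 ℤ.* v) (B-pos r n≡r r≢0) (dil₂-odd B n odd)))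
  (lemma (x ℤ.* H n) (H n)))
  where
  lemma : ∀ u h → + 15 ℤ.* u ℤ.+ + 20 ℤ.* 0ℤ ℤ.+ (-[1+ 4 ] ℤ.* h ℤ.+ + 4 ℤ.* 0ℤ) ≡ + 15 ℤ.* u ℤ.- + 5 ℤ.* h
  lemma = ℤ-Solver.solve-∀

ā₅-even : ∀ m r x s y → χ r ≡ x → (2 * m) % 5 ≡ r → r ≢ 0 → χ s ≡ y → m % 5 ≡ s → s ≢ 0 →
          + 5 ℤ.* ā₅ (2 * m) ≡ + 15 ℤ.* (x ℤ.* H (2 * m)) ℤ.- + 5 ℤ.* H (2 * m) ℤ.+ (+ 20 ℤ.* (y ℤ.* H m) ℤ.- + 20 ℤ.* H m)
ā₅-even m r x s y χr n≡r r≢0 χs m≡s s≢0 = trans (eisenstein-at (2 * m)) (trans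
  (cong₂ ℤ._+_ (cong₂ (λ u v → + 15 ℤ.* u ℤ.+ + 20 ℤ.* v) (D-χ r x χr n≡r r≢0) (trans (dil₂-even D m) (D-χ s y χs m≡s s≢0)))
               (cong₂ (λ u v → u ℤ.+ + 4 ℤ.* v) (B-pos r n≡r r≢0) (trans (dil₂-even B m) (B-pos s m≡s s≢0))))
  (lemma (x ℤ.* H (2 * m)) (H (2 * m)) (y ℤ.* H m) (H m)))
  where
  lemma : ∀ u h v g → + 15 ℤ.* u ℤ.+ + 20 ℤ.* v ℤ.+ (-[1+ 4 ] ℤ.* h ℤ.+ + 4 ℤ.* (-[1+ 4 ] ℤ.* g)) ≡ + 15 ℤ.* u ℤ.- + 5 ℤ.* h ℤ.+ (+ 20 ℤ.* v ℤ.- + 20 ℤ.* g)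
  lemma = ℤ-Solver.solve-∀

-- For n ≡ ±2 modulo 5 the terms in q² cancel, n / 2 being ≡ ±1.
nonresidue : ∀ n r → χ r ≡ -1ℤ → n % 5 ≡ r → r ≢ 0 → (∀ m → n ≡ 2 * m → χ (m % 5) ≡ 1ℤ) → ā₅ n ≡ + 4 ℤ.* D n
nonresidue n r χr n≡r r≢0 half = 5-cancel (trans (go (2 ∣? n)) (lemma (H n) (D-χ r -1ℤ χr n≡r r≢0)))
  where
  go : Dec (2 ∣ n) → + 5 ℤ.* ā₅ n ≡ + 15 ℤ.* (-1ℤ ℤ.* H n) ℤ.- + 5 ℤ.* H n
  go (no odd) = ā₅-odd n r -1ℤ χr n≡r r≢0 odd
  go (yes (divides m eq)) = even m (trans eq (ℕ.*-comm m 2)) n≡r (half m (trans eq (ℕ.*-comm m 2)))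
    where
    contra : 1ℤ ≢ 0ℤ
    contra ()
    cancel : ∀ u h → u ℤ.+ (+ 20 ℤ.* (1ℤ ℤ.* h) ℤ.- + 20 ℤ.* h) ≡ u
    cancel = ℤ-Solver.solve-∀
    even : ∀ {n} m → n ≡ 2 * m → n % 5 ≡ r → χ (m % 5) ≡ 1ℤ → + 5 ℤ.* ā₅ n ≡ + 15 ℤ.* (-1ℤ ℤ.* H n) ℤ.- + 5 ℤ.* H n
    even m refl n≡r χm = trans (ā₅-even m r -1ℤ (m % 5) 1ℤ χr n≡r r≢0 χm refl (λ m≡0 → contra (trans (sym χm) (cong χ m≡0))))
      (cancel (+ 15 ℤ.* (-1ℤ ℤ.* H (2 * m)) ℤ.- + 5 ℤ.* H (2 * m)) (H m))
  lemma : ∀ h {d} → d ≡ -1ℤ ℤ.* h → + 15 ℤ.* (-1ℤ ℤ.* h) ℤ.- + 5 ℤ.* h ≡ + 5 ℤ.* (+ 4 ℤ.* d)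
  lemma h refl = ring h
    where
    ring : ∀ h → + 15 ℤ.* (-1ℤ ℤ.* h) ℤ.- + 5 ℤ.* h ≡ + 5 ℤ.* (+ 4 ℤ.* (-1ℤ ℤ.* h))
    ring = ℤ-Solver.solve-∀

-- For odd n the series in q² contribute nothing, and `D` = `H` on these classes, so 15 - 5 = 10 is
-- all that remains.
residue-odd : ∀ n r → χ r ≡ 1ℤ → n % 5 ≡ r → r ≢ 0 → ¬ 2 ∣ n → ā₅ n ≡ + 2 ℤ.* D n
residue-odd n r χr n≡r r≢0 odd = 5-cancel (trans (ā₅-odd n r 1ℤ χr n≡r r≢0 odd) (lemma (H n) (D-χ r 1ℤ χr n≡r r≢0)))
  where
  lemma : ∀ h {d} → d ≡ 1ℤ ℤ.* h → + 15 ℤ.* (1ℤ ℤ.* h) ℤ.- + 5 ℤ.* h ≡ + 5 ℤ.* (+ 2 ℤ.* d)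
  lemma h refl = ring h
    where
    ring : ∀ h → + 15 ℤ.* (1ℤ ℤ.* h) ℤ.- + 5 ℤ.* h ≡ + 5 ℤ.* (+ 2 ℤ.* (1ℤ ℤ.* h))
    ring = ℤ-Solver.solve-∀

-- Everything is expressed by `H m` = -`D m`: the level 5 terms give 10 `H (2 * m)` = -10 `H m` by
-- `H-2*`, and the terms in q² give -40 `H m`. The sum is 50 `D m`.
twice-odd : ∀ m r s → χ r ≡ 1ℤ → (2 * m) % 5 ≡ r → r ≢ 0 → χ s ≡ -1ℤ → m % 5 ≡ s → s ≢ 0 → ¬ 2 ∣ m → ā₅ (2 * m) ≡ + 10 ℤ.* D m
twice-odd m r s χr n≡r r≢0 χs m≡s s≢0 odd = 5-cancel (trans (ā₅-even m r 1ℤ s -1ℤ χr n≡r r≢0 χs m≡s s≢0)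
  (trans (cong (λ h → + 15 ℤ.* (1ℤ ℤ.* h) ℤ.- + 5 ℤ.* h ℤ.+ (+ 20 ℤ.* (-1ℤ ℤ.* H m) ℤ.- + 20 ℤ.* H m)) (H-2* m odd)) (lemma (H m) (D-χ s -1ℤ χs m≡s s≢0))))
  where
  lemma : ∀ h {d} → d ≡ -1ℤ ℤ.* h → + 15 ℤ.* (1ℤ ℤ.* (ℤ.- h)) ℤ.- + 5 ℤ.* (ℤ.- h) ℤ.+ (+ 20 ℤ.* (-1ℤ ℤ.* h) ℤ.- + 20 ℤ.* h) ≡ + 5 ℤ.* (+ 10 ℤ.* d)
  lemma h refl = ring h
    where
    ring : ∀ h → + 15 ℤ.* (1ℤ ℤ.* (ℤ.- h)) ℤ.- + 5 ℤ.* (ℤ.- h) ℤ.+ (+ 20 ℤ.* (-1ℤ ℤ.* h) ℤ.- + 20 ℤ.* h) ≡ + 5 ℤ.* (+ 10 ℤ.* (-1ℤ ℤ.* h))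
    ring = ℤ-Solver.solve-∀

χ-% : ∀ n → χ (n % 5) ≡ χ n
χ-% n = sym (trans (cong χ (m≡m%n+[m/n]*n n 5)) (χ-periodic (n % 5) (n / 5)))

χ-half : ∀ n r m → χ r ≡ -1ℤ → n % 5 ≡ r → n ≡ 2 * m → χ (m % 5) ≡ 1ℤ
χ-half _ r m χr n≡r refl = trans (χ-% m) (flip (χ m) (trans (sym (χ-double m)) (trans (sym (χ-% (2 * m))) (trans (cong χ n≡r) χr))))
  where
  flip : ∀ x → -1ℤ ℤ.* x ≡ -1ℤ → x ≡ 1ℤ
  flip x eq = ℤ.*-cancelˡ-≡ -1ℤ x 1ℤ eq

mod-5 : ∀ n r k → n ≡ r + k * 5 → r < 5 → n % 5 ≡ r
mod-5 _ r k refl r<5 = trans ([m+kn]%n≡m%n r k 5) (m<n⇒m%n≡m r<5)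

odd-∤ : ∀ n k → n ≡ 2 * k + 1 → ¬ 2 ∣ n
odd-∤ _ k refl 2∣ = ℕ.<⇒≱ (s≤s (s≤s z≤n)) (∣⇒≤ (∣m+n∣m⇒∣n 2∣ (m∣m*n k)))

D-at : ∀ {m} n → m ≡ suc n → D m ≡ + c₅ n
D-at n refl = D-suc n

-- Powers of 5: the two eigenvalues of U₅

repunit : ℕ → ℕ
repunit zero    = 0
repunit (suc k) = 1 + 5 * repunit k

-- Shows that base 5 repunits are the quotients (5^k - 1)/4; through them the natural-number
-- subtraction and division of the statement are exact.
5^k≡ : ∀ k → 5 ^ k ≡ 1 + repunit k * 4
5^k≡ zero    = refl
5^k≡ (suc k) = trans (cong (5 *_) (5^k≡ k)) (lemma (repunit k))
  where
  lemma : ∀ r → 5 * (1 + r * 4) ≡ 1 + (1 + 5 * r) * 4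
  lemma = ℕ-Solver.solve-∀

[5^k-1]/4 : ∀ k → (5 ^ k ∸ 1) / 4 ≡ repunit k
[5^k-1]/4 k = trans (cong (λ n → (n ∸ 1) / 4) (5^k≡ k)) (m*n/n≡m (repunit k) 4)

[5^k-5]/4 : ∀ k → (5 ^ suc k ∸ 5) / 4 ≡ 5 * repunit k
[5^k-5]/4 k = trans (cong (λ n → (n ∸ 5) / 4) (trans (5^k≡ (suc k)) (lemma (repunit k)))) (m*n/n≡m (5 * repunit k) 4)
  where
  lemma : ∀ r → 1 + (1 + 5 * r) * 4 ≡ 5 + 5 * r * 4
  lemma = ℕ-Solver.solve-∀

-- ā₅ splits into eigenvectors of U₅, with eigenvalues 5 and 1.
private
  V₅ V₁ : ℕ → ℤ
  V₅ n = + 15 ℤ.* D n ℤ.+ + 20 ℤ.* D₂ n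
  V₁ n = B n ℤ.+ + 4 ℤ.* B₂ n

-- U₅ commutes with q ↦ q², because 2 and 5 are coprime.
dil₂-eigen : ∀ F c → (∀ n → F (5 * n) ≡ c ℤ.* F n) → ∀ n → dil 2 F (5 * n) ≡ c ℤ.* dil 2 F n
dil₂-eigen F c p n = go (2 ∣? n)
  where
  go : Dec (2 ∣ n) → dil 2 F (5 * n) ≡ c ℤ.* dil 2 F n
  go (no odd) = trans (dil₂-odd F (5 * n) (odd ∘ prime-∣-cancel n prime-5 5∤2)) (sym (trans (cong (λ y → c ℤ.* y) (dil₂-odd F n odd)) (ℤ.*-zeroʳ c)))
    where
    prime-5 = from-yes (prime? 5)
    5∤2 : ¬ 5 ∣ 2
    5∤2 5∣2 = ℕ.<⇒≱ (s≤s (s≤s (s≤s z≤n))) (∣⇒≤ 5∣2)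
  go (yes (divides m refl)) = trans (trans (cong (dil 2 F) (lemma m)) (trans (dil₂-even F (5 * m)) (p m))) (cong (λ y → c ℤ.* y) (sym (dil-* 2 F m)))
    where
    lemma : ∀ m → 5 * (m * 2) ≡ 2 * (5 * m)
    lemma = ℕ-Solver.solve-∀

B-5* : ∀ n → B (5 * n) ≡ 1ℤ ℤ.* B n
B-5* n = trans (trans (B-at (5 * n)) (trans (cong₂ (λ x y → x ℤ.- + 5 ℤ.* y) (one-* 5 n) (H-5* n)) (sym (B-at n)))) (sym (ℤ.*-identityˡ (B n)))

V₅-eigen : ∀ n → V₅ (5 * n) ≡ + 5 ℤ.* V₅ n
V₅-eigen n = trans (cong₂ (λ x y → + 15 ℤ.* x ℤ.+ + 20 ℤ.* y) (D-5* n) (dil₂-eigen D (+ 5) D-5* n)) (lemma (D n) (D₂ n))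
  where
  lemma : ∀ x y → + 15 ℤ.* (+ 5 ℤ.* x) ℤ.+ + 20 ℤ.* (+ 5 ℤ.* y) ≡ + 5 ℤ.* (+ 15 ℤ.* x ℤ.+ + 20 ℤ.* y)
  lemma = ℤ-Solver.solve-∀

V₁-eigen : ∀ n → V₁ (5 * n) ≡ V₁ n
V₁-eigen n = trans (cong₂ (λ x y → x ℤ.+ + 4 ℤ.* y) (B-5* n) (dil₂-eigen B 1ℤ B-5* n)) (lemma (B n) (B₂ n))
  where
  lemma : ∀ x y → 1ℤ ℤ.* x ℤ.+ + 4 ℤ.* (1ℤ ℤ.* y) ≡ x ℤ.+ + 4 ℤ.* y
  lemma = ℤ-Solver.solve-∀

5^-shift : ∀ k n → 5 ^ suc k * n ≡ 5 * (5 ^ k * n)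
5^-shift k n = ℕ.*-assoc 5 (5 ^ k) n

V₅-power : ∀ k n → V₅ (5 ^ k * n) ≡ (1ℤ ℤ.+ + repunit k ℤ.* + 4) ℤ.* V₅ n
V₅-power zero    n = trans (cong V₅ (ℕ.+-identityʳ n)) (sym (ℤ.*-identityˡ (V₅ n)))
V₅-power (suc k) n = trans (cong V₅ (5^-shift k n)) (trans (V₅-eigen (5 ^ k * n)) (trans (cong (λ y → + 5 ℤ.* y) (V₅-power k n))
  (trans (lemma (+ repunit k) (V₅ n)) (cong (λ r → (1ℤ ℤ.+ r ℤ.* + 4) ℤ.* V₅ n) (sym (trans (ℤ.pos-+ 1 (5 * repunit k)) (cong (λ y → 1ℤ ℤ.+ y) (ℤ.pos-* 5 (repunit k)))))))))
  where
  lemma : ∀ r v → + 5 ℤ.* ((1ℤ ℤ.+ r ℤ.* + 4) ℤ.* v) ≡ (1ℤ ℤ.+ (1ℤ ℤ.+ + 5 ℤ.* r) ℤ.* + 4) ℤ.* v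
  lemma = ℤ-Solver.solve-∀

V₁-power : ∀ k n → V₁ (5 ^ k * n) ≡ V₁ n
V₁-power zero    n = cong V₁ (ℕ.+-identityʳ n)
V₁-power (suc k) n = trans (cong V₁ (5^-shift k n)) (trans (V₁-eigen (5 ^ k * n)) (V₁-power k n))

-- On eigenvectors for 5 and 1 the coefficients x of `ā₅ (5 * n)` and -y of `ā₅ n` must satisfy 5x -
-- y = 5^(k+1) and x - y = 1, which determines x = (5^(k+1) - 1)/4 and y = (5^(k+1) - 5)/4.
ā₅-power : ∀ n k → ā₅ (5 ^ suc k * n) ≡ + ((5 ^ suc k ∸ 1) / 4) ℤ.* ā₅ (5 * n) ℤ.- + ((5 ^ suc k ∸ 5) / 4) ℤ.* ā₅ n
ā₅-power n k = 5-cancel (begin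
  + 5 ℤ.* ā₅ (5 ^ suc k * n)
    ≡⟨ trans (eisenstein-at (5 ^ suc k * n)) (cong₂ ℤ._+_ (V₅-power (suc k) n) (V₁-power (suc k) n)) ⟩
  (1ℤ ℤ.+ + repunit (suc k) ℤ.* + 4) ℤ.* V₅ n ℤ.+ V₁ n
    ≡⟨ cong (λ r → (1ℤ ℤ.+ r ℤ.* + 4) ℤ.* V₅ n ℤ.+ V₁ n) repunit-suc ⟩
  (1ℤ ℤ.+ (1ℤ ℤ.+ + 5 ℤ.* r) ℤ.* + 4) ℤ.* V₅ n ℤ.+ V₁ n
    ≡⟨ lemma r (V₅ n) (V₁ n) ⟩
  (1ℤ ℤ.+ + 5 ℤ.* r) ℤ.* (+ 5 ℤ.* V₅ n ℤ.+ V₁ n) ℤ.- (+ 5 ℤ.* r) ℤ.* (V₅ n ℤ.+ V₁ n)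
    ≡⟨ cong₂ (λ x y → (1ℤ ℤ.+ + 5 ℤ.* r) ℤ.* x ℤ.- (+ 5 ℤ.* r) ℤ.* y)
         (sym (trans (eisenstein-at (5 * n)) (cong₂ ℤ._+_ (V₅-eigen n) (V₁-eigen n)))) (sym (eisenstein-at n)) ⟩
  (1ℤ ℤ.+ + 5 ℤ.* r) ℤ.* (+ 5 ℤ.* ā₅ (5 * n)) ℤ.- (+ 5 ℤ.* r) ℤ.* (+ 5 ℤ.* ā₅ n)
    ≡⟨ cong₂ (λ x y → x ℤ.* (+ 5 ℤ.* ā₅ (5 * n)) ℤ.- y ℤ.* (+ 5 ℤ.* ā₅ n))
         (trans (sym repunit-suc) (cong +_ (sym ([5^k-1]/4 (suc k))))) (trans (sym (ℤ.pos-* 5 (repunit k))) (cong +_ (sym ([5^k-5]/4 k)))) ⟩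
  p ℤ.* (+ 5 ℤ.* ā₅ (5 * n)) ℤ.- q ℤ.* (+ 5 ℤ.* ā₅ n)
    ≡⟨ lemma′ p q (ā₅ (5 * n)) (ā₅ n) ⟩
  + 5 ℤ.* (p ℤ.* ā₅ (5 * n) ℤ.- q ℤ.* ā₅ n) ∎)
  where
  open ≡-Reasoning
  r p q : ℤ
  r = + repunit k
  p = + ((5 ^ suc k ∸ 1) / 4)
  q = + ((5 ^ suc k ∸ 5) / 4)
  repunit-suc : + repunit (suc k) ≡ 1ℤ ℤ.+ + 5 ℤ.* r
  repunit-suc = trans (ℤ.pos-+ 1 (5 * repunit k)) (cong (λ y → 1ℤ ℤ.+ y) (ℤ.pos-* 5 (repunit k)))
  lemma : ∀ r v u → (1ℤ ℤ.+ (1ℤ ℤ.+ + 5 ℤ.* r) ℤ.* + 4) ℤ.* v ℤ.+ u ≡ (1ℤ ℤ.+ + 5 ℤ.* r) ℤ.* (+ 5 ℤ.* v ℤ.+ u) ℤ.- (+ 5 ℤ.* r) ℤ.* (v ℤ.+ u)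
  lemma = ℤ-Solver.solve-∀
  lemma′ : ∀ p q x y → p ℤ.* (+ 5 ℤ.* x) ℤ.- q ℤ.* (+ 5 ℤ.* y) ≡ + 5 ℤ.* (p ℤ.* x ℤ.- q ℤ.* y)
  lemma′ = ℤ-Solver.solve-∀

theorem2 : (∀ (n : ℕ) →
    (ā₅ (5 * n + 2) ≡ + 4 ℤ.* + c₅ (5 * n + 1))
    × (ā₅ (5 * n + 3) ≡ + 4 ℤ.* + c₅ (5 * n + 2))
    × (ā₅ (10 * n + 1) ≡ + 2 ℤ.* + c₅ (10 * n))
    × (ā₅ (10 * n + 9) ≡ + 2 ℤ.* + c₅ (10 * n + 8))
    × (ā₅ (20 * n + 6) ≡ + 10 ℤ.* + c₅ (10 * n + 2))
    × (ā₅ (20 * n + 14) ≡ + 10 ℤ.* + c₅ (10 * n + 6)))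
    × (∀ (n k : ℕ) → k ≥ 2 →
    ā₅ (5 ^ k * n) ≡
    + ((5 ^ k ∸ 1) / 4) ℤ.* ā₅ (5 * n) ℤ.- + ((5 ^ k ∸ 5) / 4) ℤ.* ā₅ n)
theorem2 = (λ n →
    trans (nonresidue (5 * n + 2) 2 refl (m₂ n) nonzero (λ m → χ-half (5 * n + 2) 2 m refl (m₂ n))) (cong (λ y → + 4 ℤ.* y) (D-at (5 * n + 1) (i₁ n))) ,
    trans (nonresidue (5 * n + 3) 3 refl (m₃ n) nonzero (λ m → χ-half (5 * n + 3) 3 m refl (m₃ n))) (cong (λ y → + 4 ℤ.* y) (D-at (5 * n + 2) (i₂ n))) ,
    trans (residue-odd (10 * n + 1) 1 refl (mod-5 _ 1 (2 * n) (i₃ n) (ℕ.m≤m+n 2 3)) nonzero (odd-∤ _ (5 * n) (o₁ n))) (cong (λ y → + 2 ℤ.* y) (D-at (10 * n) (i₄ n))) ,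
    trans (residue-odd (10 * n + 9) 4 refl (mod-5 _ 4 (2 * n + 1) (i₅′ n) ℕ.≤-refl) nonzero (odd-∤ _ (5 * n + 4) (o₂ n))) (cong (λ y → + 2 ℤ.* y) (D-at (10 * n + 8) (i₆ n))) ,
    trans (cong ā₅ (i₇ n)) (trans (twice-odd (10 * n + 3) 1 3 refl (mod-5 _ 1 (4 * n + 1) (i₈ n) (ℕ.m≤m+n 2 3)) nonzero refl (mod-5 _ 3 (2 * n) (i₉ n) (ℕ.m≤m+n 4 1)) nonzero (odd-∤ _ (5 * n + 1) (o₃ n)))
      (cong (λ y → + 10 ℤ.* y) (D-at (10 * n + 2) (i₁₀ n)))) ,
    trans (cong ā₅ (i₁₁ n)) (trans (twice-odd (10 * n + 7) 4 2 refl (mod-5 _ 4 (4 * n + 2) (i₁₂ n) ℕ.≤-refl) nonzero refl (mod-5 _ 2 (2 * n + 1) (i₁₃ n) 2<5) nonzero (odd-∤ _ (5 * n + 3) (o₄ n)))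
      (cong (λ y → + 10 ℤ.* y) (D-at (10 * n + 6) (i₁₄ n))))) ,
  λ { n (suc k) _ → ā₅-power n k }
  where
  nonzero : ∀ {r} → suc r ≢ 0
  nonzero ()
  2<5 : 2 < 5
  2<5 = s≤s (s≤s (s≤s z≤n))
  m₂ : ∀ n → (5 * n + 2) % 5 ≡ 2
  m₂ n = mod-5 _ 2 n (lemma n) 2<5
    where
    lemma : ∀ n → 5 * n + 2 ≡ 2 + n * 5
    lemma = ℕ-Solver.solve-∀
  m₃ : ∀ n → (5 * n + 3) % 5 ≡ 3
  m₃ n = mod-5 _ 3 n (lemma n) (ℕ.m≤m+n 4 1)
    where
    lemma : ∀ n → 5 * n + 3 ≡ 3 + n * 5
    lemma = ℕ-Solver.solve-∀
  i₁ : ∀ n → 5 * n + 2 ≡ suc (5 * n + 1)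
  i₁ = ℕ-Solver.solve-∀
  i₂ : ∀ n → 5 * n + 3 ≡ suc (5 * n + 2)
  i₂ = ℕ-Solver.solve-∀
  i₃ : ∀ n → 10 * n + 1 ≡ 1 + 2 * n * 5
  i₃ = ℕ-Solver.solve-∀
  o₁ : ∀ n → 10 * n + 1 ≡ 2 * (5 * n) + 1
  o₁ = ℕ-Solver.solve-∀
  i₄ : ∀ n → 10 * n + 1 ≡ suc (10 * n)
  i₄ = ℕ-Solver.solve-∀
  i₅′ : ∀ n → 10 * n + 9 ≡ 4 + (2 * n + 1) * 5
  i₅′ = ℕ-Solver.solve-∀
  o₂ : ∀ n → 10 * n + 9 ≡ 2 * (5 * n + 4) + 1
  o₂ = ℕ-Solver.solve-∀
  i₆ : ∀ n → 10 * n + 9 ≡ suc (10 * n + 8)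
  i₆ = ℕ-Solver.solve-∀
  i₇ : ∀ n → 20 * n + 6 ≡ 2 * (10 * n + 3)
  i₇ = ℕ-Solver.solve-∀
  i₈ : ∀ n → 2 * (10 * n + 3) ≡ 1 + (4 * n + 1) * 5
  i₈ = ℕ-Solver.solve-∀
  i₉ : ∀ n → 10 * n + 3 ≡ 3 + 2 * n * 5
  i₉ = ℕ-Solver.solve-∀
  o₃ : ∀ n → 10 * n + 3 ≡ 2 * (5 * n + 1) + 1
  o₃ = ℕ-Solver.solve-∀
  i₁₀ : ∀ n → 10 * n + 3 ≡ suc (10 * n + 2)
  i₁₀ = ℕ-Solver.solve-∀
  i₁₁ : ∀ n → 20 * n + 14 ≡ 2 * (10 * n + 7)
  i₁₁ = ℕ-Solver.solve-∀
  i₁₂ : ∀ n → 2 * (10 * n + 7) ≡ 4 + (4 * n + 2) * 5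
  i₁₂ = ℕ-Solver.solve-∀
  i₁₃ : ∀ n → 10 * n + 7 ≡ 2 + (2 * n + 1) * 5
  i₁₃ = ℕ-Solver.solve-∀
  o₄ : ∀ n → 10 * n + 7 ≡ 2 * (5 * n + 3) + 1
  o₄ = ℕ-Solver.solve-∀
  i₁₄ : ∀ n → 10 * n + 7 ≡ suc (10 * n + 6)
  i₁₄ = ℕ-Solver.solve-∀
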